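{- Let $W$ be the affine Weyl group of type $\tilde{B}_2$. For every $z\in W$ the following are equivalent: (1) $z\in\mathcal{D}_1$; (2) there exists $d\in\mathcal{D}_0$ such that $z\sim_{LR}d$ and $\tilde{\mu}(z,d)\neq 0$.
   Context: $W$ is a Coxeter group with simple reflections $S=\{r,s,t\}$, relations $r^2=s^2=t^2=e$, $rt=tr$, $(rs)^4=(st)^4=e$; $l$ is the length function, $\le$ the Bruhat order, $e$ the identity. $P_{u,w}\in\mathbb{Z}[q]$ are the Kazhdan–Lusztig polynomials ($P_{w,w}=1$, $\deg P_{u,w}\le \frac12(l(w)-l(u)-1)$ for $u<w$, $P_{u,w}=0$ if $u\not\le w$). For $u\le w$, $\mu(u,w)$ is the coefficient of $q^{\frac12(l(w)-l(u)-1)}$ in $P_{u,w}$ (taken to be $0$ if the exponent is not an integer). Set $\tilde\mu(u,w)=\mu(u,w)$ if $u\le w$, $\tilde\mu(u,w)=\mu(w,u)$ if $w\le u$, and $0$ otherwise. $\sim_{LR}$ is the Kazhdan–Lusztig two-sided cell equivalence. $a$ denotes Lusztig's $a$-function on $W$. For $z\in W$ let $\delta(z)=\deg P_{e,z}$; then $l(z)-a(z)-2\delta(z)\ge 0$, and $\mathcal{D}_i=\{d\in W\mid l(d)-a(d)-2\delta(d)=i\}$ ($\mathcal{D}_0$ is the set of distinguished involutions). -}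

module Defs where

open import Data.Nat as ℕ using (ℕ; zero; suc; _+_; _*_; _∸_; _≤_; _<_; _<ᵇ_; _≡ᵇ_; _/_; _%_)
open import Data.Integer as ℤ using (ℤ; +_; -_) renaming (_+_ to _+ℤ_; _*_ to _*ℤ_; _-_ to _-ℤ_)
open import Data.Bool using (Bool; true; false; if_then_else_; _∧_; _∨_; not; T)
open import Data.List using (List; []; _∷_; _++_; map; concatMap; foldr; length; filterᵇ; [_])
open import Data.Bool.ListAction using (any)
open import Data.Product using (Σ; ∃; ∃₂; _×_; _,_)
open import Data.Product.Properties using (≡-dec)
open import Relation.Nullary using (¬_; Dec; yes; no)
open import Relation.Nullary.Decidable using (isYes)
open import Relation.Binary.PropositionalEquality using (_≡_)

data Gen : Set where
  r s t : Gen

Word : Set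
Word = List Gen

-- Faithful integral representation of W on the root lattice ℤα_r ⊕ ℤα_s ⊕ ℤα_t
-- of the affine Kac–Moody algebra with (generalised) Cartan matrix
--   r : ( 2 , -1 ,  0 )
--   s : (-2 ,  2 , -2 )
--   t : ( 0 , -1 ,  2 )
-- i.e.  σ_i(x) = x - (Σ_j a_ij x_j) α_i .  Here a_rs a_sr = a_st a_ts = 2
-- (m = 4) and a_rt = a_tr = 0 (m = 2), so the generated group is the Coxeter
-- group of the statement and the representation is faithful.

V : Set
V = ℤ × ℤ × ℤ

σ : Gen → V → V
σ r (x , y , z) = (y -ℤ x , y , z)
σ s (x , y , z) = (x , (+ 2 *ℤ x +ℤ + 2 *ℤ z) -ℤ y , z)
σ t (x , y , z) = (x , y , y -ℤ z)

act : Word → V → V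
act [] v = v
act (g ∷ w) v = σ g (act w v)

image : Word → V × V × V
image w = act w (+ 1 , + 0 , + 0) , act w (+ 0 , + 1 , + 0) , act w (+ 0 , + 0 , + 1)

_≈_ : Word → Word → Set
u ≈ w = image u ≡ image w

_≈?_ : (u w : Word) → Dec (u ≈ w)
u ≈? w = ≡-dec V≟ (≡-dec V≟ V≟) (image u) (image w)
  where
  V≟ : (a b : V) → Dec (a ≡ b)
  V≟ = ≡-dec ℤ._≟_ (≡-dec ℤ._≟_ ℤ._≟_)

eqW : Word → Word → Bool
eqW u w = isYes (u ≈? w)

allWords : ℕ → List Word
allWords zero = [] ∷ []
allWords (suc n) = concatMap (λ w → (r ∷ w) ∷ (s ∷ w) ∷ (t ∷ w) ∷ []) (allWords n)

wordsUpTo : ℕ → List Word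
wordsUpTo zero = allWords zero
wordsUpTo (suc n) = wordsUpTo n ++ allWords (suc n)

private
  search : ℕ → ℕ → Word → ℕ
  search zero n w = n
  search (suc f) n w = if any (eqW w) (allWords n) then n else search f (suc n) w

len : Word → ℕ
len w = search (length w) 0 w

reducedWords : Word → List Word
reducedWords w = filterᵇ (eqW w) (allWords (len w))

firstOr : Word → List Word → Word
firstOr d [] = d
firstOr d (x ∷ _) = x

red : Word → Word
red w = firstOr w (reducedWords w)

subwords : Word → List Word
subwords [] = [] ∷ []
subwords (g ∷ w) = map (g ∷_) (subwords w) ++ subwords w

nubW : List Word → List Word
nubW = foldr (λ w acc → if any (eqW w) acc then acc else w ∷ acc) []

-- Bruhat order (subword characterisation): u ≤ w iff some reduced
-- expression of w has a subexpression representing u.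

leqB : Word → Word → Bool
leqB u w = any (λ x → any (eqW u) (subwords x)) (reducedWords w)

_≤ᴮ_ : Word → Word → Set
u ≤ᴮ w = T (leqB u w)

Ball : ℕ → List Word
Ball n = map red (nubW (wordsUpTo n))

Below : Word → List Word
Below w = filterᵇ (λ y → leqB y w) (Ball (len w))

-- Polynomials in q (coefficient lists) and Laurent polynomials in v = q^{1/2}

Poly : Set
Poly = List ℤ

coeffP : Poly → ℕ → ℤ
coeffP [] _ = + 0
coeffP (c ∷ _) zero = c
coeffP (_ ∷ cs) (suc k) = coeffP cs k

allZero : Poly → Bool
allZero [] = true
allZero (c ∷ cs) = isYes (c ℤ.≟ + 0) ∧ allZero cs

-- degree (largest index of a nonzero coefficient; 0 for the zero polynomial)
degP : Poly → ℕ
degP [] = 0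
degP (c ∷ cs) = if allZero cs then 0 else suc (degP cs)

-- Laurent polynomial in v as a formal sum of monomials (exponent , coefficient)
Laur : Set
Laur = List (ℤ × ℤ)

eqℤ : ℤ → ℤ → Bool
eqℤ a b = isYes (a ℤ.≟ b)

coefL : Laur → ℤ → ℤ
coefL [] k = + 0
coefL ((e , c) ∷ L) k = (if eqℤ e k then c else + 0) +ℤ coefL L k

-- Hecke algebra over ℤ[v,v⁻¹] (q = v²), elements as formal sums of
-- terms  c v^e T_w  written (w , e , c).

Term : Set
Term = Word × ℤ × ℤ

H : Set
H = List Term

coefH : H → Word → ℤ → ℤ
coefH [] u e = + 0
coefH ((w , e' , c) ∷ h) u e = (if eqW w u ∧ eqℤ e' e then c else + 0) +ℤ coefH h u e

tS : Gen → Term → H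
tS g (w , e , c) =
  if len w <ᵇ len (g ∷ w)
  then (g ∷ w , e , c) ∷ []
  else (w , e +ℤ + 2 , c) ∷ (w , e , - c) ∷ (g ∷ w , e +ℤ + 2 , c) ∷ []

tSH : Gen → H → H
tSH g = concatMap (tS g)

tW : Word → H → H
tW x h = foldr tSH h (red x)

scaleT : ℤ → ℤ → Term → Term
scaleT e c (w , e' , c') = (w , e +ℤ e' , c *ℤ c')

mulH : H → H → H
mulH h₁ h₂ = concatMap (λ { (x , e , c) → map (scaleT e c) (tW x h₂) }) h₁

scaleL : Laur → H → H
scaleL L h = concatMap (λ { (e , c) → map (scaleT e c) h }) L

-- T_g⁻¹ = v⁻² T_g + (v⁻² - 1)
invS : Gen → H → H
invS g h = map (scaleT (- + 2) (+ 1)) (tSH g h) ++ map (scaleT (- + 2) (+ 1)) h ++ map (scaleT (+ 0) (- + 1)) h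

-- bar involution:  bar(c v^e T_y) = c v^{-e} (T_{y⁻¹})⁻¹ = c v^{-e} T_{g₁}⁻¹ ⋯ T_{g_k}⁻¹
-- for a reduced expression y = g₁ ⋯ g_k
barH : H → H
barH = concatMap (λ { (y , e , c) → foldr invS (([] , - e , c) ∷ []) (red y) })

-- Kazhdan–Lusztig basis  C'_w = v^{-l(w)} Σ_{y ≤ w} P_{y,w}(v²) T_y

KLFun : Set
KLFun = Word → Word → Poly

polyTerms : Word → ℕ → ℕ → Poly → H
polyTerms y L k [] = []
polyTerms y L k (c ∷ cs) = (y , + (2 * k) -ℤ + L , c) ∷ polyTerms y L (suc k) cs

C' : KLFun → Word → H
C' P w = concatMap (λ y → polyTerms y (len w) 0 (P y w)) (Below w)

-- P is the family of Kazhdan–Lusztig polynomials (KL 1979, Thm 1.1)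
record IsKL (P : KLFun) : Set where
  field
    resp    : ∀ y y′ w w′ → y ≈ y′ → w ≈ w′ → ∀ k → coeffP (P y w) k ≡ coeffP (P y′ w′) k
    diag₀   : ∀ w → coeffP (P w w) 0 ≡ + 1
    diagₛ   : ∀ w k → coeffP (P w w) (suc k) ≡ + 0
    vanish  : ∀ y w → ¬ (y ≤ᴮ w) → ∀ k → coeffP (P y w) k ≡ + 0
    degree  : ∀ y w → y ≤ᴮ w → ¬ (y ≈ w) → ∀ k → len w < len y + 2 * k + 1 → coeffP (P y w) k ≡ + 0
    barInv  : ∀ w u e → coefH (barH (C' P w)) u e ≡ coefH (C' P w) u e

StructFun : Set
StructFun = Word → Word → Word → Laur

record IsStruct (P : KLFun) (h : StructFun) : Set where
  field
    resp    : ∀ x x′ y y′ z z′ → x ≈ x′ → y ≈ y′ → z ≈ z′ → ∀ k → coefL (h x y z) k ≡ coefL (h x′ y′ z′) k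
    expand  : ∀ x y u e → coefH (mulH (C' P x) (C' P y)) u e
                          ≡ coefH (concatMap (λ z → scaleL (h x y z) (C' P z)) (Ball (len x + len y))) u e
    outside : ∀ x y z → len x + len y < len z → ∀ k → coefL (h x y z) k ≡ + 0

NonZeroL : Laur → Set
NonZeroL L = ∃ λ k → ¬ (coefL L k ≡ + 0)

IsAFun : StructFun → (Word → ℕ) → Set
IsAFun h a = ∀ z → (∀ x y k → + (a z) ℤ.< k → coefL (h x y z) k ≡ + 0)
                 × (∃₂ λ x y → ¬ (coefL (h x y z) (+ (a z)) ≡ + 0))

data _≤LR⟨_⟩_ : Word → StructFun → Word → Set where
  same  : ∀ {h x y} → x ≈ y → x ≤LR⟨ h ⟩ y
  left  : ∀ {h x y} (g : Gen) → NonZeroL (h [ g ] y x) → x ≤LR⟨ h ⟩ y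
  right : ∀ {h x y} (g : Gen) → NonZeroL (h y [ g ] x) → x ≤LR⟨ h ⟩ y
  trans : ∀ {h x y z} → x ≤LR⟨ h ⟩ y → y ≤LR⟨ h ⟩ z → x ≤LR⟨ h ⟩ z

_∼LR⟨_⟩_ : Word → StructFun → Word → Set
x ∼LR⟨ h ⟩ y = (x ≤LR⟨ h ⟩ y) × (y ≤LR⟨ h ⟩ x)

odd : ℕ → Bool
odd n = (n % 2) ≡ᵇ 1

μ : KLFun → Word → Word → ℤ
μ P u w =
  if leqB u w ∧ (len u <ᵇ len w) ∧ odd (len w ∸ len u)
  then coeffP (P u w) ((len w ∸ len u ∸ 1) / 2)
  else + 0

μ~ : KLFun → Word → Word → ℤ
μ~ P u w = if leqB u w then μ P u w else (if leqB w u then μ P w u else + 0)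

δ : KLFun → Word → ℕ
δ P z = degP (P [] z)

InD : ℕ → KLFun → (Word → ℕ) → Word → Set
InD i P a z = len z ≡ a z + 2 * δ P z + i

module Submission where

-- Write p(u,w) = v^{l(u)-l(w)} P_{u,w}(v²) and let m(u,w) be its coefficient at v⁻¹, so that
-- μ̃(u,w) = m(u,w) + m(w,u).  The two-sided cells are {e} and the sets with a = 1, 2, 4.  An element of
-- the lowest cell (a = 4) is z = py with L(y) = {r,s} or {s,t} and p one of four prefixes, and
-- C_z = X_p C_y for an X_p depending only on p.  Evaluating at e shows that p(e,z) starts with
-- [y = w_J p⁻¹] v⁻⁴ + μ̃(y, w_J p⁻¹) v⁻⁵; hence D₀ consists of the elements d = p w_J p⁻¹, and z lies in
-- D₁ iff μ̃(y, w_J p⁻¹) ≠ 0.  The Kazhdan–Lusztig star operations turn this into μ̃(z,d) ≠ 0, and elements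
-- z, d of different types can only be joined through an edge visible in the descent sets, which makes
-- z⁻¹ and d = d⁻¹ of the same type.  The cell a = 2 is treated in the same way modulo the lowest one,
-- with {r,t} in place of J; for a = 1 one has p(e,z) = v⁻¹ p(g,z) for g ∈ L(z).
-- The a-function is bounded above by Bremke's estimate for the degree of T_x T_y and by the types of
-- x, and below by C_{w_J} C_y.  That z ∼ d follows from the constant term 1 of the coefficient of
-- C_y C_{y⁻¹} at e, which only w_J (rt, g) can contribute.

-- The data `P`, `h` and `a` are known only through their axioms, so every fact comes either from
-- the uniqueness of bar-invariant elements or from finite tables. The tables are possible because
-- left descents and the value of a depend only on one of 27 states of the automaton of small roots.
-- Multiplication on the right is controlled differently: X_p acts from the left, hence commutes
-- with it, so the prefix p of z is constant along right edges of the W-graph and that of z⁻¹ along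
-- left edges (for a = 2, as long as the lowest cell is avoided). The symmetric sum μ̃ is the
-- natural quantity because, for strings of opposite parity, μ(u,w) and μ(w,u) are shifted by
-- opposite Kronecker symbols. The cell a = 2 hides one irregularity: passing from y to sy does not
-- preserve μ̃. At the single element Y = rtsrts, the value of μ̃ against rts is 2 before and 3
-- after, so only its nonvanishing can be transported. Membership in D_i is tested throughout as the
-- statement that the highest exponent of v in p(e,z) is -(a(z) + i).

import Defs
open Defs using (KLFun; IsKL; StructFun; IsStruct; IsAFun; Word)
open import Data.Bool as Bool using (Bool; true; false; not; if_then_else_; _∧_; _∨_) renaming (T to IsTrue)
open import Data.Bool.ListAction using (any)
import Data.Bool.Properties as Bool
open import Data.Empty using (⊥; ⊥-elim)
open import Data.Integer as ℤ using (ℤ; +_; -_; -[1+_]; ∣_∣; _+_; _*_; _-_)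
open import Data.Integer.Properties as ℤ using (+-identityʳ; +-identityˡ; *-identityˡ; *-identityʳ; *-zeroʳ; +-inverseʳ; +-assoc; +-comm; +-injective; i-j≡0⇒i≡j)
open import Data.Integer.Tactic.RingSolver using (solve-∀)
open import Data.List as List using (List; []; _∷_; _++_; map; concatMap; foldr; filterᵇ; length; reverse; _∷ʳ_; _ʳ++_)
import Data.List.Properties as List
open import Data.List.Membership.Propositional using (_∈_)
import Data.List.Membership.Propositional.Properties as ∈
open import Data.List.Relation.Unary.All as All using (All; []; _∷_)
import Data.List.Relation.Unary.All.Properties as All
open import Data.List.Relation.Unary.AllPairs using ([]; _∷_)
open import Data.List.Relation.Unary.Any using (here; there)
open import Data.List.Relation.Unary.Unique.Propositional using (Unique)
open import Data.Nat as ℕ using (ℕ; zero; suc; _≤_; _<_; z≤n; s≤s)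
import Data.Nat.DivMod as ℕ
open import Data.Nat.Induction using (<-wellFounded)
open import Data.Nat.Properties as ℕ using (≤-trans; ≤-refl; ≤-reflexive; <⇒≤; <⇒≱; <⇒≢; ≰⇒>; n≤1+n; suc-injective; +-suc)
import Data.Nat.Tactic.RingSolver as ℕs
open import Data.Product using (Σ; ∃; ∃₂; _×_; _,_; proj₁; proj₂)
open import Data.Product.Properties using (≡-dec)
open import Data.Sum using (_⊎_; inj₁; inj₂)
open import Function using (_∘_)
open import Induction.WellFounded using (Acc; acc)
open import Relation.Binary.Definitions using (tri<; tri≈; tri>)
open import Relation.Binary.PropositionalEquality hiding (J; [_])
open import Relation.Nullary using (¬_; Dec; yes; no)
open import Relation.Nullary.Decidable using (isYes; map′; _×-dec_; _→-dec_; _⊎-dec_; ¬?; toWitness)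

-- Integer coordinates for W and the left and right translations by generators.

module Alcoves where
 open Defs using (Gen; r; s; t)

 data K : Set where
   k0 k1 k2 k3 k4 k5 k6 k7 : K

 data D : Set where
   d1 d2 d3 d4 : D

 -- Quantifiers over finite types are decidable; every table below is proved by applying `toWitness`
 -- to such a decision, that is, by evaluation.
 Gen∀ : {P : Gen → Set} → (∀ g → Dec (P g)) → Dec (∀ g → P g)
 Gen∀ d = map′ (λ { (a , b , c) → λ { r → a ; s → b ; t → c } }) (λ f → f r , f s , f t)
   (d r ×-dec d s ×-dec d t)

 D∀ : {P : D → Set} → (∀ i → Dec (P i)) → Dec (∀ i → P i)
 D∀ d = map′ (λ { (a , b , c , e) → λ { d1 → a ; d2 → b ; d3 → c ; d4 → e } })
   (λ f → f d1 , f d2 , f d3 , f d4) (d d1 ×-dec d d2 ×-dec d d3 ×-dec d d4)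

 K∀ : {P : K → Set} → (∀ k → Dec (P k)) → Dec (∀ k → P k)
 K∀ d = map′
   (λ { (a0 , a1 , a2 , a3 , a4 , a5 , a6 , a7) → λ { k0 → a0 ; k1 → a1 ; k2 → a2 ; k3 → a3 ; k4 → a4 ; k5 → a5 ; k6 → a6 ; k7 → a7 } })
   (λ f → f k0 , f k1 , f k2 , f k3 , f k4 , f k5 , f k6 , f k7)
   (d k0 ×-dec d k1 ×-dec d k2 ×-dec d k3 ×-dec d k4 ×-dec d k5 ×-dec d k6 ×-dec d k7)

 kcode : K → ℕ
 kcode k0 = 0
 kcode k1 = 1
 kcode k2 = 2
 kcode k3 = 3
 kcode k4 = 4
 kcode k5 = 5
 kcode k6 = 6
 kcode k7 = 7

 kdecode : ℕ → K
 kdecode 0 = k0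
 kdecode 1 = k1
 kdecode 2 = k2
 kdecode 3 = k3
 kdecode 4 = k4
 kdecode 5 = k5
 kdecode 6 = k6
 kdecode _ = k7

 kcode-inv : ∀ k → kdecode (kcode k) ≡ k
 kcode-inv k0 = refl
 kcode-inv k1 = refl
 kcode-inv k2 = refl
 kcode-inv k3 = refl
 kcode-inv k4 = refl
 kcode-inv k5 = refl
 kcode-inv k6 = refl
 kcode-inv k7 = refl

 infix 4 _≟K_
 _≟K_ : (k l : K) → Dec (k ≡ l)
 k ≟K l = map′ (λ e → trans (sym (kcode-inv k)) (trans (cong kdecode e) (kcode-inv l))) (cong kcode) (kcode k ℕ.≟ kcode l)

 -- An element w = w̄ t_μ of W is stored as (w̄ , m , n): w̄ is an index for the finite part,
 -- and 2m, n are the coefficients of the null root in w α_r and w α_s.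
 El : Set
 El = K × ℤ × ℤ

 kL : Gen → K → K
 kL r k0 = k1
 kL r k1 = k0
 kL r k2 = k4
 kL r k3 = k5
 kL r k4 = k2
 kL r k5 = k3
 kL r k6 = k7
 kL r k7 = k6
 kL s k0 = k2
 kL s k1 = k6
 kL s k2 = k0
 kL s k3 = k4
 kL s k4 = k3
 kL s k5 = k7
 kL s k6 = k1
 kL s k7 = k5
 kL t k0 = k3
 kL t k1 = k5
 kL t k2 = k6
 kL t k3 = k0
 kL t k4 = k7
 kL t k5 = k1
 kL t k6 = k2
 kL t k7 = k4

 kR : Gen → K → K
 kR r k0 = k1
 kR r k1 = k0
 kR r k2 = k6
 kR r k3 = k5
 kR r k4 = k7
 kR r k5 = k3
 kR r k6 = k2
 kR r k7 = k4
 kR s k0 = k2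
 kR s k1 = k4
 kR s k2 = k0
 kR s k3 = k6
 kR s k4 = k1
 kR s k5 = k7
 kR s k6 = k3
 kR s k7 = k5
 kR t k0 = k3
 kR t k1 = k5
 kR t k2 = k4
 kR t k3 = k0
 kR t k4 = k2
 kR t k5 = k1
 kR t k6 = k7
 kR t k7 = k6

 shm shn : Gen → K → ℤ
 shm t k2 = + 1
 shm t k4 = + 1
 shm t k6 = -[1+ 0 ]
 shm t k7 = -[1+ 0 ]
 shm _ _ = + 0
 shn t k0 = + 1
 shn t k1 = + 1
 shn t k2 = -[1+ 0 ]
 shn t k3 = -[1+ 0 ]
 shn t k4 = -[1+ 0 ]
 shn t k5 = -[1+ 0 ]
 shn t k6 = + 1
 shn t k7 = + 1
 shn _ _ = + 0

 -- Contribution of the finite part to `c`. The minimal positive root of a negative finite direction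
 -- already contains the null root once, which costs -1. For `d3` the base root α_t itself contains
 -- the null root, so there the correction becomes +1 on the positive directions.
 ε : D → K → ℤ
 ε d1 k1 = -[1+ 0 ]
 ε d1 k5 = -[1+ 0 ]
 ε d1 k6 = -[1+ 0 ]
 ε d1 k7 = -[1+ 0 ]
 ε d2 k2 = -[1+ 0 ]
 ε d2 k3 = -[1+ 0 ]
 ε d2 k4 = -[1+ 0 ]
 ε d2 k5 = -[1+ 0 ]
 ε d3 k3 = + 1
 ε d3 k4 = + 1
 ε d3 k5 = + 1
 ε d3 k7 = + 1
 ε d4 k3 = -[1+ 0 ]
 ε d4 k5 = -[1+ 0 ]
 ε d4 k6 = -[1+ 0 ]
 ε d4 k7 = -[1+ 0 ]
 ε _ _ = + 0

 -- For given g and k exactly one direction changes, and by ±1: only the wall crossed by left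
 -- multiplication matters.
 Δc : D → Gen → K → ℤ
 Δc d1 r k0 = -[1+ 0 ]
 Δc d1 r k1 = + 1
 Δc d3 r k2 = + 1
 Δc d1 r k3 = -[1+ 0 ]
 Δc d3 r k4 = -[1+ 0 ]
 Δc d1 r k5 = + 1
 Δc d3 r k6 = + 1
 Δc d3 r k7 = -[1+ 0 ]
 Δc d2 s k0 = -[1+ 0 ]
 Δc d4 s k1 = -[1+ 0 ]
 Δc d2 s k2 = + 1
 Δc d4 s k3 = + 1
 Δc d4 s k4 = -[1+ 0 ]
 Δc d2 s k5 = + 1
 Δc d4 s k6 = + 1
 Δc d2 s k7 = -[1+ 0 ]
 Δc d3 t k0 = -[1+ 0 ]
 Δc d3 t k1 = -[1+ 0 ]
 Δc d1 t k2 = + 1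
 Δc d3 t k3 = + 1
 Δc d1 t k4 = + 1
 Δc d3 t k5 = + 1
 Δc d1 t k6 = -[1+ 0 ]
 Δc d1 t k7 = -[1+ 0 ]
 Δc _ _ _ = + 0

 -- For d other than the direction of h, the reflection h sends β_d to β with index `π h d` or to
 -- the null root minus it, and `sg` is the corresponding sign. Both are minimal roots, so `cR` has
 -- no constant term; the extra -1 in `cR-dir` comes from α_h being sent to -α_h.
 π : Gen → D → D
 π r d1 = d1
 π r d2 = d4
 π r d3 = d3
 π r d4 = d2
 π s d1 = d3
 π s d2 = d2
 π s d3 = d1
 π s d4 = d4
 π t d1 = d1
 π t d2 = d4
 π t d3 = d3
 π t d4 = d2

 sg : Gen → D → ℤ
 sg r d1 = -[1+ 0 ]
 sg r d2 = + 1
 sg r d3 = + 1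
 sg r d4 = + 1
 sg s d1 = -[1+ 0 ]
 sg s d2 = -[1+ 0 ]
 sg s d3 = -[1+ 0 ]
 sg s d4 = + 1
 sg t d1 = + 1
 sg t d2 = -[1+ 0 ]
 sg t d3 = -[1+ 0 ]
 sg t d4 = -[1+ 0 ]

 -- For each of the four directions of finite roots fix a minimal positive affine root β_d
 -- (α_r, α_s, α_t, α_r + α_s).  Then w β_d is the minimal positive root of some direction
 -- plus c d w times the null root; so β_d is inverted by w iff c d w < 0.
 fm fn : D → ℤ
 fm d1 = + 2
 fm d2 = + 0
 fm d3 = -[1+ 1 ]
 fm d4 = + 2
 fn d1 = + 0
 fn d2 = + 1
 fn d3 = -[1+ 1 ]
 fn d4 = + 1

 form : D → ℤ → ℤ → ℤ
 form d m n = fm d * m + fn d * n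

 c : D → El → ℤ
 c d (k , m , n) = form d m n + ε d k

 dir : Gen → D
 dir r = d1
 dir s = d2
 dir t = d3

 e : El
 e = k0 , + 0 , + 0

 Rm Rn : Gen → ℤ → ℤ → ℤ
 Rm r m n = - m
 Rm s m n = m + n
 Rm t m n = m
 Rn r m n = n + + 2 * m
 Rn s m n = - n
 Rn t m n = + 1 + - (+ 2 * m) + - n

 L R : Gen → El → El
 L g (k , m , n) = kL g k , m + shm g k , n + shn g k
 R h (k , m , n) = kR h k , Rm h m n , Rn h m n

 el≡ : ∀ {k k′ : K} {m m′ n n′ : ℤ} → k ≡ k′ → m ≡ m′ → n ≡ n′ → _≡_ {A = El} (k , m , n) (k′ , m′ , n′)
 el≡ refl refl refl = refl

 _≟_ : (x y : El) → Dec (x ≡ y)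
 (k , m , n) ≟ (k′ , m′ , n′) with k ≟K k′ | m ℤ.≟ m′ | n ℤ.≟ n′
 ... | yes refl | yes refl | yes refl = yes refl
 ... | no ne | _ | _ = no (ne ∘ cong proj₁)
 ... | yes _ | no ne | _ = no (ne ∘ cong (proj₁ ∘ proj₂))
 ... | yes _ | yes _ | no ne = no (ne ∘ cong (proj₂ ∘ proj₂))

 L-invol : ∀ g x → L g (L g x) ≡ x
 L-invol g (k , m , n) = el≡
   (toWitness {a? = Gen∀ λ g → K∀ λ k → kL g (kL g k) ≟K k} _ g k)
   (trans (+-assoc m _ _) (trans (cong (_+_ m) (toWitness {a? = Gen∀ λ g → K∀ λ k → shm g k + shm g (kL g k) ℤ.≟ + 0} _ g k)) (+-identityʳ m)))
   (trans (+-assoc n _ _) (trans (cong (_+_ n) (toWitness {a? = Gen∀ λ g → K∀ λ k → shn g k + shn g (kL g k) ℤ.≟ + 0} _ g k)) (+-identityʳ n)))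

 opaque
   kLR : ∀ g h k → kL g (kR h k) ≡ kR h (kL g k)
   kLR = toWitness {a? = Gen∀ λ g → Gen∀ λ h → K∀ λ k → kL g (kR h k) ≟K kR h (kL g k)} _

 LR : ∀ g h x → L g (R h x) ≡ R h (L g x)
 LR g r (k , m , n) = el≡ (kLR g r k)
   (trans (cong (_+_ (- m)) (toWitness {a? = Gen∀ λ g → K∀ λ k → shm g (kR r k) ℤ.≟ - shm g k} _ g k)) (i₁ m _))
   (trans (cong (_+_ (n + + 2 * m)) (toWitness {a? = Gen∀ λ g → K∀ λ k → shn g (kR r k) ℤ.≟ shn g k + + 2 * shm g k} _ g k)) (i₂ m n _ _))
   where
   i₁ : ∀ m a → - m + - a ≡ - (m + a)
   i₁ = solve-∀
   i₂ : ∀ m n a b → n + + 2 * m + (b + + 2 * a) ≡ n + b + + 2 * (m + a)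
   i₂ = solve-∀
 LR g s (k , m , n) = el≡ (kLR g s k)
   (trans (cong (_+_ (m + n)) (toWitness {a? = Gen∀ λ g → K∀ λ k → shm g (kR s k) ℤ.≟ shm g k + shn g k} _ g k)) (i₁ m n _ _))
   (trans (cong (_+_ (- n)) (toWitness {a? = Gen∀ λ g → K∀ λ k → shn g (kR s k) ℤ.≟ - shn g k} _ g k)) (i₂ n _))
   where
   i₁ : ∀ m n a b → m + n + (a + b) ≡ m + a + (n + b)
   i₁ = solve-∀
   i₂ : ∀ n b → - n + - b ≡ - (n + b)
   i₂ = solve-∀
 LR g t (k , m , n) = el≡ (kLR g t k)
   (cong (_+_ m) (toWitness {a? = Gen∀ λ g → K∀ λ k → shm g (kR t k) ℤ.≟ shm g k} _ g k))
   (trans (cong (_+_ (+ 1 + - (+ 2 * m) + - n)) (toWitness {a? = Gen∀ λ g → K∀ λ k → shn g (kR t k) ℤ.≟ - (+ 2 * shm g k) + - shn g k} _ g k)) (i₂ m n _ _))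
   where
   i₂ : ∀ m n a b → + 1 + - (+ 2 * m) + - n + (- (+ 2 * a) + - b) ≡ + 1 + - (+ 2 * (m + a)) + - (n + b)
   i₂ = solve-∀

 Le≡Re : ∀ g → L g e ≡ R g e
 Le≡Re r = refl
 Le≡Re s = refl
 Le≡Re t = refl

 cL : ∀ d g k m n → c d (L g (k , m , n)) ≡ c d (k , m , n) + Δc d g k
 cL d g k m n = trans (i₁ (fm d) (fn d) m n _ _ _)
   (trans (cong (_+_ (fm d * m + fn d * n)) (toWitness {a? = D∀ λ d → Gen∀ λ g → K∀ λ k → fm d * shm g k + fn d * shn g k + ε d (kL g k) ℤ.≟ ε d k + Δc d g k} _ d g k))
   (sym (+-assoc (fm d * m + fn d * n) _ _)))
   where
   i₁ : ∀ a b m n x y z → a * (m + x) + b * (n + y) + z ≡ a * m + b * n + (a * x + b * y + z)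
   i₁ = solve-∀

 cR-dir : ∀ h x → c (dir h) (R h x) ≡ - c (dir h) x + -[1+ 0 ]
 cR-dir r (k , m , n) = trans (cong (_+_ (+ 2 * - m + + 0 * (n + + 2 * m))) (toWitness {a? = K∀ λ k → ε d1 (kR r k) ℤ.≟ - ε d1 k + -[1+ 0 ]} _ k)) (i m n (ε d1 k))
   where
   i : ∀ m n a → + 2 * - m + + 0 * (n + + 2 * m) + (- a + -[1+ 0 ]) ≡ - (+ 2 * m + + 0 * n + a) + -[1+ 0 ]
   i = solve-∀
 cR-dir s (k , m , n) = trans (cong (_+_ (+ 0 * (m + n) + + 1 * - n)) (toWitness {a? = K∀ λ k → ε d2 (kR s k) ℤ.≟ - ε d2 k + -[1+ 0 ]} _ k)) (i m n (ε d2 k))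
   where
   i : ∀ m n a → + 0 * (m + n) + + 1 * - n + (- a + -[1+ 0 ]) ≡ - (+ 0 * m + + 1 * n + a) + -[1+ 0 ]
   i = solve-∀
 cR-dir t (k , m , n) = trans (cong (_+_ (-[1+ 1 ] * m + -[1+ 1 ] * (+ 1 + - (+ 2 * m) + - n))) (toWitness {a? = K∀ λ k → ε d3 (kR t k) ℤ.≟ - ε d3 k + + 1} _ k)) (i m n (ε d3 k))
   where
   i : ∀ m n a → -[1+ 1 ] * m + -[1+ 1 ] * (+ 1 + - (+ 2 * m) + - n) + (- a + + 1) ≡ - (-[1+ 1 ] * m + -[1+ 1 ] * n + a) + -[1+ 0 ]
   i = solve-∀

 infix 4 _≟D_
 dcode : D → ℕ
 dcode d1 = 0
 dcode d2 = 1
 dcode d3 = 2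
 dcode d4 = 3
 dcode-inj : ∀ i j → dcode i ≡ dcode j → i ≡ j
 dcode-inj d1 d1 _ = refl
 dcode-inj d2 d2 _ = refl
 dcode-inj d3 d3 _ = refl
 dcode-inj d4 d4 _ = refl

 _≟D_ : (i j : D) → Dec (i ≡ j)
 i ≟D j = map′ (dcode-inj i j) (cong dcode) (dcode i ℕ.≟ dcode j)

 ρ₀ : Gen → D → ℤ
 ρ₀ t d2 = + 1
 ρ₀ t d3 = -[1+ 1 ]
 ρ₀ t d4 = + 1
 ρ₀ _ _ = + 0

 cR : ∀ h d x → d ≢ dir h → c d (R h x) ≡ sg h d * c (π h d) x
 cR h d (k , m , n) ne = trans (cong (_+ ε d (kR h k)) (lin h d ne))
   (trans (+-assoc (sg h d * form (π h d) m n) _ _)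
   (trans (cong (_+_ (sg h d * form (π h d) m n)) (table d h k ne))
   (sym (ℤ.*-distribˡ-+ (sg h d) (form (π h d) m n) _))))
   where
   table : ∀ d h k → d ≢ dir h → ρ₀ h d + ε d (kR h k) ≡ sg h d * ε (π h d) k
   table d h k ne with toWitness {a? = D∀ λ d → Gen∀ λ h → K∀ λ k → (d ≟D dir h) ⊎? (ρ₀ h d + ε d (kR h k) ℤ.≟ sg h d * ε (π h d) k)} _ d h k
     where
     _⊎?_ : ∀ {A B : Set} → Dec A → Dec B → Dec (A ⊎ B)
     _⊎?_ = Relation.Nullary.Decidable._⊎-dec_
   ... | inj₁ eq = ⊥-elim (ne eq)
   ... | inj₂ eq = eq
   j₁ : ∀ m n → + 0 * - m + + 1 * (n + + 2 * m) ≡ + 1 * (+ 2 * m + + 1 * n) + + 0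
   j₁ = solve-∀
   j₂ : ∀ m n → -[1+ 1 ] * - m + -[1+ 1 ] * (n + + 2 * m) ≡ + 1 * (-[1+ 1 ] * m + -[1+ 1 ] * n) + + 0
   j₂ = solve-∀
   j₃ : ∀ m n → + 2 * - m + + 1 * (n + + 2 * m) ≡ + 1 * (+ 0 * m + + 1 * n) + + 0
   j₃ = solve-∀
   j₄ : ∀ m n → + 2 * (m + n) + + 0 * - n ≡ -[1+ 0 ] * (-[1+ 1 ] * m + -[1+ 1 ] * n) + + 0
   j₄ = solve-∀
   j₅ : ∀ m n → -[1+ 1 ] * (m + n) + -[1+ 1 ] * - n ≡ -[1+ 0 ] * (+ 2 * m + + 0 * n) + + 0
   j₅ = solve-∀
   j₆ : ∀ m n → + 2 * (m + n) + + 1 * - n ≡ + 1 * (+ 2 * m + + 1 * n) + + 0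
   j₆ = solve-∀
   j₇ : ∀ m n → + 2 * m + + 0 * (+ 1 + - (+ 2 * m) + - n) ≡ + 1 * (+ 2 * m + + 0 * n) + + 0
   j₇ = solve-∀
   j₈ : ∀ m n → + 0 * m + + 1 * (+ 1 + - (+ 2 * m) + - n) ≡ -[1+ 0 ] * (+ 2 * m + + 1 * n) + + 1
   j₈ = solve-∀
   j₉ : ∀ m n → + 2 * m + + 1 * (+ 1 + - (+ 2 * m) + - n) ≡ -[1+ 0 ] * (+ 0 * m + + 1 * n) + + 1
   j₉ = solve-∀
   lin′ : ∀ {a b} q {z} → a ≡ b + q → a + z ≡ b + (q + z)
   lin′ {b = b} q {z} eq = trans (cong (_+ z) eq) (+-assoc b q z)
   lin : ∀ h d → d ≢ dir h → form d (Rm h m n) (Rn h m n) ≡ sg h d * form (π h d) m n + ρ₀ h d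
   lin r d1 ne = ⊥-elim (ne refl)
   lin r d2 _ = j₁ m n
   lin r d3 _ = j₂ m n
   lin r d4 _ = j₃ m n
   lin s d1 _ = j₄ m n
   lin s d2 ne = ⊥-elim (ne refl)
   lin s d3 _ = j₅ m n
   lin s d4 _ = j₆ m n
   lin t d1 _ = j₇ m n
   lin t d2 _ = j₈ m n
   lin t d3 ne = ⊥-elim (ne refl)
   lin t d4 _ = j₉ m n

-- Length, inversion, the exchange condition and the automaton of small roots.

module Automaton where
 open Alcoves
 open Defs using (Gen; r; s; t; Word)

 isNeg : ℤ → Bool
 isNeg (+ _) = false
 isNeg -[1+ _ ] = true

 -- The Iwahori-Matsumoto formula: among the hyperplanes of one direction, ∣`c d x`∣ separate the
 -- two alcoves.
 ℓ : El → ℕ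
 ℓ x = ∣ c d1 x ∣ ℕ.+ ∣ c d2 x ∣ ℕ.+ ∣ c d3 x ∣ ℕ.+ ∣ c d4 x ∣

 ∣sg∣ : ∀ h d z → ∣ sg h d * z ∣ ≡ ∣ z ∣
 ∣sg∣ h d z = trans (ℤ.abs-* (sg h d) z)
   (trans (cong (ℕ._* ∣ z ∣) (toWitness {a? = Gen∀ λ h → D∀ λ d → ∣ sg h d ∣ ℕ.≟ 1} _ h d)) (ℕ.*-identityˡ ∣ z ∣))

 ∣cR∣ : ∀ h d x → d ≢ dir h → ∣ c d (R h x) ∣ ≡ ∣ c (π h d) x ∣
 ∣cR∣ h d x ne = trans (cong ∣_∣ (cR h d x ne)) (∣sg∣ h d (c (π h d) x))

 flip-up : ∀ z → isNeg z ≡ false → ∣ - z + -[1+ 0 ] ∣ ≡ suc ∣ z ∣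
 flip-up (+ zero) _ = refl
 flip-up (+ suc n) _ = cong (suc ∘ suc) (ℕ.+-identityʳ n)

 flip-down : ∀ z → isNeg z ≡ true → ∣ z ∣ ≡ suc ∣ - z + -[1+ 0 ] ∣
 flip-down -[1+ n ] _ = refl

 sum-lemma : ∀ h a (f : D → ℕ) → f (dir h) ≡ a → (g : D → ℕ) → (∀ d → d ≢ dir h → g d ≡ f (π h d)) →
   g (dir h) ℕ.+ (f d1 ℕ.+ f d2 ℕ.+ f d3 ℕ.+ f d4) ≡ a ℕ.+ (g d1 ℕ.+ g d2 ℕ.+ g d3 ℕ.+ g d4)
 sum-lemma r a f refl g p rewrite p d2 (λ ()) | p d3 (λ ()) | p d4 (λ ()) = i (g d1) (f d1) (f d2) (f d3) (f d4)
   where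
   i : ∀ x a b c d → x ℕ.+ (a ℕ.+ b ℕ.+ c ℕ.+ d) ≡ a ℕ.+ (x ℕ.+ d ℕ.+ c ℕ.+ b)
   i = ℕs.solve-∀
 sum-lemma s a f refl g p rewrite p d1 (λ ()) | p d3 (λ ()) | p d4 (λ ()) = i (g d2) (f d1) (f d2) (f d3) (f d4)
   where
   i : ∀ x a b c d → x ℕ.+ (a ℕ.+ b ℕ.+ c ℕ.+ d) ≡ b ℕ.+ (c ℕ.+ x ℕ.+ a ℕ.+ d)
   i = ℕs.solve-∀
 sum-lemma t a f refl g p rewrite p d1 (λ ()) | p d2 (λ ()) | p d4 (λ ()) = i (g d3) (f d1) (f d2) (f d3) (f d4)
   where
   i : ∀ x a b c d → x ℕ.+ (a ℕ.+ b ℕ.+ c ℕ.+ d) ≡ c ℕ.+ (a ℕ.+ d ℕ.+ x ℕ.+ b)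
   i = ℕs.solve-∀

 ℓR-sum : ∀ h x → ∣ c (dir h) (R h x) ∣ ℕ.+ ℓ x ≡ ∣ c (dir h) x ∣ ℕ.+ ℓ (R h x)
 ℓR-sum h x = sum-lemma h _ (λ d → ∣ c d x ∣) refl (λ d → ∣ c d (R h x) ∣) (λ d → ∣cR∣ h d x)

 ℓR-up : ∀ h x → isNeg (c (dir h) x) ≡ false → ℓ (R h x) ≡ suc (ℓ x)
 ℓR-up h x b = ℕ.+-cancelˡ-≡ ∣ c (dir h) x ∣ _ _ (trans (sym (ℓR-sum h x))
   (trans (cong (ℕ._+ ℓ x) (trans (cong ∣_∣ (cR-dir h x)) (flip-up _ b))) (sym (+-suc ∣ c (dir h) x ∣ (ℓ x)))))

 ℓR-down : ∀ h x → isNeg (c (dir h) x) ≡ true → ℓ x ≡ suc (ℓ (R h x))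
 ℓR-down h x b = ℕ.+-cancelˡ-≡ ∣ c (dir h) (R h x) ∣ _ _ (trans (ℓR-sum h x)
   (trans (cong (ℕ._+ ℓ (R h x)) (trans (flip-down _ b) (cong (suc ∘ ∣_∣) (sym (cR-dir h x))))) (sym (+-suc ∣ c (dir h) (R h x) ∣ (ℓ (R h x))))))

 R-invol : ∀ h x → R h (R h x) ≡ x
 R-invol h (k , m , n) = el≡ (toWitness {a? = Gen∀ λ h → K∀ λ k → kR h (kR h k) ≟K k} _ h k) (i h m n) (j h m n)
   where
   i : ∀ h m n → Rm h (Rm h m n) (Rn h m n) ≡ m
   i r = λ m n → ℤ.neg-involutive m
   i s = i₁ where
     i₁ : ∀ m n → m + n + - n ≡ m
     i₁ = solve-∀
   i t = λ m n → refl
   j : ∀ h m n → Rn h (Rm h m n) (Rn h m n) ≡ n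
   j r = i₁ where
     i₁ : ∀ m n → n + + 2 * m + + 2 * - m ≡ n
     i₁ = solve-∀
   j s = λ m n → ℤ.neg-involutive n
   j t = i₁ where
     i₁ : ∀ m n → + 1 + - (+ 2 * m) + - (+ 1 + - (+ 2 * m) + - n) ≡ n
     i₁ = solve-∀

 nonneg : ∀ z → isNeg z ≡ false → ∃ λ a → z ≡ + a
 nonneg (+ a) _ = a , refl

 -- The null root α_r + 2α_s + α_t is fixed by W, so this combination of the three values of `c`
 -- does not depend on m and n.
 κ : K → ℤ
 κ k = ε d1 k + + 2 * ε d2 k + ε d3 k

 κ-sum : ∀ k m n → c d1 (k , m , n) + + 2 * c d2 (k , m , n) + c d3 (k , m , n) ≡ κ k
 κ-sum k m n = i m n (ε d1 k) (ε d2 k) (ε d3 k)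
   where
   i : ∀ m n a b c → (+ 2 * m + + 0 * n + a) + + 2 * (+ 0 * m + + 1 * n + b) + (-[1+ 1 ] * m + -[1+ 1 ] * n + c) ≡ a + + 2 * b + c
   i = solve-∀

 opaque
   κ-table : ∀ k → k ≡ k0 ⊎ k ≡ k7 ⊎ isNeg (κ k) ≡ true
   κ-table = toWitness {a? = K∀ λ k → (k ≟K k0) ⊎-dec ((k ≟K k7) ⊎-dec (isNeg (κ k) Bool.≟ true))} _

 -- Three nonnegative values make `κ` nonnegative, which leaves `k0` and `k7`. In both cases the sum
 -- is 0, so all three values are 0; for `k0` this is the identity, for `k7` it would require 2m =
 -- 1.
 alcove : ∀ x → (∀ g → isNeg (c (dir g) x) ≡ false) → x ≡ e
 alcove (k , m , n) p with nonneg _ (p r) | nonneg _ (p s) | nonneg _ (p t) | κ-table k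
 ... | a , pa | b , pb | z , pz | inj₂ (inj₂ q) = ⊥-elim (lem (sum a b z pa pb pz) q)
   where
   sum : ∀ a b z → c d1 (k , m , n) ≡ + a → c d2 (k , m , n) ≡ + b → c d3 (k , m , n) ≡ + z → κ k ≡ + (a ℕ.+ 2 ℕ.* b ℕ.+ z)
   sum a b z pa pb pz = trans (sym (κ-sum k m n)) (trans (cong₂ _+_ (cong₂ (λ u v → u + + 2 * v) pa pb) pz)
     (trans (cong (λ u → + a + u + + z) (sym (ℤ.pos-* 2 b))) refl))
   lem : ∀ {a} → κ k ≡ + a → isNeg (κ k) ≡ true → ⊥
   lem eq q rewrite eq with q
   ... | ()
 ... | a , pa | b , pb | z , pz | inj₁ refl = el≡ refl
     (ℤ.*-cancelˡ-≡ (+ 2) m (+ 0) (trans (i₁ m n) (trans pa (cong +_ a0))))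
     (trans (i₂ m n) (trans pb (cong +_ b0)))
   where
   i₁ : ∀ m n → + 2 * m ≡ + 2 * m + + 0 * n + + 0
   i₁ = solve-∀
   i₂ : ∀ m n → n ≡ + 0 * m + + 1 * n + + 0
   i₂ = solve-∀
   tot : a ℕ.+ 2 ℕ.* b ℕ.+ z ≡ 0
   tot = sym (+-injective (trans (sym (κ-sum k0 m n)) (trans (cong₂ _+_ (cong₂ (λ u v → u + + 2 * v) pa pb) pz)
     (cong (λ u → + a + u + + z) (sym (ℤ.pos-* 2 b))))))
   a0 : a ≡ 0
   a0 = ℕ.m+n≡0⇒m≡0 a (ℕ.m+n≡0⇒m≡0 (a ℕ.+ 2 ℕ.* b) tot)
   b0 : b ≡ 0
   b0 = ℕ.m+n≡0⇒m≡0 b (ℕ.m+n≡0⇒n≡0 a (ℕ.m+n≡0⇒m≡0 (a ℕ.+ 2 ℕ.* b) tot))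
 ... | a , pa | b , pb | z , pz | inj₂ (inj₁ refl) = ⊥-elim (odd ∣ m ∣ (trans (sym (ℤ.abs-* (+ 2) m)) (cong ∣_∣ two)))
   where
   tot : a ℕ.+ 2 ℕ.* b ℕ.+ z ≡ 0
   tot = sym (+-injective (trans (sym (κ-sum k7 m n)) (trans (cong₂ _+_ (cong₂ (λ u v → u + + 2 * v) pa pb) pz)
     (cong (λ u → + a + u + + z) (sym (ℤ.pos-* 2 b))))))
   a0 : a ≡ 0
   a0 = ℕ.m+n≡0⇒m≡0 a (ℕ.m+n≡0⇒m≡0 (a ℕ.+ 2 ℕ.* b) tot)
   i₁ : ∀ m n → + 2 * m ≡ + 2 * m + + 0 * n + -[1+ 0 ] + + 1
   i₁ = solve-∀
   two : + 2 * m ≡ + 1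
   two = trans (i₁ m n) (cong (_+ + 1) (trans pa (cong +_ a0)))
   odd : ∀ j → 2 ℕ.* j ≢ 1
   odd (suc j) q with trans (sym (+-suc j (j ℕ.+ 0))) (suc-injective q)
   ... | ()

 private
   find : ∀ x → (∃ λ h → isNeg (c (dir h) x) ≡ true) ⊎ x ≡ e
   find x with isNeg (c d1 x) in p | isNeg (c d2 x) in q | isNeg (c d3 x) in u
   ... | true | _ | _ = inj₁ (r , p)
   ... | false | true | _ = inj₁ (s , q)
   ... | false | false | true = inj₁ (t , u)
   ... | false | false | false = inj₂ (alcove x λ { r → p ; s → q ; t → u })

 evL evR : Word → El
 evL = foldr L e
 evR = foldr R e

 wordOf : ∀ n x → ℓ x ≡ n → Σ Word λ w → evR w ≡ x × length w ≡ n
 wordOf n x eq with find x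
 wordOf zero x eq | inj₁ (h , b) with trans (sym (ℓR-down h x b)) eq
 ... | ()
 wordOf (suc n) x eq | inj₁ (h , b) with wordOf n (R h x) (suc-injective (trans (sym (ℓR-down h x b)) eq))
 ... | w , p , q = h ∷ w , trans (cong (R h) p) (R-invol h x) , cong suc q
 wordOf n x eq | inj₂ refl = [] , refl , eq

 wR : El → Word
 wR x = proj₁ (wordOf (ℓ x) x refl)

 evR-wR : ∀ x → evR (wR x) ≡ x
 evR-wR x = proj₁ (proj₂ (wordOf (ℓ x) x refl))

 length-wR : ∀ x → length (wR x) ≡ ℓ x
 length-wR x = proj₂ (proj₂ (wordOf (ℓ x) x refl))

 L-ρ : ∀ g u y → L g (foldr R y u) ≡ foldr R (L g y) u
 L-ρ g [] y = refl
 L-ρ g (h ∷ u) y = trans (LR g h _) (cong (R h) (L-ρ g u y))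

 λ-R : ∀ h u y → foldr L (R h y) u ≡ R h (foldr L y u)
 λ-R h [] y = refl
 λ-R h (g ∷ u) y = trans (cong (L g) (λ-R h u y)) (LR g h _)

 λ-ρ : ∀ a u y → foldr L (foldr R y u) a ≡ foldr R (foldr L y a) u
 λ-ρ [] u y = refl
 λ-ρ (g ∷ a) u y = trans (cong (L g) (λ-ρ a u y)) (L-ρ g u _)

 evL-∷ʳ : ∀ u h → evL (u ∷ʳ h) ≡ R h (evL u)
 evL-∷ʳ u h = trans (List.foldr-++ L e u _) (trans (cong (λ z → foldr L z u) (Le≡Re h)) (λ-R h u e))

 evR-∷ʳ : ∀ u g → evR (u ∷ʳ g) ≡ L g (evR u)
 evR-∷ʳ u g = trans (List.foldr-++ R e u _) (trans (cong (λ z → foldr R z u) (sym (Le≡Re g))) (sym (L-ρ g u e)))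

 evL-reverse : ∀ u → evL (reverse u) ≡ evR u
 evL-reverse [] = refl
 evL-reverse (g ∷ u) = trans (cong evL (List.unfold-reverse g u)) (trans (evL-∷ʳ (reverse u) g) (cong (R g) (evL-reverse u)))

 λ-cancel : ∀ u y → foldr L (foldr L y u) (reverse u) ≡ y
 λ-cancel [] y = refl
 λ-cancel (g ∷ u) y = trans (cong (foldr L _) (List.unfold-reverse g u))
   (trans (List.foldr-++ L _ (reverse u) _) (trans (cong (λ z → foldr L z (reverse u)) (L-invol g _)) (λ-cancel u y)))

 -- Makes `inv` independent of the word chosen. Every element is an `evR`, and left translations
 -- commute with right ones, so translation by a reversed word is determined by its value at `e`;
 -- cancelling this common translation gives the claim.
 evR→evL : ∀ u v → evR u ≡ evR v → evL u ≡ evL v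
 evR→evL u v eq = trans (sym (λ-cancel′ (evL u)))
   (trans (cong (λ z → foldr L z (reverse (reverse v))) (trans (same (evL u)) (λ-cancel u e))) (cong evL (List.reverse-involutive v)))
   where
   same : ∀ y → foldr L y (reverse v) ≡ foldr L y (reverse u)
   same y = subst (λ y → foldr L y (reverse v) ≡ foldr L y (reverse u)) (evR-wR y)
     (trans (λ-ρ (reverse v) (wR y) e) (trans (cong (λ z → foldr R z (wR y)) (trans (evL-reverse v) (trans (sym eq) (sym (evL-reverse u))))) (sym (λ-ρ (reverse u) (wR y) e))))
   λ-cancel′ : ∀ y → foldr L (foldr L y (reverse v)) (reverse (reverse v)) ≡ y
   λ-cancel′ y = λ-cancel (reverse v) y

 opaque
   inv : El → El
   inv x = evL (wR x)

   inv-evR : ∀ u → inv (evR u) ≡ evL u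
   inv-evR u = evR→evL (wR (evR u)) u (evR-wR (evR u))

   inv-R : ∀ h x → inv (R h x) ≡ L h (inv x)
   inv-R h x = trans (cong (inv ∘ R h) (sym (evR-wR x))) (inv-evR (h ∷ wR x))

   inv-L : ∀ g x → inv (L g x) ≡ R g (inv x)
   inv-L g x = trans (cong (inv ∘ L g) (sym (evR-wR x))) (trans (cong inv (sym (evR-∷ʳ (wR x) g)))
     (trans (inv-evR (wR x ∷ʳ g)) (evL-∷ʳ (wR x) g)))

   inv-e : inv e ≡ e
   inv-e = inv-evR []

   inv-evL : ∀ u → inv (evL u) ≡ evR u
   inv-evL [] = inv-e
   inv-evL (g ∷ u) = trans (inv-L g (evL u)) (cong (R g) (inv-evL u))

   inv-invol : ∀ x → inv (inv x) ≡ x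
   inv-invol x = trans (inv-evL (wR x)) (evR-wR x)

   ℓR≤ : ∀ h x → ℓ (R h x) ≤ suc (ℓ x)
   ℓR≤ h x with isNeg (c (dir h) x) in b
   ... | false = ≤-reflexive (ℓR-up h x b)
   ... | true = ≤-trans (≤-trans (n≤1+n _) (≤-reflexive (sym (ℓR-down h x b)))) (n≤1+n _)

   ℓ-evR≤ : ∀ u → ℓ (evR u) ≤ length u
   ℓ-evR≤ [] = z≤n
   ℓ-evR≤ (h ∷ u) = ≤-trans (ℓR≤ h (evR u)) (s≤s (ℓ-evR≤ u))

   ℓ-evL≤ : ∀ u → ℓ (evL u) ≤ length u
   ℓ-evL≤ u = subst₂ (λ a b → ℓ a ≤ b) (trans (sym (evL-reverse (reverse u))) (cong evL (List.reverse-involutive u))) (List.length-reverse u) (ℓ-evR≤ (reverse u))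

   ℓ-inv : ∀ x → ℓ (inv x) ≡ ℓ x
   ℓ-inv x = ℕ.≤-antisym (h x) (subst (_≤ ℓ (inv x)) (cong ℓ (inv-invol x)) (h (inv x)))
     where
     h : ∀ x → ℓ (inv x) ≤ ℓ x
     h x = subst (ℓ (inv x) ≤_) (length-wR x) (ℓ-evL≤ (wR x))

 ld : Gen → El → Bool
 ld g x = isNeg (c (dir g) (inv x))

 ℓL-up : ∀ g x → ld g x ≡ false → ℓ (L g x) ≡ suc (ℓ x)
 ℓL-up g x b = trans (sym (ℓ-inv (L g x))) (trans (cong ℓ (inv-L g x)) (trans (ℓR-up g (inv x) b) (cong suc (ℓ-inv x))))

 ℓL-down : ∀ g x → ld g x ≡ true → ℓ x ≡ suc (ℓ (L g x))
 ℓL-down g x b = trans (sym (ℓ-inv x)) (trans (ℓR-down g (inv x) b) (cong suc (trans (cong ℓ (sym (inv-L g x))) (ℓ-inv (L g x)))))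

 findL : ∀ x → (∃ λ g → ld g x ≡ true) ⊎ x ≡ e
 findL x with find (inv x)
 ... | inj₁ p = inj₁ p
 ... | inj₂ p = inj₂ (trans (sym (inv-invol x)) (trans (cong inv p) inv-e))

 private
   opaque
     Δ-cases : ∀ d g k → Δc d g k ≡ -[1+ 0 ] ⊎ isNeg (Δc d g k) ≡ false
     Δ-cases = toWitness {a? = D∀ λ d → Gen∀ λ g → K∀ λ k → (Δc d g k ℤ.≟ -[1+ 0 ]) ⊎-dec (isNeg (Δc d g k) Bool.≟ false)} _

   pos-+ : ∀ a b → isNeg a ≡ false → isNeg b ≡ false → isNeg (a + b) ≡ false
   pos-+ (+ _) (+ _) _ _ = refl

   pred-neg : ∀ a → isNeg a ≡ false → isNeg (a + -[1+ 0 ]) ≡ true → a ≡ + 0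
   pred-neg (+ zero) _ _ = refl

   opaque
     kLR-match : ∀ g h k → Δc (dir g) h k ≡ -[1+ 0 ] → kL h k ≡ kR g k
     kLR-match = toWitness {a? = Gen∀ λ g → Gen∀ λ h → K∀ λ k → (Δc (dir g) h k ℤ.≟ -[1+ 0 ]) →-dec (kL h k ≟K kR g k)} _

   match : ∀ g h k m n → Δc (dir g) h k ≡ -[1+ 0 ] → c (dir g) (k , m , n) ≡ + 0 → L h (k , m , n) ≡ R g (k , m , n)
   match r h k m n p q = el≡ (kLR-match r h k p)
     (trans (cong (_+_ m) (toWitness {a? = Gen∀ λ h → K∀ λ k → (Δc d1 h k ℤ.≟ -[1+ 0 ]) →-dec (shm h k ℤ.≟ ε d1 k)} _ h k p)) (fin (i₁ m n (ε d1 k)) q))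
     (trans (cong (_+_ n) (toWitness {a? = Gen∀ λ h → K∀ λ k → (Δc d1 h k ℤ.≟ -[1+ 0 ]) →-dec (shn h k ℤ.≟ - ε d1 k)} _ h k p)) (sym (trans (i₂ m n (ε d1 k)) (trans (cong (_+_ (n + - ε d1 k)) q) (+-identityʳ _)))))
     where
     i₁ : ∀ m n a → m + a ≡ - m + (+ 2 * m + + 0 * n + a)
     i₁ = solve-∀
     i₂ : ∀ m n a → n + + 2 * m ≡ n + - a + (+ 2 * m + + 0 * n + a)
     i₂ = solve-∀
     fin : ∀ {a b z} → a ≡ b + z → z ≡ + 0 → a ≡ b
     fin {b = b} refl refl = +-identityʳ b
   match s h k m n p q = el≡ (kLR-match s h k p)
     (trans (cong (_+_ m) (toWitness {a? = Gen∀ λ h → K∀ λ k → (Δc d2 h k ℤ.≟ -[1+ 0 ]) →-dec (shm h k ℤ.≟ - ε d2 k)} _ h k p)) (sym (fin (i₁ m n (ε d2 k)) q)))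
     (trans (cong (_+_ n) (toWitness {a? = Gen∀ λ h → K∀ λ k → (Δc d2 h k ℤ.≟ -[1+ 0 ]) →-dec (shn h k ℤ.≟ + 2 * ε d2 k)} _ h k p)) (trans (i₂ m n (ε d2 k)) (trans (cong (λ z → - n + + 2 * z) q) (+-identityʳ _))))
     where
     i₁ : ∀ m n a → m + n ≡ m + - a + (+ 0 * m + + 1 * n + a)
     i₁ = solve-∀
     i₂ : ∀ m n a → n + + 2 * a ≡ - n + + 2 * (+ 0 * m + + 1 * n + a)
     i₂ = solve-∀
     fin : ∀ {a b z} → a ≡ b + z → z ≡ + 0 → a ≡ b
     fin {b = b} refl refl = +-identityʳ b
   match t h k m n p q = el≡ (kLR-match t h k p)
     (trans (cong (_+_ m) (toWitness {a? = Gen∀ λ h → K∀ λ k → (Δc d3 h k ℤ.≟ -[1+ 0 ]) →-dec (shm h k ℤ.≟ + 0)} _ h k p)) (+-identityʳ m))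
     (trans (cong (_+_ n) (toWitness {a? = Gen∀ λ h → K∀ λ k → (Δc d3 h k ℤ.≟ -[1+ 0 ]) →-dec (shn h k ℤ.≟ + 1 + - ε d3 k)} _ h k p)) (sym (trans (i₂ m n (ε d3 k)) (trans (cong (_+_ (n + (+ 1 + - ε d3 k))) q) (+-identityʳ _)))))
     where
     i₂ : ∀ m n a → + 1 + - (+ 2 * m) + - n ≡ n + (+ 1 + - a) + (-[1+ 1 ] * m + -[1+ 1 ] * n + a)
     i₂ = solve-∀

   match′ : ∀ g h y → isNeg (c (dir g) y) ≡ false → isNeg (c (dir g) (L h y)) ≡ true → L h y ≡ R g y
   match′ g h (k , m , n) p q with Δ-cases (dir g) h k | subst (λ z → isNeg z ≡ true) (cL (dir g) h k m n) q
   ... | inj₁ eq | q′ = match g h k m n eq (pred-neg _ p (subst (λ z → isNeg (c (dir g) (k , m , n) + z) ≡ true) eq q′))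
   ... | inj₂ ge | q′ with trans (sym q′) (pos-+ _ _ p ge)
   ...   | ()

 -- On y = x⁻¹ the hypotheses say that left multiplication by h makes `c (dir g) y` negative. It
 -- lowers this value by at most 1, so the value was 0; then `match` applies, where the coordinates
 -- of the two sides differ by multiples of it.
 exchange : ∀ g h x → ld g x ≡ false → ld g (R h x) ≡ true → L g x ≡ R h x
 exchange g h x p q = trans (sym (inv-invol (L g x))) (trans (cong inv (trans (inv-L g x) (sym m))) (trans (cong inv (sym (inv-R h x))) (inv-invol (R h x))))
   where
   m : L h (inv x) ≡ R g (inv x)
   m = match′ g h (inv x) p (subst (λ z → isNeg (c (dir g) z) ≡ true) (inv-R h x) q)

 data Trit : Set where
   neg zer pos : Trit

 trit : ℤ → Trit
 trit (+ zero) = zer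
 trit (+ suc _) = pos
 trit -[1+ _ ] = neg

 opp : Trit → Trit
 opp neg = pos
 opp zer = zer
 opp pos = neg

 data Q : Set where
   q0 q1 q2 q3 q4 q5 q6 q7 q8 q9 q10 q11 q12 q13 q14 q15 q16 q17 q18 q19 q20 q21 q22 q23 q24 q25 q26 : Q

 -- The automaton of small roots.  A state records, for the four directions, whether β_d or the
 -- opposite minimal root is inverted by w⁻¹; two of the 25 sign patterns are split, to keep
 -- the elements rsr and tst apart.
 tri : D → Q → Trit
 tri d1 q1 = neg
 tri d1 q4 = neg
 tri d1 q5 = neg
 tri d1 q7 = pos
 tri d1 q9 = neg
 tri d1 q10 = neg
 tri d1 q12 = pos
 tri d1 q13 = pos
 tri d1 q14 = pos
 tri d1 q15 = neg
 tri d1 q16 = neg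
 tri d1 q17 = neg
 tri d1 q18 = pos
 tri d1 q20 = pos
 tri d1 q21 = neg
 tri d1 q22 = neg
 tri d1 q23 = pos
 tri d1 q24 = pos
 tri d1 q25 = neg
 tri d1 q26 = pos
 tri d2 q2 = neg
 tri d2 q6 = neg
 tri d2 q7 = neg
 tri d2 q10 = pos
 tri d2 q11 = neg
 tri d2 q12 = neg
 tri d2 q13 = neg
 tri d2 q15 = neg
 tri d2 q17 = pos
 tri d2 q18 = neg
 tri d2 q19 = pos
 tri d2 q21 = pos
 tri d2 q22 = pos
 tri d2 q23 = neg
 tri d2 q24 = neg
 tri d2 q25 = pos
 tri d2 q26 = pos
 tri d3 q3 = neg
 tri d3 q5 = neg
 tri d3 q6 = pos
 tri d3 q8 = neg
 tri d3 q9 = pos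
 tri d3 q10 = neg
 tri d3 q11 = pos
 tri d3 q12 = pos
 tri d3 q14 = neg
 tri d3 q15 = pos
 tri d3 q16 = pos
 tri d3 q18 = neg
 tri d3 q19 = neg
 tri d3 q20 = neg
 tri d3 q21 = neg
 tri d3 q22 = neg
 tri d3 q23 = pos
 tri d3 q24 = pos
 tri d3 q25 = pos
 tri d3 q26 = neg
 tri d4 q4 = neg
 tri d4 q8 = pos
 tri d4 q9 = neg
 tri d4 q11 = neg
 tri d4 q13 = pos
 tri d4 q14 = pos
 tri d4 q15 = neg
 tri d4 q16 = neg
 tri d4 q17 = neg
 tri d4 q18 = pos
 tri d4 q19 = pos
 tri d4 q20 = pos
 tri d4 q21 = neg
 tri d4 q22 = pos
 tri d4 q23 = neg
 tri d4 q24 = pos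
 tri d4 q25 = neg
 tri d4 q26 = pos
 tri _ _ = zer
 δ : Gen → Q → Q
 δ r q0 = q1
 δ r q2 = q4
 δ r q3 = q5
 δ r q6 = q9
 δ r q7 = q4
 δ r q8 = q10
 δ r q11 = q15
 δ r q12 = q16
 δ r q13 = q17
 δ r q14 = q10
 δ r q18 = q21
 δ r q19 = q22
 δ r q20 = q10
 δ r q23 = q15
 δ r q24 = q25
 δ r q26 = q22
 δ s q0 = q2
 δ s q1 = q6
 δ s q3 = q7
 δ s q4 = q11
 δ s q5 = q12
 δ s q8 = q13
 δ s q9 = q15
 δ s q10 = q12
 δ s q14 = q18
 δ s q16 = q15
 δ s q17 = q11
 δ s q19 = q13
 δ s q20 = q18
 δ s q21 = q23
 δ s q22 = q24
 δ s q25 = q15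
 δ s q26 = q18
 δ t q0 = q3
 δ t q1 = q5
 δ t q2 = q8
 δ t q4 = q10
 δ t q6 = q8
 δ t q7 = q14
 δ t q9 = q10
 δ t q11 = q19
 δ t q12 = q20
 δ t q13 = q18
 δ t q15 = q22
 δ t q16 = q10
 δ t q17 = q21
 δ t q23 = q26
 δ t q24 = q18
 δ t q25 = q21
 -- Default for a letter that is already a descent. For all other letters `tri-dir` forces a genuine
 -- transition.
 δ _ q = q

 negT : Trit → Bool
 negT neg = true
 negT _ = false

 bit : Gen → Q → Bool
 bit g q = negT (tri (dir g) q)

 sgT : ℤ → Trit → Trit
 sgT -[1+ _ ] x = opp x
 sgT (+ _) x = x

 tcode : Trit → ℕ
 tcode neg = 0
 tcode zer = 1
 tcode pos = 2

 _≟T_ : (a b : Trit) → Dec (a ≡ b)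
 a ≟T b = map′ (inj a b) (cong tcode) (tcode a ℕ.≟ tcode b)
   where
   inj : ∀ a b → tcode a ≡ tcode b → a ≡ b
   inj neg neg _ = refl
   inj zer zer _ = refl
   inj pos pos _ = refl

 qcode : Q → ℕ × ℕ
 qcode q0 = 0 , 0
 qcode q1 = 0 , 1
 qcode q2 = 0 , 2
 qcode q3 = 0 , 3
 qcode q4 = 0 , 4
 qcode q5 = 0 , 5
 qcode q6 = 0 , 6
 qcode q7 = 0 , 7
 qcode q8 = 0 , 8
 qcode q9 = 1 , 0
 qcode q10 = 1 , 1
 qcode q11 = 1 , 2
 qcode q12 = 1 , 3
 qcode q13 = 1 , 4
 qcode q14 = 1 , 5
 qcode q15 = 1 , 6
 qcode q16 = 1 , 7
 qcode q17 = 1 , 8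
 qcode q18 = 2 , 0
 qcode q19 = 2 , 1
 qcode q20 = 2 , 2
 qcode q21 = 2 , 3
 qcode q22 = 2 , 4
 qcode q23 = 2 , 5
 qcode q24 = 2 , 6
 qcode q25 = 2 , 7
 qcode q26 = 2 , 8

 qdecode : ℕ × ℕ → Q
 qdecode (0 , 0) = q0
 qdecode (0 , 1) = q1
 qdecode (0 , 2) = q2
 qdecode (0 , 3) = q3
 qdecode (0 , 4) = q4
 qdecode (0 , 5) = q5
 qdecode (0 , 6) = q6
 qdecode (0 , 7) = q7
 qdecode (0 , 8) = q8
 qdecode (1 , 0) = q9
 qdecode (1 , 1) = q10
 qdecode (1 , 2) = q11
 qdecode (1 , 3) = q12
 qdecode (1 , 4) = q13
 qdecode (1 , 5) = q14
 qdecode (1 , 6) = q15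
 qdecode (1 , 7) = q16
 qdecode (1 , 8) = q17
 qdecode (2 , 0) = q18
 qdecode (2 , 1) = q19
 qdecode (2 , 2) = q20
 qdecode (2 , 3) = q21
 qdecode (2 , 4) = q22
 qdecode (2 , 5) = q23
 qdecode (2 , 6) = q24
 qdecode (2 , 7) = q25
 qdecode _ = q26

 qcode-inv : ∀ q → qdecode (qcode q) ≡ q
 qcode-inv q0 = refl
 qcode-inv q1 = refl
 qcode-inv q2 = refl
 qcode-inv q3 = refl
 qcode-inv q4 = refl
 qcode-inv q5 = refl
 qcode-inv q6 = refl
 qcode-inv q7 = refl
 qcode-inv q8 = refl
 qcode-inv q9 = refl
 qcode-inv q10 = refl
 qcode-inv q11 = refl
 qcode-inv q12 = refl
 qcode-inv q13 = refl
 qcode-inv q14 = refl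
 qcode-inv q15 = refl
 qcode-inv q16 = refl
 qcode-inv q17 = refl
 qcode-inv q18 = refl
 qcode-inv q19 = refl
 qcode-inv q20 = refl
 qcode-inv q21 = refl
 qcode-inv q22 = refl
 qcode-inv q23 = refl
 qcode-inv q24 = refl
 qcode-inv q25 = refl
 qcode-inv q26 = refl

 _≟Q_ : (k l : Q) → Dec (k ≡ l)
 k ≟Q l = map′ (λ e → trans (sym (qcode-inv k)) (trans (cong qdecode e) (qcode-inv l))) (cong qcode) (≡-dec ℕ._≟_ ℕ._≟_ (qcode k) (qcode l))

 Q∀ : {P : Q → Set} → (∀ q → Dec (P q)) → Dec (∀ q → P q)
 Q∀ d = map′
   (λ { (a0 , a1 , a2 , a3 , a4 , a5 , a6 , a7 , a8 , a9 , a10 , a11 , a12 , a13 , a14 , a15 , a16 , a17 , a18 , a19 , a20 , a21 , a22 , a23 , a24 , a25 , a26) → λ { q0 → a0 ; q1 → a1 ; q2 → a2 ; q3 → a3 ; q4 → a4 ; q5 → a5 ; q6 → a6 ; q7 → a7 ; q8 → a8 ; q9 → a9 ; q10 → a10 ; q11 → a11 ; q12 → a12 ; q13 → a13 ; q14 → a14 ; q15 → a15 ; q16 → a16 ; q17 → a17 ; q18 → a18 ; q19 → a19 ; q20 → a20 ; q21 → a21 ; q22 → a22 ; q23 → a23 ; q24 → a24 ; q25 → a25 ; q26 → a26 } })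
   (λ f → f q0 , f q1 , f q2 , f q3 , f q4 , f q5 , f q6 , f q7 , f q8 , f q9 , f q10 , f q11 , f q12 , f q13 , f q14 , f q15 , f q16 , f q17 , f q18 , f q19 , f q20 , f q21 , f q22 , f q23 , f q24 , f q25 , f q26)
   (d q0 ×-dec d q1 ×-dec d q2 ×-dec d q3 ×-dec d q4 ×-dec d q5 ×-dec d q6 ×-dec d q7 ×-dec d q8 ×-dec d q9 ×-dec d q10 ×-dec d q11 ×-dec d q12 ×-dec d q13 ×-dec d q14 ×-dec d q15 ×-dec d q16 ×-dec d q17 ×-dec d q18 ×-dec d q19 ×-dec d q20 ×-dec d q21 ×-dec d q22 ×-dec d q23 ×-dec d q24 ×-dec d q25 ×-dec d q26)

 data Run : El → Q → Set where
   start : Run e q0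
   step  : ∀ {x q} g → Run x q → bit g q ≡ false → Run (L g x) (δ g q)

 isNeg-trit : ∀ z → isNeg z ≡ negT (trit z)
 isNeg-trit (+ zero) = refl
 isNeg-trit (+ suc _) = refl
 isNeg-trit -[1+ _ ] = refl

 private
   trit-flip : ∀ z → isNeg z ≡ false → trit (- z + -[1+ 0 ]) ≡ neg
   trit-flip (+ zero) _ = refl
   trit-flip (+ suc _) _ = refl

   trit-sg : ∀ h d z → trit (sg h d * z) ≡ sgT (sg h d) (trit z)
   trit-sg h d z with sg h d | toWitness {a? = Gen∀ λ h → D∀ λ d → (sg h d ℤ.≟ + 1) ⊎-dec (sg h d ℤ.≟ -[1+ 0 ])} _ h d
   ... | .(+ 1) | inj₁ refl = cong trit (*-identityˡ z)
   ... | .(-[1+ 0 ]) | inj₂ refl = trans (cong trit (ℤ.-1*i≡-i z)) (h′ z)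
     where
     h′ : ∀ z → trit (- z) ≡ opp (trit z)
     h′ (+ zero) = refl
     h′ (+ suc _) = refl
     h′ -[1+ _ ] = refl

   opaque
     tri-dir : ∀ g q → bit g q ≡ false → tri (dir g) (δ g q) ≡ neg
     tri-dir = toWitness {a? = Gen∀ λ g → Q∀ λ q → (bit g q Bool.≟ false) →-dec (tri (dir g) (δ g q) ≟T neg)} _

   opaque
     tri-other : ∀ g d q → d ≡ dir g ⊎ (bit g q ≡ false → tri d (δ g q) ≡ sgT (sg g d) (tri (π g d) q))
     tri-other = toWitness {a? = Gen∀ λ g → D∀ λ d → Q∀ λ q → (d ≟D dir g) ⊎-dec ((bit g q Bool.≟ false) →-dec (tri d (δ g q) ≟T sgT (sg g d) (tri (π g d) q)))} _

 -- The sign vector of x⁻¹ evolves by itself: a letter on the left of x is a letter on the right of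
 -- x⁻¹, which by `cR` permutes three of the values up to sign and by `cR-dir` turns the nonnegative
 -- fourth one negative.
 run-trit : ∀ {x q} → Run x q → ∀ d → trit (c d (inv x)) ≡ tri d q
 run-trit start d = trans (cong (λ z → trit (c d z)) inv-e) (toWitness {a? = D∀ λ d → trit (c d e) ≟T tri d q0} _ d)
 run-trit (step {x} {q} g p b) d with d ≟D dir g
 ... | yes refl = trans (cong (λ z → trit (c (dir g) z)) (inv-L g x)) (trans (cong trit (cR-dir g (inv x)))
         (trans (trit-flip _ (trans (isNeg-trit _) (trans (cong negT (run-trit p (dir g))) b))) (sym (tri-dir g q b))))
 ... | no ne with tri-other g d q
 ...   | inj₁ eq = ⊥-elim (ne eq)
 ...   | inj₂ f = trans (cong (λ z → trit (c d z)) (inv-L g x)) (trans (cong trit (cR g d (inv x) ne))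
         (trans (trit-sg g d _) (trans (cong (sgT (sg g d)) (run-trit p (π g d))) (sym (f b)))))

 run-ld : ∀ {x q} → Run x q → ∀ g → ld g x ≡ bit g q
 run-ld p g = trans (isNeg-trit _) (cong negT (run-trit p (dir g)))

 ld-flip : ∀ g x → ld g x ≡ true → ld g (L g x) ≡ false
 ld-flip g x b with ld g (L g x) in p
 ... | false = refl
 ... | true = ⊥-elim (<⇒≢ (n≤1+n (suc (ℓ x))) (trans (ℓL-down g x b) (cong suc (trans (ℓL-down g (L g x) p) (cong (suc ∘ ℓ) (L-invol g x))))))

 run-total : ∀ n x → ℓ x ≡ n → ∃ (Run x)
 run-total n x eq with findL x
 run-total n .e eq | inj₂ refl = q0 , start
 run-total zero x eq | inj₁ (g , b) with trans (sym (ℓL-down g x b)) eq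
 ... | ()
 run-total (suc n) x eq | inj₁ (g , b) with run-total n (L g x) (suc-injective (trans (sym (ℓL-down g x b)) eq))
 ... | q , p = δ g q , subst (λ z → Run z (δ g q)) (L-invol g x) (step g p (trans (sym (run-ld p g)) (ld-flip g x b)))

 private
   merge : Q → Q
   merge q16 = q9
   merge q20 = q14
   merge q = q

   untri : Trit → Trit → Trit → Trit → Q
   untri zer zer zer zer = q0
   untri neg zer zer zer = q1
   untri zer neg zer zer = q2
   untri zer zer neg zer = q3
   untri neg zer zer neg = q4
   untri neg zer neg zer = q5
   untri zer neg pos zer = q6
   untri pos neg zer zer = q7
   untri zer zer neg pos = q8
   untri neg zer pos neg = q9
   untri neg pos neg zer = q10
   untri zer neg pos neg = q11
   untri pos neg pos zer = q12
   untri pos neg zer pos = q13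
   untri pos zer neg pos = q14
   untri neg neg pos neg = q15
   untri neg pos zer neg = q17
   untri pos neg neg pos = q18
   untri zer pos neg pos = q19
   untri neg pos neg neg = q21
   untri neg pos neg pos = q22
   untri pos neg pos neg = q23
   untri pos neg pos pos = q24
   untri neg pos pos neg = q25
   untri pos pos neg pos = q26
   untri _ _ _ _ = q0

   opaque
     untri-tri : ∀ q → untri (tri d1 q) (tri d2 q) (tri d3 q) (tri d4 q) ≡ merge q
     untri-tri = toWitness {a? = Q∀ λ q → untri (tri d1 q) (tri d2 q) (tri d3 q) (tri d4 q) ≟Q merge q} _

   opaque
     merge-cases : ∀ q → merge q ≡ q ⊎ (q ≡ q16 × merge q ≡ q9) ⊎ (q ≡ q20 × merge q ≡ q14)
     merge-cases = toWitness {a? = Q∀ λ q → (merge q ≟Q q) ⊎-dec (((q ≟Q q16) ×-dec (merge q ≟Q q9)) ⊎-dec ((q ≟Q q20) ×-dec (merge q ≟Q q14)))} _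

   trits-inj : ∀ q q′ → (∀ d → tri d q ≡ tri d q′) → q ≡ q′ ⊎ (q ≡ q9 × q′ ≡ q16) ⊎ (q ≡ q16 × q′ ≡ q9) ⊎ (q ≡ q14 × q′ ≡ q20) ⊎ (q ≡ q20 × q′ ≡ q14)
   trits-inj q q′ f = go (merge-cases q) (merge-cases q′) (trans (sym (untri-tri q)) (trans (cong₂ (λ h w → h w) (cong₂ (λ h w → h w) (cong₂ untri (f d1) (f d2)) (f d3)) (f d4)) (untri-tri q′)))
     where
     go : ∀ {q q′ a b} → a ≡ q ⊎ (q ≡ q16 × a ≡ q9) ⊎ (q ≡ q20 × a ≡ q14) → b ≡ q′ ⊎ (q′ ≡ q16 × b ≡ q9) ⊎ (q′ ≡ q20 × b ≡ q14) → a ≡ b →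
       q ≡ q′ ⊎ (q ≡ q9 × q′ ≡ q16) ⊎ (q ≡ q16 × q′ ≡ q9) ⊎ (q ≡ q14 × q′ ≡ q20) ⊎ (q ≡ q20 × q′ ≡ q14)
     go (inj₁ refl) (inj₁ refl) refl = inj₁ refl
     go (inj₁ refl) (inj₂ (inj₁ (refl , refl))) refl = inj₂ (inj₁ (refl , refl))
     go (inj₁ refl) (inj₂ (inj₂ (refl , refl))) refl = inj₂ (inj₂ (inj₂ (inj₁ (refl , refl))))
     go (inj₂ (inj₁ (refl , refl))) (inj₁ refl) refl = inj₂ (inj₂ (inj₁ (refl , refl)))
     go (inj₂ (inj₁ (refl , _))) (inj₂ (inj₁ (refl , _))) _ = inj₁ refl
     go (inj₂ (inj₁ (refl , refl))) (inj₂ (inj₂ (refl , refl))) ()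
     go (inj₂ (inj₂ (refl , refl))) (inj₁ refl) refl = inj₂ (inj₂ (inj₂ (inj₂ (refl , refl))))
     go (inj₂ (inj₂ (refl , refl))) (inj₂ (inj₁ (refl , refl))) ()
     go (inj₂ (inj₂ (refl , _))) (inj₂ (inj₂ (refl , _))) _ = inj₁ refl

   pred : Q → Gen × Q
   pred q with q ≟Q q9 | q ≟Q q16 | q ≟Q q14
   ... | yes _ | _ | _ = r , q6
   ... | _ | yes _ | _ = r , q12
   ... | _ | _ | yes _ = t , q7
   ... | _ | _ | _ = t , q12

   special : Q → Set
   special q = q ≡ q9 ⊎ q ≡ q16 ⊎ q ≡ q14 ⊎ q ≡ q20

   gcode : Gen → ℕ
   gcode r = 0
   gcode s = 1
   gcode t = 2

   _≟G_ : (g h : Gen) → Dec (g ≡ h)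
   g ≟G h = map′ (inj g h) (cong gcode) (gcode g ℕ.≟ gcode h)
     where
     inj : ∀ a b → gcode a ≡ gcode b → a ≡ b
     inj r r _ = refl
     inj s s _ = refl
     inj t t _ = refl

   opaque
     pred-table : ∀ g q → bit g q ≡ false → special (δ g q) → g ≡ proj₁ (pred (δ g q)) × q ≡ proj₂ (pred (δ g q))
     pred-table = toWitness {a? = Gen∀ λ g → Q∀ λ q → (bit g q Bool.≟ false) →-dec
       (((δ g q ≟Q q9) ⊎-dec ((δ g q ≟Q q16) ⊎-dec ((δ g q ≟Q q14) ⊎-dec (δ g q ≟Q q20)))) →-dec
       ((g ≟G proj₁ (pred (δ g q))) ×-dec (q ≟Q proj₂ (pred (δ g q)))))} _

   run-pred : ∀ {x q} → Run x q → special q → Run (L (proj₁ (pred q)) x) (proj₂ (pred q))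
   run-pred start (inj₁ ())
   run-pred start (inj₂ (inj₁ ()))
   run-pred start (inj₂ (inj₂ (inj₁ ())))
   run-pred start (inj₂ (inj₂ (inj₂ ())))
   run-pred (step {x} {q} g p b) sp = subst₂ (λ g′ q′ → Run (L g′ (L g x)) q′)
     (proj₁ (pred-table g q b sp)) (proj₂ (pred-table g q b sp)) (subst (λ z → Run z q) (sym (L-invol g x)) p)

   trit-clash : ∀ {x q q′} → Run x q → Run x q′ → tri d1 q ≡ tri d1 q′ × tri d3 q ≡ tri d3 q′
   trit-clash p p′ = trans (sym (run-trit p d1)) (run-trit p′ d1) , trans (sym (run-trit p d3)) (run-trit p′ d3)

 -- The signs determine the state except within the pairs `q9`, `q16` and `q14`, `q20`. Each of
 -- these four states has a unique last letter and predecessor, and within a pair the predecessors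
 -- do differ in a sign.
 run-det : ∀ {x q q′} → Run x q → Run x q′ → q ≡ q′
 run-det {x} {q} {q′} p p′ with trits-inj q q′ (λ d → trans (sym (run-trit p d)) (run-trit p′ d))
 ... | inj₁ eq = eq
 ... | inj₂ (inj₁ (refl , refl)) with trit-clash (run-pred p (inj₁ refl)) (run-pred p′ (inj₂ (inj₁ refl)))
 ...   | () , _
 run-det p p′ | inj₂ (inj₂ (inj₁ (refl , refl))) with trit-clash (run-pred p (inj₂ (inj₁ refl))) (run-pred p′ (inj₁ refl))
 ...   | () , _
 run-det p p′ | inj₂ (inj₂ (inj₂ (inj₁ (refl , refl)))) with trit-clash (run-pred p (inj₂ (inj₂ (inj₁ refl)))) (run-pred p′ (inj₂ (inj₂ (inj₂ refl))))
 ...   | _ , ()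
 run-det p p′ | inj₂ (inj₂ (inj₂ (inj₂ (refl , refl)))) with trit-clash (run-pred p (inj₂ (inj₂ (inj₂ refl)))) (run-pred p′ (inj₂ (inj₂ (inj₁ refl))))
 ...   | _ , ()

 opaque
   state : El → Q
   state x = proj₁ (run-total (ℓ x) x refl)

   state-run : ∀ x → Run x (state x)
   state-run x = proj₂ (run-total (ℓ x) x refl)

 ld-state : ∀ g x → ld g x ≡ bit g (state x)
 ld-state g x = run-ld (state-run x) g

 state-step : ∀ g x → ld g x ≡ false → state (L g x) ≡ δ g (state x)
 state-step g x b = run-det (state-run (L g x)) (step g (state-run x) (trans (sym (ld-state g x)) b))

 state-e : state e ≡ q0
 state-e = run-det (state-run e) start

-- Faithfulness of the coordinates, and the abstract interface to W.

module Coxeter where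
 open Alcoves
 open Automaton hiding (inv; ℓ; exchange; inv-invol; ℓ-inv)
 open Defs using (Gen; r; s; t; Word; V; σ; image; _≈_)

 infix 4 _≟V_
 _≟V_ : (a b : V) → Dec (a ≡ b)
 _≟V_ = ≡-dec ℤ._≟_ (≡-dec ℤ._≟_ ℤ._≟_)

 addδ : V → ℤ → V
 addδ (x , y , z) n = x + n , y + + 2 * n , z + n

 -- finite parts of the columns w α_r, w α_s
 col-r col-s col-t : K → V
 col-r k0 = + 1 , + 0 , + 0
 col-r k1 = -[1+ 0 ] , + 0 , + 0
 col-r k2 = + 1 , + 2 , + 0
 col-r k3 = + 1 , + 0 , + 0
 col-r k4 = + 1 , + 2 , + 0
 col-r k5 = -[1+ 0 ] , + 0 , + 0
 col-r k6 = -[1+ 0 ] , -[1+ 1 ] , + 0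
 col-r k7 = -[1+ 0 ] , -[1+ 1 ] , + 0
 col-s k0 = + 0 , + 1 , + 0
 col-s k1 = + 1 , + 1 , + 0
 col-s k2 = + 0 , -[1+ 0 ] , + 0
 col-s k3 = -[1+ 0 ] , -[1+ 0 ] , + 0
 col-s k4 = -[1+ 0 ] , -[1+ 0 ] , + 0
 col-s k5 = + 0 , -[1+ 0 ] , + 0
 col-s k6 = + 1 , + 1 , + 0
 col-s k7 = + 0 , + 1 , + 0
 col-t k0 = -[1+ 0 ] , -[1+ 1 ] , + 0
 col-t k1 = -[1+ 0 ] , -[1+ 1 ] , + 0
 col-t k2 = -[1+ 0 ] , + 0 , + 0
 col-t k3 = + 1 , + 2 , + 0
 col-t k4 = + 1 , + 0 , + 0
 col-t k5 = + 1 , + 2 , + 0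
 col-t k6 = -[1+ 0 ] , + 0 , + 0
 col-t k7 = + 1 , + 0 , + 0

 -- The third column follows from α_t being the null root minus α_r + 2α_s. The finite parts are
 -- written with third coordinate 0, so that the multiple of the null root can be read off from that
 -- coordinate; `addδ-inj` depends on this.
 matrix : El → V × V × V
 matrix (k , m , n) = addδ (col-r k) (+ 2 * m) , addδ (col-s k) n , addδ (col-t k) (+ 1 + - (+ 2 * m) + - (+ 2 * n))

 V≡ : ∀ {a a′ b b′ c c′ : ℤ} → a ≡ a′ → b ≡ b′ → c ≡ c′ → _≡_ {A = V} (a , b , c) (a′ , b′ , c′)
 V≡ refl refl refl = refl

 σ-addδ : ∀ g v n → σ g (addδ v n) ≡ addδ (σ g v) n
 σ-addδ r (x , y , z) n = cong (λ u → u , y + + 2 * n , z + n) (i x y n)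
   where
   i : ∀ x y n → y + + 2 * n - (x + n) ≡ y - x + n
   i = solve-∀
 σ-addδ s (x , y , z) n = cong (λ u → x + n , u , z + n) (i x y z n)
   where
   i : ∀ x y z n → + 2 * (x + n) + + 2 * (z + n) - (y + + 2 * n) ≡ + 2 * x + + 2 * z - y + + 2 * n
   i = solve-∀
 σ-addδ t (x , y , z) n = cong (λ u → x + n , y + + 2 * n , u) (i y z n)
   where
   i : ∀ y z n → y + + 2 * n - (z + n) ≡ y - z + n
   i = solve-∀

 addδ-+ : ∀ v m n → addδ (addδ v m) n ≡ addδ v (m + n)
 addδ-+ (x , y , z) m n = V≡ (+-assoc x m n) (i y m n) (+-assoc z m n)
   where
   i : ∀ y m n → y + + 2 * m + + 2 * n ≡ y + + 2 * (m + n)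
   i = solve-∀

 private
   column : ∀ g v v′ d n n′ → σ g v ≡ addδ v′ d → n′ ≡ d + n → σ g (addδ v n) ≡ addδ v′ n′
   column g v v′ d n n′ p refl = trans (σ-addδ g v n) (trans (cong (λ u → addδ u n) p) (addδ-+ v′ d n))

   column-r : ∀ g k m → σ g (addδ (col-r k) (+ 2 * m)) ≡ addδ (col-r (kL g k)) (+ 2 * (m + shm g k))
   column-r g k m = column g (col-r k) (col-r (kL g k)) (+ 2 * shm g k) _ _
     (toWitness {a? = Gen∀ λ g → K∀ λ k → σ g (col-r k) ≟V addδ (col-r (kL g k)) (+ 2 * shm g k)} _ g k) (i m (shm g k))
     where
     i : ∀ m a → + 2 * (m + a) ≡ + 2 * a + + 2 * m
     i = solve-∀

   column-s : ∀ g k n → σ g (addδ (col-s k) n) ≡ addδ (col-s (kL g k)) (n + shn g k)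
   column-s g k n = column g (col-s k) (col-s (kL g k)) (shn g k) _ _
     (toWitness {a? = Gen∀ λ g → K∀ λ k → σ g (col-s k) ≟V addδ (col-s (kL g k)) (shn g k)} _ g k) (+-comm n (shn g k))

   column-t : ∀ g k m n → σ g (addδ (col-t k) (+ 1 + - (+ 2 * m) + - (+ 2 * n))) ≡
     addδ (col-t (kL g k)) (+ 1 + - (+ 2 * (m + shm g k)) + - (+ 2 * (n + shn g k)))
   column-t g k m n = column g (col-t k) (col-t (kL g k)) (- (+ 2 * shm g k) + - (+ 2 * shn g k)) _ _
     (toWitness {a? = Gen∀ λ g → K∀ λ k → σ g (col-t k) ≟V addδ (col-t (kL g k)) (- (+ 2 * shm g k) + - (+ 2 * shn g k))} _ g k) (i m n (shm g k) (shn g k))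
     where
     i : ∀ m n a b → + 1 + - (+ 2 * (m + a)) + - (+ 2 * (n + b)) ≡ - (+ 2 * a) + - (+ 2 * b) + (+ 1 + - (+ 2 * m) + - (+ 2 * n))
     i = solve-∀

 mapσ : Gen → V × V × V → V × V × V
 mapσ g (a , b , c) = σ g a , σ g b , σ g c

 matrix-L : ∀ g x → mapσ g (matrix x) ≡ matrix (L g x)
 matrix-L g (k , m , n) = cong₂ _,_ (column-r g k m) (cong₂ _,_ (column-s g k n) (column-t g k m n))

 image-evL : ∀ w → image w ≡ matrix (evL w)
 image-evL [] = refl
 image-evL (g ∷ w) = trans (cong (mapσ g) (image-evL w)) (matrix-L g (evL w))

 private
   opaque
     cols-inj : ∀ k k′ → col-r k ≡ col-r k′ → col-s k ≡ col-s k′ → k ≡ k′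
     cols-inj = toWitness {a? = K∀ λ k → K∀ λ k′ → (col-r k ≟V col-r k′) →-dec ((col-s k ≟V col-s k′) →-dec (k ≟K k′))} _

   opaque
     col-rz : ∀ k → proj₂ (proj₂ (col-r k)) ≡ + 0
     col-rz = toWitness {a? = K∀ λ k → proj₂ (proj₂ (col-r k)) ℤ.≟ + 0} _

   opaque
     col-sz : ∀ k → proj₂ (proj₂ (col-s k)) ≡ + 0
     col-sz = toWitness {a? = K∀ λ k → proj₂ (proj₂ (col-s k)) ℤ.≟ + 0} _

   addδ-inj : ∀ v v′ n n′ → proj₂ (proj₂ v) ≡ + 0 → proj₂ (proj₂ v′) ≡ + 0 → addδ v n ≡ addδ v′ n′ → n ≡ n′ × v ≡ v′
   addδ-inj (x , y , .(+ 0)) (x′ , y′ , .(+ 0)) n n′ refl refl eq with trans (sym (+-identityˡ n)) (trans (cong (proj₂ ∘ proj₂) eq) (+-identityˡ n′))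
   ... | refl = refl , V≡ (canc _ (cong proj₁ eq)) (canc _ (cong (proj₁ ∘ proj₂) eq)) refl
     where
     canc : ∀ {a b} n → a + n ≡ b + n → a ≡ b
     canc {a} {b} n eq = trans (sym (i a n)) (trans (cong (_+ - n) eq) (i b n))
       where
       i : ∀ a n → a + n + - n ≡ a
       i = solve-∀

 matrix-inj : ∀ x y → matrix x ≡ matrix y → x ≡ y
 matrix-inj (k , m , n) (k′ , m′ , n′) eq
   with addδ-inj (col-r k) (col-r k′) _ _ (col-rz k) (col-rz k′) (cong proj₁ eq)
      | addδ-inj (col-s k) (col-s k′) _ _ (col-sz k) (col-sz k′) (cong (proj₁ ∘ proj₂) eq)
 ... | p , p′ | q , q′ = el≡ (cols-inj k k′ p′ q′) (ℤ.*-cancelˡ-≡ (+ 2) m m′ p) q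

 -- Everything that is used about W from here on. The instance is opaque, so integer coordinates
 -- never reappear in goals, and descents enter only through the state.
 record CoxeterModel : Set₁ where
   field
     W : Set
     _≟W_ : (x y : W) → Dec (x ≡ y)
     1W : W
     l ρ : Gen → W → W
     inv : W → W
     ℓ : W → ℕ
     st : W → Q
     ev : Word → W
     word : W → Word
     ev-[] : ev [] ≡ 1W
     ev-∷ : ∀ g w → ev (g ∷ w) ≡ l g (ev w)
     ev-word : ∀ x → ev (word x) ≡ x
     length-word : ∀ x → length (word x) ≡ ℓ x
     ≈⇒≡ : ∀ u w → u ≈ w → ev u ≡ ev w
     ≡⇒≈ : ∀ u w → ev u ≡ ev w → u ≈ w
     l-invol : ∀ g x → l g (l g x) ≡ x
     ρ-invol : ∀ g x → ρ g (ρ g x) ≡ x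
     l-ρ : ∀ g h x → l g (ρ h x) ≡ ρ h (l g x)
     l1≡ρ1 : ∀ g → l g 1W ≡ ρ g 1W
     inv-l : ∀ g x → inv (l g x) ≡ ρ g (inv x)
     inv-ρ : ∀ g x → inv (ρ g x) ≡ l g (inv x)
     inv-1 : inv 1W ≡ 1W
     inv-invol : ∀ x → inv (inv x) ≡ x
     ℓ-inv : ∀ x → ℓ (inv x) ≡ ℓ x
     ℓ-1 : ℓ 1W ≡ 0
     ℓ≡0 : ∀ x → ℓ x ≡ 0 → x ≡ 1W
     ℓ-up : ∀ g x → bit g (st x) ≡ false → ℓ (l g x) ≡ suc (ℓ x)
     ℓ-down : ∀ g x → bit g (st x) ≡ true → ℓ x ≡ suc (ℓ (l g x))
     st-1 : st 1W ≡ q0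
     st-up : ∀ g x → bit g (st x) ≡ false → st (l g x) ≡ δ g (st x)
     exchange : ∀ g h x → bit g (st x) ≡ false → bit g (st (ρ h x)) ≡ true → l g x ≡ ρ h x

 opaque
   model : CoxeterModel
   model = record
     { W = El ; _≟W_ = Alcoves._≟_ ; 1W = e ; l = L ; ρ = R ; inv = Automaton.inv ; ℓ = Automaton.ℓ ; st = state
     ; ev = evL ; word = λ x → reverse (wR x)
     ; ev-[] = refl ; ev-∷ = λ _ _ → refl
     ; ev-word = λ x → trans (evL-reverse (wR x)) (evR-wR x)
     ; length-word = λ x → trans (List.length-reverse (wR x)) (length-wR x)
     ; ≈⇒≡ = λ u w p → matrix-inj _ _ (trans (sym (image-evL u)) (trans p (image-evL w)))
     ; ≡⇒≈ = λ u w p → trans (image-evL u) (trans (cong matrix p) (sym (image-evL w)))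
     ; l-invol = L-invol ; ρ-invol = R-invol ; l-ρ = LR ; l1≡ρ1 = Le≡Re
     ; inv-l = inv-L ; inv-ρ = inv-R ; inv-1 = inv-e ; inv-invol = Automaton.inv-invol
     ; ℓ-inv = Automaton.ℓ-inv ; ℓ-1 = refl
     ; ℓ≡0 = ℓ-zero
     ; ℓ-up = λ g x b → ℓL-up g x (trans (ld-state g x) b)
     ; ℓ-down = λ g x b → ℓL-down g x (trans (ld-state g x) b)
     ; st-1 = state-e
     ; st-up = λ g x b → state-step g x (trans (ld-state g x) b)
     ; exchange = λ g h x p q → Automaton.exchange g h x (trans (ld-state g x) p) (trans (ld-state g (R h x)) q)
     }
     where
     ℓ-zero : ∀ x → Automaton.ℓ x ≡ 0 → x ≡ e
     ℓ-zero x p with wR x | length-wR x | evR-wR x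
     ... | [] | _ | q = sym q
     ... | _ ∷ _ | q | _ with trans q p
     ...   | ()

 open CoxeterModel model public

-- Lengths, reduced words, the Bruhat order and balls, compared with the model.

module ReducedWords where
 open import Data.List.Membership.Propositional using (find; lose)
 open Coxeter
 open Automaton using (bit)
 open Defs renaming (same to LR-same; left to LR-left; right to LR-right; trans to LR-trans)

 isYes-true : ∀ {A : Set} (d : Dec A) → isYes d ≡ true → A
 isYes-true (yes a) _ = a

 isYes-intro : ∀ {A : Set} (d : Dec A) → A → isYes d ≡ true
 isYes-intro (yes _) _ = refl
 isYes-intro (no na) a = ⊥-elim (na a)

 eqW-ev : ∀ u w → eqW u w ≡ true → ev u ≡ ev w
 eqW-ev u w p = ≈⇒≡ u w (isYes-true (u ≈? w) p)

 ev-eqW : ∀ u w → ev u ≡ ev w → eqW u w ≡ true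
 ev-eqW u w p = isYes-intro (u ≈? w) (≡⇒≈ u w p)

 any-elim : ∀ {A : Set} (p : A → Bool) xs → any p xs ≡ true → ∃ λ x → x ∈ xs × p x ≡ true
 any-elim p (x ∷ xs) h with p x in q
 ... | true = x , here refl , q
 ... | false with any-elim p xs h
 ...   | y , m , k = y , there m , k

 any-intro : ∀ {A : Set} (p : A → Bool) {x} xs → x ∈ xs → p x ≡ true → any p xs ≡ true
 any-intro p (x ∷ xs) (here refl) h rewrite h = refl
 any-intro p (x ∷ xs) (there m) h with p x
 ... | true = refl
 ... | false = any-intro p xs m h

 allWords-complete : ∀ w → w ∈ allWords (length w)
 allWords-complete [] = here refl
 allWords-complete (g ∷ w) = ∈.∈-concatMap⁺ (λ w → (r ∷ w) ∷ (s ∷ w) ∷ (t ∷ w) ∷ []) {allWords (length w)}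
   (lose (allWords-complete w) (h g))
   where
   h : ∀ g → (g ∷ w) ∈ ((r ∷ w) ∷ (s ∷ w) ∷ (t ∷ w) ∷ [])
   h r = here refl
   h s = there (here refl)
   h t = there (there (here refl))

 allWords-length : ∀ n w → w ∈ allWords n → length w ≡ n
 allWords-length zero .[] (here refl) = refl
 allWords-length (suc n) w m with find (∈.∈-concatMap⁻ (λ w → (r ∷ w) ∷ (s ∷ w) ∷ (t ∷ w) ∷ []) {allWords n} m)
 ... | v , mv , here refl = cong suc (allWords-length n v mv)
 ... | v , mv , there (here refl) = cong suc (allWords-length n v mv)
 ... | v , mv , there (there (here refl)) = cong suc (allWords-length n v mv)

 l-≤ : ∀ g x → ℓ (l g x) ≤ suc (ℓ x)
 l-≤ g x with bit g (st x) in b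
 ... | false = ≤-reflexive (ℓ-up g x b)
 ... | true = ≤-trans (n≤1+n _) (≤-trans (≤-reflexive (sym (ℓ-down g x b))) (n≤1+n _))

 ℓ-ev : ∀ w → ℓ (ev w) ≤ length w
 ℓ-ev [] = ≤-reflexive (trans (cong ℓ ev-[]) ℓ-1)
 ℓ-ev (g ∷ w) = ≤-trans (≤-reflexive (cong ℓ (ev-∷ g w))) (≤-trans (l-≤ g (ev w)) (s≤s (ℓ-ev w)))

 found : ∀ n w → any (eqW w) (allWords n) ≡ true → ℓ (ev w) ≤ n
 found n w p with any-elim (eqW w) (allWords n) p
 ... | u , m , q = subst₂ (λ a b → ℓ a ≤ b) (sym (eqW-ev w u q)) (allWords-length n u m) (ℓ-ev u)

 exists : ∀ w → any (eqW w) (allWords (ℓ (ev w))) ≡ true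
 exists w = any-intro (eqW w) _ (subst (λ n → word (ev w) ∈ allWords n) (length-word (ev w)) (allWords-complete (word (ev w))))
   (ev-eqW w (word (ev w)) (sym (ev-word (ev w))))

 module Search (S : ℕ → ℕ → Word → ℕ) (S-zero : ∀ n w → S 0 n w ≡ n)
   (S-suc : ∀ f n w → S (suc f) n w ≡ (if any (eqW w) (allWords n) then n else S f (suc n) w)) where

   search-spec : ∀ f n w → n ≤ ℓ (ev w) → ℓ (ev w) ≤ f ℕ.+ n → S f n w ≡ ℓ (ev w)
   search-spec zero n w p q = trans (S-zero n w) (ℕ.≤-antisym p q)
   search-spec (suc f) n w p q with any (eqW w) (allWords n) in b | S-suc f n w
   ... | true | eq = trans eq (ℕ.≤-antisym p (found n w b))
   ... | false | eq = trans eq (search-spec f (suc n) w (ℕ.≤∧≢⇒< p ne) (subst (ℓ (ev w) ≤_) (sym (+-suc f n)) q))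
     where
     ne : n ≢ ℓ (ev w)
     ne refl with trans (sym b) (exists w)
     ... | ()

 -- The search function of Defs is private; it is recovered here by unification.
 mutual
   search′ : ℕ → ℕ → Word → ℕ
   search′ = λ f n w → _

   len-ℓ : ∀ w → len w ≡ ℓ (ev w)
   -- This is `length w` in unfolded form. With the fuel and the start value abstracted, the search
   -- is applied to distinct variables, so its unknown body is found by pattern unification.
   len-ℓ w with foldr (λ _ → suc) 0 w | ℓ-ev w
   ... | k | b with 0 | (z≤n {ℓ (ev w)})
   ...   | n | p = Search.search-spec search′ (λ _ _ → refl) (λ _ _ _ → refl) k n w p (≤-trans b (ℕ.m≤m+n k n))

 filterᵇ-∈ : ∀ {A : Set} (p : A → Bool) {x} xs → x ∈ xs → p x ≡ true → x ∈ filterᵇ p xs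
 filterᵇ-∈ p (x ∷ xs) (here refl) h rewrite h = here refl
 filterᵇ-∈ p (x ∷ xs) (there m) h with p x
 ... | true = there (filterᵇ-∈ p xs m h)
 ... | false = filterᵇ-∈ p xs m h

 filterᵇ-∈⁻ : ∀ {A : Set} (p : A → Bool) {x} xs → x ∈ filterᵇ p xs → x ∈ xs × p x ≡ true
 filterᵇ-∈⁻ p (x ∷ xs) m with p x in q
 filterᵇ-∈⁻ p (x ∷ xs) (here refl) | true = here refl , q
 filterᵇ-∈⁻ p (x ∷ xs) (there m) | true with filterᵇ-∈⁻ p xs m
 ... | m′ , h = there m′ , h
 filterᵇ-∈⁻ p (x ∷ xs) m | false with filterᵇ-∈⁻ p xs m
 ... | m′ , h = there m′ , h

 reducedWords-spec : ∀ w u → u ∈ reducedWords w → ev u ≡ ev w × length u ≡ ℓ (ev w)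
 reducedWords-spec w u m with filterᵇ-∈⁻ (eqW w) (allWords (len w)) m
 ... | m′ , h = sym (eqW-ev w u h) , trans (allWords-length _ u m′) (len-ℓ w)

 red-spec : ∀ w → ev (red w) ≡ ev w × length (red w) ≡ ℓ (ev w)
 red-spec w = go (reducedWords w) (λ u → reducedWords-spec w u)
   (filterᵇ-∈ (eqW w) (allWords (len w))
     (subst (λ n → word (ev w) ∈ allWords n) (trans (length-word (ev w)) (sym (len-ℓ w))) (allWords-complete (word (ev w))))
     (ev-eqW w (word (ev w)) (sym (ev-word (ev w)))))
   where
   go : ∀ xs {v} → (∀ u → u ∈ xs → ev u ≡ ev w × length u ≡ ℓ (ev w)) → v ∈ xs →
     ev (firstOr w xs) ≡ ev w × length (firstOr w xs) ≡ ℓ (ev w)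
   go (x ∷ xs) f _ = f x (here refl)

 subwords-length : ∀ w u → u ∈ subwords w → length u ≤ length w
 subwords-length [] .[] (here refl) = z≤n
 subwords-length (g ∷ w) u m with ∈.∈-++⁻ (map (g ∷_) (subwords w)) m
 ... | inj₁ m′ with ∈.∈-map⁻ (g ∷_) m′
 ...   | v , mv , refl = s≤s (subwords-length w v mv)
 subwords-length (g ∷ w) u m | inj₂ m′ = ℕ.m≤n⇒m≤1+n (subwords-length w u m′)

 leqB-ℓ : ∀ u w → leqB u w ≡ true → ℓ (ev u) ≤ ℓ (ev w)
 leqB-ℓ u w p with any-elim _ (reducedWords w) p
 ... | x , mx , q with any-elim _ (subwords x) q
 ...   | v , mv , k = subst₂ _≤_ (cong ℓ (sym (eqW-ev u v k))) (proj₂ (reducedWords-spec w x mx))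
         (≤-trans (ℓ-ev v) (subwords-length x v mv))

 nubW-sound : ∀ ws {w} → w ∈ nubW ws → w ∈ ws
 nubW-sound (v ∷ ws) m with any (eqW v) (nubW ws)
 ... | true = there (nubW-sound ws m)
 nubW-sound (v ∷ ws) (here refl) | false = here refl
 nubW-sound (v ∷ ws) (there m) | false = there (nubW-sound ws m)

 nubW-complete : ∀ ws {w} → w ∈ ws → ev w ∈ map ev (nubW ws)
 nubW-complete (v ∷ ws) (here refl) with any (eqW v) (nubW ws) in b
 ... | true with any-elim _ (nubW ws) b
 ...   | u , mu , k = subst (_∈ map ev (nubW ws)) (sym (eqW-ev v u k)) (∈.∈-map⁺ ev mu)
 nubW-complete (v ∷ ws) (here refl) | false = here refl
 nubW-complete (v ∷ ws) (there m) with any (eqW v) (nubW ws)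
 ... | true = nubW-complete ws m
 ... | false = there (nubW-complete ws m)

 nubW-unique : ∀ ws → Unique (map ev (nubW ws))
 nubW-unique [] = []
 nubW-unique (v ∷ ws) with any (eqW v) (nubW ws) in b
 ... | true = nubW-unique ws
 ... | false = All.tabulate (λ {y} my eq → lem y my eq) ∷ nubW-unique ws
   where
   lem : ∀ y → y ∈ map ev (nubW ws) → ev v ≡ y → ⊥
   lem y my eq with ∈.∈-map⁻ ev my
   ... | u , mu , refl with trans (sym b) (any-intro (eqW v) (nubW ws) mu (ev-eqW v u eq))
   ...   | ()

 wordsUpTo-complete : ∀ n w → length w ≤ n → w ∈ wordsUpTo n
 wordsUpTo-complete zero [] z≤n = here refl
 wordsUpTo-complete (suc n) w p with length w ℕ.≟ suc n
 ... | yes eq = ∈.∈-++⁺ʳ (wordsUpTo n) (subst (λ k → w ∈ allWords k) eq (allWords-complete w))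
 ... | no ne = ∈.∈-++⁺ˡ (wordsUpTo-complete n w (ℕ.≤-pred (ℕ.≤∧≢⇒< p ne)))

 wordsUpTo-length : ∀ n w → w ∈ wordsUpTo n → length w ≤ n
 wordsUpTo-length zero .[] (here refl) = z≤n
 wordsUpTo-length (suc n) w m with ∈.∈-++⁻ (wordsUpTo n) m
 ... | inj₁ m′ = ℕ.m≤n⇒m≤1+n (wordsUpTo-length n w m′)
 ... | inj₂ m′ = ≤-reflexive (allWords-length (suc n) w m′)

 ball : ℕ → List W
 ball n = map ev (Ball n)

 ball-nubW : ∀ n → ball n ≡ map ev (nubW (wordsUpTo n))
 ball-nubW n = trans (sym (List.map-∘ (nubW (wordsUpTo n)))) (List.map-cong (λ w → proj₁ (red-spec w)) (nubW (wordsUpTo n)))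

 ball-unique : ∀ n → Unique (ball n)
 ball-unique n = subst Unique (sym (ball-nubW n)) (nubW-unique (wordsUpTo n))

 ball-complete : ∀ n x → ℓ x ≤ n → x ∈ ball n
 ball-complete n x p = subst₂ _∈_ (ev-word x) (sym (ball-nubW n))
   (nubW-complete (wordsUpTo n) (wordsUpTo-complete n (word x) (subst (_≤ n) (sym (length-word x)) p)))

 ball-sound : ∀ n x → x ∈ ball n → ℓ x ≤ n
 ball-sound n x m with ∈.∈-map⁻ ev (subst (x ∈_) (ball-nubW n) m)
 ... | w , mw , refl = ≤-trans (ℓ-ev w) (wordsUpTo-length n w (nubW-sound (wordsUpTo n) mw))

-- Formal Laurent combinations over W and linear functionals on them.

module FormalSums where
 open Coxeter

 F : Set
 F = W → ℤ → ℤ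

 infix 4 _≗F_
 _≗F_ : F → F → Set
 f ≗F g = ∀ u e → f u e ≡ g u e

 -- (w , k , c) stands for c vᵏ times the w-th element of some basis indexed by W
 Tm : Set
 Tm = W × ℤ × ℤ

 lin : F → List Tm → ℤ
 lin φ [] = + 0
 lin φ ((w , k , c) ∷ ts) = c * φ w k + lin φ ts

 kr : W → ℤ → F
 kr u e w k with w ≟W u | k ℤ.≟ e
 ... | yes _ | yes _ = + 1
 ... | yes _ | no _ = + 0
 ... | no _ | _ = + 0

 val : List Tm → F
 val ts u e = lin (kr u e) ts

 kr-yes : ∀ u e → kr u e u e ≡ + 1
 kr-yes u e with u ≟W u | e ℤ.≟ e
 ... | yes _ | yes _ = refl
 ... | yes _ | no ne = ⊥-elim (ne refl)
 ... | no ne | _ = ⊥-elim (ne refl)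

 kr-no₁ : ∀ {u w} e k → w ≢ u → kr u e w k ≡ + 0
 kr-no₁ {u} {w} e k ne with w ≟W u | k ℤ.≟ e
 ... | yes eq | _ = ⊥-elim (ne eq)
 ... | no _ | _ = refl

 kr-no₂ : ∀ u w {e k} → k ≢ e → kr u e w k ≡ + 0
 kr-no₂ u w {e} {k} ne with w ≟W u | k ℤ.≟ e
 ... | _ | yes eq = ⊥-elim (ne eq)
 ... | yes _ | no _ = refl
 ... | no _ | no _ = refl

 kr-iff : ∀ {u e w k u′ e′ w′ k′} → (w ≡ u → k ≡ e → w′ ≡ u′ × k′ ≡ e′) → (w′ ≡ u′ → k′ ≡ e′ → w ≡ u × k ≡ e) → kr u e w k ≡ kr u′ e′ w′ k′
 kr-iff {u} {e} {w} {k} {u′} {e′} {w′} {k′} f g with w ≟W u | k ℤ.≟ e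
 ... | yes p | yes q = trans (sym (kr-yes u′ e′)) (cong₂ (kr u′ e′) (sym (proj₁ (f p q))) (sym (proj₂ (f p q))))
 ... | no p | _ = sym (lem (λ p′ q′ → p (proj₁ (g p′ q′))))
   where
   lem : (w′ ≡ u′ → k′ ≡ e′ → ⊥) → kr u′ e′ w′ k′ ≡ + 0
   lem h with w′ ≟W u′ | k′ ℤ.≟ e′
   ... | yes a | yes b = ⊥-elim (h a b)
   ... | yes _ | no _ = refl
   ... | no _ | _ = refl
 ... | yes _ | no q = sym (lem (λ p′ q′ → q (proj₂ (g p′ q′))))
   where
   lem : (w′ ≡ u′ → k′ ≡ e′ → ⊥) → kr u′ e′ w′ k′ ≡ + 0
   lem h with w′ ≟W u′ | k′ ℤ.≟ e′
   ... | yes a | yes b = ⊥-elim (h a b)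
   ... | yes _ | no _ = refl
   ... | no _ | _ = refl

 lin-cong : ∀ {φ ψ} → φ ≗F ψ → ∀ ts → lin φ ts ≡ lin ψ ts
 lin-cong p [] = refl
 lin-cong p ((w , k , c) ∷ ts) = cong₂ (λ a b → c * a + b) (p w k) (lin-cong p ts)

 lin-++ : ∀ φ ts us → lin φ (ts ++ us) ≡ lin φ ts + lin φ us
 lin-++ φ [] us = sym (+-identityˡ _)
 lin-++ φ ((w , k , c) ∷ ts) us = trans (cong (_+_ (c * φ w k)) (lin-++ φ ts us)) (sym (+-assoc (c * φ w k) (lin φ ts) (lin φ us)))

 lin-+ : ∀ φ ψ ts → lin (λ w k → φ w k + ψ w k) ts ≡ lin φ ts + lin ψ ts
 lin-+ φ ψ [] = refl
 lin-+ φ ψ ((w , k , c) ∷ ts) = trans (cong (_+_ (c * (φ w k + ψ w k))) (lin-+ φ ψ ts)) (i c (φ w k) (ψ w k) (lin φ ts) (lin ψ ts))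
   where
   i : ∀ c a b x y → c * (a + b) + (x + y) ≡ c * a + x + (c * b + y)
   i = solve-∀

 lin-* : ∀ a φ ts → lin (λ w k → a * φ w k) ts ≡ a * lin φ ts
 lin-* a φ [] = sym (*-zeroʳ a)
 lin-* a φ ((w , k , c) ∷ ts) = trans (cong (_+_ (c * (a * φ w k))) (lin-* a φ ts)) (i a c (φ w k) (lin φ ts))
   where
   i : ∀ a c x y → c * (a * x) + a * y ≡ a * (c * x + y)
   i = solve-∀

 lin-neg : ∀ φ ts → lin (λ w k → - φ w k) ts ≡ - lin φ ts
 lin-neg φ ts = trans (lin-cong (λ w k → sym (ℤ.-1*i≡-i (φ w k))) ts) (trans (lin-* (-[1+ 0 ]) φ ts) (ℤ.-1*i≡-i (lin φ ts)))

 lin-0 : ∀ ts → lin (λ _ _ → + 0) ts ≡ + 0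
 lin-0 [] = refl
 lin-0 ((w , k , c) ∷ ts) = cong₂ _+_ (*-zeroʳ c) (lin-0 ts)

 scale : ℤ → List Tm → List Tm
 scale a = map λ { (w , k , c) → w , k , a * c }

 lin-scale : ∀ a φ ts → lin φ (scale a ts) ≡ a * lin φ ts
 lin-scale a φ [] = sym (*-zeroʳ a)
 lin-scale a φ ((w , k , c) ∷ ts) = trans (cong₂ _+_ (ℤ.*-assoc a c (φ w k)) (lin-scale a φ ts)) (sym (ℤ.*-distribˡ-+ a (c * φ w k) (lin φ ts)))

 Nonzero : List Tm → Tm → Set
 Nonzero ts (w , k , _) = val ts w k ≢ + 0

 private
   erase : W → ℤ → List Tm → List Tm
   erase u e [] = []
   erase u e ((w , k , c) ∷ ts) with w ≟W u | k ℤ.≟ e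
   ... | yes _ | yes _ = erase u e ts
   ... | yes _ | no _ = (w , k , c) ∷ erase u e ts
   ... | no _ | _ = (w , k , c) ∷ erase u e ts

   erase-length : ∀ u e ts → length (erase u e ts) ≤ length ts
   erase-length u e [] = z≤n
   erase-length u e ((w , k , c) ∷ ts) with w ≟W u | k ℤ.≟ e
   ... | yes _ | yes _ = ℕ.m≤n⇒m≤1+n (erase-length u e ts)
   ... | yes _ | no _ = s≤s (erase-length u e ts)
   ... | no _ | _ = s≤s (erase-length u e ts)

   erase-lin : ∀ φ u e ts → lin φ ts ≡ val ts u e * φ u e + lin φ (erase u e ts)
   erase-lin φ u e [] = refl
   erase-lin φ u e ((w , k , c) ∷ ts) with w ≟W u | k ℤ.≟ e
   ... | yes refl | yes refl = trans (cong (_+_ (c * φ w k)) (erase-lin φ u e ts)) (i c (φ w k) (val ts w k) _)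
     where
     i : ∀ c x a b → c * x + (a * x + b) ≡ (c * + 1 + a) * x + b
     i = solve-∀
   ... | yes _ | no _ = trans (cong (_+_ (c * φ w k)) (erase-lin φ u e ts)) (i c (φ w k) (φ u e) (val ts u e) _)
     where
     i : ∀ c x y a b → c * x + (a * y + b) ≡ (c * + 0 + a) * y + (c * x + b)
     i = solve-∀
   ... | no _ | _ = trans (cong (_+_ (c * φ w k)) (erase-lin φ u e ts)) (i c (φ w k) (φ u e) (val ts u e) _)
     where
     i : ∀ c x y a b → c * x + (a * y + b) ≡ (c * + 0 + a) * y + (c * x + b)
     i = solve-∀

   erase-val : ∀ u e ts w k → val (erase u e ts) w k ≡ val ts w k ⊎ (w ≡ u × k ≡ e)
   erase-val u e ts w k with w ≟W u | k ℤ.≟ e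
   ... | yes p | yes q = inj₂ (p , q)
   ... | yes p | no q = inj₁ (sym (drop (kr-no₂ w u (q ∘ sym))))
     where
     drop : kr w k u e ≡ + 0 → val ts w k ≡ val (erase u e ts) w k
     drop z = trans (erase-lin (kr w k) u e ts) (trans (cong (λ a → val ts u e * a + val (erase u e ts) w k) z) (trans (cong (_+ val (erase u e ts) w k) (*-zeroʳ (val ts u e))) (+-identityˡ _)))
   ... | no p | _ = inj₁ (sym (drop (kr-no₁ k e (p ∘ sym))))
     where
     drop : kr w k u e ≡ + 0 → val ts w k ≡ val (erase u e ts) w k
     drop z = trans (erase-lin (kr w k) u e ts) (trans (cong (λ a → val ts u e * a + val (erase u e ts) w k) z) (trans (cong (_+ val (erase u e ts) w k) (*-zeroʳ (val ts u e))) (+-identityˡ _)))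

   erase-self : ∀ u e ts → val (erase u e ts) u e ≡ + 0
   erase-self u e [] = refl
   erase-self u e ((w , k , c) ∷ ts) with w ≟W u | k ℤ.≟ e
   ... | yes _ | yes _ = erase-self u e ts
   ... | yes _ | no q = trans (cong₂ (λ a b → c * a + b) (kr-no₂ u w q) (erase-self u e ts)) (trans (+-identityʳ _) (*-zeroʳ c))
   ... | no p | _ = trans (cong₂ (λ a b → c * a + b) (kr-no₁ e k p) (erase-self u e ts)) (trans (+-identityʳ _) (*-zeroʳ c))

   lin-zero-fuel : ∀ n φ ts → length ts ≤ n → (∀ w k → val ts w k ≡ + 0 ⊎ φ w k ≡ + 0) → lin φ ts ≡ + 0
   lin-zero-fuel n φ [] _ _ = refl
   lin-zero-fuel (suc n) φ ts@((u , e , c) ∷ ts′) (s≤s le) h =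
     trans (erase-lin φ u e ts) (cong₂ _+_ (zero-prod (h u e)) (lin-zero-fuel n φ (erase u e ts) shorter h′))
     where
     zero-prod : ∀ {a b} → a ≡ + 0 ⊎ b ≡ + 0 → a * b ≡ + 0
     zero-prod {b = b} (inj₁ refl) = refl
     zero-prod {a = a} (inj₂ refl) = *-zeroʳ a
     shorter : length (erase u e ts) ≤ n
     shorter with u ≟W u | e ℤ.≟ e
     ... | yes _ | yes _ = ≤-trans (erase-length u e ts′) le
     ... | yes _ | no ne = ⊥-elim (ne refl)
     ... | no ne | _ = ⊥-elim (ne refl)
     h′ : ∀ w k → val (erase u e ts) w k ≡ + 0 ⊎ φ w k ≡ + 0
     h′ w k with erase-val u e ts w k | h w k
     ... | inj₁ eq | inj₁ z = inj₁ (trans eq z)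
     ... | inj₁ eq | inj₂ z = inj₂ z
     ... | inj₂ (refl , refl) | _ = inj₁ (erase-self w k ts)

   prune-fuel : ∀ n ts → length ts ≤ n → Σ (List Tm) λ us → val us ≗F val ts × All (Nonzero ts) us
   prune-fuel n [] _ = [] , (λ _ _ → refl) , []
   prune-fuel (suc n) ts@((u , e , c) ∷ ts′) (s≤s le) with prune-fuel n (erase u e ts) shorter
     where
     shorter : length (erase u e ts) ≤ n
     shorter with u ≟W u | e ℤ.≟ e
     ... | yes _ | yes _ = ≤-trans (erase-length u e ts′) le
     ... | yes _ | no ne = ⊥-elim (ne refl)
     ... | no ne | _ = ⊥-elim (ne refl)
   ... | us , eq , al = go (val ts u e ℤ.≟ + 0)
     where
     keep : ∀ t → Nonzero (erase u e ts) t → Nonzero ts t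
     keep (w , k , _) ne with erase-val u e ts w k
     ... | inj₁ q = λ z → ne (trans q z)
     ... | inj₂ (refl , refl) = ⊥-elim (ne (erase-self w k ts))
     split : ∀ w k → val ts w k ≡ val ts u e * kr w k u e + val (erase u e ts) w k
     split w k = erase-lin (kr w k) u e ts
     go : Dec (val ts u e ≡ + 0) → Σ (List Tm) λ us → val us ≗F val ts × All (Nonzero ts) us
     go (yes z) = us , (λ w k → trans (eq w k) (sym (trans (split w k) (trans (cong (λ a → a * kr w k u e + val (erase u e ts) w k) z) (+-identityˡ _))))) , All.map (λ {t} → keep t) al
     go (no nz) = (u , e , val ts u e) ∷ us , (λ w k → trans (cong (_+_ (val ts u e * kr w k u e)) (eq w k)) (sym (split w k))) , nz ∷ All.map (λ {t} → keep t) al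

 -- A list may contain cancelling terms, so an entry of it says nothing about coefficients. In the
 -- pruned list every entry has a nonzero coefficient, and a condition known for nonzero
 -- coefficients can be checked entry by entry.
 prune : ∀ ts → Σ (List Tm) λ us → val us ≗F val ts × All (Nonzero ts) us
 prune ts = prune-fuel (length ts) ts ≤-refl

 val-entry : ∀ ts w k → val ts w k ≢ + 0 → ∃ λ c → (w , k , c) ∈ ts
 val-entry [] w k ne = ⊥-elim (ne refl)
 val-entry ((u , e , c) ∷ ts) w k ne with u ≟W w | e ℤ.≟ k
 ... | yes refl | yes refl = c , here refl
 ... | yes _ | no _ = Data.Product.map₂ there (val-entry ts w k (λ z → ne (trans (cong (_+ val ts w k) (*-zeroʳ c)) (trans (+-identityˡ _) z))))
 ... | no _ | _ = Data.Product.map₂ there (val-entry ts w k (λ z → ne (trans (cong (_+ val ts w k) (*-zeroʳ c)) (trans (+-identityˡ _) z))))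

 lin-zero : ∀ φ ts → (∀ w k → val ts w k ≡ + 0 ⊎ φ w k ≡ + 0) → lin φ ts ≡ + 0
 lin-zero φ ts = lin-zero-fuel (length ts) φ ts ≤-refl

 -- Formal sums are not normalised; this carries any functional from one list to another with the
 -- same coefficients, by applying `lin-zero` to their difference.
 lin-val : ∀ φ ts us → val ts ≗F val us → lin φ ts ≡ lin φ us
 lin-val φ ts us p = i-j≡0⇒i≡j _ _ (trans (sym (diff φ)) (lin-zero φ (ts ++ scale -[1+ 0 ] us)
     (λ w k → inj₁ (trans (diff (kr w k)) (trans (cong (_+ _) (p w k)) (+-inverseʳ (val us w k)))))))
   where
   diff : ∀ φ → lin φ (ts ++ scale -[1+ 0 ] us) ≡ lin φ ts + - lin φ us
   diff φ = trans (lin-++ φ ts _) (cong (_+_ (lin φ ts)) (trans (lin-scale -[1+ 0 ] φ us) (ℤ.-1*i≡-i _)))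

 lin-diff : ∀ φ ψ ts → (∀ w k → val ts w k ≡ + 0 ⊎ φ w k ≡ ψ w k) → lin φ ts ≡ lin ψ ts
 lin-diff φ ψ ts h = i-j≡0⇒i≡j _ _ (trans (sym (trans (lin-+ φ (λ w k → - ψ w k) ts) (cong (_+_ (lin φ ts)) (lin-neg ψ ts))))
   (lin-zero _ ts h′))
   where
   h′ : ∀ w k → val ts w k ≡ + 0 ⊎ φ w k + - ψ w k ≡ + 0
   h′ w k with h w k
   ... | inj₁ z = inj₁ z
   ... | inj₂ eq = inj₂ (trans (cong (_+ _) eq) (+-inverseʳ (ψ w k)))

 Σl : List W → (W → ℤ) → ℤ
 Σl [] f = + 0
 Σl (y ∷ ys) f = f y + Σl ys f

 Σl-cong : ∀ ys {f g : W → ℤ} → (∀ y → f y ≡ g y) → Σl ys f ≡ Σl ys g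
 Σl-cong [] p = refl
 Σl-cong (y ∷ ys) p = cong₂ _+_ (p y) (Σl-cong ys p)

 Σl-+ : ∀ ys (f g : W → ℤ) → Σl ys (λ y → f y + g y) ≡ Σl ys f + Σl ys g
 Σl-+ [] f g = refl
 Σl-+ (y ∷ ys) f g = trans (cong (_+_ (f y + g y)) (Σl-+ ys f g)) (i (f y) (g y) _ _)
   where
   i : ∀ a b x y → a + b + (x + y) ≡ a + x + (b + y)
   i = solve-∀

 Σl-zero : ∀ ys (f : W → ℤ) → (∀ y → y ∈ ys → f y ≡ + 0) → Σl ys f ≡ + 0
 Σl-zero [] f p = refl
 Σl-zero (y ∷ ys) f p = cong₂ _+_ (p y (here refl)) (Σl-zero ys f (λ z m → p z (there m)))

 Σl-single : ∀ ys (f : W → ℤ) u → Unique ys → u ∈ ys ⊎ f u ≡ + 0 → (∀ y → y ≢ u → f y ≡ + 0) → Σl ys f ≡ f u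
 Σl-single [] f u _ (inj₂ z) p = sym z
 Σl-single (y ∷ ys) f u (ny ∷ un) (inj₁ (here refl)) p =
   trans (cong (_+_ (f y)) (Σl-zero ys f (λ z m → p z (λ { refl → All.lookup ny m refl })))) (+-identityʳ (f y))
 Σl-single (y ∷ ys) f u (ny ∷ un) (inj₁ (there m)) p =
   trans (cong₂ _+_ (p y (λ { refl → All.lookup ny m refl })) (Σl-single ys f u un (inj₁ m) p)) (+-identityˡ (f u))
 Σl-single (y ∷ ys) f u (ny ∷ un) (inj₂ z) p with y ≟W u
 ... | yes refl = trans (cong (_+ Σl ys f) z) (trans (+-identityˡ _) (Σl-single ys f y un (inj₂ z) p))
 ... | no ne = trans (cong₂ _+_ (p y ne) (Σl-single ys f u un (inj₂ z) p)) (+-identityˡ (f u))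

 lin-concatMap : ∀ φ (f : W → List Tm) ys → lin φ (concatMap f ys) ≡ Σl ys (λ y → lin φ (f y))
 lin-concatMap φ f [] = refl
 lin-concatMap φ f (y ∷ ys) = trans (lin-++ φ (f y) (concatMap f ys)) (cong (_+_ (lin φ (f y))) (lin-concatMap φ f ys))

 lin-swap : ∀ (φ : W → ℤ → W → ℤ → ℤ) ts us → lin (λ w k → lin (φ w k) us) ts ≡ lin (λ y j → lin (λ w k → φ w k y j) ts) us
 lin-swap φ [] us = sym (lin-0 us)
 lin-swap φ ((w , k , c) ∷ ts) us = trans (cong₂ _+_ (sym (lin-* c (φ w k) us)) (lin-swap φ ts us)) (sym (lin-+ (λ y j → c * φ w k y j) (λ y j → lin (λ w k → φ w k y j) ts) us))

 lin-nonzero : ∀ φ ts → lin φ ts ≢ + 0 → ∃ λ w → ∃ λ k → val ts w k ≢ + 0 × φ w k ≢ + 0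
 lin-nonzero φ ts ne with prune ts
 ... | us , eq , al = go us al (λ z → ne (trans (sym (lin-val φ us ts eq)) z))
   where
   go : ∀ us → All (Nonzero ts) us → lin φ us ≢ + 0 → ∃ λ w → ∃ λ k → val ts w k ≢ + 0 × φ w k ≢ + 0
   go [] _ n = ⊥-elim (n refl)
   go ((w , k , c) ∷ us) (a ∷ al) n with φ w k ℤ.≟ + 0
   ... | no nz = w , k , a , nz
   ... | yes z = go us al (λ q → n (trans (cong₂ (λ x y → c * x + y) z q) (trans (+-identityʳ _) (*-zeroʳ c))))

-- The Hecke algebra acting on coordinate functions, and the bar involution.

module Hecke where
 open Coxeter
 open FormalSums
 open ReducedWords using (ℓ-ev)
 open Automaton using (bit)
 open Defs using (Gen; Word)

 lb rb : Gen → W → Bool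
 lb g u = bit g (st u)
 rb g u = lb g (inv u)

 bool-clash : ∀ {A : Set} {b : Bool} → b ≡ true → b ≡ false → A
 bool-clash refl ()

 lb-flip : ∀ g u → lb g (l g u) ≡ not (lb g u)
 lb-flip g u with lb g u in p | lb g (l g u) in q
 ... | true | false = refl
 ... | false | true = refl
 ... | true | true = ⊥-elim (<⇒≢ (n≤1+n (suc (ℓ u))) (trans (ℓ-down g u p) (cong suc (trans (ℓ-down g (l g u) q) (cong (suc ∘ ℓ) (l-invol g u))))))
 ... | false | false = ⊥-elim (<⇒≢ (n≤1+n (suc (ℓ u))) (trans (cong ℓ (sym (l-invol g u))) (trans (ℓ-up g (l g u) q) (cong suc (ℓ-up g u p)))))

 rb-flip : ∀ h u → rb h (ρ h u) ≡ not (rb h u)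
 rb-flip h u = trans (cong (lb h) (inv-ρ h u)) (lb-flip h (inv u))

 ℓ-ρ : ∀ h u → ℓ (ρ h u) ≡ ℓ (l h (inv u))
 ℓ-ρ h u = trans (sym (ℓ-inv (ρ h u))) (cong ℓ (inv-ρ h u))

 ℓρ-up : ∀ h u → rb h u ≡ false → ℓ (ρ h u) ≡ suc (ℓ u)
 ℓρ-up h u b = trans (ℓ-ρ h u) (trans (ℓ-up h (inv u) b) (cong suc (ℓ-inv u)))

 ℓρ-down : ∀ h u → rb h u ≡ true → ℓ u ≡ suc (ℓ (ρ h u))
 ℓρ-down h u b = trans (sym (ℓ-inv u)) (trans (ℓ-down h (inv u) b) (cong suc (sym (ℓ-ρ h u))))

 lb-ρ : ∀ g h u → lb g (ρ h u) ≡ lb g u ⊎ l g u ≡ ρ h u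
 lb-ρ g h u with lb g u in p | lb g (ρ h u) in q
 ... | true | true = inj₁ refl
 ... | false | false = inj₁ refl
 ... | false | true = inj₂ (exchange g h u p q)
 ... | true | false = inj₂ (trans (cong (l g) (sym eq)) (l-invol g (ρ h u)))
   where
   eq : l g (ρ h u) ≡ u
   eq = trans (exchange g h (ρ h u) q (trans (cong (lb g) (ρ-invol h u)) p)) (ρ-invol h u)

 rb-l : ∀ g h u → rb h (l g u) ≡ rb h u ⊎ l g u ≡ ρ h u
 rb-l g h u with lb-ρ h g (inv u)
 ... | inj₁ eq = inj₁ (trans (cong (lb h) (inv-l g u)) eq)
 ... | inj₂ eq = inj₂ (trans (sym (inv-invol (l g u))) (trans (cong inv (trans (inv-l g u) (sym eq))) (trans (inv-l h (inv u)) (cong (ρ h) (inv-invol u)))))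

 lb≡rb : ∀ g h u → l g u ≡ ρ h u → lb g u ≡ rb h u
 lb≡rb g h u eq with lb g u in p | rb h u in q
 ... | true | true = refl
 ... | false | false = refl
 ... | true | false = ⊥-elim (<⇒≢ (n≤1+n (suc (ℓ u))) (trans (ℓ-down g u p) (cong suc (trans (cong ℓ eq) (ℓρ-up h u q)))))
 ... | false | true = ⊥-elim (<⇒≢ (n≤1+n (suc (ℓ u))) (trans (ℓρ-down h u q) (cong suc (trans (cong ℓ (sym eq)) (ℓ-up g u p)))))

 -- multiplication by v on exponents: (v f)(e) = f (pred e)
 sh : Bool → ℤ → ℤ
 sh true = ℤ.pred
 sh false = ℤ.suc

 sh-comm : ∀ a b e → sh a (sh b e) ≡ sh b (sh a e)
 sh-comm true true e = refl
 sh-comm false false e = refl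
 sh-comm true false e = trans (ℤ.pred-suc e) (sym (ℤ.suc-pred e))
 sh-comm false true e = trans (ℤ.suc-pred e) (sym (ℤ.pred-suc e))

 -- The operators of multiplication by C_g = v⁻¹(T_g + 1), and the normalised T̃_g = v⁻¹ T_g and
 -- its inverse, on coordinates with respect to the basis T̃_w.
 C CR T I TR : Gen → F → F
 C g f u e = f (l g u) e + f u (sh (lb g u) e)
 CR h f u e = f (ρ h u) e + f u (sh (rb h u) e)
 T g f u e = C g f u e + - f u (ℤ.suc e)
 TR g f u e = CR g f u e + - f u (ℤ.suc e)
 I g f u e = C g f u e + - f u (ℤ.pred e)
 IR : Gen → F → F
 IR g f u e = CR g f u e + - f u (ℤ.pred e)

 C-cong : ∀ g {f f′} → f ≗F f′ → C g f ≗F C g f′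
 C-cong g p u e = cong₂ _+_ (p _ _) (p _ _)

 CR-cong : ∀ g {f f′} → f ≗F f′ → CR g f ≗F CR g f′
 CR-cong g p u e = cong₂ _+_ (p _ _) (p _ _)

 T-cong : ∀ g {f f′} → f ≗F f′ → T g f ≗F T g f′
 T-cong g p u e = cong₂ (λ a b → a + - b) (C-cong g p u e) (p _ _)

 TR-cong : ∀ g {f f′} → f ≗F f′ → TR g f ≗F TR g f′
 TR-cong g p u e = cong₂ (λ a b → a + - b) (CR-cong g p u e) (p _ _)

 I-cong : ∀ g {f f′} → f ≗F f′ → I g f ≗F I g f′
 I-cong g p u e = cong₂ (λ a b → a + - b) (C-cong g p u e) (p _ _)

 IR-cong : ∀ g {f f′} → f ≗F f′ → IR g f ≗F IR g f′
 IR-cong g p u e = cong₂ (λ a b → a + - b) (CR-cong g p u e) (p _ _)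

 foldr-cong : (X : Gen → F → F) → (∀ g {f f′} → f ≗F f′ → X g f ≗F X g f′) → ∀ a {f f′} → f ≗F f′ → foldr X f a ≗F foldr X f′ a
 foldr-cong X c [] p = p
 foldr-cong X c (g ∷ a) p = c g (foldr-cong X c a p)

 -- Compared coordinatewise, the only danger is that one multiplication changes the descent seen by
 -- the other. By the exchange condition this happens only if gu = uh, and then both descents flip
 -- together.
 C-CR : ∀ g h f → C g (CR h f) ≗F CR h (C g f)
 C-CR g h f u e = go (lb-ρ g h u) (rb-l g h u)
   where
   i : ∀ a b c d → a + b + (c + d) ≡ a + c + (b + d)
   i = solve-∀
   j : ∀ a b c d → a + b + (c + d) ≡ a + b + (c + d)
   j = solve-∀
   fu : f u (sh (rb h u) (sh (lb g u) e)) ≡ f u (sh (lb g u) (sh (rb h u) e))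
   fu = cong (f u) (sh-comm (rb h u) (lb g u) e)
   head : f (ρ h (l g u)) e ≡ f (l g (ρ h u)) e
   head = cong (λ z → f z e) (sym (l-ρ g h u))
   same : rb h (l g u) ≡ rb h u → lb g (ρ h u) ≡ lb g u → C g (CR h f) u e ≡ CR h (C g f) u e
   same p q = trans (cong₂ _+_ (cong₂ _+_ head (cong (λ b → f (l g u) (sh b e)) p)) (cong₂ _+_ (cong (λ b → f (ρ h u) (sh b e)) (sym q)) fu))
     (i (f (l g (ρ h u)) e) (f (l g u) (sh (rb h u) e)) (f (ρ h u) (sh (lb g (ρ h u)) e)) (f u (sh (lb g u) (sh (rb h u) e))))
   flip : l g u ≡ ρ h u → C g (CR h f) u e ≡ CR h (C g f) u e
   flip eq = cong₂ _+_ (cong₂ _+_ head (cong₂ (λ x b → f x (sh b e)) eq b₁)) (cong₂ _+_ (cong₂ (λ x b → f x (sh b e)) (sym eq) (lb≡rb g h u eq)) fu)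
     where
     b₁ : rb h (l g u) ≡ lb g (ρ h u)
     b₁ = trans (cong (rb h) eq) (trans (rb-flip h u) (trans (cong not (sym (lb≡rb g h u eq))) (trans (sym (lb-flip g u)) (cong (lb g) eq))))
   go : lb g (ρ h u) ≡ lb g u ⊎ l g u ≡ ρ h u → rb h (l g u) ≡ rb h u ⊎ l g u ≡ ρ h u → C g (CR h f) u e ≡ CR h (C g f) u e
   go (inj₂ eq) _ = flip eq
   go (inj₁ _) (inj₂ eq) = flip eq
   go (inj₁ q) (inj₁ p) = same p q

 C-quad : ∀ g f u e → C g (C g f) u e ≡ C g f u (ℤ.pred e) + C g f u (ℤ.suc e)
 C-quad g f u e with lb g u in p | lb-flip g u
 ... | true | q rewrite q | l-invol g u | ℤ.pred-suc e = i (f u e) (f (l g u) (ℤ.suc e)) (f (l g u) (ℤ.pred e)) (f u (ℤ.pred (ℤ.pred e)))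
   where
   i : ∀ a b c d → a + b + (c + d) ≡ c + d + (b + a)
   i = solve-∀
 ... | false | q rewrite q | l-invol g u | ℤ.suc-pred e = i (f u e) (f (l g u) (ℤ.pred e)) (f (l g u) (ℤ.suc e)) (f u (ℤ.suc (ℤ.suc e)))
   where
   i : ∀ a b c d → a + b + (c + d) ≡ b + a + (c + d)
   i = solve-∀

 C-sh : ∀ g b f u e → C g (λ u e → f u (sh b e)) u e ≡ C g f u (sh b e)
 C-sh g b f u e = cong (λ z → f (l g u) (sh b e) + f u z) (sh-comm b (lb g u) e)

 CR-sh : ∀ g b f u e → CR g (λ u e → f u (sh b e)) u e ≡ CR g f u (sh b e)
 CR-sh g b f u e = cong (λ z → f (ρ g u) (sh b e) + f u z) (sh-comm b (rb g u) e)

 C-sub : ∀ g f h u e → C g (λ u e → f u e + - h u e) u e ≡ C g f u e + - C g h u e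
 C-sub g f h u e = i (f (l g u) e) (h (l g u) e) (f u (sh (lb g u) e)) (h u (sh (lb g u) e))
   where
   i : ∀ a b c d → a + - b + (c + - d) ≡ a + c + - (b + d)
   i = solve-∀

 CR-sub : ∀ g f h u e → CR g (λ u e → f u e + - h u e) u e ≡ CR g f u e + - CR g h u e
 CR-sub g f h u e = i (f (ρ g u) e) (h (ρ g u) e) (f u (sh (rb g u) e)) (h u (sh (rb g u) e))
   where
   i : ∀ a b c d → a + - b + (c + - d) ≡ a + c + - (b + d)
   i = solve-∀

 TI : ∀ g f → T g (I g f) ≗F f
 TI g f u e = trans (cong (_+ - I g f u (ℤ.suc e)) (trans (C-sub g (C g f) (λ u e → f u (ℤ.pred e)) u e) (cong₂ (λ a b → a + - b) (C-quad g f u e) (C-sh g true f u e))))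
   (trans (i (C g f u (ℤ.pred e)) (C g f u (ℤ.suc e)) (f u (ℤ.pred (ℤ.suc e)))) (cong (f u) (ℤ.pred-suc e)))
   where
   i : ∀ a b c → a + b + - a + - (b + - c) ≡ c
   i = solve-∀

 IT : ∀ g f → I g (T g f) ≗F f
 IT g f u e = trans (cong (_+ - T g f u (ℤ.pred e)) (trans (C-sub g (C g f) (λ u e → f u (ℤ.suc e)) u e) (cong₂ (λ a b → a + - b) (C-quad g f u e) (C-sh g false f u e))))
   (trans (i (C g f u (ℤ.pred e)) (C g f u (ℤ.suc e)) (f u (ℤ.suc (ℤ.pred e)))) (cong (f u) (ℤ.suc-pred e)))
   where
   i : ∀ a b c → a + b + - b + - (a + - c) ≡ c
   i = solve-∀

 X-XR : ∀ a b g h f u e → (C g (λ u e → CR h f u e + - f u (sh b e)) u e + - (CR h f u (sh a e) + - f u (sh b (sh a e))))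
   ≡ (CR h (λ u e → C g f u e + - f u (sh a e)) u e + - (C g f u (sh b e) + - f u (sh a (sh b e))))
 X-XR a b g h f u e =
   trans (cong (_+ - (CR h f u (sh a e) + - f u (sh b (sh a e)))) (trans (C-sub g (CR h f) (λ u e → f u (sh b e)) u e) (cong₂ (λ x y → x + - y) (C-CR g h f u e) (C-sh g b f u e))))
   (trans (i (CR h (C g f) u e) (C g f u (sh b e)) (CR h f u (sh a e)) _ _ (cong (f u) (sh-comm b a e)))
   (sym (cong (_+ - (C g f u (sh b e) + - f u (sh a (sh b e)))) (trans (CR-sub h (C g f) (λ u e → f u (sh a e)) u e) (cong (λ y → CR h (C g f) u e + - y) (CR-sh h a f u e))))))
   where
   i : ∀ x y z w w′ → w ≡ w′ → x + - y + - (z + - w) ≡ x + - z + - (y + - w′)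
   i x y z w .w refl = i′ x y z w
     where
     i′ : ∀ x y z w → x + - y + - (z + - w) ≡ x + - z + - (y + - w)
     i′ = solve-∀

 T-TR : ∀ g h f → T g (TR h f) ≗F TR h (T g f)
 T-TR g h f = X-XR false false g h f

 I-IR : ∀ g h f → I g (IR h f) ≗F IR h (I g f)
 I-IR g h f = X-XR true true g h f

 T-TR* : ∀ g b f → T g (foldr TR f b) ≗F foldr TR (T g f) b
 T-TR* g [] f u e = refl
 T-TR* g (h ∷ b) f u e = trans (T-TR g h (foldr TR f b) u e) (TR-cong h (T-TR* g b f) u e)

 T*-TR* : ∀ a b f → foldr T (foldr TR f b) a ≗F foldr TR (foldr T f a) b
 T*-TR* [] b f u e = refl
 T*-TR* (g ∷ a) b f u e = trans (T-cong g (T*-TR* a b f) u e) (T-TR* g b (foldr T f a) u e)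

 kδ : W → ℤ → F
 kδ w k u e = kr u e w k

 Red : Word → Set
 Red a = length a ≡ ℓ (ev a)

 Red-tail : ∀ g a → Red (g ∷ a) → Red a × lb g (ev a) ≡ false
 Red-tail g a p with lb g (ev a) in b
 ... | false = suc-injective (trans p (trans (cong ℓ (ev-∷ g a)) (ℓ-up g (ev a) b))) , refl
 ... | true = ⊥-elim (<⇒≱ (s≤s (≤-trans (ℓ-ev a) (n≤1+n _)))
     (≤-reflexive (trans (cong suc p) (trans (cong (suc ∘ ℓ) (ev-∷ g a)) (sym (ℓ-down g (ev a) b))))))

 Red-cons : ∀ g a → Red a → lb g (ev a) ≡ false → Red (g ∷ a)
 Red-cons g a p b = trans (cong suc p) (sym (trans (cong ℓ (ev-∷ g a)) (ℓ-up g (ev a) b)))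

 Red-word : ∀ x → Red (word x)
 Red-word x = trans (length-word x) (cong ℓ (sym (ev-word x)))

 kr-suc : ∀ u e w k → kr u (ℤ.suc e) w k ≡ kr u e w (ℤ.pred k)
 kr-suc u e w k = kr-iff (λ p q → p , trans (cong ℤ.pred q) (ℤ.pred-suc e)) (λ p q → p , trans (sym (ℤ.suc-pred k)) (cong ℤ.suc q))

 kr-pred : ∀ u e w k → kr u (ℤ.pred e) w k ≡ kr u e w (ℤ.suc k)
 kr-pred u e w k = kr-iff (λ p q → p , trans (cong ℤ.suc q) (ℤ.suc-pred e)) (λ p q → p , trans (sym (ℤ.pred-suc k)) (cong ℤ.pred q))

 kr-sh : ∀ b u e w k → kr u (sh b e) w k ≡ kr u e w (sh (not b) k)
 kr-sh true = kr-pred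
 kr-sh false = kr-suc

 kr-l : ∀ g u e w k → kr (l g u) e w k ≡ kr u e (l g w) k
 kr-l g u e w k = kr-iff (λ p q → trans (cong (l g) p) (l-invol g u) , q) (λ p q → trans (sym (l-invol g w)) (cong (l g) p) , q)

 kr-ρ : ∀ g u e w k → kr (ρ g u) e w k ≡ kr u e (ρ g w) k
 kr-ρ g u e w k = kr-iff (λ p q → trans (cong (ρ g) p) (ρ-invol g u) , q) (λ p q → trans (sym (ρ-invol g w)) (cong (ρ g) p) , q)

 kr-bit : ∀ (β : W → Bool) u e w k → kr u (sh (β u) e) w k ≡ kr u e w (sh (not (β w)) k)
 kr-bit β u e w k = trans (kr-sh (β u) u e w k) (lem (w ≟W u))
   where
   lem : Dec (w ≡ u) → kr u e w (sh (not (β u)) k) ≡ kr u e w (sh (not (β w)) k)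
   lem (yes refl) = refl
   lem (no ne) = trans (kr-no₁ e _ ne) (sym (kr-no₁ e _ ne))

 C-kδ : ∀ g w k u e → C g (kδ w k) u e ≡ kδ (l g w) k u e + kδ w (sh (not (lb g w)) k) u e
 C-kδ g w k u e = cong₂ _+_ (kr-l g u e w k) (kr-bit (lb g) u e w k)

 CR-kδ : ∀ g w k u e → CR g (kδ w k) u e ≡ kδ (ρ g w) k u e + kδ w (sh (not (rb g w)) k) u e
 CR-kδ g w k u e = cong₂ _+_ (kr-ρ g u e w k) (kr-bit (rb g) u e w k)

 cancel : ∀ a b → a + b + - b ≡ a
 cancel a b = trans (+-assoc a b (- b)) (trans (cong (_+_ a) (+-inverseʳ b)) (+-identityʳ a))

 T-kδ : ∀ g w k → lb g w ≡ false → T g (kδ w k) ≗F kδ (l g w) k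
 T-kδ g w k b u e = trans (cong₂ (λ x y → x + - y) (trans (C-kδ g w k u e) (cong (λ z → kδ (l g w) k u e + kδ w (sh (not z) k) u e) b)) (kr-suc u e w k)) (cancel _ _)

 TR-kδ : ∀ g w k → rb g w ≡ false → TR g (kδ w k) ≗F kδ (ρ g w) k
 TR-kδ g w k b u e = trans (cong₂ (λ x y → x + - y) (trans (CR-kδ g w k u e) (cong (λ z → kδ (ρ g w) k u e + kδ w (sh (not z) k) u e) b)) (kr-suc u e w k)) (cancel _ _)

 T*-1 : ∀ a k → Red a → foldr T (kδ 1W k) a ≗F kδ (ev a) k
 T*-1 [] k p u e = cong (λ x → kr u e x k) (sym ev-[])
 T*-1 (g ∷ a) k p u e with Red-tail g a p
 ... | q , b = trans (T-cong g (T*-1 a k q) u e) (trans (T-kδ g (ev a) k b u e) (cong (λ x → kr u e x k) (sym (ev-∷ g a))))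

 TR*-1 : ∀ a k → Red a → foldr TR (kδ 1W k) a ≗F kδ (inv (ev a)) k
 TR*-1 [] k p u e = cong (λ x → kr u e x k) (sym (trans (cong inv ev-[]) inv-1))
 TR*-1 (g ∷ a) k p u e with Red-tail g a p
 ... | q , b = trans (TR-cong g (TR*-1 a k q) u e) (trans (TR-kδ g (inv (ev a)) k (trans (cong (lb g) (inv-invol (ev a))) b) u e)
     (cong (λ x → kr u e x k) (sym (trans (cong inv (ev-∷ g a)) (inv-l g (ev a))))))

 private
   right-form : ∀ w k → kδ w k ≗F foldr TR (kδ 1W k) (word (inv w))
   right-form w k u e = sym (trans (TR*-1 (word (inv w)) k (Red-word (inv w)) u e) (cong (λ x → kr u e x k) (trans (cong inv (ev-word (inv w))) (inv-invol w))))

 -- Takes the place of the braid relations: T̃_w is written as a product of right operators applied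
 -- to 1, these are moved out past the left operators, and two reduced words with the same value
 -- send 1 to the same basis element.
 T*-kδ : ∀ a a′ w k → Red a → Red a′ → ev a ≡ ev a′ → foldr T (kδ w k) a ≗F foldr T (kδ w k) a′
 T*-kδ a a′ w k p p′ eq u e = trans (h a p) (trans (foldr-cong TR TR-cong (word (inv w)) (λ u e → cong (λ x → kr u e x k) eq) u e) (sym (h a′ p′)))
   where
   h : ∀ a → Red a → foldr T (kδ w k) a u e ≡ foldr TR (kδ (ev a) k) (word (inv w)) u e
   h a p = trans (foldr-cong T T-cong a (right-form w k) u e) (trans (T*-TR* a (word (inv w)) (kδ 1W k) u e)
     (foldr-cong TR TR-cong (word (inv w)) (T*-1 a k p) u e))

 lin-C : ∀ g (X : W → ℤ → F) ts → C g (λ u e → lin (λ w k → X w k u e) ts) ≗F (λ u e → lin (λ w k → C g (X w k) u e) ts)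
 lin-C g X ts u e = sym (lin-+ (λ w k → X w k (l g u) e) (λ w k → X w k u (sh (lb g u) e)) ts)

 lin-T : ∀ g (X : W → ℤ → F) ts → T g (λ u e → lin (λ w k → X w k u e) ts) ≗F (λ u e → lin (λ w k → T g (X w k) u e) ts)
 lin-T g X ts u e = trans (cong₂ _+_ (lin-C g X ts u e) (sym (lin-neg (λ w k → X w k u (ℤ.suc e)) ts))) (sym (lin-+ (λ w k → C g (X w k) u e) (λ w k → - X w k u (ℤ.suc e)) ts))

 lin-T* : ∀ a ts → foldr T (val ts) a ≗F (λ u e → lin (λ w k → foldr T (kδ w k) a u e) ts)
 lin-T* [] ts u e = refl
 lin-T* (g ∷ a) ts u e = trans (T-cong g (lin-T* a ts) u e) (lin-T g (λ w k → foldr T (kδ w k) a) ts u e)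

 T*-indep : ∀ a a′ ts → Red a → Red a′ → ev a ≡ ev a′ → foldr T (val ts) a ≗F foldr T (val ts) a′
 T*-indep a a′ ts p p′ eq u e = trans (lin-T* a ts u e) (trans (lin-cong (λ w k → T*-kδ a a′ w k p p′ eq u e) ts) (sym (lin-T* a′ ts u e)))

 Top : W → F → F
 Top x f = foldr T f (word x)

 Top-up : ∀ g x ts → lb g x ≡ false → Top (l g x) (val ts) ≗F T g (Top x (val ts))
 Top-up g x ts b = T*-indep (word (l g x)) (g ∷ word x) ts (Red-word (l g x))
   (Red-cons g (word x) (Red-word x) (trans (cong (lb g) (ev-word x)) b)) (trans (ev-word (l g x)) (sym (trans (ev-∷ g (word x)) (cong (l g) (ev-word x)))))

 C-Top : ∀ g x ts u e → C g (Top x (val ts)) u e ≡ Top (l g x) (val ts) u e + Top x (val ts) u (sh (lb g x) e)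
 C-Top g x ts u e with lb g x in b
 ... | false = sym (trans (cong (_+ Top x (val ts) u (ℤ.suc e)) (Top-up g x ts b u e)) (i _ _))
   where
   i : ∀ a b → a + - b + b ≡ a
   i = solve-∀
 ... | true = trans (C-cong g up u e) (trans (C-sub g (C g f) (λ u e → f u (ℤ.suc e)) u e) (trans (cong₂ (λ a b → a + - b) (C-quad g f u e) (C-sh g false f u e))
     (trans (i (C g f u (ℤ.pred e)) (C g f u (ℤ.suc e)) (f u e)) (cong (_+_ (f u e)) (trans (cong (λ z → C g f u (ℤ.pred e) + - f u z) (sym (ℤ.suc-pred e))) (sym (up u (ℤ.pred e))))))))
   where
   f : F
   f = Top (l g x) (val ts)
   up : Top x (val ts) ≗F T g f
   up u e = trans (cong (λ z → Top z (val ts) u e) (sym (l-invol g x))) (Top-up g (l g x) ts (trans (lb-flip g x) (cong not b)) u e)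
   i : ∀ a b c → a + b + - b ≡ c + (a + - c)
   i = solve-∀

 cL : Gen → List Tm → List Tm
 cL g [] = []
 cL g ((w , k , c) ∷ ts) = (l g w , k , c) ∷ (w , sh (not (lb g w)) k , c) ∷ cL g ts

 lin-cL : ∀ g φ ts → lin φ (cL g ts) ≡ lin (λ w k → φ (l g w) k + φ w (sh (not (lb g w)) k)) ts
 lin-cL g φ [] = refl
 lin-cL g φ ((w , k , c) ∷ ts) = trans (cong (λ z → c * φ (l g w) k + (c * φ w (sh (not (lb g w)) k) + z)) (lin-cL g φ ts)) (i c _ _ _)
   where
   i : ∀ c a b x → c * a + (c * b + x) ≡ c * (a + b) + x
   i = solve-∀

 val-cL : ∀ g ts → val (cL g ts) ≗F C g (val ts)
 val-cL g ts u e = trans (lin-cL g (kr u e) ts) (trans (lin-cong (λ w k → sym (C-kδ g w k u e)) ts) (sym (lin-C g kδ ts u e)))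

 shift : Bool → List Tm → List Tm
 shift b = map λ { (w , k , c) → w , sh (not b) k , c }

 lin-shift : ∀ b φ ts → lin φ (shift b ts) ≡ lin (λ w k → φ w (sh (not b) k)) ts
 lin-shift b φ [] = refl
 lin-shift b φ ((w , k , c) ∷ ts) = cong (_+_ (c * φ w (sh (not b) k))) (lin-shift b φ ts)

 val-shift : ∀ b ts u e → val (shift b ts) u e ≡ val ts u (sh b e)
 val-shift b ts u e = trans (lin-shift b (kr u e) ts) (lin-cong (λ w k → sym (kr-sh b u e w k)) ts)

 iL : Gen → List Tm → List Tm
 iL g ts = cL g ts ++ scale -[1+ 0 ] (shift true ts)

 val-iL : ∀ g ts → val (iL g ts) ≗F I g (val ts)
 val-iL g ts u e = trans (lin-++ (kr u e) (cL g ts) _) (cong₂ _+_ (val-cL g ts u e)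
   (trans (lin-scale -[1+ 0 ] (kr u e) (shift true ts)) (trans (ℤ.-1*i≡-i _) (cong -_ (val-shift true ts u e)))))

 -- B w is the image of T̃_w under the bar involution
 B₀ : Word → F
 B₀ a = foldr I (kδ 1W (+ 0)) a

 B : W → F
 B x = B₀ (word x)

 private
   bL : Word → List Tm
   bL [] = (1W , + 0 , + 1) ∷ []
   bL (g ∷ a) = iL g (bL a)

   val-bL : ∀ a → val (bL a) ≗F B₀ a
   val-bL [] u e = trans (+-identityʳ _) (*-identityˡ _)
   val-bL (g ∷ a) u e = trans (val-iL g (bL a) u e) (I-cong g (val-bL a) u e)

   T*-cancel : ∀ a f → foldr T (foldr I f a) (reverse a) ≗F f
   T*-cancel [] f u e = refl
   T*-cancel (g ∷ a) f u e = trans (cong (λ w → foldr T (I g (foldr I f a)) w u e) (List.unfold-reverse g a))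
     (trans (cong (λ h → h u e) (List.foldr-++ T (I g (foldr I f a)) (reverse a) (g ∷ [])))
     (trans (foldr-cong T T-cong (reverse a) (TI g (foldr I f a)) u e) (T*-cancel a f u e)))

   I*-cancel : ∀ a f → foldr I (foldr T f (reverse a)) a ≗F f
   I*-cancel [] f u e = refl
   I*-cancel (g ∷ a) f u e = trans (I-cong g (foldr-cong I I-cong a (λ u e → trans (cong (λ w → foldr T f w u e) (List.unfold-reverse g a)) (cong (λ h → h u e) (List.foldr-++ T f (reverse a) (g ∷ []))))) u e)
     (trans (I-cong g (I*-cancel a (T g f)) u e) (IT g f u e))

   ev-foldr : ∀ a b → ev (a ++ b) ≡ foldr l (ev b) a
   ev-foldr [] b = refl
   ev-foldr (g ∷ a) b = trans (ev-∷ g (a ++ b)) (cong (l g) (ev-foldr a b))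

   l*-ρ : ∀ g a x → foldr l (ρ g x) a ≡ ρ g (foldr l x a)
   l*-ρ g [] x = refl
   l*-ρ g (h ∷ a) x = trans (cong (l h) (l*-ρ g a x)) (l-ρ h g _)

 ev-++[] : ∀ a g → ev (a ++ g ∷ []) ≡ ρ g (ev a)
 ev-++[] a g = trans (ev-foldr a (g ∷ [])) (trans (cong (λ x → foldr l x a) (trans (ev-∷ g []) (trans (cong (l g) ev-[]) (l1≡ρ1 g))))
   (trans (l*-ρ g a 1W) (cong (ρ g) (trans (cong (λ x → foldr l x a) (sym ev-[])) (trans (sym (ev-foldr a [])) (cong ev (List.++-identityʳ a)))))))

 ev-reverse : ∀ a → ev (reverse a) ≡ inv (ev a)
 ev-reverse [] = trans ev-[] (sym (trans (cong inv ev-[]) inv-1))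
 ev-reverse (g ∷ a) = trans (cong ev (List.unfold-reverse g a)) (trans (ev-++[] (reverse a) g) (trans (cong (ρ g) (ev-reverse a)) (sym (trans (cong inv (ev-∷ g a)) (inv-l g (ev a))))))

 Red-reverse : ∀ a → Red a → Red (reverse a)
 Red-reverse a p = trans (List.length-reverse a) (trans p (sym (trans (cong ℓ (ev-reverse a)) (ℓ-inv (ev a)))))

 -- `B₀ a` is the solution f of T f = 1 for the operator T of the reversed word, because `I` inverts
 -- `T`; that operator is independent of the reduced word by `T*-indep`.
 B₀-indep : ∀ a b → Red a → Red b → ev a ≡ ev b → B₀ a ≗F B₀ b
 B₀-indep a b p q eq u e = trans (sym (I*-cancel a (B₀ a) u e)) (trans (foldr-cong I I-cong a h u e) (I*-cancel a (B₀ b) u e))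
   where
   h : foldr T (B₀ a) (reverse a) ≗F foldr T (B₀ b) (reverse a)
   h u e = trans (T*-cancel a (kδ 1W (+ 0)) u e) (trans (sym (T*-cancel b (kδ 1W (+ 0)) u e))
     (trans (foldr-cong T T-cong (reverse b) (λ u e → sym (val-bL b u e)) u e)
     (trans (T*-indep (reverse b) (reverse a) (bL b) (Red-reverse b q) (Red-reverse a p) (trans (ev-reverse b) (trans (cong inv (sym eq)) (sym (ev-reverse a)))) u e)
     (foldr-cong T T-cong (reverse a) (val-bL b) u e))))

 B-up : ∀ g x → lb g x ≡ false → B (l g x) ≗F I g (B x)
 B-up g x b = B₀-indep (word (l g x)) (g ∷ word x) (Red-word (l g x))
   (Red-cons g (word x) (Red-word x) (trans (cong (lb g) (ev-word x)) b)) (trans (ev-word (l g x)) (sym (trans (ev-∷ g (word x)) (cong (l g) (ev-word x)))))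

 -- C_g is fixed by the bar involution, so this is the image of the multiplication rule for C_g
 -- T̃_x; the shift is negated because the bar inverts v.
 C-B : ∀ g x u e → C g (B x) u e ≡ B (l g x) u e + B x u (sh (not (lb g x)) e)
 C-B g x u e with lb g x in b
 ... | false = sym (trans (cong (_+ B x u (ℤ.pred e)) (B-up g x b u e)) (i _ _))
   where
   i : ∀ a b → a + - b + b ≡ a
   i = solve-∀
 ... | true = trans (C-cong g up u e) (trans (C-sub g (C g f) (λ u e → f u (ℤ.pred e)) u e) (trans (cong₂ (λ a b → a + - b) (C-quad g f u e) (C-sh g true f u e))
     (trans (i (C g f u (ℤ.pred e)) (C g f u (ℤ.suc e)) (f u e)) (cong (_+_ (f u e)) (trans (cong (λ z → C g f u (ℤ.suc e) + - f u z) (sym (ℤ.pred-suc e))) (sym (up u (ℤ.suc e))))))))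
   where
   f : F
   f = B (l g x)
   up : B x ≗F I g f
   up u e = trans (cong (λ z → B z u e) (sym (l-invol g x))) (B-up g (l g x) (trans (lb-flip g x) (cong not b)) u e)
   i : ∀ a b c → a + b + - a ≡ c + (b + - c)
   i = solve-∀

 -- The exponent is e + k, where a product would have e - k, since the bar sends vᵏ to v⁻ᵏ.
 barv : List Tm → F
 barv ts u e = lin (λ w k → B w u (e + k)) ts

 sh-+ : ∀ b e k → sh b (e + k) ≡ sh b e + k
 sh-+ true e k = sym (+-assoc -[1+ 0 ] e k)
 sh-+ false e k = sym (+-assoc (+ 1) e k)

 sh-+ʳ : ∀ b e k → e + sh b k ≡ sh b (e + k)
 sh-+ʳ b e k = trans (+-comm e _) (trans (sym (sh-+ b k e)) (cong (sh b) (+-comm k e)))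

 barv-cL : ∀ g ts → barv (cL g ts) ≗F C g (barv ts)
 barv-cL g ts u e = trans (lin-cL g (λ w k → B w u (e + k)) ts) (trans (lin-cong h ts) (lin-+ (λ w k → B w (l g u) (e + k)) (λ w k → B w u (sh (lb g u) e + k)) ts))
   where
   h : ∀ w k → B (l g w) u (e + k) + B w u (e + sh (not (lb g w)) k) ≡ B w (l g u) (e + k) + B w u (sh (lb g u) e + k)
   h w k = trans (cong (λ z → B (l g w) u (e + k) + B w u z) (sh-+ʳ (not (lb g w)) e k)) (trans (sym (C-B g w u (e + k))) (cong (λ z → B w (l g u) (e + k) + B w u z) (sh-+ (lb g u) e k)))

 l≡-sym : ∀ g {x y} → l g x ≡ y → x ≡ l g y
 l≡-sym g {x} p = trans (sym (l-invol g x)) (cong (l g) p)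

 ℓ-l≤ : ∀ g x → ℓ x ≤ suc (ℓ (l g x))
 ℓ-l≤ g x with lb g x in b
 ... | true = ≤-reflexive (ℓ-down g x b)
 ... | false = ≤-trans (n≤1+n _) (≤-trans (≤-reflexive (sym (ℓ-up g x b))) (n≤1+n _))

 B₀-triangular : ∀ a u e → Red a → length a ≤ ℓ u → B₀ a u e ≡ kδ (ev a) (+ 0) u e
 B₀-triangular [] u e p le = cong (λ x → kr u e x (+ 0)) (sym ev-[])
 B₀-triangular (g ∷ a) u e p le with Red-tail g a p
 ... | q , b = trans (cong₂ (λ x y → x + - y) (cong₂ _+_ (B₀-triangular a (l g u) e q (ℕ.≤-pred (≤-trans le (ℓ-l≤ g u)))) (z (sh (lb g u) e))) (z (ℤ.pred e)))
     (trans (+-identityʳ _) (trans (+-identityʳ _) (trans (kr-l g u e (ev a) (+ 0)) (cong (λ x → kr u e x (+ 0)) (sym (ev-∷ g a))))))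
   where
   z : ∀ e → B₀ a u e ≡ + 0
   z e = trans (B₀-triangular a u e q (≤-trans (n≤1+n _) le)) (kr-no₁ e (+ 0) (λ { refl → <⇒≱ le (ℓ-ev a) }))

 -- T̃_g⁻¹ is T̃_g plus a scalar, so a product of such factors has T̃_w as its only term of length
 -- at least that of w.
 B-triangular : ∀ w u e → ℓ w ≤ ℓ u → B w u e ≡ kδ w (+ 0) u e
 B-triangular w u e le = trans (B₀-triangular (word w) u e (Red-word w) (subst (_≤ ℓ u) (sym (length-word w)) le)) (cong (λ x → kr u e x (+ 0)) (ev-word w))

 maxℓ : List Tm → ℕ
 maxℓ [] = 0
 maxℓ ((w , _) ∷ ts) = ℓ w ℕ.⊔ maxℓ ts

 above-max : ∀ ts u e → maxℓ ts < ℓ u → val ts u e ≡ + 0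
 above-max [] u e _ = refl
 above-max ((w , k , c) ∷ ts) u e p = cong₂ _+_ (trans (cong (_*_ c) (kr-no₁ e k (λ { refl → <⇒≱ p (ℕ.m≤m⊔n (ℓ w) (maxℓ ts)) }))) (*-zeroʳ c))
   (above-max ts u e (≤-trans (s≤s (ℕ.m≤n⊔m (ℓ w) (maxℓ ts))) p))

 -- Kazhdan–Lusztig uniqueness, by descending induction on length
 module _ (ts : List Tm) (bi : barv ts ≗F val ts) (neg : ∀ u n → val ts u (+ n) ≡ + 0) where
   private
     step : ∀ n u e → maxℓ ts < ℓ u ℕ.+ n → val ts u e ≡ + 0
     step zero u e p = above-max ts u e (subst (maxℓ ts <_) (ℕ.+-identityʳ _) p)
     step (suc n) u e p = fin e
       where
       h : ∀ e w k → val ts w k ≡ + 0 ⊎ B w u (e + k) ≡ kr u (- e) w k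
       h e w k with ℓ w ℕ.≤? ℓ u
       ... | no gt = inj₁ (step n w k (≤-trans p (≤-trans (≤-reflexive (+-suc (ℓ u) n)) (ℕ.+-monoˡ-≤ n (≰⇒> gt)))))
       ... | yes le = inj₂ (trans (B-triangular w u (e + k) le) (kr-iff
           (λ p q → p , i-j≡0⇒i≡j k (- e) (trans (i e k) (sym q)))
           (λ p q → p , sym (trans (cong (_+_ e) q) (+-inverseʳ e)))))
         where
         i : ∀ e k → k + - - e ≡ e + k
         i e k = trans (cong (_+_ k) (ℤ.neg-involutive e)) (+-comm k e)
       -- Coefficients of elements longer than u vanish by induction, and among the others only w =
       -- u contributes at u; for it the bar exchanges the exponents e and -e.
       mirror : ∀ e → val ts u e ≡ val ts u (- e)
       mirror e = trans (sym (bi u e)) (lin-diff (λ w k → B w u (e + k)) (kr u (- e)) ts (h e))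
       fin : ∀ e → val ts u e ≡ + 0
       fin (+ m) = neg u m
       fin -[1+ m ] = trans (mirror -[1+ m ]) (neg u (suc m))

   bar-unique : ∀ u e → val ts u e ≡ + 0
   bar-unique u e = step (suc (maxℓ ts)) u e (ℕ.m≤n+m (suc (maxℓ ts)) (ℓ u))

 ι : List Tm → List Tm
 ι = map λ { (w , k , c) → inv w , k , c }

 lin-ι : ∀ φ ts → lin φ (ι ts) ≡ lin (λ w k → φ (inv w) k) ts
 lin-ι φ [] = refl
 lin-ι φ ((w , k , c) ∷ ts) = cong (_+_ (c * φ (inv w) k)) (lin-ι φ ts)

 kr-inv : ∀ u e w k → kr u e (inv w) k ≡ kr (inv u) e w k
 kr-inv u e w k = kr-iff (λ p q → trans (sym (inv-invol w)) (cong inv p) , q) (λ p q → trans (cong inv p) (inv-invol u) , q)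

 val-ι : ∀ ts u e → val (ι ts) u e ≡ val ts (inv u) e
 val-ι ts u e = trans (lin-ι (kr u e) ts) (lin-cong (λ w k → kr-inv u e w k) ts)

 private
   I*-IR : ∀ h a f → foldr I (IR h f) a ≗F IR h (foldr I f a)
   I*-IR h [] f u e = refl
   I*-IR h (g ∷ a) f u e = trans (I-cong g (I*-IR h a f) u e) (I-IR g h (foldr I f a) u e)

   I1 : ∀ g → IR g (kδ 1W (+ 0)) ≗F I g (kδ 1W (+ 0))
   I1 g u e = cong (_+ - kδ 1W (+ 0) u (ℤ.pred e)) (trans (CR-kδ g 1W (+ 0) u e) (trans (cong₂ (λ x b → kδ x (+ 0) u e + kδ 1W (sh (not b) (+ 0)) u e) (sym (l1≡ρ1 g)) (cong (lb g) inv-1)) (sym (C-kδ g 1W (+ 0) u e))))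

   IR*-1 : ∀ a → foldr IR (kδ 1W (+ 0)) a ≗F B₀ (reverse a)
   IR*-1 [] u e = refl
   IR*-1 (g ∷ a) u e = trans (IR-cong g (IR*-1 a) u e) (trans (sym (I*-IR g (reverse a) (kδ 1W (+ 0)) u e)) (trans (foldr-cong I I-cong (reverse a) (I1 g) u e)
     (trans (cong (λ h → h u e) (sym (List.foldr-++ I (kδ 1W (+ 0)) (reverse a) (g ∷ [])))) (cong (λ w → B₀ w u e) (sym (List.unfold-reverse g a))))))

   IR*-inv : ∀ a u e → foldr IR (kδ 1W (+ 0)) a u e ≡ B₀ a (inv u) e
   IR*-inv [] u e = trans (cong (λ x → kr u e x (+ 0)) (sym inv-1)) (kr-inv u e 1W (+ 0))
   IR*-inv (g ∷ a) u e = cong₂ (λ x y → x + - y) (cong₂ _+_ (trans (IR*-inv a (ρ g u) e) (cong (λ z → B₀ a z e) (inv-ρ g u))) (IR*-inv a u _)) (IR*-inv a u _)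

 B-inv : ∀ w u e → B (inv w) u e ≡ B w (inv u) e
 B-inv w u e = trans (B₀-indep (word (inv w)) (reverse (word w)) (Red-word (inv w)) (Red-reverse (word w) (Red-word w))
   (trans (ev-word (inv w)) (sym (trans (ev-reverse (word w)) (cong inv (ev-word w))))) u e)
   (trans (sym (IR*-1 (word w) u e)) (IR*-inv (word w) u e))

 barv-ι : ∀ ts u e → barv (ι ts) u e ≡ barv ts (inv u) e
 barv-ι ts u e = trans (lin-ι _ ts) (lin-cong (λ w k → B-inv w u (e + k)) ts)

-- Descent sets, values of a on states, and factorisations of elements.

module Descents where
 open Coxeter
 open Hecke
 open Automaton using (Q; q0; q5; q10; q12; q15; q16; q18; q20; q21; q22; q23; q24; q25; q26; bit; δ; Q∀; _≟Q_)
 open Alcoves using (Gen∀)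
 open Defs using (Gen; r; s; t; Word)

 st-down : ∀ g x → lb g x ≡ true → lb g (l g x) ≡ false × δ g (st (l g x)) ≡ st x
 st-down g x b = f , trans (sym (st-up g (l g x) f)) (cong st (l-invol g x))
   where
   f : lb g (l g x) ≡ false
   f = trans (lb-flip g x) (cong not b)

 -- the value of the a-function on the elements with a given state
 av : Q → ℕ
 av q0 = 0
 av q5 = 2
 av q10 = 2
 av q12 = 2
 av q16 = 2
 av q20 = 2
 av q15 = 4
 av q18 = 4
 av q21 = 4
 av q22 = 4
 av q23 = 4
 av q24 = 4
 av q25 = 4
 av q26 = 4
 av _ = 1

 aW : W → ℕ
 aW x = av (st x)

 -- {a σ , s} generates a finite parabolic subgroup of order 8, and c σ is the third generator
 data Side : Set where
   RS ST : Side

 a c : Side → Gen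
 a RS = r
 a ST = t
 c RS = t
 c ST = r

 opp : Side → Side
 opp RS = ST
 opp ST = RS

 Side∀ : {P : Side → Set} → (∀ σ → Dec (P σ)) → Dec (∀ σ → P σ)
 Side∀ d = map′ (λ { (x , y) → λ { RS → x ; ST → y } }) (λ f → f RS , f ST) (d RS ×-dec d ST)

 _is_ : (b b′ : Bool) → Dec (b ≡ b′)
 _is_ = Bool._≟_

 J : Side → W → Set
 J σ y = lb (a σ) y ≡ true × lb s y ≡ true

 Jq : Side → Q → Set
 Jq σ q = bit (a σ) q ≡ true × bit s q ≡ true

 Jq? : ∀ σ q → Dec (Jq σ q)
 Jq? σ q = (bit (a σ) q is true) ×-dec (bit s q is true)

 data Lv : Set where
   l0 l1 l2 l3 : Lv

 -- The prefixes p = 1, c, sc, asc. Applied to elements having a and s as descents, they produce all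
 -- states of value 4.
 lev : Side → Lv → W → W
 lev σ l0 y = y
 lev σ l1 y = l (c σ) y
 lev σ l2 y = l s (l (c σ) y)
 lev σ l3 y = l (a σ) (l s (l (c σ) y))

 levq : Side → Lv → Q → Q
 levq σ l0 q = q
 levq σ l1 q = δ (c σ) q
 levq σ l2 q = δ s (δ (c σ) q)
 levq σ l3 q = δ (a σ) (δ s (δ (c σ) q))

 Bits : Side → Q → Bool → Bool → Bool → Set
 Bits σ q x y z = bit (a σ) q ≡ x × bit s q ≡ y × bit (c σ) q ≡ z

 Bits? : ∀ σ q x y z → Dec (Bits σ q x y z)
 Bits? σ q x y z = (bit (a σ) q is x) ×-dec ((bit s q is y) ×-dec (bit (c σ) q is z))

 private
   opaque
     J-fact : ∀ σ q → Jq σ q → Bits σ q true true false × Bits σ (levq σ l1 q) true false true × Bits σ (levq σ l2 q) false true false ×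
       Bits σ (levq σ l3 q) true false false × bit s (δ (c σ) (levq σ l2 q)) ≡ true × bit (a σ) (δ s (levq σ l3 q)) ≡ true ×
       av q ≡ 4 × av (levq σ l1 q) ≡ 4 × av (levq σ l2 q) ≡ 4 × av (levq σ l3 q) ≡ 4
     J-fact = toWitness {a? = Side∀ λ σ → Q∀ λ q → Jq? σ q →-dec (Bits? σ q true true false ×-dec (Bits? σ (levq σ l1 q) true false true ×-dec (Bits? σ (levq σ l2 q) false true false ×-dec
       (Bits? σ (levq σ l3 q) true false false ×-dec ((bit s (δ (c σ) (levq σ l2 q)) is true) ×-dec ((bit (a σ) (δ s (levq σ l3 q)) is true) ×-dec
       ((av q ℕ.≟ 4) ×-dec ((av (levq σ l1 q) ℕ.≟ 4) ×-dec ((av (levq σ l2 q) ℕ.≟ 4) ×-dec (av (levq σ l3 q) ℕ.≟ 4))))))))))} _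

   opaque
     J-pred-a : ∀ σ q → bit (a σ) q ≡ false → Jq σ (δ (a σ) q) → bit (c σ) q ≡ false
     J-pred-a = toWitness {a? = Side∀ λ σ → Q∀ λ q → (bit (a σ) q is false) →-dec (Jq? σ (δ (a σ) q) →-dec (bit (c σ) q is false))} _

   opaque
     J-pred-s : ∀ σ q → bit s q ≡ false → Jq σ (δ s q) → bit (c σ) q ≡ false
     J-pred-s = toWitness {a? = Side∀ λ σ → Q∀ λ q → (bit s q is false) →-dec (Jq? σ (δ s q) →-dec (bit (c σ) q is false))} _

   opaque
     J1-pred : ∀ σ q q′ → Jq σ q → bit (a σ) q′ ≡ false → δ (a σ) q′ ≡ δ (c σ) q → bit s q′ ≡ false
     J1-pred = toWitness {a? = Side∀ λ σ → Q∀ λ q → Q∀ λ q′ → Jq? σ q →-dec ((bit (a σ) q′ is false) →-dec ((δ (a σ) q′ ≟Q δ (c σ) q) →-dec (bit s q′ is false)))} _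

   opaque
     three : ∀ q → bit r q ≡ true → bit s q ≡ true → bit t q ≡ false
     three = toWitness {a? = Q∀ λ q → (bit r q is true) →-dec ((bit s q is true) →-dec (bit t q is false))} _

 -- Reflects that W is infinite: an element with all generators as left descents would be a longest
 -- element.
 not-three : ∀ σ x → lb (a σ) x ≡ true → lb s x ≡ true → lb (c σ) x ≡ true → ⊥
 not-three RS x p q u = bool-clash u (three (st x) p q)
 not-three ST x p q u = bool-clash p (three (st x) u q)

 module _ {σ : Side} {y : W} (j : J σ y) where
   private
     F = J-fact σ (st y) j
     B0 = proj₁ F
     B1 = proj₁ (proj₂ F)
     B2 = proj₁ (proj₂ (proj₂ F))
     B3 = proj₁ (proj₂ (proj₂ (proj₂ F)))
     F4 = proj₂ (proj₂ (proj₂ (proj₂ F)))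

   J-c : lb (c σ) y ≡ false
   J-c = proj₂ (proj₂ B0)

   st1 : st (lev σ l1 y) ≡ levq σ l1 (st y)
   st1 = st-up (c σ) y J-c

   st2 : st (lev σ l2 y) ≡ levq σ l2 (st y)
   st2 = trans (st-up s (lev σ l1 y) (trans (cong (bit s) st1) (proj₁ (proj₂ B1)))) (cong (δ s) st1)

   st3 : st (lev σ l3 y) ≡ levq σ l3 (st y)
   st3 = trans (st-up (a σ) (lev σ l2 y) (trans (cong (bit (a σ)) st2) (proj₁ B2))) (cong (δ (a σ)) st2)

   J1-a : lb (a σ) (lev σ l1 y) ≡ true
   J1-a = trans (cong (bit (a σ)) st1) (proj₁ B1)
   J1-s : lb s (lev σ l1 y) ≡ false
   J1-s = trans (cong (bit s) st1) (proj₁ (proj₂ B1))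
   J1-c : lb (c σ) (lev σ l1 y) ≡ true
   J1-c = trans (cong (bit (c σ)) st1) (proj₂ (proj₂ B1))
   J2-a : lb (a σ) (lev σ l2 y) ≡ false
   J2-a = trans (cong (bit (a σ)) st2) (proj₁ B2)
   J2-s : lb s (lev σ l2 y) ≡ true
   J2-s = trans (cong (bit s) st2) (proj₁ (proj₂ B2))
   J2-c : lb (c σ) (lev σ l2 y) ≡ false
   J2-c = trans (cong (bit (c σ)) st2) (proj₂ (proj₂ B2))
   J3-a : lb (a σ) (lev σ l3 y) ≡ true
   J3-a = trans (cong (bit (a σ)) st3) (proj₁ B3)
   J3-s : lb s (lev σ l3 y) ≡ false
   J3-s = trans (cong (bit s) st3) (proj₁ (proj₂ B3))
   J3-c : lb (c σ) (lev σ l3 y) ≡ false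
   J3-c = trans (cong (bit (c σ)) st3) (proj₂ (proj₂ B3))

   J-csc : lb s (l (c σ) (lev σ l2 y)) ≡ true
   J-csc = trans (cong (bit s) (trans (st-up (c σ) (lev σ l2 y) J2-c) (cong (δ (c σ)) st2))) (proj₁ F4)
   J-sasc : lb (a σ) (l s (lev σ l3 y)) ≡ true
   J-sasc = trans (cong (bit (a σ)) (trans (st-up s (lev σ l3 y) J3-s) (cong (δ s) st3))) (proj₁ (proj₂ F4))

   aW-lev : ∀ i → aW (lev σ i y) ≡ 4
   aW-lev l0 = proj₁ (proj₂ (proj₂ F4))
   aW-lev l1 = trans (cong av st1) (proj₁ (proj₂ (proj₂ (proj₂ F4))))
   aW-lev l2 = trans (cong av st2) (proj₁ (proj₂ (proj₂ (proj₂ (proj₂ F4)))))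
   aW-lev l3 = trans (cong av st3) (proj₂ (proj₂ (proj₂ (proj₂ (proj₂ F4)))))

   J-a-down : lb (c σ) (l (a σ) y) ≡ false
   J-a-down = J-pred-a σ (st (l (a σ) y)) (proj₁ d) (subst (Jq σ) (sym (proj₂ d)) j)
     where
     d = st-down (a σ) y (proj₁ j)

   J-s-down : lb (c σ) (l s y) ≡ false
   J-s-down = J-pred-s σ (st (l s y)) (proj₁ d) (subst (Jq σ) (sym (proj₂ d)) j)
     where
     d = st-down s y (proj₂ j)

   J1-a-down : lb s (l (a σ) (lev σ l1 y)) ≡ false
   J1-a-down = J1-pred σ (st y) (st (l (a σ) (lev σ l1 y))) j (proj₁ d) (trans (proj₂ d) st1)
     where
     d = st-down (a σ) (lev σ l1 y) J1-a

 private
   pred-table : ∀ g q q₁ → bit g q ≡ false → δ g q ≡ q₁ → (g ≡ t → q₁ ≡ q22 → q ≡ q15) × (g ≡ r → q₁ ≡ q21 → q ≡ q18) × (g ≡ s → q₁ ≡ q24 → q ≡ q22) × (g ≡ s → q₁ ≡ q23 → q ≡ q21) × (g ≡ r → q₁ ≡ q25 → q ≡ q24) × (g ≡ t → q₁ ≡ q26 → q ≡ q23)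
   pred-table g q q₁ b refl = (λ { refl e → pt q b e }) , (λ { refl e → pr q b e }) , (λ { refl e → ps q b e }) , (λ { refl e → ps′ q b e }) , (λ { refl e → pr′ q b e }) , (λ { refl e → pt′ q b e })
     where
     opaque
       pt : ∀ q → bit t q ≡ false → δ t q ≡ q22 → q ≡ q15
       pt = toWitness {a? = Q∀ λ q → (bit t q is false) →-dec ((δ t q ≟Q q22) →-dec (q ≟Q q15))} _
     opaque
       pt′ : ∀ q → bit t q ≡ false → δ t q ≡ q26 → q ≡ q23
       pt′ = toWitness {a? = Q∀ λ q → (bit t q is false) →-dec ((δ t q ≟Q q26) →-dec (q ≟Q q23))} _
     opaque
       pr : ∀ q → bit r q ≡ false → δ r q ≡ q21 → q ≡ q18
       pr = toWitness {a? = Q∀ λ q → (bit r q is false) →-dec ((δ r q ≟Q q21) →-dec (q ≟Q q18))} _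
     opaque
       pr′ : ∀ q → bit r q ≡ false → δ r q ≡ q25 → q ≡ q24
       pr′ = toWitness {a? = Q∀ λ q → (bit r q is false) →-dec ((δ r q ≟Q q25) →-dec (q ≟Q q24))} _
     opaque
       ps : ∀ q → bit s q ≡ false → δ s q ≡ q24 → q ≡ q22
       ps = toWitness {a? = Q∀ λ q → (bit s q is false) →-dec ((δ s q ≟Q q24) →-dec (q ≟Q q22))} _
     opaque
       ps′ : ∀ q → bit s q ≡ false → δ s q ≡ q23 → q ≡ q21
       ps′ = toWitness {a? = Q∀ λ q → (bit s q is false) →-dec ((δ s q ≟Q q23) →-dec (q ≟Q q21))} _

   jq : Side → Lv → Q
   jq RS l0 = q15
   jq RS l1 = q22
   jq RS l2 = q24
   jq RS l3 = q25
   jq ST l0 = q18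
   jq ST l1 = q21
   jq ST l2 = q23
   jq ST l3 = q26

   step-down : ∀ g q₁ q₂ x → bit g q₁ ≡ true → (∀ q → bit g q ≡ false → δ g q ≡ q₁ → q ≡ q₂) → st x ≡ q₁ → st (l g x) ≡ q₂
   step-down g q₁ q₂ x b h e with st-down g x (trans (cong (bit g) e) b)
   ... | b′ , d = h _ b′ (trans d e)

   c0-cases : ∀ q → av q ≡ 4 → Σ Side λ σ → Σ Lv λ i → q ≡ jq σ i
   c0-cases q15 _ = RS , l0 , refl
   c0-cases q18 _ = ST , l0 , refl
   c0-cases q21 _ = ST , l1 , refl
   c0-cases q22 _ = RS , l1 , refl
   c0-cases q23 _ = ST , l2 , refl
   c0-cases q24 _ = RS , l2 , refl
   c0-cases q25 _ = RS , l3 , refl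
   c0-cases q26 _ = ST , l3 , refl

   J-jq : ∀ σ x → st x ≡ jq σ l0 → J σ x
   J-jq RS x e = trans (cong (bit r) e) refl , trans (cong (bit s) e) refl
   J-jq ST x e = trans (cong (bit t) e) refl , trans (cong (bit s) e) refl

   d1 : ∀ σ x → st x ≡ jq σ l1 → st (l (c σ) x) ≡ jq σ l0
   d1 RS x = step-down t q22 q15 x refl (λ q b e → proj₁ (pred-table t q _ b e) refl refl)
   d1 ST x = step-down r q21 q18 x refl (λ q b e → proj₁ (proj₂ (pred-table r q _ b e)) refl refl)
   d2 : ∀ σ x → st x ≡ jq σ l2 → st (l s x) ≡ jq σ l1
   d2 RS x = step-down s q24 q22 x refl (λ q b e → proj₁ (proj₂ (proj₂ (pred-table s q _ b e))) refl refl)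
   d2 ST x = step-down s q23 q21 x refl (λ q b e → proj₁ (proj₂ (proj₂ (proj₂ (pred-table s q _ b e)))) refl refl)
   d3 : ∀ σ x → st x ≡ jq σ l3 → st (l (a σ) x) ≡ jq σ l2
   d3 RS x = step-down r q25 q24 x refl (λ q b e → proj₁ (proj₂ (proj₂ (proj₂ (proj₂ (pred-table r q _ b e))))) refl refl)
   d3 ST x = step-down t q26 q23 x refl (λ q b e → proj₂ (proj₂ (proj₂ (proj₂ (proj₂ (pred-table t q _ b e))))) refl refl)

 record Dec4 (z : W) : Set where
   constructor dec4
   field
     σ : Side
     i : Lv
     y : W
     j : J σ y
     eq : z ≡ lev σ i y

 -- The eight states of value 4 are the `jq σ i`. For the letter stripped at each level above `l0`
 -- the source state is unique, and it is the state of the level below.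
 decompose4 : ∀ z → aW z ≡ 4 → Dec4 z
 decompose4 z e with c0-cases (st z) e
 ... | σ , l0 , q = dec4 σ l0 z (J-jq σ z q) refl
 ... | σ , l1 , q = dec4 σ l1 (l (c σ) z) (J-jq σ _ (d1 σ z q)) (sym (l-invol (c σ) z))
 ... | σ , l2 , q = dec4 σ l2 (l (c σ) (l s z)) (J-jq σ _ (d1 σ _ (d2 σ z q))) (sym (trans (cong (l s) (l-invol (c σ) _)) (l-invol s z)))
 ... | σ , l3 , q = dec4 σ l3 (l (c σ) (l s (l (a σ) z))) (J-jq σ _ (d1 σ _ (d2 σ _ (d3 σ z q))))
         (sym (trans (cong (l (a σ) ∘ l s) (l-invol (c σ) _)) (trans (cong (l (a σ)) (l-invol s _)) (l-invol (a σ) z))))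

 -- The condition on `aW` separates these elements from those of the lowest cell at level `l1`,
 -- whose descent set is also {r,t}.
 K2 : W → Set
 K2 y = lb r y ≡ true × lb t y ≡ true × aW y ≡ 2

 Kq : Q → Set
 Kq q = bit r q ≡ true × bit t q ≡ true × av q ≡ 2

 Kq? : ∀ q → Dec (Kq q)
 Kq? q = (bit r q is true) ×-dec ((bit t q is true) ×-dec (av q ℕ.≟ 2))

 data Lv2 : Set where
   n0 ns : Lv2
   na : Side → Lv2

 lev2 : Lv2 → W → W
 lev2 n0 y = y
 lev2 ns y = l s y
 lev2 (na σ) y = l (a σ) (l s y)

 private
   opaque
     K-fact : ∀ σ q → Kq q → Bits σ q true false true × Bits σ (δ s q) false true false × Bits σ (δ (a σ) (δ s q)) true false false × bit (a σ) (δ s (δ (a σ) (δ s q))) ≡ true ×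
       av (δ s q) ≡ 2 × av (δ (a σ) (δ s q)) ≡ 2
     K-fact = toWitness {a? = Side∀ λ σ → Q∀ λ q → Kq? q →-dec (Bits? σ q true false true ×-dec (Bits? σ (δ s q) false true false ×-dec (Bits? σ (δ (a σ) (δ s q)) true false false ×-dec
       ((bit (a σ) (δ s (δ (a σ) (δ s q))) is true) ×-dec ((av (δ s q) ℕ.≟ 2) ×-dec (av (δ (a σ) (δ s q)) ℕ.≟ 2))))))} _

   opaque
     K-pred : ∀ σ q → bit (a σ) q ≡ false → Kq (δ (a σ) q) → bit s q ≡ false
     K-pred = toWitness {a? = Side∀ λ σ → Q∀ λ q → (bit (a σ) q is false) →-dec (Kq? (δ (a σ) q) →-dec (bit s q is false))} _

 module _ (σ : Side) {y : W} (k : K2 y) where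
   private
     F = K-fact σ (st y) k

   K-a : lb (a σ) y ≡ true
   K-a = proj₁ (proj₁ F)
   K-s : lb s y ≡ false
   K-s = proj₁ (proj₂ (proj₁ F))

   stK1 : st (l s y) ≡ δ s (st y)
   stK1 = st-up s y K-s

   K1-a : lb (a σ) (l s y) ≡ false
   K1-a = trans (cong (bit (a σ)) stK1) (proj₁ (proj₁ (proj₂ F)))
   K1-s : lb s (l s y) ≡ true
   K1-s = trans (cong (bit s) stK1) (proj₁ (proj₂ (proj₁ (proj₂ F))))

   stK2 : st (l (a σ) (l s y)) ≡ δ (a σ) (δ s (st y))
   stK2 = trans (st-up (a σ) (l s y) K1-a) (cong (δ (a σ)) stK1)

   K2-a : lb (a σ) (l (a σ) (l s y)) ≡ true
   K2-a = trans (cong (bit (a σ)) stK2) (proj₁ (proj₁ (proj₂ (proj₂ F))))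
   K2-s : lb s (l (a σ) (l s y)) ≡ false
   K2-s = trans (cong (bit s) stK2) (proj₁ (proj₂ (proj₁ (proj₂ (proj₂ F)))))
   K2-c : lb (c σ) (l (a σ) (l s y)) ≡ false
   K2-c = trans (cong (bit (c σ)) stK2) (proj₂ (proj₂ (proj₁ (proj₂ (proj₂ F)))))
   K-sas : lb (a σ) (l s (l (a σ) (l s y))) ≡ true
   K-sas = trans (cong (bit (a σ)) (trans (st-up s _ K2-s) (cong (δ s) stK2))) (proj₁ (proj₂ (proj₂ (proj₂ F))))

   K-a-down : lb s (l (a σ) y) ≡ false
   K-a-down = K-pred σ (st (l (a σ) y)) (proj₁ d) (subst Kq (sym (proj₂ d)) k)
     where
     d = st-down (a σ) y K-a

   aW-K1 : aW (l s y) ≡ 2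
   aW-K1 = trans (cong av stK1) (proj₁ (proj₂ (proj₂ (proj₂ (proj₂ F)))))
   aW-K2 : aW (l (a σ) (l s y)) ≡ 2
   aW-K2 = trans (cong av stK2) (proj₂ (proj₂ (proj₂ (proj₂ (proj₂ F)))))

 aW-lev2 : ∀ i {y} → K2 y → aW (lev2 i y) ≡ 2
 aW-lev2 n0 k = proj₂ (proj₂ k)
 aW-lev2 ns k = aW-K1 RS k
 aW-lev2 (na σ) k = aW-K2 σ k

 record Dec2 (z : W) : Set where
   constructor dec2
   field
     i : Lv2
     y : W
     k : K2 y
     eq : z ≡ lev2 i y

 private

   opaque
     s12 : ∀ q → bit s q ≡ false → δ s q ≡ q12 → Kq q
     s12 = toWitness {a? = Q∀ λ q → (bit s q is false) →-dec ((δ s q ≟Q q12) →-dec Kq? q)} _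
   opaque
     r16 : ∀ q → bit r q ≡ false → δ r q ≡ q16 → q ≡ q12
     r16 = toWitness {a? = Q∀ λ q → (bit r q is false) →-dec ((δ r q ≟Q q16) →-dec (q ≟Q q12))} _
   opaque
     t20 : ∀ q → bit t q ≡ false → δ t q ≡ q20 → q ≡ q12
     t20 = toWitness {a? = Q∀ λ q → (bit t q is false) →-dec ((δ t q ≟Q q20) →-dec (q ≟Q q12))} _

   ds : ∀ x → st x ≡ q12 → K2 (l s x)
   ds x e with st-down s x (trans (cong (bit s) e) refl)
   ... | b , d = s12 _ b (trans d e)

 decompose2 : ∀ z → aW z ≡ 2 → Dec2 z
 decompose2 z e with st z in q
 ... | q5 = dec2 n0 z (trans (cong (bit r) q) refl , trans (cong (bit t) q) refl , trans (cong av q) refl) refl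
 ... | q10 = dec2 n0 z (trans (cong (bit r) q) refl , trans (cong (bit t) q) refl , trans (cong av q) refl) refl
 ... | q12 = dec2 ns (l s z) (ds z q) (sym (l-invol s z))
 ... | q16 = dec2 (na RS) (l s (l r z)) (ds (l r z) (step-down r q16 q12 z refl r16 q)) (sym (trans (cong (l r) (l-invol s _)) (l-invol r z)))
 ... | q20 = dec2 (na ST) (l s (l t z)) (ds (l t z) (step-down t q20 q12 z refl t20 q)) (sym (trans (cong (l t) (l-invol s _)) (l-invol t z)))

 aW-cases : ∀ z → aW z ≡ 4 ⊎ aW z ≡ 2 ⊎ aW z ≡ 1 ⊎ aW z ≡ 0
 aW-cases z = h (st z)
   where
   opaque
     h : ∀ q → av q ≡ 4 ⊎ av q ≡ 2 ⊎ av q ≡ 1 ⊎ av q ≡ 0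
     h = toWitness {a? = Q∀ λ q → (av q ℕ.≟ 4) ⊎-dec ((av q ℕ.≟ 2) ⊎-dec ((av q ℕ.≟ 1) ⊎-dec (av q ℕ.≟ 0)))} _

 -- Decides reducedness by running the automaton, since W itself is opaque. For an explicit word it
 -- evaluates to `true`, and `st-ev` then supplies all its left descents and its value of a.
 redW : Word → Bool
 stW : Word → Q
 stW = foldr δ q0
 redW [] = true
 redW (g ∷ w) = if redW w then not (bit g (stW w)) else false

 st-ev : ∀ w → redW w ≡ true → st (ev w) ≡ stW w
 st-ev [] _ = trans (cong st ev-[]) st-1
 st-ev (g ∷ w) h with redW w in b
 st-ev (g ∷ w) h | true with bit g (stW w) in b′
 ... | false = trans (cong st (ev-∷ g w)) (trans (st-up g (ev w) (trans (cong (bit g) (st-ev w b)) b′)) (cong (δ g) (st-ev w b)))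

 redW-Red : ∀ w → redW w ≡ true → Red w
 redW-Red [] _ = sym (trans (cong ℓ ev-[]) ℓ-1)
 redW-Red (g ∷ w) h with redW w in b
 redW-Red (g ∷ w) h | true with bit g (stW w) in b′
 ... | false = Red-cons g w (redW-Red w b) (trans (cong (bit g) (st-ev w b)) b′)

 opaque
   av-up : ∀ g q → bit g q ≡ false → (av q ≡ 4 → av (δ g q) ≡ 4) × (2 ≤ av q → 2 ≤ av (δ g q))
   av-up = toWitness {a? = Gen∀ λ g → Q∀ λ q → (bit g q is false) →-dec (((av q ℕ.≟ 4) →-dec (av (δ g q) ℕ.≟ 4)) ×-dec ((2 ℕ.≤? av q) →-dec (2 ℕ.≤? av (δ g q))))} _

 aW-up : ∀ g x → lb g x ≡ false → (aW x ≡ 4 → aW (l g x) ≡ 4) × (2 ≤ aW x → 2 ≤ aW (l g x))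
 aW-up g x b rewrite st-up g x b = av-up g (st x) b

 Red-suffix : ∀ b w → Red (b ++ w) → Red w
 Red-suffix [] w h = h
 Red-suffix (g ∷ b) w h = Red-suffix b w (proj₁ (Red-tail g (b ++ w) h))

 aW-prefix : ∀ b w → Red (b ++ w) → (aW (ev w) ≡ 4 → aW (ev (b ++ w)) ≡ 4) × (2 ≤ aW (ev w) → 2 ≤ aW (ev (b ++ w)))
 aW-prefix [] w h = (λ x → x) , (λ x → x)
 aW-prefix (g ∷ b) w h with Red-tail g (b ++ w) h
 ... | h′ , bt rewrite ev-∷ g (b ++ w) = proj₁ (aW-up g _ bt) ∘ proj₁ (aW-prefix b w h′) , proj₂ (aW-up g _ bt) ∘ proj₂ (aW-prefix b w h′)

 wJ : Side → Word
 wJ σ = s ∷ a σ ∷ s ∷ a σ ∷ []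

 private
   opaque
     J-d1 : ∀ σ q → bit s q ≡ false → Jq σ (δ s q) → bit (a σ) q ≡ true
     J-d1 = toWitness {a? = Side∀ λ σ → Q∀ λ q → (bit s q is false) →-dec (Jq? σ (δ s q) →-dec (bit (a σ) q is true))} _
   opaque
     J-d2 : ∀ σ q → bit (a σ) q ≡ false → bit s (δ (a σ) q) ≡ false → Jq σ (δ s (δ (a σ) q)) → bit s q ≡ true
     J-d2 = toWitness {a? = Side∀ λ σ → Q∀ λ q → (bit (a σ) q is false) →-dec ((bit s (δ (a σ) q) is false) →-dec (Jq? σ (δ s (δ (a σ) q)) →-dec (bit s q is true)))} _
   opaque
     J-d3 : ∀ σ q → bit s q ≡ false → bit (a σ) (δ s q) ≡ false → bit s (δ (a σ) (δ s q)) ≡ false → Jq σ (δ s (δ (a σ) (δ s q))) → bit (a σ) q ≡ true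
     J-d3 = toWitness {a? = Side∀ λ σ → Q∀ λ q → (bit s q is false) →-dec ((bit (a σ) (δ s q) is false) →-dec ((bit s (δ (a σ) (δ s q)) is false) →-dec (Jq? σ (δ s (δ (a σ) (δ s q))) →-dec (bit (a σ) q is true))))} _
   opaque
     J-d4 : ∀ σ q → bit (a σ) q ≡ false → bit s (δ (a σ) q) ≡ false → bit (a σ) (δ s (δ (a σ) q)) ≡ false → bit s (δ (a σ) (δ s (δ (a σ) q))) ≡ false → Jq σ (δ s (δ (a σ) (δ s (δ (a σ) q)))) → bit s q ≡ false
     J-d4 = toWitness {a? = Side∀ λ σ → Q∀ λ q → (bit (a σ) q is false) →-dec ((bit s (δ (a σ) q) is false) →-dec ((bit (a σ) (δ s (δ (a σ) q)) is false) →-dec ((bit s (δ (a σ) (δ s (δ (a σ) q))) is false) →-dec (Jq? σ (δ s (δ (a σ) (δ s (δ (a σ) q)))) →-dec (bit s q is false)))))} _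

 -- y = w_J · x with x minimal in its coset
 record Long (σ : Side) (y : W) : Set where
   field
     x : W
     xa : lb (a σ) x ≡ false
     xs : lb s x ≡ false
     u₁ : lb s (l (a σ) x) ≡ false
     u₂ : lb (a σ) (l s (l (a σ) x)) ≡ false
     u₃ : lb s (l (a σ) (l s (l (a σ) x))) ≡ false
     eq : y ≡ l s (l (a σ) (l s (l (a σ) x)))

 -- Strips s, a, s, a one at a time. A state below a given one is known only through the transitions
 -- leading up from it, so each of the tables `J-d1` to `J-d4` refers to the whole chain back to y.
 long : ∀ σ y → J σ y → Long σ y
 long σ y (ja , js) = record { x = x4 ; xa = f4 ; xs = b5 ; u₁ = f3′ ; u₂ = f2′ ; u₃ = f1′ ; eq = sym (trans (cong (l s ∘ l (a σ) ∘ l s) (l-invol (a σ) x3)) (trans (cong (l s ∘ l (a σ)) (l-invol s x2)) (trans (cong (l s) (l-invol (a σ) x1)) (l-invol s y)))) }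
   where
   x1 = l s y
   x2 = l (a σ) x1
   x3 = l s x2
   x4 = l (a σ) x3
   f1 : lb s x1 ≡ false
   f1 = proj₁ (st-down s y js)
   e1 : δ s (st x1) ≡ st y
   e1 = proj₂ (st-down s y js)
   b1 : lb (a σ) x1 ≡ true
   b1 = J-d1 σ (st x1) f1 (subst (Jq σ) (sym e1) (ja , js))
   f2 : lb (a σ) x2 ≡ false
   f2 = proj₁ (st-down (a σ) x1 b1)
   e2 : δ (a σ) (st x2) ≡ st x1
   e2 = proj₂ (st-down (a σ) x1 b1)
   b2 : lb s x2 ≡ true
   b2 = J-d2 σ (st x2) f2 (trans (cong (bit s) e2) f1) (subst (Jq σ) (sym (trans (cong (δ s) e2) e1)) (ja , js))
   f3 : lb s x3 ≡ false
   f3 = proj₁ (st-down s x2 b2)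
   e3 : δ s (st x3) ≡ st x2
   e3 = proj₂ (st-down s x2 b2)
   b3 : lb (a σ) x3 ≡ true
   b3 = J-d3 σ (st x3) f3 (trans (cong (bit (a σ)) e3) f2) (trans (cong (bit s) (trans (cong (δ (a σ)) e3) e2)) f1) (subst (Jq σ) (sym (trans (cong (δ s) (trans (cong (δ (a σ)) e3) e2)) e1)) (ja , js))
   f4 : lb (a σ) x4 ≡ false
   f4 = proj₁ (st-down (a σ) x3 b3)
   e4 : δ (a σ) (st x4) ≡ st x3
   e4 = proj₂ (st-down (a σ) x3 b3)
   e43 : δ s (δ (a σ) (st x4)) ≡ st x2
   e43 = trans (cong (δ s) e4) e3
   e432 : δ (a σ) (δ s (δ (a σ) (st x4))) ≡ st x1
   e432 = trans (cong (δ (a σ)) e43) e2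
   b5 : lb s x4 ≡ false
   b5 = J-d4 σ (st x4) f4 (trans (cong (bit s) e4) f3) (trans (cong (bit (a σ)) e43) f2) (trans (cong (bit s) e432) f1) (subst (Jq σ) (sym (trans (cong (δ s) e432) e1)) (ja , js))
   f3′ : lb s (l (a σ) x4) ≡ false
   f3′ = trans (cong (lb s) (l-invol (a σ) x3)) f3
   f2′ : lb (a σ) (l s (l (a σ) x4)) ≡ false
   f2′ = trans (cong (lb (a σ) ∘ l s) (l-invol (a σ) x3)) (trans (cong (lb (a σ)) (l-invol s x2)) f2)
   f1′ : lb s (l (a σ) (l s (l (a σ) x4))) ≡ false
   f1′ = trans (cong (lb s ∘ l (a σ) ∘ l s) (l-invol (a σ) x3)) (trans (cong (lb s ∘ l (a σ)) (l-invol s x2)) (trans (cong (lb s) (l-invol (a σ) x1)) f1))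

 cons-word : ∀ g {w z} → Red w × ev w ≡ z → lb g z ≡ false → Red (g ∷ w) × ev (g ∷ w) ≡ l g z
 cons-word g {w} (h , refl) b = Red-cons g w h b , ev-∷ g w

 long-word : ∀ σ y → J σ y → ∃ λ b → Red (wJ σ ++ b) × ev (wJ σ ++ b) ≡ y
 long-word σ y j = word x , proj₁ all , trans (proj₂ all) (sym eq)
   where
   open Long (long σ y j)
   all = cons-word s (cons-word (a σ) (cons-word s (cons-word (a σ) (Red-word x , ev-word x) xa) u₁) u₂) u₃

 pre : Side → Lv → Word
 pre σ l0 = []
 pre σ l1 = c σ ∷ []
 pre σ l2 = s ∷ c σ ∷ []
 pre σ l3 = a σ ∷ s ∷ c σ ∷ []

 pre-word : ∀ σ i y w → J σ y → Red w → ev w ≡ y → Red (pre σ i ++ w) × ev (pre σ i ++ w) ≡ lev σ i y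
 pre-word σ l0 y w j h eq = h , eq
 pre-word σ l1 y w j h eq = cons-word (c σ) (h , eq) (J-c j)
 pre-word σ l2 y w j h eq = cons-word s (cons-word (c σ) (h , eq) (J-c j)) (J1-s j)
 pre-word σ l3 y w j h eq = cons-word (a σ) (cons-word s (cons-word (c σ) (h , eq) (J-c j)) (J1-s j)) (J2-a j)

 private
   core4 : Side → Lv → Word
   core4 σ i = reverse (wJ σ) ++ reverse (pre σ i)

   core4-a : ∀ σ i → aW (ev (core4 σ i)) ≡ 4
   core4-a RS l0 = cong av (st-ev (core4 RS l0) refl)
   core4-a RS l1 = cong av (st-ev (core4 RS l1) refl)
   core4-a RS l2 = cong av (st-ev (core4 RS l2) refl)
   core4-a RS l3 = cong av (st-ev (core4 RS l3) refl)
   core4-a ST l0 = cong av (st-ev (core4 ST l0) refl)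
   core4-a ST l1 = cong av (st-ev (core4 ST l1) refl)
   core4-a ST l2 = cong av (st-ev (core4 ST l2) refl)
   core4-a ST l3 = cong av (st-ev (core4 ST l3) refl)

   rev3 : ∀ (x y z : Word) → reverse (x ++ y ++ z) ≡ reverse z ++ (reverse y ++ reverse x)
   rev3 x y z = trans (List.reverse-++ x (y ++ z)) (trans (cong (_++ reverse x) (List.reverse-++ y z)) (List.++-assoc (reverse z) (reverse y) (reverse x)))

 -- The automaton sees one side of an element only, so behaviour under inversion is invisible in its
 -- tables. A reduced word of z has the form p w_J b; its reverse ends in one of eight explicit
 -- words of value 4, and by `aW-up` further letters on the left preserve this value.
 aW4-inv : ∀ z → aW z ≡ 4 → aW (inv z) ≡ 4
 aW4-inv z e with decompose4 z e
 ... | dec4 σ i y j eq with long-word σ y j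
 ...   | b , h , q with pre-word σ i y (wJ σ ++ b) j h q
 ...     | h′ , q′ = subst (λ x → aW x ≡ 4) (trans (cong ev (sym (rev3 (pre σ i) (wJ σ) b))) (trans (ev-reverse w) (cong inv (trans q′ (sym eq)))))
             (proj₁ (aW-prefix (reverse b) (core4 σ i) (subst Red (rev3 (pre σ i) (wJ σ) b) (Red-reverse w h′))) (core4-a σ i))
   where
   w : Word
   w = pre σ i ++ wJ σ ++ b

 pre2 : Lv2 → Word
 pre2 n0 = []
 pre2 ns = s ∷ []
 pre2 (na σ) = a σ ∷ s ∷ []

 private
   K-rt : ∀ y → K2 y → lb t (l r y) ≡ true
   K-rt y k = h (st (l r y)) (proj₁ d) (subst Kq (sym (proj₂ d)) k)
     where
     d = st-down r y (proj₁ k)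
     opaque
       h : ∀ q → bit r q ≡ false → Kq (δ r q) → bit t q ≡ true
       h = toWitness {a? = Q∀ λ q → (bit r q is false) →-dec (Kq? (δ r q) →-dec (bit t q is true))} _

 K-word : ∀ y → K2 y → ∃ λ b → Red (r ∷ t ∷ b) × ev (r ∷ t ∷ b) ≡ y
 K-word y k = word x , Red-cons r (t ∷ word x) ht (trans (cong (lb r) et) (proj₁ (st-down r y (proj₁ k)))) ,
   trans (ev-∷ r _) (trans (cong (l r) et) (l-invol r y))
   where
   x = l t (l r y)
   et : ev (t ∷ word x) ≡ l r y
   et = trans (ev-∷ t (word x)) (trans (cong (l t) (ev-word x)) (l-invol t (l r y)))
   ht : Red (t ∷ word x)
   ht = Red-cons t (word x) (Red-word x) (trans (cong (lb t) (ev-word x)) (proj₁ (st-down t (l r y) (K-rt y k))))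

 pre2-word : ∀ i y w → K2 y → Red w → ev w ≡ y → Red (pre2 i ++ w) × ev (pre2 i ++ w) ≡ lev2 i y
 pre2-word n0 y w k h eq = h , eq
 pre2-word ns y w k h eq = cons-word s (h , eq) (K-s RS k)
 pre2-word (na σ) y w k h eq = cons-word (a σ) (cons-word s (h , eq) (K-s RS k)) (K1-a σ k)

 private
   core2 : Lv2 → Word
   core2 i = (t ∷ r ∷ []) ++ reverse (pre2 i)

   core2-a : ∀ i → 2 ≤ aW (ev (core2 i))
   core2-a n0 = ≤-reflexive (sym (cong av (st-ev (core2 n0) refl)))
   core2-a ns = ≤-reflexive (sym (cong av (st-ev (core2 ns) refl)))
   core2-a (na RS) = ≤-reflexive (sym (cong av (st-ev (core2 (na RS)) refl)))
   core2-a (na ST) = ≤-reflexive (sym (cong av (st-ev (core2 (na ST)) refl)))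

 aW2-inv : ∀ z → aW z ≡ 2 → 2 ≤ aW (inv z)
 aW2-inv z e with decompose2 z e
 ... | dec2 i y k eq with K-word y k
 ...   | b , h , q with pre2-word i y (r ∷ t ∷ b) k h q
 ...     | h′ , q′ = subst (λ x → 2 ≤ aW x) (trans (cong ev (sym (rev3 (pre2 i) (r ∷ t ∷ []) b))) (trans (ev-reverse w) (cong inv (trans q′ (sym eq)))))
             (proj₂ (aW-prefix (reverse b) (core2 i) (subst Red (rev3 (pre2 i) (r ∷ t ∷ []) b) (Red-reverse w h′))) (core2-a i))
   where
   w : Word
   w = pre2 i ++ r ∷ t ∷ b

 aW0 : ∀ z → aW z ≡ 0 → z ≡ 1W
 aW0 z e = h (st z) e refl
   where
   opaque
     tr : ∀ q → av q ≡ 0 → bit r q ≡ false × bit s q ≡ false × bit t q ≡ false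
     tr = toWitness {a? = Q∀ λ q → (av q ℕ.≟ 0) →-dec ((bit r q is false) ×-dec ((bit s q is false) ×-dec (bit t q is false)))} _
   h : ∀ q → av q ≡ 0 → st z ≡ q → z ≡ 1W
   h q e refl with word z | ev-word z | Red-word z
   ... | [] | eq | _ = trans (sym eq) ev-[]
   ... | g ∷ w | eq | h with Red-tail g w h
   ...   | _ , b = ⊥-elim (bool-clash (trans (cong (lb g) (sym (trans (sym (ev-∷ g w)) eq))) (trans (lb-flip g (ev w)) (cong not b))) (none g))
     where
     none : ∀ g → bit g (st z) ≡ false
     none r = proj₁ (tr (st z) e)
     none s = proj₁ (proj₂ (tr (st z) e))
     none t = proj₂ (proj₂ (tr (st z) e))

 aW-inv : ∀ z → aW (inv z) ≡ aW z
 aW-inv z with aW-cases z | aW-cases (inv z)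
 ... | inj₁ p | _ = trans (aW4-inv z p) (sym p)
 ... | inj₂ p | inj₁ q = trans q (sym (subst (λ x → aW x ≡ 4) (inv-invol z) (aW4-inv (inv z) q)))
 ... | inj₂ (inj₁ p) | inj₂ (inj₁ q) = trans q (sym p)
 ... | inj₂ (inj₁ p) | inj₂ (inj₂ (inj₁ q)) = ⊥-elim (<⇒≱ (s≤s (s≤s z≤n)) (subst (2 ≤_) q (aW2-inv z p)))
 ... | inj₂ (inj₁ p) | inj₂ (inj₂ (inj₂ q)) = ⊥-elim (<⇒≱ (s≤s z≤n) (subst (2 ≤_) q (aW2-inv z p)))
 ... | inj₂ (inj₂ p) | inj₂ (inj₁ q) = ⊥-elim (lem p (subst (λ x → 2 ≤ aW x) (inv-invol z) (aW2-inv (inv z) q)))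
   where
   lem : aW z ≡ 1 ⊎ aW z ≡ 0 → 2 ≤ aW z → ⊥
   lem (inj₁ e) h = <⇒≱ (s≤s (s≤s z≤n)) (subst (2 ≤_) e h)
   lem (inj₂ e) h = <⇒≱ (s≤s z≤n) (subst (2 ≤_) e h)
 ... | inj₂ (inj₂ (inj₁ p)) | inj₂ (inj₂ (inj₁ q)) = trans q (sym p)
 ... | inj₂ (inj₂ (inj₂ p)) | inj₂ (inj₂ (inj₂ q)) = trans q (sym p)
 ... | inj₂ (inj₂ (inj₂ p)) | inj₂ (inj₂ (inj₁ q)) = cong aW (trans (cong inv (aW0 z p)) (trans inv-1 (sym (aW0 z p))))
 ... | inj₂ (inj₂ (inj₁ p)) | inj₂ (inj₂ (inj₂ q)) = cong aW (trans e (sym (trans (sym (inv-invol z)) (trans (cong inv e) inv-1))))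
   where
   e : inv z ≡ 1W
   e = aW0 (inv z) q

module KLBasis (P : KLFun) (isKL : IsKL P) where

 -- The Kazhdan-Lusztig basis in normalised coordinates and its multiplication by C_g.

 module KLPolynomials where
  open Defs renaming (same to LR-same; left to LR-left; right to LR-right; trans to LR-trans; δ to degδ)
  open Coxeter
  open FormalSums
  open Hecke
  open ReducedWords

  -- passage from the basis T_w to T̃_w = v^{-ℓ(w)} T_w
  N : H → List Tm
  N [] = []
  N ((w , e , c) ∷ h) = (ev w , e + + ℓ (ev w) , c) ∷ N h

  N-++ : ∀ h h′ → N (h ++ h′) ≡ N h ++ N h′
  N-++ [] h′ = refl
  N-++ (_ ∷ h) h′ = cong (_ ∷_) (N-++ h h′)

  +-shift-inj : ∀ a b n → a + n ≡ b + n → a ≡ b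
  +-shift-inj a b n p = trans (sym (i a n)) (trans (cong (_+ - n) p) (i b n))
    where
    i : ∀ a n → a + n + - n ≡ a
    i = solve-∀

  coefH-term : ∀ u e w e′ c → (if eqW w u ∧ eqℤ e′ e then c else + 0) ≡ c * kr (ev u) (e + + ℓ (ev u)) (ev w) (e′ + + ℓ (ev w))
  coefH-term u e w e′ c with w ≈? u | e′ ℤ.≟ e
  ... | no ne | _ = sym (trans (cong (_*_ c) (kr-no₁ _ _ (ne ∘ ≡⇒≈ w u))) (*-zeroʳ c))
  ... | yes eq | yes refl rewrite ≈⇒≡ w u eq = sym (trans (cong (_*_ c) (kr-yes _ _)) (*-identityʳ c))
  ... | yes eq | no ne rewrite ≈⇒≡ w u eq = sym (trans (cong (_*_ c) (kr-no₂ (ev u) (ev u) (ne ∘ +-shift-inj e′ e _))) (*-zeroʳ c))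

  coefH-val : ∀ h u e → coefH h u e ≡ val (N h) (ev u) (e + + ℓ (ev u))
  coefH-val [] u e = refl
  coefH-val ((w , e′ , c) ∷ h) u e = cong₂ _+_ (coefH-term u e w e′ c) (coefH-val h u e)

  val-coefH : ∀ h u e → val (N h) u e ≡ coefH h (word u) (e - + ℓ u)
  val-coefH h u e = sym (trans (coefH-val h (word u) _) (trans (cong (λ x → val (N h) x (e - + ℓ u + + ℓ x)) (ev-word u)) (cong (val (N h) u) (i e (+ ℓ u)))))
    where
    i : ∀ e n → e - n + n ≡ e
    i = solve-∀

  <ᵇ-up : ∀ a b → b ≡ suc a → (a ℕ.<ᵇ b) ≡ true
  <ᵇ-up zero _ refl = refl
  <ᵇ-up (suc a) _ refl = <ᵇ-up a _ refl

  <ᵇ-down : ∀ a b → a ≡ suc b → (a ℕ.<ᵇ b) ≡ false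
  <ᵇ-down _ zero refl = refl
  <ᵇ-down _ (suc b) refl = <ᵇ-down _ b refl

  len<ᵇ : ∀ g w → (len w ℕ.<ᵇ len (g ∷ w)) ≡ not (lb g (ev w))
  len<ᵇ g w with lb g (ev w) in b
  ... | true = <ᵇ-down _ _ (trans (len-ℓ w) (trans (ℓ-down g (ev w) b) (cong suc (sym (trans (len-ℓ (g ∷ w)) (cong ℓ (ev-∷ g w)))))))
  ... | false = <ᵇ-up _ _ (trans (trans (len-ℓ (g ∷ w)) (cong ℓ (ev-∷ g w))) (trans (ℓ-up g (ev w) b) (cong suc (sym (len-ℓ w)))))

  tT : Gen → F → F
  tT g φ w k = φ (l g w) (ℤ.suc k) + (if lb g w then φ w (ℤ.suc (ℤ.suc k)) + - φ w k else + 0)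

  lin-tS : ∀ g φ w e c → lin φ (N (tS g (w , e , c))) ≡ c * tT g φ (ev w) (e + + ℓ (ev w))
  lin-tS g φ w e c with len w ℕ.<ᵇ len (g ∷ w) | len<ᵇ g w
  lin-tS g φ w e c | b | q with lb g (ev w) in lbw
  lin-tS g φ w e c | .false | refl | true = trans (cong₂ _+_ (cong (λ z → c * φ (ev w) z) (i₁ e (+ ℓ (ev w)))) (cong (_+_ (- c * φ (ev w) (e + + ℓ (ev w)))) (cong (_+ + 0) (cong (_*_ c) (cong₂ φ (ev-∷ g w) i₂)))))
      (i c (φ (ev w) (ℤ.suc (ℤ.suc (e + + ℓ (ev w))))) (φ (ev w) (e + + ℓ (ev w))) (φ (l g (ev w)) (ℤ.suc (e + + ℓ (ev w)))))
    where
    i₁ : ∀ e n → e + + 2 + n ≡ + 1 + (+ 1 + (e + n))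
    i₁ = solve-∀
    i₂′ : ∀ e n → e + + 2 + n ≡ + 1 + (e + (+ 1 + n))
    i₂′ = solve-∀
    i₂ : e + + 2 + + ℓ (ev (g ∷ w)) ≡ ℤ.suc (e + + ℓ (ev w))
    i₂ = trans (cong (λ x → e + + 2 + + ℓ x) (ev-∷ g w)) (trans (i₂′ e (+ ℓ (l g (ev w)))) (cong (λ n → + 1 + (e + + n)) (sym (ℓ-down g (ev w) lbw))))
    i : ∀ c a b d → c * a + (- c * b + (c * d + + 0)) ≡ c * (d + (a + - b))
    i = solve-∀
  lin-tS g φ w e c | .true | refl | false = trans (cong (_+ + 0) (cong (_*_ c) (cong₂ φ (ev-∷ g w) i₂))) (i c (φ (l g (ev w)) (ℤ.suc (e + + ℓ (ev w)))))
    where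
    i₂′ : ∀ e n → e + (+ 1 + n) ≡ + 1 + (e + n)
    i₂′ = solve-∀
    i₂ : e + + ℓ (ev (g ∷ w)) ≡ ℤ.suc (e + + ℓ (ev w))
    i₂ = trans (cong (λ x → e + + ℓ x) (ev-∷ g w)) (trans (cong (λ n → e + + n) (ℓ-up g (ev w) lbw)) (i₂′ e (+ ℓ (ev w))))
    i : ∀ c a → c * a + + 0 ≡ c * (a + + 0)
    i = solve-∀

  lin-tSH : ∀ g φ h → lin φ (N (tSH g h)) ≡ lin (tT g φ) (N h)
  lin-tSH g φ [] = refl
  lin-tSH g φ ((w , e , c) ∷ h) = trans (cong (lin φ) (N-++ (tS g (w , e , c)) (tSH g h))) (trans (lin-++ φ (N (tS g (w , e , c))) _)
    (cong₂ _+_ (lin-tS g φ w e c) (lin-tSH g φ h)))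

  tT-kr : ∀ g u e w k → tT g (kr u e) w k ≡ T g (kδ w k) u (ℤ.pred e)
  tT-kr g u e w k = sym (trans (cong₂ (λ x y → x + - y) (C-kδ g w k u (ℤ.pred e)) (cong (λ z → kr u z w k) (ℤ.suc-pred e)))
    (trans (cong (λ z → z + kr u (ℤ.pred e) w (sh (not (lb g w)) k) + - kr u e w k) (kr-pred u e (l g w) k))
    (trans (+-assoc (kr u e (l g w) (ℤ.suc k)) _ _) (cong (_+_ (kr u e (l g w) (ℤ.suc k))) (h (lb g w))))))
    where
    h : ∀ b → kr u (ℤ.pred e) w (sh (not b) k) + - kr u e w k ≡ (if b then kr u e w (ℤ.suc (ℤ.suc k)) + - kr u e w k else + 0)
    h true = cong (_+ - kr u e w k) (kr-pred u e w (ℤ.suc k))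
    h false = trans (cong (_+ - kr u e w k) (trans (kr-pred u e w (ℤ.pred k)) (cong (kr u e w) (ℤ.suc-pred k)))) (+-inverseʳ (kr u e w k))

  val-tSH : ∀ g h u e → val (N (tSH g h)) u e ≡ T g (val (N h)) u (ℤ.pred e)
  val-tSH g h u e = trans (lin-tSH g (kr u e) h) (trans (lin-cong (tT-kr g u e) (N h)) (sym (lin-T g kδ (N h) u (ℤ.pred e))))

  lin-scaleT : ∀ a c′ φ h → lin φ (N (map (scaleT a c′) h)) ≡ c′ * lin (λ w k → φ w (a + k)) (N h)
  lin-scaleT a c′ φ [] = sym (*-zeroʳ c′)
  lin-scaleT a c′ φ ((w , e , c) ∷ h) = trans (cong₂ (λ x y → c′ * c * φ (ev w) x + y) (+-assoc a e _) (lin-scaleT a c′ φ h))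
    (i c′ c (φ (ev w) (a + (e + + ℓ (ev w)))) _)
    where
    i : ∀ a c x y → a * c * x + a * y ≡ a * (c * x + y)
    i = solve-∀

  val-scaleT : ∀ a c h u e → val (N (map (scaleT a c) h)) u e ≡ c * val (N h) u (e + - a)
  val-scaleT a c h u e = trans (lin-scaleT a c (kr u e) h) (cong (_*_ c) (lin-cong (λ w k → kr-iff
    (λ p q → p , trans (i₁ a k) (cong (_+ - a) q)) (λ p q → p , trans (cong (_+_ a) q) (i₂ a e))) (N h)))
    where
    i₁ : ∀ a k → k ≡ a + k + - a
    i₁ = solve-∀
    i₂ : ∀ a e → a + (e + - a) ≡ e
    i₂ = solve-∀

  val-invS : ∀ g h u e → val (N (invS g h)) u e ≡ I g (val (N h)) u (ℤ.suc e)
  val-invS g h u e = trans (cong (λ z → lin (kr u e) z) (trans (N-++ (map (scaleT (- + 2) (+ 1)) (tSH g h)) _) (cong (N (map (scaleT (- + 2) (+ 1)) (tSH g h)) ++_) (N-++ (map (scaleT (- + 2) (+ 1)) h) _))))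
    (trans (lin-++ (kr u e) (N (map (scaleT (- + 2) (+ 1)) (tSH g h))) _) (trans (cong₂ _+_ e₁ (trans (lin-++ (kr u e) (N (map (scaleT (- + 2) (+ 1)) h)) _) (cong₂ _+_ e₂ e₃)))
    (i (C g f u (ℤ.suc e)) (f u (e + + 2)) (f u (ℤ.pred (ℤ.suc e))) _ (cong (f u) (j e)))))
    where
    f : F
    f = val (N h)
    j : ∀ e → + 1 + (+ 1 + e) ≡ e + + 2
    j = solve-∀
    j′ : ∀ e → -[1+ 0 ] + (e + + 2) ≡ + 1 + e
    j′ = solve-∀
    e₁ : val (N (map (scaleT (- + 2) (+ 1)) (tSH g h))) u e ≡ T g f u (ℤ.suc e)
    e₁ = trans (val-scaleT (- + 2) (+ 1) (tSH g h) u e) (trans (*-identityˡ _) (trans (val-tSH g h u (e + + 2)) (cong (T g f u) (j′ e))))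
    e₂ : val (N (map (scaleT (- + 2) (+ 1)) h)) u e ≡ f u (e + + 2)
    e₂ = trans (val-scaleT (- + 2) (+ 1) h u e) (*-identityˡ _)
    e₃ : val (N (map (scaleT (+ 0) (- + 1)) h)) u e ≡ - f u (ℤ.pred (ℤ.suc e))
    e₃ = trans (val-scaleT (+ 0) (- + 1) h u e) (trans (ℤ.-1*i≡-i _) (cong (λ z → - f u z) (trans (+-identityʳ e) (sym (ℤ.pred-suc e)))))
    i : ∀ a b c b′ → b′ ≡ b → a + - b′ + (b + - c) ≡ a + - c
    i a b c .b refl = i′ a b c
      where
      i′ : ∀ a b c → a + - b + (b + - c) ≡ a + - c
      i′ = solve-∀

  val-invS* : ∀ a e c u x → val (N (foldr invS (([] , - e , c) ∷ []) a)) u x ≡ c * B₀ a u (x + (e + + length a))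
  val-invS* [] e c u x = trans (+-identityʳ _) (cong (_*_ c) (trans (cong (λ z → kr u x z (- e + + ℓ z)) ev-[]) (kr-iff
    (λ p q → p , sym (trans (cong (_+ (e + + 0)) (sym q)) (trans (cong (λ n → - e + + n + (e + + 0)) ℓ-1) (i e))))
    (λ p q → p , trans (cong (λ n → - e + + n) ℓ-1) (trans (i₂ e x) (trans (cong (_+_ x) (trans (cong (_+_ (- (x + (e + + 0)))) q) (ℤ.+-inverseˡ (x + (e + + 0))))) (+-identityʳ x)))))))
    where
    i : ∀ e → - e + + 0 + (e + + 0) ≡ + 0
    i = solve-∀
    i₂ : ∀ e x → - e + + 0 ≡ x + (- (x + (e + + 0)) + + 0)
    i₂ = solve-∀
  val-invS* (g ∷ a) e c u x = trans (val-invS g (foldr invS (([] , - e , c) ∷ []) a) u x) (trans (I-cong g (val-invS* a e c) u (ℤ.suc x)) (trans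
    (cong₂ (λ y z → c * B₀ a (l g u) (ℤ.suc x + n) + c * B₀ a u y + - (c * B₀ a u z)) (sym (sh-+ (lb g u) (ℤ.suc x) n)) (sym (sh-+ true (ℤ.suc x) n)))
    (trans (i c (B₀ a (l g u) (ℤ.suc x + n)) _ _) (cong (λ z → c * I g (B₀ a) u z) (j x e (+ length a))))))
    where
    n : ℤ
    n = e + + length a
    i : ∀ c x y z → c * x + c * y + - (c * z) ≡ c * (x + y + - z)
    i = solve-∀
    j : ∀ x e n → + 1 + x + (e + n) ≡ x + (e + (+ 1 + n))
    j = solve-∀

  Red-red : ∀ w → Red (red w)
  Red-red w = trans (proj₂ (red-spec w)) (cong ℓ (sym (proj₁ (red-spec w))))

  B₀-red : ∀ w → B₀ (red w) ≗F B (ev w)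
  B₀-red w = B₀-indep (red w) (word (ev w)) (Red-red w) (Red-word (ev w)) (trans (proj₁ (red-spec w)) (sym (ev-word (ev w))))

  val-barH : ∀ h u x → val (N (barH h)) u x ≡ barv (N h) u x
  val-barH [] u x = refl
  val-barH ((w , e , c) ∷ h) u x = trans (cong (lin (kr u x)) (N-++ (foldr invS (([] , - e , c) ∷ []) (red w)) (barH h)))
    (trans (lin-++ (kr u x) (N (foldr invS (([] , - e , c) ∷ []) (red w))) _) (cong₂ _+_
      (trans (val-invS* (red w) e c u x) (cong (_*_ c) (trans (cong (λ n → B₀ (red w) u (x + (e + + n))) (proj₂ (red-spec w))) (B₀-red w u _))))
      (val-barH h u x)))

  opaque
    kl : W → List Tm
    kl w = N (C' P (word w))

    kl-def : ∀ w → kl w ≡ N (C' P (word w))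
    kl-def w = refl

  p : W → W → ℤ → ℤ
  p u w e = val (kl w) u e

  kl-bar : ∀ w → barv (kl w) ≗F val (kl w)
  kl-bar w u e rewrite kl-def w = trans (sym (val-barH (C' P (word w)) u e)) (trans (val-coefH (barH (C' P (word w))) u e)
    (trans (IsKL.barInv isKL (word w) (word u) (e - + ℓ u)) (sym (val-coefH (C' P (word w)) u e))))

  -- The coefficient of vᶻ after q = v² and a shift by 2k. `kr` with both group arguments frozen
  -- serves as a Kronecker symbol on exponents.
  pv : ℕ → Poly → ℤ → ℤ
  pv k [] z = + 0
  pv k (c ∷ cs) z = c * kr 1W z 1W (+ (2 ℕ.* k)) + pv (suc k) cs z

  2*-inj : ∀ a b → 2 ℕ.* a ≡ 2 ℕ.* b → a ≡ b
  2*-inj a b = ℕ.*-cancelˡ-≡ a b 2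

  pv-even : ∀ k cs j → pv k cs (+ (2 ℕ.* (k ℕ.+ j))) ≡ coeffP cs j
  pv-below : ∀ k cs j → j < k → pv k cs (+ (2 ℕ.* j)) ≡ + 0
  pv-below k [] j _ = refl
  pv-below k (c ∷ cs) j lt = cong₂ _+_ (trans (cong (_*_ c) (kr-no₂ 1W 1W (λ q → <⇒≢ lt (sym (2*-inj k j (+-injective q)))))) (*-zeroʳ c))
    (pv-below (suc k) cs j (ℕ.m≤n⇒m≤1+n lt))
  pv-even k [] j = refl
  pv-even k (c ∷ cs) zero = trans (cong₂ (λ a b → c * a + b) (trans (cong (λ n → kr 1W (+ (2 ℕ.* n)) 1W (+ (2 ℕ.* k))) (ℕ.+-identityʳ k)) (kr-yes 1W _))
    (trans (cong (λ n → pv (suc k) cs (+ (2 ℕ.* n))) (ℕ.+-identityʳ k)) (pv-below (suc k) cs k (ℕ.n<1+n k)))) (trans (+-identityʳ _) (*-identityʳ c))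
  pv-even k (c ∷ cs) (suc j) = trans (cong₂ (λ a b → c * a + b) (kr-no₂ 1W 1W (λ q → <⇒≢ (ℕ.m<m+n k (s≤s z≤n)) (2*-inj k (k ℕ.+ suc j) (+-injective q))))
    (trans (cong (λ n → pv (suc k) cs (+ (2 ℕ.* n))) (+-suc k j)) (pv-even (suc k) cs j))) (trans (cong (_+ coeffP cs j) (*-zeroʳ c)) (+-identityˡ _))

  pv-other : ∀ k cs z → (∀ j → z ≢ + (2 ℕ.* j)) → pv k cs z ≡ + 0
  pv-other k [] z h = refl
  pv-other k (c ∷ cs) z h = cong₂ _+_ (trans (cong (_*_ c) (kr-no₂ 1W 1W (λ q → h k (sym q)))) (*-zeroʳ c)) (pv-other (suc k) cs z h)

  val-poly : ∀ y L k cs z → val (N (polyTerms y L k cs)) (ev y) (z - + L + + ℓ (ev y)) ≡ pv k cs z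
  val-poly y L k [] z = refl
  val-poly y L k (c ∷ cs) z = cong₂ (λ a b → c * a + b) (kr-iff (λ _ q → refl , +-shift-inj _ _ (- + L) (+-shift-inj _ _ (+ ℓ (ev y)) q)) (λ _ q → refl , cong (λ n → n - + L + + ℓ (ev y)) q))
    (val-poly y L (suc k) cs z)

  val-poly-other : ∀ y L k cs u e → ev y ≢ u → val (N (polyTerms y L k cs)) u e ≡ + 0
  val-poly-other y L k [] u e ne = refl
  val-poly-other y L k (c ∷ cs) u e ne = cong₂ _+_ (trans (cong (_*_ c) (kr-no₁ e _ ne)) (*-zeroʳ c)) (val-poly-other y L (suc k) cs u e ne)

  sumOver : (Word → ℤ) → List Word → ℤ
  sumOver f [] = + 0
  sumOver f (y ∷ ys) = f y + sumOver f ys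

  lin-N-concatMap : ∀ φ (f : Word → H) ys → lin φ (N (concatMap f ys)) ≡ sumOver (λ y → lin φ (N (f y))) ys
  lin-N-concatMap φ f [] = refl
  lin-N-concatMap φ f (y ∷ ys) = trans (cong (lin φ) (N-++ (f y) _)) (trans (lin-++ φ (N (f y)) _) (cong (_+_ (lin φ (N (f y)))) (lin-N-concatMap φ f ys)))

  sumOver-filter : ∀ f (q : Word → Bool) ys → (∀ y → q y ≡ false → f y ≡ + 0) → sumOver f (filterᵇ q ys) ≡ sumOver f ys
  sumOver-filter f q [] h = refl
  sumOver-filter f q (y ∷ ys) h with q y in b
  ... | true = cong (_+_ (f y)) (sumOver-filter f q ys h)
  ... | false = trans (sumOver-filter f q ys h) (trans (sym (+-identityˡ _)) (cong (_+ sumOver f ys) (sym (h y b))))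

  sumOver-none : ∀ f ys → (∀ y → y ∈ ys → f y ≡ + 0) → sumOver f ys ≡ + 0
  sumOver-none f [] h = refl
  sumOver-none f (y ∷ ys) h = cong₂ _+_ (h y (here refl)) (sumOver-none f ys (λ z m → h z (there m)))

  sumOver-one : ∀ f ys u → Unique (map ev ys) → (∀ y → ev y ≢ u → f y ≡ + 0) → ∀ y → y ∈ ys → ev y ≡ u → sumOver f ys ≡ f y
  sumOver-one f (x ∷ ys) u (nx ∷ un) h .x (here refl) eq = trans (cong (_+_ (f x)) (sumOver-none f ys
    (λ z m → h z (λ q → All.lookup nx (∈.∈-map⁺ ev m) (trans eq (sym q)))))) (+-identityʳ (f x))
  sumOver-one f (x ∷ ys) u (nx ∷ un) h y (there m) eq = trans (cong₂ _+_ (h x (λ q → All.lookup nx (∈.∈-map⁺ ev m) (trans q (sym eq)))) (sumOver-one f ys u un h y m eq)) (+-identityˡ (f y))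

  halve : ∀ m → (∃ λ j → m ≡ 2 ℕ.* j) ⊎ (∀ j → m ≢ 2 ℕ.* j)
  halve zero = inj₁ (0 , refl)
  halve (suc zero) = inj₂ λ { zero () ; (suc j) q → h j (trans (suc-injective q) (+-suc j (j ℕ.+ 0))) }
    where
    h : ∀ j → 0 ≢ suc (j ℕ.+ (j ℕ.+ 0))
    h j ()
  halve (suc (suc m)) with halve m
  ... | inj₁ (j , eq) = inj₁ (suc j , trans (cong (suc ∘ suc) eq) (cong suc (sym (+-suc j (j ℕ.+ 0)))))
  ... | inj₂ h = inj₂ λ { zero () ; (suc j) q → h j (suc-injective (trans (suc-injective q) (+-suc j (j ℕ.+ 0)))) }

  even? : ∀ z → (∃ λ j → z ≡ + (2 ℕ.* j)) ⊎ (∀ j → z ≢ + (2 ℕ.* j))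
  even? -[1+ m ] = inj₂ λ j ()
  even? (+ m) with halve m
  ... | inj₁ (j , eq) = inj₁ (j , cong +_ eq)
  ... | inj₂ h = inj₂ (λ j q → h j (+-injective q))

  ev-≈ : ∀ y → y ≈ word (ev y)
  ev-≈ y = ≡⇒≈ y (word (ev y)) (sym (ev-word (ev y)))

  pv-ext : ∀ cs cs′ z → (∀ j → coeffP cs j ≡ coeffP cs′ j) → pv 0 cs z ≡ pv 0 cs′ z
  pv-ext cs cs′ z h with even? z
  ... | inj₁ (j , refl) = trans (pv-even 0 cs j) (trans (h j) (sym (pv-even 0 cs′ j)))
  ... | inj₂ ne = trans (pv-other 0 cs z ne) (sym (pv-other 0 cs′ z ne))

  pv-zero : ∀ cs z → (∀ j → coeffP cs j ≡ + 0) → pv 0 cs z ≡ + 0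
  pv-zero cs z h with even? z
  ... | inj₁ (j , refl) = trans (pv-even 0 cs j) (h j)
  ... | inj₂ ne = pv-other 0 cs z ne

  ¬T : ∀ {b} → b ≡ false → ¬ IsTrue b
  ¬T refl ()

  -- Replaces the sum over words by a single polynomial: the vanishing of P off the Bruhat order
  -- removes the filter, and the ball contains exactly one word for each element not longer than w.
  C′-pv : ∀ u w e → val (N (C' P w)) u e ≡ pv 0 (P (word u) w) (e + + ℓ (ev w) - + ℓ u)
  C′-pv u w e = trans (lin-N-concatMap (kr u e) f (Below w)) (trans (sumOver-filter (λ y → val (N (f y)) u e) (λ y → leqB y w) (Ball (len w)) notBelow) (go (ℓ u ℕ.≤? ℓ (ev w))))
    where
    f : Word → H
    f y = polyTerms y (len w) 0 (P y w)
    i : ∀ e a b → e ≡ e + a - b - a + b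
    i = solve-∀
    at : ∀ y → ev y ≡ u → val (N (f y)) u e ≡ pv 0 (P y w) (e + + ℓ (ev w) - + ℓ u)
    at y refl = trans (cong (val (N (f y)) (ev y)) (trans (i e (+ ℓ (ev w)) (+ ℓ (ev y))) (cong (λ n → e + + ℓ (ev w) - + ℓ (ev y) - + n + + ℓ (ev y)) (sym (len-ℓ w))))) (val-poly y (len w) 0 (P y w) _)
    notBelow : ∀ y → leqB y w ≡ false → val (N (f y)) u e ≡ + 0
    notBelow y b with ev y ≟W u
    ... | no ne = val-poly-other y (len w) 0 (P y w) u e ne
    ... | yes eq = trans (at y eq) (pv-zero (P y w) (e + + ℓ (ev w) - + ℓ u) (IsKL.vanish isKL y w (¬T b)))
    go : Dec (ℓ u ≤ ℓ (ev w)) → sumOver (λ y → val (N (f y)) u e) (Ball (len w)) ≡ pv 0 (P (word u) w) (e + + ℓ (ev w) - + ℓ u)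
    go (yes le) with ∈.∈-map⁻ ev (ball-complete (len w) u (subst (ℓ u ≤_) (sym (len-ℓ w)) le))
    ... | y , m , refl = trans (sumOver-one (λ z → val (N (f z)) (ev y) e) (Ball (len w)) (ev y) (ball-unique (len w)) (λ z → val-poly-other z (len w) 0 (P z w) (ev y) e) y m refl)
          (trans (at y refl) (pv-ext (P y w) (P (word (ev y)) w) (e + + ℓ (ev w) - + ℓ (ev y)) (IsKL.resp isKL y (word (ev y)) w w (ev-≈ y) refl)))
    go (no gt) = trans (sumOver-none (λ z → val (N (f z)) u e) (Ball (len w)) none) (sym (pv-zero (P (word u) w) (e + + ℓ (ev w) - + ℓ u) (IsKL.vanish isKL (word u) w (λ tt → lem _ refl tt))))
      where
      none : ∀ y → y ∈ Ball (len w) → val (N (f y)) u e ≡ + 0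
      none y m = val-poly-other y (len w) 0 (P y w) u e (λ { refl → gt (subst (ℓ (ev y) ≤_) (len-ℓ w) (ball-sound (len w) (ev y) (∈.∈-map⁺ ev m))) })
      lem : ∀ b → leqB (word u) w ≡ b → IsTrue b → ⊥
      lem true q _ = gt (subst (λ a → ℓ a ≤ ℓ (ev w)) (ev-word u) (leqB-ℓ (word u) w q))

  p-pv : ∀ u w e → p u w e ≡ pv 0 (P (word u) (word w)) (e + + ℓ w - + ℓ u)
  p-pv u w e = trans (cong (lin (kr u e)) (kl-def w)) (trans (C′-pv u (word w) e) (cong (λ x → pv 0 (P (word u) (word w)) (e + + ℓ x - + ℓ u)) (ev-word w)))

  C′-p : ∀ u w e → val (N (C' P w)) u e ≡ p u (ev w) e
  C′-p u w e = trans (C′-pv u w e) (trans (pv-ext (P (word u) w) (P (word u) (word (ev w))) (e + + ℓ (ev w) - + ℓ u) (IsKL.resp isKL (word u) (word u) w (word (ev w)) refl (ev-≈ w))) (sym (p-pv u (ev w) e)))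

  coeff-high : ∀ u w j → u ≢ w → ℓ w ≤ ℓ u ℕ.+ 2 ℕ.* j → coeffP (P (word u) (word w)) j ≡ + 0
  coeff-high u w j ne le with leqB (word u) (word w) in b
  ... | false = IsKL.vanish isKL (word u) (word w) (¬T b) j
  ... | true = IsKL.degree isKL (word u) (word w) (subst IsTrue (sym b) _) (λ q → ne (trans (sym (ev-word u)) (trans (≈⇒≡ _ _ q) (ev-word w)))) j
    (subst₂ (λ a b → a < b ℕ.+ 2 ℕ.* j ℕ.+ 1) (sym (trans (len-ℓ (word w)) (cong ℓ (ev-word w)))) (sym (trans (len-ℓ (word u)) (cong ℓ (ev-word u))))
      (≤-trans (s≤s le) (≤-reflexive (ℕ.+-comm 1 _))))

  p-zero : ∀ u w e → u ≢ w → (∀ j → e + + ℓ w - + ℓ u ≡ + (2 ℕ.* j) → ℓ w ≤ ℓ u ℕ.+ 2 ℕ.* j) → p u w e ≡ + 0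
  p-zero u w e ne h with even? (e + + ℓ w - + ℓ u)
  ... | inj₁ (j , eq) = trans (p-pv u w e) (trans (cong (pv 0 (P (word u) (word w))) eq) (trans (pv-even 0 (P (word u) (word w)) j) (coeff-high u w j ne (h j eq))))
  ... | inj₂ nev = trans (p-pv u w e) (pv-other 0 (P (word u) (word w)) _ nev)

  -- The degree bound for P_{u,w} in this normalisation: off the diagonal only negative powers of v
  -- occur.
  p-nonneg : ∀ u w n → u ≢ w → p u w (+ n) ≡ + 0
  p-nonneg u w n ne = p-zero u w (+ n) ne λ j eq → ≤-trans (ℕ.m≤n+m (ℓ w) n) (≤-reflexive (+-injective (trans (i (+ n) (+ ℓ w) (+ ℓ u)) (cong (_+_ (+ ℓ u)) eq))))
    where
    i : ∀ n a b → n + a ≡ b + (n + a - b)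
    i = solve-∀

  p-long : ∀ u w e → u ≢ w → ℓ w ≤ ℓ u → p u w e ≡ + 0
  p-long u w e ne le = p-zero u w e ne (λ j _ → ≤-trans le (ℕ.m≤m+n (ℓ u) _))

  private
    diag-z : ∀ w e → e + + ℓ w - + ℓ w ≡ e
    diag-z w e = i e (+ ℓ w)
      where
      i : ∀ e n → e + n - n ≡ e
      i = solve-∀

  p-diag₀ : ∀ w → p w w (+ 0) ≡ + 1
  p-diag₀ w = trans (p-pv w w (+ 0)) (trans (cong (pv 0 (P (word w) (word w))) (diag-z w (+ 0))) (trans (pv-even 0 (P (word w) (word w)) 0) (IsKL.diag₀ isKL (word w))))

  p-diag : ∀ w e → e ≢ + 0 → p w w e ≡ + 0
  p-diag w e ne with even? e
  ... | inj₂ nev = trans (p-pv w w e) (trans (cong (pv 0 (P (word w) (word w))) (diag-z w e)) (pv-other 0 (P (word w) (word w)) e nev))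
  ... | inj₁ (zero , eq) = ⊥-elim (ne eq)
  ... | inj₁ (suc j , eq) = trans (p-pv w w e) (trans (cong (pv 0 (P (word w) (word w))) (trans (diag-z w e) eq)) (trans (pv-even 0 (P (word w) (word w)) (suc j)) (IsKL.diagₛ isKL (word w) j)))

  p-pos : ∀ u w n → p u w (+ suc n) ≡ + 0
  p-pos u w n with u ≟W w
  ... | yes refl = p-diag w _ (λ ())
  ... | no ne = p-nonneg u w (suc n) ne

  m : W → W → ℤ
  m u w = p u w -[1+ 0 ]

  S : Gen → W → F
  S g w u e = Σl (ball (ℓ w)) (λ y → if lb g y then m y w * p u y e else + 0)

  klsum : Gen → W → List Tm
  klsum g w = concatMap (λ y → if lb g y then scale (m y w) (kl y) else []) (ball (ℓ w))

  lin-klsum : ∀ g w φ → lin φ (klsum g w) ≡ Σl (ball (ℓ w)) (λ y → if lb g y then m y w * lin φ (kl y) else + 0)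
  lin-klsum g w φ = trans (lin-concatMap φ _ (ball (ℓ w))) (Σl-cong (ball (ℓ w)) λ y → h y (lb g y))
    where
    h : ∀ y b → lin φ (if b then scale (m y w) (kl y) else []) ≡ (if b then m y w * lin φ (kl y) else + 0)
    h y true = lin-scale (m y w) φ (kl y)
    h y false = refl

  private

    barv-++ : ∀ ts us u e → barv (ts ++ us) u e ≡ barv ts u e + barv us u e
    barv-++ ts us u e = lin-++ _ ts us

    barv-neg : ∀ ts u e → barv (scale -[1+ 0 ] ts) u e ≡ - barv ts u e
    barv-neg ts u e = trans (lin-scale -[1+ 0 ] _ ts) (ℤ.-1*i≡-i _)

    val-neg : ∀ ts u e → val (scale -[1+ 0 ] ts) u e ≡ - val ts u e
    val-neg ts u e = trans (lin-scale -[1+ 0 ] _ ts) (ℤ.-1*i≡-i _)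

    klsum-bar : ∀ g w → barv (klsum g w) ≗F val (klsum g w)
    klsum-bar g w u e = trans (lin-klsum g w _) (trans (Σl-cong (ball (ℓ w)) λ y → cong (λ z → if lb g y then m y w * z else + 0) (kl-bar y u e)) (sym (lin-klsum g w (kr u e))))

    S-nonneg : ∀ g w u n → S g w u (+ n) ≡ (if lb g u then m u w * p u u (+ n) else + 0)
    S-nonneg g w u n = Σl-single (ball (ℓ w)) _ u (ball-unique (ℓ w)) mem λ y ne → h y ne (lb g y)
      where
      h : ∀ y → y ≢ u → ∀ b → (if b then m y w * p u y (+ n) else + 0) ≡ + 0
      h y ne true = trans (cong (_*_ (m y w)) (p-nonneg u y n (ne ∘ sym))) (*-zeroʳ (m y w))
      h y ne false = refl
      z : ∀ b → m u w ≡ + 0 → (if b then m u w * p u u (+ n) else + 0) ≡ + 0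
      z true q = trans (cong (_* p u u (+ n)) q) refl
      z false q = refl
      mem : u ∈ ball (ℓ w) ⊎ (if lb g u then m u w * p u u (+ n) else + 0) ≡ + 0
      mem with ℓ u ℕ.≤? ℓ w
      ... | yes le = inj₁ (ball-complete (ℓ w) u le)
      ... | no gt = inj₂ (z (lb g u) (p-long u w _ (λ { refl → gt ≤-refl }) (<⇒≤ (≰⇒> gt))))

  -- Both sides are bar-invariant, so by `bar-unique` only nonnegative powers have to agree. There
  -- every p is a Kronecker symbol, except that v times the v⁻¹ coefficient `m u w` appears at each
  -- u with g as descent; `S` removes exactly these terms.
  C-up : ∀ g w → lb g w ≡ false → ∀ u e → C g (val (kl w)) u e ≡ p u (l g w) e + S g w u e
  C-up g w b u e = i-j≡0⇒i≡j _ _ (trans (sym (valts u e)) (bar-unique ts bi neg u e))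
    where
    ts : List Tm
    ts = cL g (kl w) ++ scale -[1+ 0 ] (kl (l g w) ++ klsum g w)
    valts : ∀ u e → val ts u e ≡ C g (val (kl w)) u e + - (p u (l g w) e + S g w u e)
    valts u e = trans (lin-++ _ (cL g (kl w)) _) (cong₂ _+_ (val-cL g (kl w) u e) (trans (val-neg (kl (l g w) ++ klsum g w) u e) (cong -_ (trans (lin-++ (kr u e) (kl (l g w)) _) (cong (_+_ (p u (l g w) e)) (lin-klsum g w (kr u e)))))))
    bi : barv ts ≗F val ts
    bi u e = trans (barv-++ (cL g (kl w)) _ u e) (trans (cong₂ _+_
      (trans (barv-cL g (kl w) u e) (trans (C-cong g (kl-bar w) u e) (sym (val-cL g (kl w) u e))))
      (trans (barv-neg (kl (l g w) ++ klsum g w) u e) (trans (cong -_ (trans (barv-++ (kl (l g w)) _ u e) (trans (cong₂ _+_ (kl-bar (l g w) u e) (klsum-bar g w u e)) (sym (lin-++ (kr u e) (kl (l g w)) _))))) (sym (val-neg (kl (l g w) ++ klsum g w) u e)))))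
      (sym (lin-++ (kr u e) (cL g (kl w)) _)))
    zero-diff : ∀ {a b} → a ≡ b → a + - b ≡ + 0
    zero-diff {a} refl = +-inverseʳ a
    shifted : ∀ u n → p (l g u) w (+ n) ≡ p u (l g w) (+ n)
    shifted u n with u ≟W l g w
    shifted .(l g w) zero | yes refl = trans (cong (λ z → p z w (+ 0)) (l-invol g w)) (trans (p-diag₀ w) (sym (p-diag₀ (l g w))))
    shifted .(l g w) (suc n) | yes refl = trans (p-pos _ w n) (sym (p-pos _ (l g w) n))
    ... | no ne = trans (p-nonneg (l g u) w n (λ q → ne (l≡-sym g q))) (sym (p-nonneg u (l g w) n ne))
    neg : ∀ u n → val ts u (+ n) ≡ + 0
    neg u n = trans (valts u (+ n)) (zero-diff (cong₂ _+_ (shifted u n) (trans (h n) (sym (S-nonneg g w u n)))))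
      where
      h : ∀ n → p u w (sh (lb g u) (+ n)) ≡ (if lb g u then m u w * p u u (+ n) else + 0)
      h n with lb g u in bu
      h n | false = p-pos u w n
      h zero | true = sym (trans (cong (_*_ (m u w)) (p-diag₀ u)) (*-identityʳ (m u w)))
      h (suc n) | true = trans (p-nonneg u w n (λ { refl → bool-clash bu b })) (sym (trans (cong (_*_ (m u w)) (p-diag u (+ suc n) (λ ()))) (*-zeroʳ (m u w))))

  private
    S-double : ∀ g w u e → (∀ y → ℓ y ≤ ℓ w → lb g y ≡ true → C g (val (kl y)) u e ≡ p u y (ℤ.pred e) + p u y (ℤ.suc e)) →
      C g (S g w) u e ≡ S g w u (ℤ.pred e) + S g w u (ℤ.suc e)
    S-double g w u e h = trans (sym (Σl-+ (ball (ℓ w)) _ _)) (trans (go (ball (ℓ w)) (λ y m → ball-sound (ℓ w) y m)) (Σl-+ (ball (ℓ w)) _ _))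
      where
      X : W → ℤ → W → ℤ
      X u e y = if lb g y then m y w * p u y e else + 0
      one : ∀ y → ℓ y ≤ ℓ w → X (l g u) e y + X u (sh (lb g u) e) y ≡ X u (ℤ.pred e) y + X u (ℤ.suc e) y
      one y le with lb g y in b
      ... | false = refl
      ... | true = trans (sym (ℤ.*-distribˡ-+ (m y w) _ _)) (trans (cong (_*_ (m y w)) (h y le b)) (ℤ.*-distribˡ-+ (m y w) _ _))
      go : ∀ ys → (∀ y → y ∈ ys → ℓ y ≤ ℓ w) → Σl ys (λ y → X (l g u) e y + X u (sh (lb g u) e) y) ≡ Σl ys (λ y → X u (ℤ.pred e) y + X u (ℤ.suc e) y)
      go [] _ = refl
      go (y ∷ ys) f = cong₂ _+_ (one y (f y (here refl))) (go ys (λ z m → f z (there m)))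

    C-down′ : ∀ w → Acc _<_ (ℓ w) → ∀ g → lb g w ≡ true → ∀ u e → C g (val (kl w)) u e ≡ p u w (ℤ.pred e) + p u w (ℤ.suc e)
    C-down′ w (acc rs) g b u e = trans (C-cong g split u e) (trans (C-sub g (C g (val (kl w′))) (S g w′) u e)
      (trans (cong₂ (λ x y → x + - y) (C-quad g (val (kl w′)) u e) (S-double g w′ u e (λ y le by → C-down′ y (rs (≤-trans (s≤s le) (≤-reflexive (sym (ℓ-down g w b))))) g by u e)))
      (trans (i (C g (val (kl w′)) u (ℤ.pred e)) _ _ _) (cong₂ _+_ (sym (split u (ℤ.pred e))) (sym (split u (ℤ.suc e)))))))
      where
      w′ : W
      w′ = l g w
      split : ∀ u e → p u w e ≡ C g (val (kl w′)) u e + - S g w′ u e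
      split u e = trans (j (p u w e) (S g w′ u e)) (cong (_+ - S g w′ u e) (sym (trans (C-up g w′ (trans (lb-flip g w) (cong not b)) u e) (cong (λ z → p u z e + S g w′ u e) (l-invol g w)))))
        where
        j : ∀ a b → a ≡ a + b + - b
        j = solve-∀
      i : ∀ a b c d → a + b + - (c + d) ≡ a + - c + (b + - d)
      i = solve-∀

  -- With w = gw′, `C-up` writes C_w as C_g C_{w′} minus multiples of C_y for shorter y with g as
  -- descent. On the first summand C_g acts by v + v⁻¹ because of `C-quad`, on the others by
  -- induction.
  C-down : ∀ g w → lb g w ≡ true → ∀ u e → C g (val (kl w)) u e ≡ p u w (ℤ.pred e) + p u w (ℤ.suc e)
  C-down g w = C-down′ w (<-wellFounded (ℓ w)) g

  -- In terms of polynomials, P_{gu,w} = P_{u,w}; the shift comes from the normalisation by lengths.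
  p-descent : ∀ g u w e → lb g w ≡ true → lb g u ≡ false → p (l g u) w e ≡ p u w (ℤ.pred e)
  p-descent g u w e bw bu = i _ _ _ (subst (λ b → p (l g u) w e + p u w (sh b e) ≡ p u w (ℤ.pred e) + p u w (ℤ.suc e)) bu (C-down g w bw u e))
    where
    i : ∀ a b c → a + b ≡ c + b → a ≡ c
    i a b c q = +-shift-inj a c b q

  -- Inversion commutes with the bar by `B-inv`, so the two families satisfy the same conditions and
  -- uniqueness applies.
  p-inv : ∀ u w e → p (inv u) w e ≡ p u (inv w) e
  p-inv u w e = i-j≡0⇒i≡j _ _ (trans (sym (valts u e)) (bar-unique ts bi neg u e))
    where
    ts : List Tm
    ts = ι (kl w) ++ scale -[1+ 0 ] (kl (inv w))
    valts : ∀ u e → val ts u e ≡ p (inv u) w e + - p u (inv w) e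
    valts u e = trans (lin-++ _ (ι (kl w)) _) (cong₂ _+_ (val-ι (kl w) u e) (val-neg (kl (inv w)) u e))
    bi : barv ts ≗F val ts
    bi u e = trans (barv-++ (ι (kl w)) _ u e) (trans (cong₂ _+_
      (trans (barv-ι (kl w) u e) (trans (kl-bar w (inv u) e) (sym (val-ι (kl w) u e))))
      (trans (barv-neg (kl (inv w)) u e) (trans (cong -_ (kl-bar (inv w) u e)) (sym (val-neg (kl (inv w)) u e))))) (sym (lin-++ (kr u e) (ι (kl w)) _)))
    neg : ∀ u n → val ts u (+ n) ≡ + 0
    neg u n = trans (valts u (+ n)) (trans (cong (_+ - p u (inv w) (+ n)) (h n (u ≟W inv w))) (+-inverseʳ (p u (inv w) (+ n))))
      where
      h : ∀ n → Dec (u ≡ inv w) → p (inv u) w (+ n) ≡ p u (inv w) (+ n)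
      h zero (yes refl) = trans (cong (λ z → p z w (+ 0)) (inv-invol w)) (trans (p-diag₀ w) (sym (p-diag₀ (inv w))))
      h (suc n) (yes refl) = trans (p-pos _ w n) (sym (p-pos _ (inv w) n))
      h n (no ne) = trans (p-nonneg (inv u) w n (λ { refl → ne (sym (inv-invol u)) })) (sym (p-nonneg u (inv w) n ne))

 -- Coefficients μ, and the star operations for pairs of generators of order 4.

 module StarOperations where
  open Coxeter
  open FormalSums
  open Hecke
  open ReducedWords
  open KLPolynomials
  open Defs using (Gen)

  -1ℤ -2ℤ : ℤ
  -1ℤ = -[1+ 0 ]
  -2ℤ = -[1+ 1 ]

  -- coefficients at v⁰ (Kronecker symbols)
  [_≡_]₀ : W → W → ℤ
  [ u ≡ w ]₀ = p u w (+ 0)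

  ≡₀-no : ∀ {u w} → u ≢ w → [ u ≡ w ]₀ ≡ + 0
  ≡₀-no {u} {w} ne = p-nonneg u w 0 ne

  m-≡₀ : ∀ g u w → lb g w ≡ true → lb g u ≡ false → m u w ≡ [ l g u ≡ w ]₀
  m-≡₀ g u w bw bu = sym (p-descent g u w (+ 0) bw bu)

  -- By `p-descent` the v⁻¹ coefficient at u is the v⁰ coefficient at gu, which is a Kronecker
  -- symbol.
  m-descent : ∀ g u w → lb g w ≡ true → lb g u ≡ false → l g u ≢ w → m u w ≡ + 0
  m-descent g u w bw bu ne = trans (m-≡₀ g u w bw bu) (≡₀-no ne)

  m-up : ∀ g u → lb g u ≡ false → m u (l g u) ≡ + 1
  m-up g u b = trans (m-≡₀ g u (l g u) (trans (lb-flip g u) (cong not b)) b) (p-diag₀ (l g u))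

  m-long : ∀ u w → ℓ w ≤ ℓ u → m u w ≡ + 0
  m-long u w le with u ≟W w
  ... | yes refl = p-diag u -1ℤ (λ ())
  ... | no ne = p-long u w -1ℤ ne le

  m-inv : ∀ u w → m (inv u) (inv w) ≡ m u w
  m-inv u w = trans (p-inv u (inv w) -1ℤ) (cong (λ z → m u z) (inv-invol w))

  private
    term : Gen → W → W → ℤ → W → ℤ
    term g w u e y = if lb g y then m y w * p u y e else + 0

    term-true : ∀ g w u e y → lb g y ≡ true → term g w u e y ≡ m y w * p u y e
    term-true g w u e y b rewrite b = refl

    term-zero : ∀ g w u e y → (lb g y ≡ true → m y w ≡ + 0 ⊎ p u y e ≡ + 0) → term g w u e y ≡ + 0
    term-zero g w u e y h with lb g y
    ... | false = refl
    ... | true with h refl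
    ...   | inj₁ z = cong (_* p u y e) z
    ...   | inj₂ z = trans (cong (_*_ (m y w)) z) (*-zeroʳ (m y w))

    in-ball : ∀ g w u e y → y ∈ ball (ℓ w) ⊎ term g w u e y ≡ + 0
    in-ball g w u e y with ℓ y ℕ.≤? ℓ w
    ... | yes le = inj₁ (ball-complete (ℓ w) y le)
    ... | no gt = inj₂ (term-zero g w u e y (λ _ → inj₁ (m-long y w (<⇒≤ (≰⇒> gt)))))

  S-none : ∀ g w u e → (∀ y → lb g y ≡ true → m y w ≡ + 0 ⊎ p u y e ≡ + 0) → S g w u e ≡ + 0
  S-none g w u e h = Σl-zero (ball (ℓ w)) _ (λ y _ → term-zero g w u e y (h y))

  S-one : ∀ g w u e y₀ → lb g y₀ ≡ true → (∀ y → y ≢ y₀ → lb g y ≡ true → m y w ≡ + 0 ⊎ p u y e ≡ + 0) → S g w u e ≡ m y₀ w * p u y₀ e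
  S-one g w u e y₀ b h = trans (Σl-single (ball (ℓ w)) _ y₀ (ball-unique (ℓ w)) (in-ball g w u e y₀) (λ y ne → term-zero g w u e y (h y ne))) (term-true g w u e y₀ b)

  S-two : ∀ g w u e y₀ y₁ → y₀ ≢ y₁ → lb g y₀ ≡ true → lb g y₁ ≡ true →
    (∀ y → y ≢ y₀ → y ≢ y₁ → lb g y ≡ true → m y w ≡ + 0 ⊎ p u y e ≡ + 0) → S g w u e ≡ m y₀ w * p u y₀ e + m y₁ w * p u y₁ e
  S-two g w u e y₀ y₁ ne b₀ b₁ h = trans (Σl-cong (ball (ℓ w)) split) (trans (Σl-+ (ball (ℓ w)) f₀ f₁) (cong₂ _+_
      (trans (Σl-single (ball (ℓ w)) f₀ y₀ (ball-unique (ℓ w)) (mem f₀ y₀ (λ z → trans (f₀-at) z)) (λ y n → f₀-off y n)) (trans f₀-at (term-true g w u e y₀ b₀)))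
      (trans (Σl-single (ball (ℓ w)) f₁ y₁ (ball-unique (ℓ w)) (mem f₁ y₁ (λ z → trans (f₁-at) z)) f₁-off) (trans f₁-at (term-true g w u e y₁ b₁)))))
    where
    f₀ f₁ : W → ℤ
    f₀ y with y ≟W y₀
    ... | yes _ = term g w u e y
    ... | no _ = + 0
    f₁ y with y ≟W y₀
    ... | yes _ = + 0
    ... | no _ = term g w u e y
    split : ∀ y → term g w u e y ≡ f₀ y + f₁ y
    split y with y ≟W y₀
    ... | yes _ = sym (+-identityʳ _)
    ... | no _ = sym (+-identityˡ _)
    f₀-at : f₀ y₀ ≡ term g w u e y₀
    f₀-at with y₀ ≟W y₀
    ... | yes _ = refl
    ... | no n = ⊥-elim (n refl)
    f₀-off : ∀ y → y ≢ y₀ → f₀ y ≡ + 0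
    f₀-off y n with y ≟W y₀
    ... | yes q = ⊥-elim (n q)
    ... | no _ = refl
    f₁-at : f₁ y₁ ≡ term g w u e y₁
    f₁-at with y₁ ≟W y₀
    ... | yes q = ⊥-elim (ne (sym q))
    ... | no n = refl
    f₁-off : ∀ y → y ≢ y₁ → f₁ y ≡ + 0
    f₁-off y n with y ≟W y₀
    ... | yes _ = refl
    ... | no n₀ = term-zero g w u e y (h y n₀ n)
    mem : ∀ f y → (term g w u e y ≡ + 0 → f y ≡ + 0) → y ∈ ball (ℓ w) ⊎ f y ≡ + 0
    mem f y k with in-ball g w u e y
    ... | inj₁ i = inj₁ i
    ... | inj₂ z = inj₂ (k z)

  p-step : ∀ g w u e → lb g w ≡ false → p u (l g w) e ≡ p (l g u) w e + p u w (sh (lb g u) e) + - S g w u e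
  p-step g w u e b = trans (i (p u (l g w) e) (S g w u e)) (cong (_+ - S g w u e) (sym (C-up g w b u e)))
    where
    i : ∀ a b → a ≡ a + b + - b
    i = solve-∀

  p-step⁺ : ∀ g w u e → lb g w ≡ false → lb g u ≡ true → p u (l g w) e ≡ p (l g u) w e + p u w (ℤ.pred e) + - S g w u e
  p-step⁺ g w u e b bu = trans (p-step g w u e b) (cong (λ z → p (l g u) w e + p u w (sh z e) + - S g w u e) bu)

  p-step⁻ : ∀ g w u e → lb g w ≡ false → lb g u ≡ false → p u (l g w) e ≡ p (l g u) w e + p u w (ℤ.suc e) + - S g w u e
  p-step⁻ g w u e b bu = trans (p-step g w u e b) (cong (λ z → p (l g u) w e + p u w (sh z e) + - S g w u e) bu)

  -- a left string u, hu, ghu for a pair of generators of order 4 (middle elements of a coset of ⟨g , h⟩)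
  record Str (g h : Gen) (u : W) : Set where
    constructor str
    field
      g₁ : lb g u ≡ true
      h₁ : lb h u ≡ false
      h₀ : lb h (l g u) ≡ false
      g₂ : lb g (l h u) ≡ false
      h₃ : lb h (l g (l h u)) ≡ false
      g₄ : lb g (l h (l g (l h u))) ≡ true

  module _ {g h : Gen} where
    open Str

    flip-true : ∀ g x → lb g x ≡ false → lb g (l g x) ≡ true
    flip-true g x b = trans (lb-flip g x) (cong not b)

    flip-false : ∀ g x → lb g x ≡ true → lb g (l g x) ≡ false
    flip-false g x b = trans (lb-flip g x) (cong not b)

    p₋₁-off : ∀ g′ u y → lb g′ y ≡ true → lb g′ u ≡ false → l g′ u ≢ y → p u y -1ℤ ≡ + 0
    p₋₁-off g′ u y by bu ne = m-descent g′ u y by bu ne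

    -- The recursion for C_h C_w at hu. Its correction sum is empty: for y with g as descent, a
    -- nonzero p(hu,y) at v⁻¹ would force y = ghu, which lacks h; for y without g, a nonzero m(y,w)
    -- would force y = gw, which also lacks h.
    star-B : ∀ {u w} → Str g h u → Str g h w → m (l h u) (l h w) ≡ m u w + m (l g (l h u)) w
    star-B {u} {w} U V = trans (p-step⁺ h w (l h u) -1ℤ (h₁ V) (flip-true h u (h₁ U)))
      (trans (cong₂ (λ a b → p (l h (l h u)) w -1ℤ + a + - b) (sym (p-descent g (l h u) w -1ℤ (g₁ V) (g₂ U))) s₀)
      (trans (cong (λ z → p z w -1ℤ + m (l g (l h u)) w + + 0) (l-invol h u)) (+-identityʳ _)))
      where
      s₀ : S h w (l h u) -1ℤ ≡ + 0
      s₀ = S-none h w (l h u) -1ℤ λ y by → go y by (lb g y) refl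
        where
        go : ∀ y → lb h y ≡ true → ∀ b → lb g y ≡ b → m y w ≡ + 0 ⊎ p (l h u) y -1ℤ ≡ + 0
        go y by false gy = inj₁ (m-descent g y w (g₁ V) gy (λ q → bool-clash by (trans (cong (lb h) (l≡-sym g q)) (h₀ V))))
        go y by true gy = inj₂ (p₋₁-off g (l h u) y gy (g₂ U) (λ q → bool-clash by (trans (cong (lb h) (sym q)) (h₃ U))))

    star-A : ∀ {u w} → Str g h u → Str g h w → m u (l g (l h w)) + m u w ≡ m (l h u) (l h w)
    star-A {u} {w} U V = trans (cong (_+ m u w) (trans (p-step⁺ g (l h w) u -1ℤ (g₂ V) (g₁ U))
      (cong₂ (λ a b → a + - b) (cong₂ _+_ z₀ (sym (p-descent h u (l h w) -1ℤ (flip-true h w (h₁ V)) (h₁ U)))) s₁))) (i _ _)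
      where
      i : ∀ a b → + 0 + a + - (+ 1 * b) + b ≡ a
      i = solve-∀
      z₀ : p (l g u) (l h w) -1ℤ ≡ + 0
      z₀ = m-descent h (l g u) (l h w) (flip-true h w (h₁ V)) (h₀ U) (λ q → bool-clash (g₁ V) (trans (cong (lb g) (trans (sym (l-invol h w)) (sym (l≡-sym h q)))) (flip-false g u (g₁ U))))
      s₁ : S g (l h w) u -1ℤ ≡ + 1 * m u w
      s₁ = trans (S-one g (l h w) u -1ℤ w (g₁ V) (λ y ne gy → go y ne gy (lb h y) refl)) (cong (_* m u w) (m-up h w (h₁ V)))
        where
        go : ∀ y → y ≢ w → lb g y ≡ true → ∀ b → lb h y ≡ b → m y (l h w) ≡ + 0 ⊎ p u y -1ℤ ≡ + 0
        go y ne gy false hy = inj₁ (m-descent h y (l h w) (flip-true h w (h₁ V)) hy (λ q → ne (trans (l≡-sym h q) (l-invol h w))))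
        go y ne gy true hy = inj₂ (p₋₁-off h u y hy (h₁ U) (λ q → bool-clash gy (trans (cong (lb g) (sym q)) (g₂ U))))

    star-13 : ∀ {u w} → Str g h u → Str g h w → m u (l g (l h w)) ≡ m (l g (l h u)) w
    star-13 {u} {w} U V = +-shift-inj _ _ (m u w) (trans (star-A U V) (trans (star-B U V) (+-comm (m u w) _)))

    -- Two corrections survive here, y = w and y = hghu. They cancel the term m(ghu,w) brought in by
    -- `star-B` and the shifted term of the recursion.
    star-C : ∀ {u w} → Str g h u → Str g h w → m (l g (l h u)) (l g (l h w)) ≡ m u w
    star-C {u} {w} U V = trans (p-step⁺ g (l h w) u₃ -1ℤ (g₂ V) (flip-true g (l h u) (g₂ U)))
      (trans (cong₂ (λ a b → a + - b) (cong₂ _+_ (trans (cong (λ z → m z (l h w)) (l-invol g (l h u))) (star-B U V)) (sym (p-descent h u₃ (l h w) -1ℤ (flip-true h w (h₁ V)) (h₃ U)))) s₂)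
      (i (m u w) (m u₃ w) _))
      where
      u₃ : W
      u₃ = l g (l h u)
      i : ∀ a b c → a + b + c + - (+ 1 * b + c * + 1) ≡ a
      i = solve-∀
      s₂ : S g (l h w) u₃ -1ℤ ≡ + 1 * m u₃ w + m (l h u₃) (l h w) * + 1
      s₂ = trans (S-two g (l h w) u₃ -1ℤ w (l h u₃) (λ q → bool-clash (flip-true h u₃ (h₃ U)) (trans (cong (lb h) (sym q)) (h₁ V))) (g₁ V) (g₄ U)
          (λ y n₀ n₁ gy → go y n₀ n₁ gy (lb h y) refl))
        (cong₂ _+_ (cong (_* m u₃ w) (m-up h w (h₁ V))) (cong (_*_ (m (l h u₃) (l h w))) (m-up h u₃ (h₃ U))))
        where
        go : ∀ y → y ≢ w → y ≢ l h u₃ → lb g y ≡ true → ∀ b → lb h y ≡ b → m y (l h w) ≡ + 0 ⊎ p u₃ y -1ℤ ≡ + 0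
        go y n₀ n₁ gy false hy = inj₁ (m-descent h y (l h w) (flip-true h w (h₁ V)) hy (λ q → n₀ (trans (l≡-sym h q) (l-invol h w))))
        go y n₀ n₁ gy true hy = inj₂ (p₋₁-off h u₃ y hy (h₃ U) (λ q → n₁ (sym q)))

  -- strings of opposite parity: u starts with g, w starts with h
  module _ {g h : Gen} {u w : W} (U : Str g h u) (V : Str h g w) where
    open Str

    private
      both : ∀ x → (∀ y → lb g y ≡ true → lb h y ≡ true → p x y -1ℤ ≡ + 0) → ∀ y → lb g y ≡ true → m y w ≡ + 0 ⊎ p x y -1ℤ ≡ + 0
      both x k y gy with lb h y in hy
      ... | true = inj₂ (k y gy hy)
      ... | false = inj₁ (m-descent h y w (g₁ V) hy (λ q → bool-clash gy (trans (cong (lb g) (l≡-sym h q)) (h₀ V))))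

    mixed-12 : m u (l g w) ≡ [ l h (l g u) ≡ w ]₀ + m (l h u) w
    mixed-12 = trans (p-step⁺ g w u -1ℤ (h₁ V) (g₁ U)) (trans (cong₂ (λ a b → a + - b)
      (cong₂ _+_ (m-≡₀ h (l g u) w (g₁ V) (h₀ U)) (sym (p-descent h u w -1ℤ (g₁ V) (h₁ U))))
      (S-none g w u -1ℤ (both u (λ y gy hy → p₋₁-off {g} {h} h u y hy (h₁ U) (λ q → bool-clash gy (trans (cong (lb g) (sym q)) (g₂ U)))))))
      (+-identityʳ _))

    mixed-32 : m (l g (l h u)) (l g w) ≡ m (l h u) w
    mixed-32 = trans (p-step⁺ g w u₃ -1ℤ (h₁ V) (flip-true {g} {h} g (l h u) (g₂ U))) (trans (cong₂ (λ a b → a + - b)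
      (cong₂ _+_ (cong (λ z → m z w) (l-invol g (l h u))) (sym (p-descent h u₃ w -1ℤ (g₁ V) (h₃ U)))) s₁) (i _ _))
      where
      u₃ : W
      u₃ = l g (l h u)
      i : ∀ a b → a + b + - (b * + 1) ≡ a
      i = solve-∀
      s₁ : S g w u₃ -1ℤ ≡ m (l h u₃) w * + 1
      s₁ = trans (S-one g w u₃ -1ℤ (l h u₃) (g₄ U) (λ y ne gy → both′ y ne gy)) (cong (_*_ (m (l h u₃) w)) (m-up h u₃ (h₃ U)))
        where
        both′ : ∀ y → y ≢ l h u₃ → lb g y ≡ true → m y w ≡ + 0 ⊎ p u₃ y -1ℤ ≡ + 0
        both′ y ne gy with lb h y in hy
        ... | true = inj₂ (p₋₁-off {g} {h} h u₃ y hy (h₃ U) (λ q → ne (sym q)))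
        ... | false = inj₁ (m-descent h y w (g₁ V) hy (λ q → bool-clash gy (trans (cong (lb g) (l≡-sym h q)) (h₀ V))))

  module _ {g h : Gen} {u w : W} (U : Str g h u) (V : Str h g w) where
    open Str

    mixed-23 : m (l g w) (l g (l h u)) ≡ m w (l h u)
    mixed-23 = trans (p-step⁺ g (l h u) (l g w) -1ℤ (g₂ U) (flip-true {g} {h} g w (h₁ V)))
      (trans (cong₂ (λ a b → a + - b) (cong₂ _+_ (cong (λ z → m z (l h u)) (l-invol g w)) (trans (sym (p-descent h (l g w) (l h u) -1ℤ (flip-true {g} {h} h u (h₁ U)) (g₂ V))) (mixed-32 V U))) s₁)
      (i _ _))
      where
      i : ∀ a b → a + b + - (+ 1 * b) ≡ a
      i = solve-∀
      s₁ : S g (l h u) (l g w) -1ℤ ≡ + 1 * m (l g w) u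
      s₁ = trans (S-one g (l h u) (l g w) -1ℤ u (g₁ U) (λ y ne gy → go y ne gy (lb h y) refl)) (cong (_* m (l g w) u) (m-up h u (h₁ U)))
        where
        go : ∀ y → y ≢ u → lb g y ≡ true → ∀ b → lb h y ≡ b → m y (l h u) ≡ + 0 ⊎ p (l g w) y -1ℤ ≡ + 0
        go y ne gy false hy = inj₁ (m-descent h y (l h u) (flip-true {g} {h} h u (h₁ U)) hy (λ q → ne (trans (l≡-sym h q) (l-invol h u))))
        go y ne gy true hy = inj₂ (p₋₁-off {g} {h} h (l g w) y hy (g₂ V) (λ q → bool-clash gy (trans (cong (lb g) (sym q)) (h₃ V))))

  M : W → W → ℤ
  M u w = m u w + m w u

  M-comm : ∀ u w → M u w ≡ M w u
  M-comm u w = +-comm (m u w) (m w u)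

  M-inv : ∀ u w → M (inv u) (inv w) ≡ M u w
  M-inv u w = cong₂ _+_ (m-inv u w) (m-inv w u)

  module _ {g h : Gen} {u w : W} (U : Str g h u) (V : Str h g w) where

    M-32 : M (l g (l h u)) (l g w) ≡ M (l h u) w
    M-32 = cong₂ _+_ (mixed-32 U V) (mixed-23 U V)

    -- Neither one-sided identity is an equality: each is off by the Kronecker symbol of hgu = w,
    -- with opposite signs. Only the symmetric sum is preserved.
    M-12 : M u (l g w) ≡ M (l h u) w
    M-12 = trans (cong₂ _+_ (mixed-12 U V) mwu) (k [ l h (l g u) ≡ w ]₀ (m (l h u) w) (m w (l h u)))
      where
      i : ∀ a b → a ≡ a + b + - b
      i = solve-∀
      k : ∀ a b c → (a + b) + (c + - a) ≡ b + c
      k = solve-∀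
      same : [ l g (l h w) ≡ u ]₀ ≡ [ l h (l g u) ≡ w ]₀
      same with l g (l h w) ≟W u
      ... | yes refl = trans (p-diag₀ _) (sym (trans (cong (λ z → [ z ≡ w ]₀) (trans (cong (l h) (l-invol g (l h w))) (l-invol h w))) (p-diag₀ w)))
      ... | no ne = trans (≡₀-no ne) (sym (≡₀-no (λ q → ne (trans (cong (λ z → l g (l h z)) (sym q)) (trans (cong (l g) (l-invol h (l g u))) (l-invol g u))))))
      mwu : m (l g w) u ≡ m w (l h u) + - [ l h (l g u) ≡ w ]₀
      mwu = trans (i (m (l g w) u) [ l g (l h w) ≡ u ]₀) (cong₂ (λ a b → a + - b) (trans (+-comm (m (l g w) u) _) (sym (mixed-12 V U))) same)

 -- Expansions in the basis C_w, edges of the W-graph, and products.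

 module KLSpans where
  open Coxeter
  open FormalSums
  open Hecke
  open ReducedWords
  open KLPolynomials
  open StarOperations
  open Defs using (Gen; t)

  pf : W → F
  pf w = val (kl w)

  -- combinations of the basis C_w: the term (w , k , c) stands for c vᵏ C_w
  ⟦_⟧ : List Tm → F
  ⟦ ts ⟧ u e = lin (λ w k → p u w (e - k)) ts

  p-tri : ∀ u w e k → ℓ w ≤ ℓ u → p u w (e - k) ≡ kr u e w k
  p-tri u w e k le with u ≟W w
  ... | no ne = trans (p-long u w _ ne le) (sym (kr-no₁ e k (ne ∘ sym)))
  ... | yes refl with e ℤ.≟ k
  ...   | yes refl = trans (cong (p u u) (+-inverseʳ e)) (trans (p-diag₀ u) (sym (kr-yes u e)))
  ...   | no ne = trans (p-diag u _ (ne ∘ i-j≡0⇒i≡j e k)) (sym (kr-no₂ u u (ne ∘ sym)))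

  C-indep₀ : ∀ ts → (∀ u e → ⟦ ts ⟧ u e ≡ + 0) → ∀ u e → val ts u e ≡ + 0
  C-indep₀ ts h u e = step (suc (maxℓ ts)) u e (ℕ.m≤n+m (suc (maxℓ ts)) (ℓ u))
    where
    step : ∀ n u e → maxℓ ts < ℓ u ℕ.+ n → val ts u e ≡ + 0
    step zero u e q = above-max ts u e (subst (maxℓ ts <_) (ℕ.+-identityʳ _) q)
    step (suc n) u e q = trans (lin-diff (kr u e) (λ w k → p u w (e - k)) ts g) (h u e)
      where
      g : ∀ w k → val ts w k ≡ + 0 ⊎ kr u e w k ≡ p u w (e - k)
      g w k with ℓ w ℕ.≤? ℓ u
      ... | yes le = inj₂ (sym (p-tri u w e k le))
      ... | no gt = inj₁ (step n w k (≤-trans q (≤-trans (≤-reflexive (+-suc (ℓ u) n)) (ℕ.+-monoˡ-≤ n (≰⇒> gt)))))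

  -- The matrix p(u,w) is unitriangular for length, so coefficients are recovered by descending
  -- induction on length.
  C-indep : ∀ ts us → ⟦ ts ⟧ ≗F ⟦ us ⟧ → val ts ≗F val us
  C-indep ts us h w k = i-j≡0⇒i≡j _ _ (trans (sym (diff (kr w k))) (C-indep₀ (ts ++ scale -1ℤ us)
      (λ u e → trans (diff _) (trans (cong (_+ - ⟦ us ⟧ u e) (h u e)) (+-inverseʳ (⟦ us ⟧ u e)))) w k))
    where
    diff : ∀ φ → lin φ (ts ++ scale -1ℤ us) ≡ lin φ ts + - lin φ us
    diff φ = trans (lin-++ φ ts _) (cong (_+_ (lin φ ts)) (trans (lin-scale -1ℤ φ us) (ℤ.-1*i≡-i _)))

  -- f is a combination of terms vᵏ C_w with D w k. Degree bounds and conditions on w are carried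
  -- jointly by D, which is what the inductions over products need.
  Spn : (W → ℤ → Set) → F → Set
  Spn D f = Σ (List Tm) λ ts → All (λ t → D (proj₁ t) (proj₁ (proj₂ t))) ts × f ≗F ⟦ ts ⟧

  -- By independence, a condition checked on one expansion holds for the nonzero coefficients of
  -- every other. In this way a closure property of products becomes a statement about single edges
  -- or structure constants.
  Spn-coef : ∀ {D f} → Spn D f → ∀ ts → f ≗F ⟦ ts ⟧ → ∀ w k → val ts w k ≢ + 0 → D w k
  Spn-coef (us , al , eq) ts eq′ w k ne with val-entry us w k (λ z → ne (trans (C-indep ts us (λ u e → trans (sym (eq′ u e)) (eq u e)) w k) z))
  ... | c , i = All.lookup al i

  Spn-nonzero : ∀ {D f} ts → f ≗F ⟦ ts ⟧ → (∀ w k → val ts w k ≢ + 0 → D w k) → Spn D f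
  Spn-nonzero ts eq h with prune ts
  ... | us , eq′ , al = us , All.map (λ {t} ne → h (proj₁ t) (proj₁ (proj₂ t)) ne) al , λ u e → trans (eq u e) (sym (lin-val (λ w k → p u w (e - k)) us ts eq′))

  Spn-∧ : ∀ {D D′ : W → ℤ → Set} {f} → Spn D f → Spn D′ f → Spn (λ w k → D w k × D′ w k) f
  Spn-∧ {f = f} S@(ts , al , eq) S′ = Spn-nonzero ts eq (λ w k ne → Spn-coef S ts eq w k ne , Spn-coef S′ ts eq w k ne)

  Spn-cong : ∀ {D f f′} → f ≗F f′ → Spn D f → Spn D f′
  Spn-cong q (ts , al , eq) = ts , al , λ u e → trans (sym (q u e)) (eq u e)

  Spn-mono : ∀ {D D′ : W → ℤ → Set} {f} → (∀ w k → D w k → D′ w k) → Spn D f → Spn D′ f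
  Spn-mono h (ts , al , eq) = ts , All.map (λ {t} → h (proj₁ t) (proj₁ (proj₂ t))) al , eq

  Spn-0 : ∀ {D} → Spn D (λ _ _ → + 0)
  Spn-0 = [] , [] , λ _ _ → refl

  Spn-+ : ∀ {D f f′} → Spn D f → Spn D f′ → Spn D (λ u e → f u e + f′ u e)
  Spn-+ (ts , al , eq) (us , al′ , eq′) = ts ++ us , All.++⁺ al al′ , λ u e → trans (cong₂ _+_ (eq u e) (eq′ u e)) (sym (lin-++ _ ts us))

  Spn-* : ∀ {D f} a → Spn D f → Spn D (λ u e → a * f u e)
  Spn-* {D} a (ts , al , eq) = scale a ts , All.map⁺ (All.map (λ z → z) al) , λ u e → trans (cong (_*_ a) (eq u e)) (sym (lin-scale a _ ts))

  Spn-neg : ∀ {D f} → Spn D f → Spn D (λ u e → - f u e)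
  Spn-neg S = Spn-cong (λ u e → ℤ.-1*i≡-i _) (Spn-* -1ℤ S)

  Spn-one : ∀ {D} w k → D w k → Spn D (λ u e → p u w (e - k))
  Spn-one w k d = (w , k , + 1) ∷ [] , d ∷ [] , λ u e → sym (trans (+-identityʳ _) (*-identityˡ _))

  Spn-pf : ∀ {D} w → D w (+ 0) → Spn D (pf w)
  Spn-pf w d = Spn-cong (λ u e → cong (p u w) (+-identityʳ e)) (Spn-one w (+ 0) d)

  Spn-Σ : ∀ {D} ys (f : W → F) → (∀ y → y ∈ ys → Spn D (f y)) → Spn D (λ u e → Σl ys (λ y → f y u e))
  Spn-Σ [] f h = Spn-0
  Spn-Σ (y ∷ ys) f h = Spn-+ (h y (here refl)) (Spn-Σ ys f (λ z i → h z (there i)))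

  Spn-lin : ∀ {D D′ : W → ℤ → Set} (G : W → ℤ → F) → (∀ w k → D w k → Spn D′ (G w k)) → ∀ ts → All (λ t → D (proj₁ t) (proj₁ (proj₂ t))) ts →
    Spn D′ (λ u e → lin (λ w k → G w k u e) ts)
  Spn-lin G h [] _ = Spn-0
  Spn-lin G h ((w , k , c) ∷ ts) (d ∷ al) = Spn-+ (Spn-* c (h w k d)) (Spn-lin G h ts al)

  -- left and right edges of the W-graph
  LE RE : Gen → W → W → Set
  LE g y w = lb g y ≡ true × (y ≡ l g w ⊎ m y w ≢ + 0)
  RE g y w = LE g (inv y) (inv w)

  edges : Gen → W → List Tm
  edges g w = (l g w , + 0 , + 1) ∷ map (λ y → y , + 0 , (if lb g y then m y w else + 0)) (ball (ℓ w))

  private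
    lin-map : ∀ φ (c : W → ℤ) ys → lin φ (map (λ y → y , + 0 , c y) ys) ≡ Σl ys (λ y → c y * φ y (+ 0))
    lin-map φ c [] = refl
    lin-map φ c (y ∷ ys) = cong (_+_ (c y * φ y (+ 0))) (lin-map φ c ys)

    if-* : ∀ b a x → (if b then a else + 0) * x ≡ (if b then a * x else + 0)
    if-* true a x = refl
    if-* false a x = refl

  C-edges : ∀ g w → lb g w ≡ false → C g (pf w) ≗F ⟦ edges g w ⟧
  C-edges g w b u e = trans (C-up g w b u e) (sym (cong₂ _+_ (trans (*-identityˡ _) (cong (p u (l g w)) (+-identityʳ e)))
    (trans (lin-map (λ w k → p u w (e - k)) (λ y → if lb g y then m y w else + 0) (ball (ℓ w))) (Σl-cong (ball (ℓ w)) (λ y → trans (if-* (lb g y) (m y w) _) (cong (λ z → if lb g y then m y w * p u y z else + 0) (+-identityʳ e)))))))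

  val-edges : ∀ g w y → val (edges g w) y (+ 0) ≡ kr y (+ 0) (l g w) (+ 0) + (if lb g y then m y w else + 0)
  val-edges g w y = cong₂ _+_ (*-identityˡ (kr y (+ 0) (l g w) (+ 0))) (trans (lin-map (kr y (+ 0)) cf (ball (ℓ w))) (trans
    (Σl-single (ball (ℓ w)) (λ z → cf z * kr y (+ 0) z (+ 0)) y (ball-unique (ℓ w)) mem (λ z ne → trans (cong (_*_ (cf z)) (kr-no₁ (+ 0) (+ 0) ne)) (*-zeroʳ (cf z))))
    (trans (cong (_*_ (cf y)) (kr-yes y (+ 0))) (*-identityʳ (cf y)))))
    where
    cf : W → ℤ
    cf y = if lb g y then m y w else + 0
    z′ : ∀ b → m y w ≡ + 0 → (if b then m y w else + 0) ≡ + 0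
    z′ true q = q
    z′ false q = refl
    mem : y ∈ ball (ℓ w) ⊎ cf y * kr y (+ 0) y (+ 0) ≡ + 0
    mem with ℓ y ℕ.≤? ℓ w
    ... | yes le = inj₁ (ball-complete (ℓ w) y le)
    ... | no gt = inj₂ (cong (_* kr y (+ 0) y (+ 0)) (z′ (lb g y) (m-long y w (<⇒≤ (≰⇒> gt)))))

  edge-nonzero : ∀ g w y → lb g w ≡ false → LE g y w → val (edges g w) y (+ 0) ≢ + 0
  edge-nonzero g w y b (by , e) z with y ≟W l g w
  ... | yes refl = one (trans (sym z) (trans (val-edges g w y) (cong₂ _+_ (kr-yes y (+ 0)) (trans (cong (λ b → if b then m y w else + 0) by)
    (m-long y w (≤-trans (n≤1+n _) (≤-reflexive (sym (ℓ-up g w b)))))))))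
    where
    one : + 0 ≢ + 1 + + 0
    one ()
  ... | no n with e
  ...   | inj₁ q = n q
  ...   | inj₂ ne = ne (trans (sym (trans (val-edges g w y) (trans (cong₂ _+_ (kr-no₁ (+ 0) (+ 0) (n ∘ sym)) (cong (λ b → if b then m y w else + 0) by)) (+-identityˡ _)))) z)

  edges-All : ∀ {D : W → ℤ → Set} g w k → lb g w ≡ false → (∀ y → LE g y w → D y k) → Spn D (λ u e → C g (pf w) u (e - k))
  edges-All {D} g w k b h = Spn-cong (λ u e → sym (C-up g w b u (e - k))) (Spn-+ (Spn-one (l g w) k (h _ (trans (lb-flip g w) (cong not b) , inj₁ refl)))
    (Spn-Σ (ball (ℓ w)) (λ y u e → if lb g y then m y w * p u y (e - k) else + 0) (λ y _ → one y (lb g y) refl)))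
    where
    one : ∀ y b → lb g y ≡ b → Spn D (λ u e → if b then m y w * p u y (e - k) else + 0)
    one y false _ = Spn-0
    one y true by with m y w ℤ.≟ + 0
    ... | yes z = Spn-cong (λ u e → sym (cong (_* p u y (e - k)) z)) Spn-0
    ... | no nz = Spn-* (m y w) (Spn-one y k (h y (by , inj₂ nz)))

  sub-sh : ∀ b e k → sh b (e - k) ≡ e - sh (not b) k
  sub-sh true e k = i e k
    where
    i : ∀ e k → -[1+ 0 ] + (e + - k) ≡ e + - (+ 1 + k)
    i = solve-∀
  sub-sh false e k = i e k
    where
    i : ∀ e k → + 1 + (e + - k) ≡ e + - (-[1+ 0 ] + k)
    i = solve-∀

  C-shift : ∀ g f k u e → C g (λ u e → f u (e - k)) u e ≡ C g f u (e - k)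
  C-shift g f k u e = cong (λ z → f (l g u) (e - k) + f u z) (sym (trans (sh-+ (lb g u) e (- k)) refl))

  Spn-C : ∀ {D D′ : W → ℤ → Set} g {f} → (∀ w k → D w k → lb g w ≡ true → D′ w (ℤ.suc k) × D′ w (ℤ.pred k)) →
    (∀ w k → D w k → lb g w ≡ false → ∀ y → LE g y w → D′ y k) → Spn D f → Spn D′ (C g f)
  Spn-C {D} {D′} g h₁ h₂ (ts , al , eq) = Spn-cong (λ u e → sym (trans (C-cong g eq u e) (lin-C g (λ w k u e → p u w (e - k)) ts u e)))
    (Spn-lin {D} (λ w k → C g (λ u e → p u w (e - k))) one ts al)
    where
    one : ∀ w k → D w k → Spn D′ (C g (λ u e → p u w (e - k)))
    one w k d with lb g w in b
    ... | false = Spn-cong (λ u e → sym (C-shift g (pf w) k u e)) (edges-All g w k b (h₂ w k d b))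
    ... | true = Spn-cong (λ u e → trans (cong₂ (λ x y → p u w x + p u w y) (sym (sub-sh true e k)) (sym (sub-sh false e k))) (trans (sym (C-down g w b u (e - k))) (sym (C-shift g (pf w) k u e))))
          (Spn-+ (Spn-one w (ℤ.suc k) (proj₁ (h₁ w k d b))) (Spn-one w (ℤ.pred k) (proj₂ (h₁ w k d b))))

  CR-inv : ∀ g f u e → CR g (λ u e → f (inv u) e) u e ≡ C g f (inv u) e
  CR-inv g f u e = cong (λ z → f z e + f (inv u) (sh (rb g u) e)) (inv-ρ g u)

  Spn-inv : ∀ {D f} → Spn D f → Spn (λ w k → D (inv w) k) (λ u e → f (inv u) e)
  Spn-inv {D} (ts , al , eq) = ι ts , All.map⁺ (All.map (λ {t} → subst (λ w → D w (proj₁ (proj₂ t))) (sym (inv-invol (proj₁ t)))) al) ,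
    λ u e → trans (eq (inv u) e) (trans (lin-cong (λ w k → p-inv u w (e - k)) ts) (sym (lin-ι (λ w k → p u w (e - k)) ts)))

  pf-inv : ∀ w u e → pf w u e ≡ pf (inv w) (inv u) e
  pf-inv w u e = sym (trans (p-inv u (inv w) e) (cong (λ z → p u z e) (inv-invol w)))

  CR-pf : ∀ g w u e → CR g (pf w) u e ≡ C g (pf (inv w)) (inv u) e
  CR-pf g w u e = trans (CR-cong g (pf-inv w) u e) (CR-inv g (pf (inv w)) u e)

  -- Extracts from any span containing C_w C_g a statement about each right neighbour of w;
  -- inversion reduces it to the explicit list `edges`.
  RE-coef : ∀ {D g y w} → rb g w ≡ false → RE g y w → Spn D (CR g (pf w)) → D y (+ 0)
  RE-coef {D} {g} {y} {w} b re S = subst (λ z → D z (+ 0)) (inv-invol y) (Spn-coef (Spn-inv S) (edges g (inv w))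
    (λ u e → trans (CR-pf g w (inv u) e) (trans (cong (λ z → C g (pf (inv w)) z e) (inv-invol u)) (C-edges g (inv w) b u e)))
    (inv y) (+ 0) (edge-nonzero g (inv w) (inv y) b re))

  CR-edges : ∀ {D : W → ℤ → Set} g w → (rb g w ≡ true → D w (+ 1) × D w -1ℤ) → (rb g w ≡ false → ∀ y → RE g y w → D y (+ 0)) → Spn D (CR g (pf w))
  CR-edges {D} g w h₁ h₂ = Spn-cong (λ u e → trans (cong (λ z → C g (pf (inv w)) (inv u) z) (+-identityʳ e)) (sym (CR-pf g w u e))) (Spn-mono (λ w k → subst (λ z → D z k) (inv-invol w)) (Spn-inv (go (rb g w) refl)))
    where
    go : ∀ b → rb g w ≡ b → Spn (λ w k → D (inv w) k) (λ u e → C g (pf (inv w)) u (e - + 0))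
    go false b = edges-All g (inv w) (+ 0) b (λ y le → h₂ b (inv y) (subst (λ z → LE g z (inv w)) (sym (inv-invol y)) le))
    go true b = Spn-cong (λ u e → trans (cong₂ (λ x y → p u (inv w) x + p u (inv w) y) (trans (i e) refl) (j e)) (sym (C-down g (inv w) b u (e - + 0))))
        (Spn-+ (Spn-one (inv w) (+ 1) (subst (λ z → D z (+ 1)) (sym (inv-invol w)) (proj₁ (h₁ b)))) (Spn-one (inv w) -1ℤ (subst (λ z → D z -1ℤ) (sym (inv-invol w)) (proj₂ (h₁ b)))))
      where
      i : ∀ e → e + - + 1 ≡ -[1+ 0 ] + (e + - + 0)
      i = solve-∀
      j : ∀ e → e + - -[1+ 0 ] ≡ + 1 + (e + - + 0)
      j = solve-∀

  foldr-lin : ∀ a (X : W → ℤ → F) ts → foldr T (λ u e → lin (λ w k → X w k u e) ts) a ≗F (λ u e → lin (λ w k → foldr T (X w k) a u e) ts)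
  foldr-lin [] X ts u e = refl
  foldr-lin (g ∷ a) X ts u e = trans (T-cong g (foldr-lin a X ts) u e) (lin-T g (λ w k → foldr T (X w k) a) ts u e)

  foldr-shift : ∀ a f k → foldr T (λ u e → f u (e - k)) a ≗F (λ u e → foldr T f a u (e - k))
  foldr-shift [] f k u e = refl
  foldr-shift (g ∷ a) f k u e = trans (T-cong g (foldr-shift a f k) u e) (cong₂ (λ x y → x + - y) (C-shift g (foldr T f a) k u e) (cong (foldr T f a u) (trans (sym (sub-sh′ e k)) refl)))
    where
    sub-sh′ : ∀ e k → + 1 + (e + - k) ≡ + 1 + e + - k
    sub-sh′ = solve-∀

  -- Multiplication of f from the left by the Hecke algebra element `ts`, both given in the basis
  -- T̃.
  OP : List Tm → F → F
  OP ts f u e = lin (λ w k → Top w f u (e - k)) ts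

  OP-val : ∀ ts ts′ f → val ts ≗F val ts′ → OP ts f ≗F OP ts′ f
  OP-val ts ts′ f q u e = lin-val _ ts ts′ q

  OP-cong : ∀ ts {f f′} → f ≗F f′ → OP ts f ≗F OP ts f′
  OP-cong ts q u e = lin-cong (λ w k → foldr-cong T T-cong (word w) q u (e - k)) ts

  OP-C : ∀ g ts us → OP (cL g ts) (val us) ≗F C g (OP ts (val us))
  OP-C g ts us u e = trans (lin-cL g (λ w k → Top w (val us) u (e - k)) ts) (trans (lin-cong one ts)
    (lin-+ (λ w k → Top w (val us) (l g u) (e - k)) (λ w k → Top w (val us) u (sh (lb g u) e - k)) ts))
    where
    one : ∀ w k → Top (l g w) (val us) u (e - k) + Top w (val us) u (e - sh (not (lb g w)) k) ≡ Top w (val us) (l g u) (e - k) + Top w (val us) u (sh (lb g u) e - k)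
    one w k = trans (cong (λ z → Top (l g w) (val us) u (e - k) + Top w (val us) u z) (sym (sub-sh (lb g w) e k)))
      (trans (sym (C-Top g w us u (e - k))) (cong (λ z → Top w (val us) (l g u) (e - k) + Top w (val us) u z) (sh-+ (lb g u) e (- k))))

  OP-up : ∀ g x us → lb g x ≡ false → ∀ u e → OP (kl (l g x)) (val us) u e ≡ C g (OP (kl x) (val us)) u e + - Σl (ball (ℓ x)) (λ y → if lb g y then m y x * OP (kl y) (val us) u e else + 0)
  OP-up g x us b u e = trans (i _ _) (cong (_+ - Σl (ball (ℓ x)) (λ y → if lb g y then m y x * OP (kl y) (val us) u e else + 0))
    (trans (sym (trans (lin-++ _ (kl (l g x)) (klsum g x)) (cong (_+_ (OP (kl (l g x)) (val us) u e)) (lin-klsum g x _))))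
      (trans (OP-val (kl (l g x) ++ klsum g x) (cL g (kl x)) (val us) v u e) (OP-C g (kl x) us u e))))
    where
    i : ∀ a b → a ≡ a + b + - b
    i = solve-∀
    v : val (kl (l g x) ++ klsum g x) ≗F val (cL g (kl x))
    v u e = trans (lin-++ _ (kl (l g x)) (klsum g x)) (trans (cong (_+_ (p u (l g x) e)) (lin-klsum g x (kr u e))) (trans (sym (C-up g x b u e)) (sym (val-cL g (kl x) u e))))

  word-1 : word 1W ≡ []
  word-1 = h (word 1W) (trans (length-word 1W) ℓ-1)
    where
    h : ∀ w → length w ≡ 0 → w ≡ []
    h [] _ = refl

  kl-1 : pf 1W ≗F kδ 1W (+ 0)
  kl-1 u e = trans (cong (p u 1W) (sym (+-identityʳ e))) (p-tri u 1W e (+ 0) (subst (_≤ ℓ u) (sym ℓ-1) z≤n))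

  unit : List Tm
  unit = (1W , + 0 , + 1) ∷ []

  val-unit : val unit ≗F kδ 1W (+ 0)
  val-unit u e = trans (+-identityʳ _) (*-identityˡ _)

  OP-1 : ∀ f → OP (kl 1W) f ≗F f
  OP-1 f u e = trans (OP-val (kl 1W) unit f (λ u e → trans (kl-1 u e) (sym (val-unit u e))) u e) (trans (+-identityʳ _) (trans (*-identityˡ _)
    (trans (cong (λ a → foldr T f a u (e - + 0)) word-1) (cong (f u) (+-identityʳ e)))))

  OP-unit : ∀ ts → OP ts (kδ 1W (+ 0)) ≗F val ts
  OP-unit ts u e = lin-cong (λ w k → trans (T*-1 (word w) (+ 0) (Red-word w) u (e - k)) (trans (cong (λ z → kr u (e - k) z (+ 0)) (ev-word w))
    (kr-iff (λ q z → q , sym (i-j≡0⇒i≡j e k (sym z))) (λ q z → q , trans (sym (+-inverseʳ e)) (cong (λ k → e - k) (sym z)))))) ts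

  Spn-shift : ∀ {D D′ : W → ℤ → Set} {f} k → (∀ w j → D w j → D′ w (j + k)) → Spn D f → Spn D′ (λ u e → f u (e - k))
  Spn-shift {D} {D′} k h (ts , al , eq) = Spn-cong (λ u e → sym (eq u (e - k))) (Spn-lin {D} (λ w j u e → p u w (e - k - j)) (λ w j d → Spn-cong (λ u e → cong (p u w) (i e k j)) (Spn-one w (j + k) (h w j d))) ts al)
    where
    i : ∀ e k j → e + - (j + k) ≡ e + - k + - j
    i = solve-∀

  module _ (g : Gen) (us : List Tm) where
    private
      f : F
      f = val us

    Top-right : ∀ w → rb g w ≡ false → Top (ρ g w) f ≗F Top w (T g f)
    Top-right w b u e = trans (T*-indep (word (ρ g w)) (word w ++ g ∷ []) us (Red-word (ρ g w))
        (trans (List.length-++ (word w)) (trans (ℕ.+-comm (length (word w)) 1) (trans (cong suc (length-word w)) (trans (sym (ℓρ-up g w b)) (cong ℓ (sym evw))))))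
        (trans (ev-word (ρ g w)) (sym evw)) u e) (cong (λ h → h u e) (List.foldr-++ T f (word w) (g ∷ [])))
      where
      evw : ev (word w ++ g ∷ []) ≡ ρ g w
      evw = trans (ev-++[] (word w) g) (cong (ρ g) (ev-word w))

    Top-+ : ∀ a (h h′ : F) → foldr T (λ u e → h u e + h′ u e) a ≗F (λ u e → foldr T h a u e + foldr T h′ a u e)
    Top-+ [] h h′ u e = refl
    Top-+ (x ∷ a) h h′ u e = trans (T-cong x (Top-+ a h h′) u e) (i (A (l x u) e) (B′ (l x u) e) (A u (sh (lb x u) e)) (B′ u (sh (lb x u) e)) (A u (ℤ.suc e)) (B′ u (ℤ.suc e)))
      where
      A B′ : F
      A = foldr T h a
      B′ = foldr T h′ a
      i : ∀ a b c d x y → a + b + (c + d) + - (x + y) ≡ a + c + - x + (b + d + - y)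
      i = solve-∀

    Top-sh : ∀ a b (h : F) → foldr T (λ u e → h u (sh b e)) a ≗F (λ u e → foldr T h a u (sh b e))
    Top-sh [] b h u e = refl
    Top-sh (x ∷ a) b h u e = trans (T-cong x (Top-sh a b h) u e) (cong₂ (λ y z → y + - z) (C-sh x b (foldr T h a) u e) (cong (foldr T h a u) (sh-comm b false e)))

    C-T : ∀ (h : F) → C g h ≗F (λ u e → T g h u e + h u (sh false e))
    C-T h u e = i _ _
      where
      i : ∀ a b → a ≡ a + - b + b
      i = solve-∀

    Top-C : ∀ w u e → Top w (C g f) u e ≡ Top (ρ g w) f u e + Top w f u (sh (rb g w) e)
    Top-C w u e with rb g w in b
    ... | false = trans (foldr-cong T T-cong (word w) (C-T f) u e) (trans (Top-+ (word w) (T g f) (λ u e → f u (sh false e)) u e)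
          (cong₂ _+_ (sym (Top-right w b u e)) (Top-sh (word w) false f u e)))
    ... | true = trans (up (C g f) (Top-right′ (C g f) (cL g us) (λ u e → sym (val-cL g us u e))) u e)
        (trans (foldr-cong T T-cong (word w′) TC u e) (trans (Top-+ (word w′) f (λ u e → T g f u (ℤ.pred e)) u e)
        (cong (_+_ (Top w′ f u e)) (trans (Top-sh (word w′) true (T g f) u e) (sym (up f (Top-right w′ b′) u (ℤ.pred e)))))))
      where
      w′ : W
      w′ = ρ g w
      b′ : rb g w′ ≡ false
      b′ = trans (rb-flip g w) (cong not b)
      up : ∀ h → Top (ρ g w′) h ≗F Top w′ (T g h) → Top w h ≗F Top w′ (T g h)
      up h q u e = trans (cong (λ z → Top z h u e) (sym (ρ-invol g w))) (q u e)
      Top-right′ : ∀ h us′ → h ≗F val us′ → Top (ρ g w′) h ≗F Top w′ (T g h)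
      Top-right′ h us′ q u e = trans (foldr-cong T T-cong (word (ρ g w′)) q u e) (trans (tr us′ u e) (foldr-cong T T-cong (word w′) (T-cong g (λ u e → sym (q u e))) u e))
        where
        tr : ∀ us′ → Top (ρ g w′) (val us′) ≗F Top w′ (T g (val us′))
        tr us′ u e = trans (T*-indep (word (ρ g w′)) (word w′ ++ g ∷ []) us′ (Red-word (ρ g w′))
            (trans (List.length-++ (word w′)) (trans (ℕ.+-comm (length (word w′)) 1) (trans (cong suc (length-word w′)) (trans (sym (ℓρ-up g w′ b′)) (cong ℓ (sym evw))))))
            (trans (ev-word (ρ g w′)) (sym evw)) u e) (cong (λ h → h u e) (List.foldr-++ T (val us′) (word w′) (g ∷ [])))
          where
          evw : ev (word w′ ++ g ∷ []) ≡ ρ g w′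
          evw = trans (ev-++[] (word w′) g) (cong (ρ g) (ev-word w′))
      TC : T g (C g f) ≗F (λ u e → f u e + T g f u (ℤ.pred e))
      TC u e = trans (cong (_+ - C g f u (ℤ.suc e)) (C-quad g f u e)) (trans (i (C g f u (ℤ.pred e)) (C g f u (ℤ.suc e)) (f u e)) (cong (λ z → f u e + (C g f u (ℤ.pred e) + - f u z)) (sym (ℤ.suc-pred e))))
        where
        i : ∀ a b c → a + b + - b ≡ c + (a + - c)
        i = solve-∀

  cR : Gen → List Tm → List Tm
  cR g [] = []
  cR g ((w , k , c) ∷ ts) = (ρ g w , k , c) ∷ (w , sh (not (rb g w)) k , c) ∷ cR g ts

  lin-cR : ∀ g φ ts → lin φ (cR g ts) ≡ lin (λ w k → φ (ρ g w) k + φ w (sh (not (rb g w)) k)) ts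
  lin-cR g φ [] = refl
  lin-cR g φ ((w , k , c) ∷ ts) = trans (cong (λ z → c * φ (ρ g w) k + (c * φ w (sh (not (rb g w)) k) + z)) (lin-cR g φ ts)) (i c _ _ _)
    where
    i : ∀ c a b x → c * a + (c * b + x) ≡ c * (a + b) + x
    i = solve-∀

  val-cR : ∀ g ts → val (cR g ts) ≗F CR g (val ts)
  val-cR g ts u e = trans (lin-cR g (kr u e) ts) (trans (lin-cong (λ w k → sym (CR-kδ g w k u e)) ts) (lin-+ (λ w k → kr (ρ g u) e w k) (λ w k → kr u (sh (rb g u) e) w k) ts))

  -- Associativity with C_g in the middle; it lets an induction on the right factor hand a generator
  -- over to the left one.
  OP-R : ∀ g ts us → OP (cR g ts) (val us) ≗F OP ts (C g (val us))
  OP-R g ts us u e = trans (lin-cR g (λ w k → Top w (val us) u (e - k)) ts) (lin-cong (λ w k → trans (cong (λ z → Top (ρ g w) (val us) u (e - k) + Top w (val us) u z) (sym (sub-sh (rb g w) e k))) (sym (Top-C g us w u (e - k)))) ts)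

 -- The prefix of an element is invariant along right edges.

 module RightTypes where
  open Coxeter
  open FormalSums
  open Hecke
  open ReducedWords
  open KLPolynomials
  open StarOperations
  open KLSpans
  open Descents
  open Automaton using (bit; Q∀)
  open Defs using (r; s; t)

  l-inj : ∀ g {x y} → l g x ≡ l g y → x ≡ y
  l-inj g {x} {y} q = trans (l≡-sym g q) (l-invol g y)

  J-Str : ∀ {σ y} → J σ y → Str s (c σ) y
  J-Str j = str (proj₂ j) (J-c j) (J-s-down j) (J1-s j) (J2-c j) (J-csc j)

  J1-Str : ∀ {σ y} → J σ y → Str (a σ) s (lev σ l1 y)
  J1-Str j = str (J1-a j) (J1-s j) (J1-a-down j) (J2-a j) (J3-s j) (J-sasc j)

  K-Str : ∀ σ {y} → K2 y → Str (a σ) s y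
  K-Str σ k = str (K-a σ k) (K-s σ k) (K-a-down σ k) (K1-a σ k) (K2-s σ k) (K-sas σ k)

  -- `star-13` turns this into m(scx, y). Since a is a descent of y and not of scx, nonvanishing
  -- would mean y = ascx; but s is a descent of y and not of ascx.
  J-m13 : ∀ {σ x y} → J σ x → J σ y → m x (lev σ l2 y) ≡ + 0
  J-m13 {σ} {x} {y} jx jy = trans (star-13 (J-Str jx) (J-Str jy))
    (m-descent (a σ) (lev σ l2 x) y (proj₁ jy) (J2-a jx) (λ q → bool-clash (proj₂ jy) (trans (cong (lb s) (sym q)) (J3-s jx))))

  -- No correction occurs: an x with descent c lacks a or s by `not-three`, so m(x,y) ≠ 0 would give
  -- x = ay or x = sy, and neither of these has c as descent.
  C-lev1 : ∀ {σ y} → J σ y → C (c σ) (pf y) ≗F pf (lev σ l1 y)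
  C-lev1 {σ} {y} j u e = trans (C-up (c σ) y (J-c j) u e) (trans (cong (_+_ (p u (lev σ l1 y) e)) (S-none (c σ) y u e (λ x cx → inj₁ (go x cx (lb (a σ) x) refl (lb s x) refl)))) (+-identityʳ _))
    where
    go : ∀ x → lb (c σ) x ≡ true → ∀ b → lb (a σ) x ≡ b → ∀ b′ → lb s x ≡ b′ → m x y ≡ + 0
    go x cx true ax true sx = ⊥-elim (not-three σ x ax sx cx)
    go x cx false ax _ _ = m-descent (a σ) x y (proj₁ j) ax (λ q → bool-clash cx (trans (cong (lb (c σ)) (l≡-sym (a σ) q)) (J-a-down j)))
    go x cx true ax false sx = m-descent s x y (proj₂ j) sx (λ q → bool-clash cx (trans (cong (lb (c σ)) (l≡-sym s q)) (J-s-down j)))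

  C-lev2 : ∀ {σ y} → J σ y → C s (pf (lev σ l1 y)) ≗F (λ u e → pf (lev σ l2 y) u e + pf y u e)
  C-lev2 {σ} {y} j u e = trans (C-up s (lev σ l1 y) (J1-s j) u e) (cong (_+_ (p u (lev σ l2 y) e)) (trans
      (S-one s (lev σ l1 y) u e y (proj₂ j) (λ x ne sx → inj₁ (go x ne sx (lb (a σ) x) refl (lb (c σ) x) refl)))
      (trans (cong (_* p u y e) (m-up (c σ) y (J-c j))) (*-identityˡ _))))
    where
    go : ∀ x → x ≢ y → lb s x ≡ true → ∀ b → lb (a σ) x ≡ b → ∀ b′ → lb (c σ) x ≡ b′ → m x (lev σ l1 y) ≡ + 0
    go x ne sx true ax true cx = ⊥-elim (not-three σ x ax sx cx)
    go x ne sx false ax _ _ = m-descent (a σ) x _ (J1-a j) ax (λ q → bool-clash sx (trans (cong (lb s) (l≡-sym (a σ) q)) (J1-a-down j)))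
    go x ne sx true ax false cx = m-descent (c σ) x _ (J1-c j) cx (λ q → ne (l-inj (c σ) q))

  C-lev3 : ∀ {σ y} → J σ y → C (a σ) (pf (lev σ l2 y)) ≗F (λ u e → pf (lev σ l3 y) u e + pf (lev σ l1 y) u e)
  C-lev3 {σ} {y} j u e = trans (C-up (a σ) (lev σ l2 y) (J2-a j) u e) (cong (_+_ (p u (lev σ l3 y) e)) (trans
      (S-one (a σ) (lev σ l2 y) u e (lev σ l1 y) (J1-a j) (λ x ne ax → inj₁ (go x ne ax (lb s x) refl)))
      (trans (cong (_* p u (lev σ l1 y) e) (m-up s (lev σ l1 y) (J1-s j))) (*-identityˡ _))))
    where
    go : ∀ x → x ≢ lev σ l1 y → lb (a σ) x ≡ true → ∀ b → lb s x ≡ b → m x (lev σ l2 y) ≡ + 0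
    go x ne ax true sx = J-m13 (ax , sx) j
    go x ne ax false sx = m-descent s x _ (J2-s j) sx (λ q → ne (l-inj s q))

  -- the elements of the Hecke algebra with X σ i · C_y = C_{lev σ i y}
  module _ (σ : Side) where

    X1 X2′ X3 : F → F
    X1 f = C (c σ) f
    X2′ f u e = C s (X1 f) u e + - f u e
    X3 f u e = C (a σ) (X2′ f) u e + - X1 f u e

    X : Lv → F → F
    X l0 f = f
    X l1 f = X1 f
    X l2 f = X2′ f
    X l3 f = X3 f

    private
      cong1 : ∀ {f f′} → f ≗F f′ → X1 f ≗F X1 f′
      cong1 q = C-cong (c σ) q
      cong2 : ∀ {f f′} → f ≗F f′ → X2′ f ≗F X2′ f′
      cong2 q u e = cong₂ (λ x y → x + - y) (C-cong s (cong1 q) u e) (q u e)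

    X-cong : ∀ i {f f′} → f ≗F f′ → X i f ≗F X i f′
    X-cong l0 q = q
    X-cong l1 q = cong1 q
    X-cong l2 q = cong2 q
    X-cong l3 q u e = cong₂ (λ x y → x + - y) (C-cong (a σ) (cong2 q) u e) (cong1 q u e)

    private
      pf2 : ∀ {y} → J σ y → X2′ (pf y) ≗F pf (lev σ l2 y)
      pf2 {y} j u e = trans (cong (_+ - p u y e) (trans (C-cong s (C-lev1 j) u e) (C-lev2 j u e))) (cancel _ _)

    X-pf : ∀ i {y} → J σ y → X i (pf y) ≗F pf (lev σ i y)
    X-pf l0 j u e = refl
    X-pf l1 j = C-lev1 j
    X-pf l2 j = pf2 j
    X-pf l3 j u e = trans (cong₂ (λ x z → x + - z) (trans (C-cong (a σ) (pf2 j) u e) (C-lev3 j u e)) (C-lev1 j u e)) (cancel _ _)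

    lin-sub : ∀ (φ ψ : F) ts → lin φ ts + - lin ψ ts ≡ lin (λ w k → φ w k + - ψ w k) ts
    lin-sub φ ψ ts = sym (trans (lin-+ φ (λ w k → - ψ w k) ts) (cong (_+_ (lin φ ts)) (lin-neg ψ ts)))

    private
      lin2 : ∀ (G : W → ℤ → F) ts → X2′ (λ u e → lin (λ w k → G w k u e) ts) ≗F (λ u e → lin (λ w k → X2′ (G w k) u e) ts)
      lin2 G ts u e = trans (cong (_+ - lin (λ w k → G w k u e) ts) (trans (C-cong s (lin-C (c σ) G ts) u e) (lin-C s (λ w k → X1 (G w k)) ts u e))) (lin-sub _ _ ts)

    X-lin : ∀ i (G : W → ℤ → F) ts → X i (λ u e → lin (λ w k → G w k u e) ts) ≗F (λ u e → lin (λ w k → X i (G w k) u e) ts)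
    X-lin l0 G ts u e = refl
    X-lin l1 G ts u e = lin-C (c σ) G ts u e
    X-lin l2 G ts u e = lin2 G ts u e
    X-lin l3 G ts u e = trans (cong₂ (λ x y → x + - y) (trans (C-cong (a σ) (lin2 G ts) u e) (lin-C (a σ) (λ w k → X2′ (G w k)) ts u e)) (lin-C (c σ) G ts u e)) (lin-sub _ _ ts)

    private
      shift2 : ∀ f k → X2′ (λ u e → f u (e - k)) ≗F (λ u e → X2′ f u (e - k))
      shift2 f k u e = cong (_+ - f u (e - k)) (trans (C-cong s (C-shift (c σ) f k) u e) (C-shift s (X1 f) k u e))

    X-shift : ∀ i f k → X i (λ u e → f u (e - k)) ≗F (λ u e → X i f u (e - k))
    X-shift l0 f k u e = refl
    X-shift l1 f k u e = C-shift (c σ) f k u e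
    X-shift l2 f k u e = shift2 f k u e
    X-shift l3 f k u e = cong₂ (λ x y → x + - y) (trans (C-cong (a σ) (shift2 f k) u e) (C-shift (a σ) (X2′ f) k u e)) (C-shift (c σ) f k u e)

    private
      CR1 : ∀ g f → CR g (X1 f) ≗F X1 (CR g f)
      CR1 g f u e = sym (C-CR (c σ) g f u e)
      CR2 : ∀ g f → CR g (X2′ f) ≗F X2′ (CR g f)
      CR2 g f u e = trans (CR-sub g (C s (X1 f)) f u e) (cong (_+ - CR g f u e) (trans (sym (C-CR s g (X1 f) u e)) (C-cong s (CR1 g f) u e)))

    X-CR : ∀ i g f → CR g (X i f) ≗F X i (CR g f)
    X-CR l0 g f u e = refl
    X-CR l1 g f = CR1 g f
    X-CR l2 g f = CR2 g f
    X-CR l3 g f u e = trans (CR-sub g (C (a σ) (X2′ f)) (X1 f) u e) (cong₂ (λ x y → x + - y) (trans (sym (C-CR (a σ) g (X2′ f) u e)) (C-cong (a σ) (CR2 g f) u e)) (CR1 g f u e))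

  Ty : Side → Lv → W → Set
  Ty σ i z = ∃ λ y → J σ y × z ≡ lev σ i y

  Ty-4 : ∀ {σ i z} → Ty σ i z → aW z ≡ 4
  Ty-4 {i = i} (y , j , refl) = aW-lev j i

  X-Spn : ∀ {σ} i {f} → Spn (λ w _ → J σ w) f → Spn (λ z _ → Ty σ i z) (X σ i f)
  X-Spn {σ} i (ts , al , eq) = Spn-cong (λ u e → sym (trans (X-cong σ i eq u e) (X-lin σ i (λ w k u e → p u w (e - k)) ts u e)))
    (Spn-lin {λ w _ → J σ w} (λ w k → X σ i (λ u e → p u w (e - k))) (λ w k j → Spn-cong (λ u e → trans (sym (X-pf σ i j u (e - k))) (sym (X-shift σ i (pf w) k u e))) (Spn-one (lev σ i w) k (w , j , refl))) ts al)

  -- If h were lost along the edge, m(y′,y) ≠ 0 would force hy′ = y. As g is a right descent of y′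
  -- but not of y, this gives hy′ = y′g, and then h would be a left descent of y′ after all.
  RE-desc : ∀ {g h y y′} → RE g y′ y → rb g y ≡ false → lb h y ≡ true → lb h y′ ≡ true
  RE-desc {g} {h} {y} {y′} (by , inj₁ q) b hy with trans (sym (inv-invol y′)) (trans (cong inv q) (trans (inv-l g (inv y)) (cong (ρ g) (inv-invol y))))
  ... | refl with lb-ρ h g y
  ...   | inj₁ e = trans e hy
  ...   | inj₂ e = bool-clash hy (trans (lb≡rb h g y e) b)
  RE-desc {g} {h} {y} {y′} (by , inj₂ ne) b hy with lb h y′ in hy′
  ... | true = refl
  ... | false with l h y′ ≟W y
  ...   | no n = ⊥-elim (ne (trans (m-inv y′ y) (m-descent h y′ y hy hy′ n)))
  ...   | yes refl with rb-l h g y′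
  ...     | inj₁ e = bool-clash by (trans (sym e) b)
  ...     | inj₂ e = bool-clash by (trans (sym (lb≡rb h g y′ e)) hy′)

  -- C_w C_g = X_i (C_y C_g), because X_i acts on the left. By `RE-desc` the product C_y C_g
  -- involves only elements with a and s as descents, and X_i sends their basis elements to basis
  -- elements of type i.
  RE-ty : ∀ {g σ i z w} → Ty σ i w → rb g w ≡ false → RE g z w → Ty σ i z
  RE-ty {g} {σ} {i} {z} (y , j , refl) b re = RE-coef b re (Spn-cong (λ u e → trans (sym (X-CR σ i g (pf y) u e)) (CR-cong g (X-pf σ i j) u e))
    (X-Spn i (CR-edges g y (λ _ → j , j) (λ b y′ re′ → RE-desc re′ b (proj₁ j) , RE-desc re′ b (proj₂ j)))))

  RE-4 : ∀ {g z w} → aW w ≡ 4 → rb g w ≡ false → RE g z w → aW z ≡ 4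
  RE-4 {w = w} e b re with decompose4 w e
  ... | dec4 σ i y j eq = Ty-4 {σ} {i} (RE-ty {i = i} (y , j , eq) b re)

  LE→RE : ∀ {g z w} → LE g z w → RE g (inv z) (inv w)
  LE→RE {g} {z} {w} le = subst₂ (LE g) (sym (inv-invol z)) (sym (inv-invol w)) le

  rb-inv : ∀ g w → rb g (inv w) ≡ lb g w
  rb-inv g w = cong (lb g) (inv-invol w)

  LE-4 : ∀ {g z w} → aW w ≡ 4 → lb g w ≡ false → LE g z w → aW z ≡ 4
  LE-4 {g} {z} {w} e b le = trans (sym (aW-inv z)) (RE-4 (trans (aW-inv w) e) (trans (rb-inv g w) b) (LE→RE le))

  Spn-C4 : ∀ g {f} → Spn (λ w _ → aW w ≡ 4) f → Spn (λ w _ → aW w ≡ 4) (C g f)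
  Spn-C4 g = Spn-C g (λ w k d _ → d , d) (λ w k d b y le → LE-4 d b le)

  CR-shift : ∀ g f k u e → CR g (λ u e → f u (e - k)) u e ≡ CR g f u (e - k)
  CR-shift g f k u e = cong (λ z → f (ρ g u) (e - k) + f u z) (sym (sh-+ (rb g u) e (- k)))

  lin-CR : ∀ g (G : W → ℤ → F) ts → CR g (λ u e → lin (λ w k → G w k u e) ts) ≗F (λ u e → lin (λ w k → CR g (G w k) u e) ts)
  lin-CR g G ts u e = sym (lin-+ (λ w k → G w k (ρ g u) e) (λ w k → G w k u (sh (rb g u) e)) ts)

  Spn-CR4 : ∀ g {f} → Spn (λ w _ → aW w ≡ 4) f → Spn (λ w _ → aW w ≡ 4) (CR g f)
  Spn-CR4 g (ts , al , eq) = Spn-cong (λ u e → sym (trans (CR-cong g eq u e) (lin-CR g (λ w k u e → p u w (e - k)) ts u e)))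
    (Spn-lin {λ w _ → aW w ≡ 4} (λ w k → CR g (λ u e → p u w (e - k))) (λ w k d → Spn-cong (λ u e → sym (CR-shift g (pf w) k u e))
      (Spn-shift {λ w _ → aW w ≡ 4} k (λ _ _ d → d) (CR-edges g w (λ _ → d , d) (λ b y re → RE-4 d b re)))) ts al)

  S-split : ∀ {D : W → ℤ → Set} g w y₀ → lb g y₀ ≡ true → (∀ y → y ≢ y₀ → lb g y ≡ true → m y w ≢ + 0 → D y (+ 0)) →
    Spn D (λ u e → S g w u e + - (m y₀ w * p u y₀ e))
  S-split {D} g w y₀ b h = Spn-cong (λ u e → sym (trans (cong (_+ - (m y₀ w * p u y₀ e)) (trans (Σl-cong (ball (ℓ w)) (split u e)) (trans (Σl-+ (ball (ℓ w)) (f₀ u e) (f₁ u e))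
      (cong (_+ Σl (ball (ℓ w)) (f₁ u e)) (at u e))))) (i (m y₀ w * p u y₀ e) (Σl (ball (ℓ w)) (f₁ u e)))))
    (Spn-Σ (ball (ℓ w)) (λ y u e → f₁ u e y) (λ y _ → one y))
    where
    i : ∀ a b → a + b + - a ≡ b
    i = solve-∀
    trm : W → ℤ → W → ℤ
    trm u e y = if lb g y then m y w * p u y e else + 0
    f₀ f₁ : W → ℤ → W → ℤ
    f₀ u e y with y ≟W y₀
    ... | yes _ = trm u e y
    ... | no _ = + 0
    f₁ u e y with y ≟W y₀
    ... | yes _ = + 0
    ... | no _ = trm u e y
    split : ∀ u e y → trm u e y ≡ f₀ u e y + f₁ u e y
    split u e y with y ≟W y₀
    ... | yes _ = sym (+-identityʳ _)
    ... | no _ = sym (+-identityˡ _)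
    at₀ : ∀ u e → f₀ u e y₀ ≡ m y₀ w * p u y₀ e
    at₀ u e with y₀ ≟W y₀
    ... | yes _ = cong (λ b → if b then m y₀ w * p u y₀ e else + 0) b
    ... | no n = ⊥-elim (n refl)
    at : ∀ u e → Σl (ball (ℓ w)) (f₀ u e) ≡ m y₀ w * p u y₀ e
    at u e = trans (Σl-single (ball (ℓ w)) (f₀ u e) y₀ (ball-unique (ℓ w)) mem off) (at₀ u e)
      where
      off : ∀ y → y ≢ y₀ → f₀ u e y ≡ + 0
      off y n with y ≟W y₀
      ... | yes q = ⊥-elim (n q)
      ... | no _ = refl
      mem : y₀ ∈ ball (ℓ w) ⊎ f₀ u e y₀ ≡ + 0
      mem with ℓ y₀ ℕ.≤? ℓ w
      ... | yes le = inj₁ (ball-complete (ℓ w) y₀ le)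
      ... | no gt = inj₂ (trans (at₀ u e) (cong (_* p u y₀ e) (m-long y₀ w (<⇒≤ (≰⇒> gt)))))
    one : ∀ y → Spn D (λ u e → f₁ u e y)
    one y with y ≟W y₀
    ... | yes _ = Spn-0
    ... | no n with lb g y in gy
    ...   | false = Spn-0
    ...   | true with m y w ℤ.≟ + 0
    ...     | yes z = Spn-cong (λ u e → sym (cong (_* p u y e) z)) Spn-0
    ...     | no nz = Spn-* (m y w) (Spn-pf y (h y n gy nz))

  C-K1 : ∀ {y} → K2 y → C s (pf y) ≗F pf (l s y)
  C-K1 {y} k u e = trans (C-up s y (K-s RS k) u e) (trans (cong (_+_ (p u (l s y) e)) (S-none s y u e (λ x sx → inj₁ (go x sx (lb r x) refl (lb t x) refl)))) (+-identityʳ _))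
    where
    go : ∀ x → lb s x ≡ true → ∀ b → lb r x ≡ b → ∀ b′ → lb t x ≡ b′ → m x y ≡ + 0
    go x sx true rx true tx = ⊥-elim (not-three RS x rx sx tx)
    go x sx false rx _ _ = m-descent r x y (proj₁ k) rx (λ q → bool-clash sx (trans (cong (lb s) (l≡-sym r q)) (K-a-down RS k)))
    go x sx true rx false tx = m-descent t x y (proj₁ (proj₂ k)) tx (λ q → bool-clash sx (trans (cong (lb s) (l≡-sym t q)) (K-a-down ST k)))

  J-4 : ∀ {σ x} → J σ x → aW x ≡ 4
  J-4 j = aW-lev j l0

  -- In contrast to `C-lev3`, elements with both a and s as descents may occur. They lie in the
  -- lowest cell, which is why the statements for a = 2 hold modulo that cell; their exponent 0 is
  -- recorded for `Formulas2`.
  C-K2 : ∀ σ {y} → K2 y → Spn (λ z k → k ≡ + 0 × ∃ λ τ → J τ z) (λ u e → C (a σ) (pf (l s y)) u e + - (pf (l (a σ) (l s y)) u e + pf y u e))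
  C-K2 σ {y} k = Spn-cong (λ u e → sym (trans (cong (_+ - (pf (l (a σ) (l s y)) u e + pf y u e)) (C-up (a σ) (l s y) (K1-a σ k) u e))
      (trans (i (p u (l (a σ) (l s y)) e) (S (a σ) (l s y) u e) (p u y e)) (cong (λ z → S (a σ) (l s y) u e + - z) (sym (trans (cong (_* p u y e) (m-up s y (K-s σ k))) (*-identityˡ _)))))))
    (S-split (a σ) (l s y) y (K-a σ k) (λ x ne ax nz → refl , go x ne ax nz (lb s x) refl))
    where
    i : ∀ a b c → a + b + - (a + c) ≡ b + - c
    i = solve-∀
    go : ∀ x → x ≢ y → lb (a σ) x ≡ true → m x (l s y) ≢ + 0 → ∀ b → lb s x ≡ b → ∃ λ τ → J τ x
    go x ne ax nz true sx = σ , ax , sx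
    go x ne ax nz false sx = ⊥-elim (nz (m-descent s x (l s y) (K1-s σ k) sx (λ q → ne (l-inj s q))))

  X2 : Lv2 → F → F
  X2 n0 f = f
  X2 ns f = C s f
  X2 (na σ) f u e = C (a σ) (C s f) u e + - f u e

  A4 : W → ℤ → Set
  A4 w _ = aW w ≡ 4

  X2-pf : ∀ i {y} → K2 y → Spn A4 (λ u e → X2 i (pf y) u e + - pf (lev2 i y) u e)
  X2-pf n0 {y} k = Spn-cong (λ u e → sym (+-inverseʳ (pf y u e))) Spn-0
  X2-pf ns {y} k = Spn-cong (λ u e → sym (trans (cong (_+ - pf (l s y) u e) (C-K1 k u e)) (+-inverseʳ (pf (l s y) u e)))) Spn-0
  X2-pf (na σ) {y} k = Spn-cong (λ u e → trans (cong (_+ - (pf (l (a σ) (l s y)) u e + pf y u e)) (sym (C-cong (a σ) (C-K1 k) u e))) (i (C (a σ) (C s (pf y)) u e) (pf (l (a σ) (l s y)) u e) (pf y u e)))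
    (Spn-mono (λ w _ (_ , τ , j) → J-4 j) (C-K2 σ k))
    where
    i : ∀ a b c → a + - (b + c) ≡ a + - c + - b
    i = solve-∀

  X2-cong : ∀ i {f f′} → f ≗F f′ → X2 i f ≗F X2 i f′
  X2-cong n0 q = q
  X2-cong ns q = C-cong s q
  X2-cong (na σ) q u e = cong₂ (λ x y → x + - y) (C-cong (a σ) (C-cong s q) u e) (q u e)

  X2-lin : ∀ i (G : W → ℤ → F) ts → X2 i (λ u e → lin (λ w k → G w k u e) ts) ≗F (λ u e → lin (λ w k → X2 i (G w k) u e) ts)
  X2-lin n0 G ts u e = refl
  X2-lin ns G ts u e = lin-C s G ts u e
  X2-lin (na σ) G ts u e = trans (cong (_+ - lin (λ w k → G w k u e) ts) (trans (C-cong (a σ) (lin-C s G ts) u e) (lin-C (a σ) (λ w k → C s (G w k)) ts u e))) (lin-sub RS _ _ ts)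

  X2-shift : ∀ i f k → X2 i (λ u e → f u (e - k)) ≗F (λ u e → X2 i f u (e - k))
  X2-shift n0 f k u e = refl
  X2-shift ns f k u e = C-shift s f k u e
  X2-shift (na σ) f k u e = cong (_+ - f u (e - k)) (trans (C-cong (a σ) (C-shift s f k) u e) (C-shift (a σ) (C s f) k u e))

  X2-CR : ∀ i g f → CR g (X2 i f) ≗F X2 i (CR g f)
  X2-CR n0 g f u e = refl
  X2-CR ns g f u e = sym (C-CR s g f u e)
  X2-CR (na σ) g f u e = trans (CR-sub g (C (a σ) (C s f)) f u e) (cong (_+ - CR g f u e) (trans (sym (C-CR (a σ) g (C s f) u e)) (C-cong (a σ) (λ u e → sym (C-CR s g f u e)) u e)))

  X2-4 : ∀ i {f} → Spn A4 f → Spn A4 (X2 i f)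
  X2-4 n0 S = S
  X2-4 ns S = Spn-C4 s S
  X2-4 (na σ) S = Spn-+ (Spn-C4 (a σ) (Spn-C4 s S)) (Spn-neg S)

  Ty2 : Lv2 → W → Set
  Ty2 i z = ∃ λ y → K2 y × z ≡ lev2 i y

  Ty24 : Lv2 → W → ℤ → Set
  Ty24 i w _ = Ty2 i w ⊎ aW w ≡ 4

  X2-Spn : ∀ i {f} → Spn (λ w _ → K2 w ⊎ aW w ≡ 4) f → Spn (Ty24 i) (X2 i f)
  X2-Spn i (ts , al , eq) = Spn-cong (λ u e → sym (trans (X2-cong i eq u e) (X2-lin i (λ w k u e → p u w (e - k)) ts u e)))
    (Spn-lin {λ w _ → K2 w ⊎ aW w ≡ 4} (λ w k → X2 i (λ u e → p u w (e - k))) one ts al)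
    where
    one : ∀ w k → K2 w ⊎ aW w ≡ 4 → Spn (Ty24 i) (X2 i (λ u e → p u w (e - k)))
    one w k (inj₁ d) = Spn-cong (λ u e → trans (j (p u (lev2 i w) (e - k)) (X2 i (pf w) u (e - k))) (sym (X2-shift i (pf w) k u e)))
        (Spn-+ (Spn-one (lev2 i w) k (inj₁ (w , d , refl))) (Spn-shift {A4} k (λ _ _ d → inj₂ d) (X2-pf i d)))
      where
      j : ∀ a b → a + (b + - a) ≡ b
      j = solve-∀
    one w k (inj₂ d) = Spn-mono (λ _ _ → inj₂) (X2-4 i (Spn-one w k d))

  rt-cases : ∀ x → lb r x ≡ true → lb t x ≡ true → K2 x ⊎ aW x ≡ 4
  rt-cases x rx tx with h (st x) rx tx
    where
    opaque
      h : ∀ q → bit r q ≡ true → bit t q ≡ true → av q ≡ 2 ⊎ av q ≡ 4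
      h = toWitness {a? = Q∀ λ q → (bit r q is true) →-dec ((bit t q is true) →-dec ((av q ℕ.≟ 2) ⊎-dec (av q ℕ.≟ 4)))} _
  ... | inj₁ e = inj₁ (rx , tx , e)
  ... | inj₂ e = inj₂ e

  -- As for `RE-ty`, with the error E of `X2-pf`: E lies in the span of the lowest cell, and so does
  -- its product with C_g on the right.
  RE-ty2 : ∀ {g i z w} → Ty2 i w → rb g w ≡ false → RE g z w → Ty2 i z ⊎ aW z ≡ 4
  RE-ty2 {g} {i} {z} (y , k , refl) b re = RE-coef b re (Spn-cong (λ u e → trans (cong (_+ - CR g E u e) (sym (X2-CR i g (pf y) u e))) (trans (cong (_+_ (CR g (X2 i (pf y)) u e)) (cong -_ (CR-sub g (X2 i (pf y)) (pf (lev2 i y)) u e))) (j (CR g (X2 i (pf y)) u e) (CR g (pf (lev2 i y)) u e))))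
      (Spn-+ (X2-Spn i (CR-edges g y (λ _ → inj₁ k , inj₁ k) (λ b y′ re′ → rt-cases y′ (RE-desc re′ b (proj₁ k)) (RE-desc re′ b (proj₁ (proj₂ k))))))
        (Spn-mono (λ _ _ → inj₂) (Spn-neg (Spn-CR4 g (X2-pf i k))))))
    where
    E : F
    E u e = X2 i (pf y) u e + - pf (lev2 i y) u e
    j : ∀ a b → a + - (a + - b) ≡ b
    j = solve-∀

  Ty24-≥2 : ∀ {i z} → Ty2 i z ⊎ aW z ≡ 4 → 2 ≤ aW z
  Ty24-≥2 {i} (inj₁ (y , k , refl)) = ≤-reflexive (sym (aW-lev2 i k))
  Ty24-≥2 (inj₂ e) = subst (2 ≤_) (sym e) (s≤s (s≤s z≤n))

  RE-≥2 : ∀ {g z w} → 2 ≤ aW w → rb g w ≡ false → RE g z w → 2 ≤ aW z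
  RE-≥2 {g} {z} {w} h b re with aW-cases w
  ... | inj₁ e = subst (2 ≤_) (sym (RE-4 e b re)) (s≤s (s≤s z≤n))
  ... | inj₂ (inj₁ e) with decompose2 w e
  ...   | dec2 i y k eq = Ty24-≥2 {i} (RE-ty2 {i = i} (y , k , eq) b re)
  RE-≥2 {g} {z} {w} h b re | inj₂ (inj₂ (inj₁ e)) = ⊥-elim (<⇒≱ (s≤s (s≤s z≤n)) (subst (2 ≤_) e h))
  RE-≥2 {g} {z} {w} h b re | inj₂ (inj₂ (inj₂ e)) = ⊥-elim (<⇒≱ (s≤s z≤n) (subst (2 ≤_) e h))

  LE-≥2 : ∀ {g z w} → 2 ≤ aW w → lb g w ≡ false → LE g z w → 2 ≤ aW z
  LE-≥2 {g} {z} {w} e b le = subst (2 ≤_) (aW-inv z) (RE-≥2 (subst (2 ≤_) (sym (aW-inv w)) e) (trans (rb-inv g w) b) (LE→RE le))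

  aW-lb : ∀ g x → lb g x ≡ true → 1 ≤ aW x
  aW-lb g x b = ℕ.n≢0⇒n>0 (λ z → h g (st x) b z)
    where
    h : ∀ g q → bit g q ≡ true → av q ≡ 0 → ⊥
    h g q b z = bool-clash b (h′ g q z)
      where
      opaque
        h′ : ∀ g q → av q ≡ 0 → bit g q ≡ false
        h′ = toWitness {a? = Alcoves.Gen∀ λ g → Q∀ λ q → (av q ℕ.≟ 0) →-dec (bit g q is false)} _

 -- The first coefficients of p(e,z) in the cells a = 4 and a = 2.

 module IdentityCoefficients where
  open Coxeter
  open FormalSums
  open Hecke
  open ReducedWords
  open KLPolynomials
  open StarOperations
  open KLSpans
  open Descents
  open RightTypes
  open Automaton using (bit)
  open Defs using (r; s; t; Word; len; coeffP; allZero; degP; _≈_) renaming (δ to degδ)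

  lb-ev : ∀ g w → redW w ≡ true → lb g (ev w) ≡ bit g (stW w)
  lb-ev g w h = cong (bit g) (st-ev w h)

  redW-tail : ∀ g w → redW (g ∷ w) ≡ true → redW w ≡ true × lb g (ev w) ≡ false
  redW-tail g w h with redW w in b
  redW-tail g w h | true with bit g (stW w) in b′
  ... | false = refl , trans (lb-ev g w b) b′

  up-one : ∀ g w y e → redW (g ∷ w) ≡ true → lb g y ≡ true → p (ev (g ∷ w)) y e ≡ p (ev w) y (ℤ.pred e)
  up-one g w y e h b = trans (cong (λ x → p x y e) (ev-∷ g w)) (p-descent g (ev w) y e b (proj₂ (redW-tail g w h)))

  -- Each letter of b is a descent of y and contributes a factor v by `p-descent`. With b = w_J or
  -- rt, an evaluation at a short element becomes one near the element that may equal y.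
  chain : ∀ b w y e → redW (b ++ w) ≡ true → All (λ g → lb g y ≡ true) b → p (ev w) y e ≡ p (ev (b ++ w)) y (e + + length b)
  chain [] w y e h al = cong (p (ev w) y) (sym (+-identityʳ e))
  chain (g ∷ b) w y e h (bt ∷ al) = trans (chain b w y e (proj₁ (redW-tail g (b ++ w) h)) al)
    (sym (trans (up-one g (b ++ w) y _ h bt) (cong (p (ev (b ++ w)) y) (i e (+ length b)))))
    where
    i : ∀ e n → -[1+ 0 ] + (e + (+ 1 + n)) ≡ e + n
    i = solve-∀

  -- A word for p⁻¹, so that `x′` is w_J p⁻¹.
  rp : Side → Lv → Word
  rp σ l0 = []
  rp σ l1 = c σ ∷ []
  rp σ l2 = c σ ∷ s ∷ []
  rp σ l3 = c σ ∷ s ∷ a σ ∷ []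

  xw : Side → Lv → Word
  xw σ i = wJ σ ++ rp σ i

  x′ : Side → Lv → W
  x′ σ i = ev (xw σ i)

  redX : ∀ σ i → redW (xw σ i) ≡ true
  redX RS l0 = refl
  redX RS l1 = refl
  redX RS l2 = refl
  redX RS l3 = refl
  redX ST l0 = refl
  redX ST l1 = refl
  redX ST l2 = refl
  redX ST l3 = refl

  J-x′ : ∀ σ i → J σ (x′ σ i)
  J-x′ RS l0 = lb-ev r (xw RS l0) refl , lb-ev s (xw RS l0) refl
  J-x′ RS l1 = lb-ev r (xw RS l1) refl , lb-ev s (xw RS l1) refl
  J-x′ RS l2 = lb-ev r (xw RS l2) refl , lb-ev s (xw RS l2) refl
  J-x′ RS l3 = lb-ev r (xw RS l3) refl , lb-ev s (xw RS l3) refl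
  J-x′ ST l0 = lb-ev t (xw ST l0) refl , lb-ev s (xw ST l0) refl
  J-x′ ST l1 = lb-ev t (xw ST l1) refl , lb-ev s (xw ST l1) refl
  J-x′ ST l2 = lb-ev t (xw ST l2) refl , lb-ev s (xw ST l2) refl
  J-x′ ST l3 = lb-ev t (xw ST l3) refl , lb-ev s (xw ST l3) refl

  p-ev-step : ∀ {g b w y z} → C g (pf y) ≗F z → redW w ≡ true → bit g (stW w) ≡ b → ∀ e → z (ev w) e ≡ p (ev (g ∷ w)) y e + p (ev w) y (sh b e)
  p-ev-step {g} {b} {w} {y} q h bt e = trans (sym (q (ev w) e)) (cong₂ _+_ (cong (λ x → p x y e) (sym (ev-∷ g w))) (cong (λ z → p (ev w) y (sh z e)) (trans (lb-ev g w h) bt)))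

  module Formulas (σ : Side) {y : W} (j : J σ y) where

    A : Lv → ℤ → ℤ
    A i e = p (x′ σ i) y e

    private
      all-wJ : All (λ g → lb g y ≡ true) (wJ σ)
      all-wJ = proj₂ j ∷ proj₁ j ∷ proj₂ j ∷ proj₁ j ∷ []

      P-rp : ∀ i e → p (ev (rp σ i)) y e ≡ A i (e + + 4)
      P-rp i e = chain (wJ σ) (rp σ i) y e (redX σ i) all-wJ

      P-s : ∀ e → p (ev (s ∷ [])) y e ≡ A l0 (e + + 3)
      P-s e = trans (up-one s [] y e refl (proj₂ j)) (trans (P-rp l0 (ℤ.pred e)) (cong (A l0) (i e)))
        where
        i : ∀ e → -[1+ 0 ] + e + + 4 ≡ e + + 3
        i = solve-∀

      P-a : ∀ e → p (ev (a σ ∷ [])) y e ≡ A l0 (e + + 3)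
      P-a e = trans (up-one (a σ) [] y e (h σ) (proj₁ j)) (trans (P-rp l0 (ℤ.pred e)) (cong (A l0) (i e)))
        where
        h : ∀ σ → redW (a σ ∷ []) ≡ true
        h RS = refl
        h ST = refl
        i : ∀ e → -[1+ 0 ] + e + + 4 ≡ e + + 3
        i = solve-∀

      P-sa : ∀ e → p (ev (s ∷ a σ ∷ [])) y e ≡ A l0 (e + + 2)
      P-sa e = trans (up-one s (a σ ∷ []) y e (h σ) (proj₂ j)) (trans (P-a (ℤ.pred e)) (cong (A l0) (i e)))
        where
        h : ∀ σ → redW (s ∷ a σ ∷ []) ≡ true
        h RS = refl
        h ST = refl
        i : ∀ e → -[1+ 0 ] + e + + 3 ≡ e + + 2
        i = solve-∀

      P-ca : ∀ e → p (ev (c σ ∷ a σ ∷ [])) y e ≡ A l1 (e + + 3)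
      P-ca e = trans (cong (λ x → p x y e) (comm σ)) (trans (up-one (a σ) (c σ ∷ []) y e (h σ) (proj₁ j)) (trans (P-rp l1 (ℤ.pred e)) (cong (A l1) (i e))))
        where
        h : ∀ σ → redW (a σ ∷ c σ ∷ []) ≡ true
        h RS = refl
        h ST = refl
        comm : ∀ σ → ev (c σ ∷ a σ ∷ []) ≡ ev (a σ ∷ c σ ∷ [])
        comm RS = ≈⇒≡ _ _ refl
        comm ST = ≈⇒≡ _ _ refl
        i : ∀ e → -[1+ 0 ] + e + + 4 ≡ e + + 3
        i = solve-∀

      y1 y2 y3 : W
      y1 = lev σ l1 y
      y2 = lev σ l2 y
      y3 = lev σ l3 y

      q1 : ∀ σ → bit (c σ) (stW []) ≡ false
      q1 RS = refl
      q1 ST = refl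
      q2 : ∀ σ → bit (c σ) (stW (s ∷ [])) ≡ false
      q2 RS = refl
      q2 ST = refl
      q3 : ∀ σ → redW (a σ ∷ []) ≡ true × bit (c σ) (stW (a σ ∷ [])) ≡ false × bit s (stW (a σ ∷ [])) ≡ false
      q3 RS = refl , refl , refl
      q3 ST = refl , refl , refl
      q4 : ∀ σ → redW (s ∷ a σ ∷ []) ≡ true × bit (c σ) (stW (s ∷ a σ ∷ [])) ≡ false
      q4 RS = refl , refl
      q4 ST = refl , refl
      q5 : ∀ σ → bit (a σ) (stW []) ≡ false
      q5 RS = refl
      q5 ST = refl

      i₃ : ∀ e → + 1 + e + + 3 ≡ e + + 4
      i₃ = solve-∀
      i₂ : ∀ e → + 1 + e + + 2 ≡ e + + 3
      i₂ = solve-∀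
      i₄ : ∀ e → + 1 + e + + 4 ≡ e + + 5
      i₄ = solve-∀
      i₅ : ∀ e → + 1 + e + + 5 ≡ e + + 6
      i₅ = solve-∀
      i₆ : ∀ e → + 1 + e + + 6 ≡ e + + 7
      i₆ = solve-∀

      one-1 : ∀ e → p (ev []) y1 e ≡ A l1 (e + + 4) + A l0 (e + + 5)
      one-1 e = trans (p-ev-step (C-lev1 j) refl (q1 σ) e) (cong₂ _+_ (P-rp l1 e) (trans (P-rp l0 (ℤ.suc e)) (cong (A l0) (i₄ e))))

      one-s : ∀ e → p (ev (s ∷ [])) y1 e ≡ A l2 (e + + 4) + A l0 (e + + 4)
      one-s e = trans (p-ev-step (C-lev1 j) refl (q2 σ) e) (cong₂ _+_ (P-rp l2 e) (trans (P-s (ℤ.suc e)) (cong (A l0) (i₃ e))))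

      one-a : ∀ e → p (ev (a σ ∷ [])) y1 e ≡ A l1 (e + + 3) + A l0 (e + + 4)
      one-a e = trans (p-ev-step (C-lev1 j) (proj₁ (q3 σ)) (proj₁ (proj₂ (q3 σ))) e) (cong₂ _+_ (P-ca e) (trans (P-a (ℤ.suc e)) (cong (A l0) (i₃ e))))

      one-sa : ∀ e → p (ev (s ∷ a σ ∷ [])) y1 e ≡ A l3 (e + + 4) + A l0 (e + + 3)
      one-sa e = trans (p-ev-step (C-lev1 j) (proj₁ (q4 σ)) (proj₂ (q4 σ)) e) (cong₂ _+_ (P-rp l3 e) (trans (P-sa (ℤ.suc e)) (cong (A l0) (i₂ e))))

      minus : ∀ x y z → x + y ≡ z → x ≡ z + - y
      minus x y z refl = sym (cancel x y)

      two-1 : ∀ e → p (ev []) y2 e ≡ A l2 (e + + 4) + A l1 (e + + 5) + A l0 (e + + 6)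
      two-1 e = trans (minus _ _ _ (p-ev-step (C-lev2 j) refl refl e)) (trans (cong₂ (λ x z → x + - z) (cong₂ _+_ (one-s e) (trans (one-1 (ℤ.suc e)) (cong₂ (λ x z → A l1 x + A l0 z) (i₄ e) (i₅ e)))) (P-rp l0 e))
        (i (A l2 (e + + 4)) (A l0 (e + + 4)) (A l1 (e + + 5)) (A l0 (e + + 6))))
        where
        i : ∀ a b c d → a + b + (c + d) + - b ≡ a + c + d
        i = solve-∀

      two-a : ∀ e → p (ev (a σ ∷ [])) y2 e ≡ A l3 (e + + 4) + A l1 (e + + 4) + A l0 (e + + 5)
      two-a e = trans (minus _ _ _ (p-ev-step (C-lev2 j) (proj₁ (q3 σ)) (proj₂ (proj₂ (q3 σ))) e)) (trans (cong₂ (λ x z → x + - z) (cong₂ _+_ (one-sa e) (trans (one-a (ℤ.suc e)) (cong₂ (λ x z → A l1 x + A l0 z) (i₃ e) (i₄ e)))) (P-a e))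
        (i (A l3 (e + + 4)) (A l0 (e + + 3)) (A l1 (e + + 4)) (A l0 (e + + 5))))
        where
        i : ∀ a b c d → a + b + (c + d) + - b ≡ a + c + d
        i = solve-∀

      three-1 : ∀ e → p (ev []) y3 e ≡ A l3 (e + + 4) + A l2 (e + + 5) + A l1 (e + + 6) + A l0 (e + + 7)
      three-1 e = trans (minus _ _ _ (p-ev-step (C-lev3 j) refl (q5 σ) e)) (trans (cong₂ (λ x z → x + - z) (cong₂ _+_ (two-a e) (trans (two-1 (ℤ.suc e)) (cong₂ _+_ (cong₂ (λ x z → A l2 x + A l1 z) (i₄ e) (i₅ e)) (cong (A l0) (i₆ e))))) (one-1 e))
        (i (A l3 (e + + 4)) (A l1 (e + + 4)) (A l0 (e + + 5)) (A l2 (e + + 5)) (A l1 (e + + 6)) (A l0 (e + + 7))))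
        where
        i : ∀ a b c d f g → a + b + c + (d + f + g) + - (b + c) ≡ a + d + f + g
        i = solve-∀

    -- Obtained by evaluating C_c C_y = C_{cy}, C_s C_{cy} = C_{scy} + C_y and C_a C_{scy} =
    -- C_{ascy} + C_{cy} at e, s, a and sa, and by transporting the values of p( · ,y) with `chain`.
    formula : Lv → ℤ → ℤ
    formula l0 e = A l0 (e + + 4)
    formula l1 e = A l1 (e + + 4) + A l0 (e + + 5)
    formula l2 e = A l2 (e + + 4) + A l1 (e + + 5) + A l0 (e + + 6)
    formula l3 e = A l3 (e + + 4) + A l2 (e + + 5) + A l1 (e + + 6) + A l0 (e + + 7)

    p-lev : ∀ i e → p 1W (lev σ i y) e ≡ formula i e
    p-lev i e = trans (cong (λ x → p x (lev σ i y) e) (sym ev-[])) (h i)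
      where
      h : ∀ i → p (ev []) (lev σ i y) e ≡ formula i e
      h l0 = P-rp l0 e
      h l1 = one-1 e
      h l2 = two-1 e
      h l3 = three-1 e

    private
      A-pos : ∀ i e n → e ≡ + suc n → A i e ≡ + 0
      A-pos i _ n refl = p-pos (x′ σ i) y n

      A-shift : ∀ i e n d → e + + 4 ≡ + suc n → A i (e + (+ 4 + + d)) ≡ + 0
      A-shift i e n d q = A-pos i _ (n ℕ.+ d) (trans (sym (+-assoc e (+ 4) (+ d))) (cong (_+ + d) q))

    lev-above : ∀ i e n → e + + 4 ≡ + suc n → p 1W (lev σ i y) e ≡ + 0
    lev-above i e n q = trans (p-lev i e) (h i)
      where
      h : ∀ i → formula i e ≡ + 0
      h l0 = A-shift l0 e n 0 q
      h l1 = cong₂ _+_ (A-shift l1 e n 0 q) (A-shift l0 e n 1 q)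
      h l2 = cong₂ _+_ (cong₂ _+_ (A-shift l2 e n 0 q) (A-shift l1 e n 1 q)) (A-shift l0 e n 2 q)
      h l3 = cong₂ _+_ (cong₂ _+_ (cong₂ _+_ (A-shift l3 e n 0 q) (A-shift l2 e n 1 q)) (A-shift l1 e n 2 q)) (A-shift l0 e n 3 q)

    lev-4 : ∀ i → p 1W (lev σ i y) -[1+ 3 ] ≡ [ x′ σ i ≡ y ]₀
    lev-4 i = trans (p-lev i _) (h i)
      where
      z : ∀ i n → A i (+ suc n) ≡ + 0
      z i n = A-pos i _ n refl
      h : ∀ i → formula i -[1+ 3 ] ≡ A i (+ 0)
      h l0 = refl
      h l1 = trans (cong (_+_ (A l1 (+ 0))) (z l0 0)) (+-identityʳ _)
      h l2 = trans (cong₂ (λ x y → A l2 (+ 0) + x + y) (z l1 0) (z l0 1)) (trans (+-identityʳ _) (+-identityʳ _))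
      h l3 = trans (cong₂ (λ x y → A l3 (+ 0) + x + y + A l0 (+ 3)) (z l2 0) (z l1 1)) (trans (cong (_+_ (A l3 (+ 0) + + 0 + + 0)) (z l0 2)) (trans (+-identityʳ _) (trans (+-identityʳ _) (+-identityʳ _))))

    prevδ : Lv → ℤ
    prevδ l0 = + 0
    prevδ l1 = [ x′ σ l0 ≡ y ]₀
    prevδ l2 = [ x′ σ l1 ≡ y ]₀
    prevδ l3 = [ x′ σ l2 ≡ y ]₀

    lev-5 : ∀ i → p 1W (lev σ i y) -[1+ 4 ] ≡ m (x′ σ i) y + prevδ i
    lev-5 i = trans (p-lev i _) (h i)
      where
      z : ∀ i n → A i (+ suc n) ≡ + 0
      z i n = A-pos i _ n refl
      h : ∀ i → formula i -[1+ 4 ] ≡ m (x′ σ i) y + prevδ i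
      h l0 = sym (+-identityʳ _)
      h l1 = refl
      h l2 = trans (cong (_+_ (A l2 -1ℤ + A l1 (+ 0))) (z l0 0)) (+-identityʳ _)
      h l3 = trans (cong₂ (λ x y → A l3 -1ℤ + A l2 (+ 0) + x + y) (z l1 0) (z l0 1)) (trans (+-identityʳ _) (+-identityʳ _))

  short : ∀ w w′ → w ≈ w′ → Red w → length w′ < length w → ⊥
  short w w′ q h lt = <⇒≱ lt (≤-trans (≤-reflexive (trans h (cong ℓ (≈⇒≡ w w′ q)))) (ℓ-ev w′))

  m-up-r : ∀ g u → rb g u ≡ false → m u (ρ g u) ≡ + 1
  m-up-r g u b = trans (sym (m-inv u (ρ g u))) (trans (cong (m (inv u)) (inv-ρ g u)) (m-up g (inv u) b))

  m-gap2 : ∀ u w → ℓ w ≡ suc (suc (ℓ u)) → m u w ≡ + 0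
  m-gap2 u w q = p-zero u w -1ℤ (λ { refl → <⇒≢ (n≤1+n _) q }) (λ j e → ⊥-elim (lem j (+-injective (trans (sym (trans (cong (λ n → -1ℤ + + n - + ℓ u) q) (i (+ ℓ u)))) e))))
    where
    i : ∀ n → -[1+ 0 ] + (+ 1 + (+ 1 + n)) - n ≡ + 1
    i = solve-∀
    lem : ∀ j → 1 ≡ 2 ℕ.* j → ⊥
    lem (suc j) e with trans (suc-injective e) (+-suc j (j ℕ.+ 0))
    ... | ()

  ℓ-x′ : ∀ σ i → ℓ (x′ σ i) ≡ 4 ℕ.+ length (rp σ i)
  ℓ-x′ σ i = sym (redW-Red (xw σ i) (redX σ i))

  module _ (σ : Side) where
    open Formulas σ

    private
      rev-x3 : inv (x′ σ l3) ≡ lev σ l3 (x′ σ l0)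
      rev-x3 = trans (sym (ev-reverse (xw σ l3))) (trans (h σ) (trans (ev-∷ (a σ) _) (cong (l (a σ)) (trans (ev-∷ s _) (cong (l s) (ev-∷ (c σ) _))))))
        where
        h : ∀ σ → ev (reverse (xw σ l3)) ≡ ev (a σ ∷ s ∷ c σ ∷ xw σ l0)
        h RS = ≈⇒≡ _ _ refl
        h ST = ≈⇒≡ _ _ refl

      -- The length gap is 3, so neither parity nor adjacency decides. By `lev-5` this number is the
      -- v⁻⁵ coefficient of p(e, `x′ σ l3`); since p(e, · ) is invariant under inversion, it can be
      -- computed from the inverse, which is `lev σ l3` of w_J, and there both terms vanish.
      m-03 : m (x′ σ l0) (x′ σ l3) ≡ + 0
      m-03 = trans (sym (lev-5 (J-x′ σ l3) l0 ⟨≡⟩ +-identityʳ _)) (trans (sym (p-inv′ (x′ σ l3))) (trans (cong (λ z → p 1W z -[1+ 4 ]) rev-x3)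
        (trans (lev-5 (J-x′ σ l0) l3) (cong₂ _+_ (m-long (x′ σ l3) (x′ σ l0) (subst₂ _≤_ (sym (ℓ-x′ σ l0)) (sym (ℓ-x′ σ l3)) (s≤s (s≤s (s≤s (s≤s z≤n))))))
          (≡₀-no (λ q → <⇒≢ (n≤1+n _) (trans (sym (ℓ-x′ σ l0)) (trans (cong ℓ (sym q)) (ℓ-x′ σ l2)))))))))
        where
        _⟨≡⟩_ : ∀ {x y z : ℤ} → x ≡ y → y ≡ z → x ≡ z
        _⟨≡⟩_ = trans
        p-inv′ : ∀ z → p 1W (inv z) -[1+ 4 ] ≡ p 1W z -[1+ 4 ]
        p-inv′ z = trans (sym (p-inv 1W z -[1+ 4 ])) (cong (λ x → p x z -[1+ 4 ]) inv-1)

      tails : ∀ σ b → Red (wJ σ ++ b) → length b ≤ 2 → b ≡ rp σ l0 ⊎ b ≡ rp σ l1 ⊎ b ≡ rp σ l2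
      tails σ [] h _ = inj₁ refl
      tails RS (t ∷ []) h _ = inj₂ (inj₁ refl)
      tails RS (t ∷ s ∷ []) h _ = inj₂ (inj₂ refl)
      tails RS (r ∷ []) h _ = ⊥-elim (short (wJ RS ++ r ∷ []) (s ∷ r ∷ s ∷ []) refl h (n≤1+n _))
      tails RS (s ∷ []) h _ = ⊥-elim (short (wJ RS ++ s ∷ []) (r ∷ s ∷ r ∷ []) refl h (n≤1+n _))
      tails RS (t ∷ t ∷ []) h _ = ⊥-elim (short (wJ RS ++ t ∷ t ∷ []) (wJ RS) refl h (n≤1+n _))
      tails RS (t ∷ r ∷ []) h _ = ⊥-elim (short (wJ RS ++ t ∷ r ∷ []) (s ∷ r ∷ s ∷ t ∷ []) refl h (n≤1+n _))
      tails RS (r ∷ r ∷ []) h _ = ⊥-elim (short (wJ RS ++ r ∷ r ∷ []) (wJ RS) refl h (n≤1+n _))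
      tails RS (r ∷ s ∷ []) h _ = ⊥-elim (short (wJ RS ++ r ∷ s ∷ []) (s ∷ r ∷ s ∷ s ∷ []) refl h (n≤1+n _))
      tails RS (r ∷ t ∷ []) h _ = ⊥-elim (short (wJ RS ++ r ∷ t ∷ []) (s ∷ r ∷ s ∷ t ∷ []) refl h (n≤1+n _))
      tails RS (s ∷ r ∷ []) h _ = ⊥-elim (short (wJ RS ++ s ∷ r ∷ []) (r ∷ s ∷ r ∷ r ∷ []) refl h (n≤1+n _))
      tails RS (s ∷ s ∷ []) h _ = ⊥-elim (short (wJ RS ++ s ∷ s ∷ []) (wJ RS) refl h (n≤1+n _))
      tails RS (s ∷ t ∷ []) h _ = ⊥-elim (short (wJ RS ++ s ∷ t ∷ []) (r ∷ s ∷ r ∷ t ∷ []) refl h (n≤1+n _))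
      tails ST (r ∷ []) h _ = inj₂ (inj₁ refl)
      tails ST (r ∷ s ∷ []) h _ = inj₂ (inj₂ refl)
      tails ST (t ∷ []) h _ = ⊥-elim (short (wJ ST ++ t ∷ []) (s ∷ t ∷ s ∷ []) refl h (n≤1+n _))
      tails ST (s ∷ []) h _ = ⊥-elim (short (wJ ST ++ s ∷ []) (t ∷ s ∷ t ∷ []) refl h (n≤1+n _))
      tails ST (r ∷ r ∷ []) h _ = ⊥-elim (short (wJ ST ++ r ∷ r ∷ []) (wJ ST) refl h (n≤1+n _))
      tails ST (r ∷ t ∷ []) h _ = ⊥-elim (short (wJ ST ++ r ∷ t ∷ []) (s ∷ t ∷ s ∷ r ∷ []) refl h (n≤1+n _))
      tails ST (t ∷ t ∷ []) h _ = ⊥-elim (short (wJ ST ++ t ∷ t ∷ []) (wJ ST) refl h (n≤1+n _))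
      tails ST (t ∷ s ∷ []) h _ = ⊥-elim (short (wJ ST ++ t ∷ s ∷ []) (s ∷ t ∷ s ∷ s ∷ []) refl h (n≤1+n _))
      tails ST (t ∷ r ∷ []) h _ = ⊥-elim (short (wJ ST ++ t ∷ r ∷ []) (s ∷ t ∷ s ∷ r ∷ []) refl h (n≤1+n _))
      tails ST (s ∷ t ∷ []) h _ = ⊥-elim (short (wJ ST ++ s ∷ t ∷ []) (t ∷ s ∷ t ∷ t ∷ []) refl h (n≤1+n _))
      tails ST (s ∷ s ∷ []) h _ = ⊥-elim (short (wJ ST ++ s ∷ s ∷ []) (wJ ST) refl h (n≤1+n _))
      tails ST (s ∷ r ∷ []) h _ = ⊥-elim (short (wJ ST ++ s ∷ r ∷ []) (t ∷ s ∷ t ∷ r ∷ []) refl h (n≤1+n _))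
      tails σ (_ ∷ _ ∷ _ ∷ _) h (s≤s (s≤s ()))

      next : ∀ i i′ g → xw σ i′ ≡ xw σ i ++ g ∷ [] → ℓ (x′ σ i′) ≡ suc (ℓ (x′ σ i)) → m (x′ σ i) (x′ σ i′) ≡ + 1
      next i i′ g q le = trans (cong (m (x′ σ i)) e) (m-up-r g (x′ σ i) b)
        where
        e : x′ σ i′ ≡ ρ g (x′ σ i)
        e = trans (cong ev q) (ev-++[] (xw σ i) g)
        b : rb g (x′ σ i) ≡ false
        b with rb g (x′ σ i) in b′
        ... | false = refl
        ... | true = ⊥-elim (<⇒≢ (n≤1+n _) (trans (ℓρ-down g (x′ σ i) b′) (cong suc (trans (cong ℓ (sym e)) le))))

      distinct : ∀ i i′ → length (rp σ i) ≢ length (rp σ i′) → [ x′ σ i ≡ x′ σ i′ ]₀ ≡ + 0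
      distinct i i′ ne = ≡₀-no (λ q → ne (ℕ.+-cancelˡ-≡ 4 _ _ (trans (sym (ℓ-x′ σ i)) (trans (cong ℓ q) (ℓ-x′ σ i′)))))

      gap2 : ∀ i i′ → length (rp σ i′) ≡ suc (suc (length (rp σ i))) → m (x′ σ i) (x′ σ i′) ≡ + 0
      gap2 i i′ q = m-gap2 (x′ σ i) (x′ σ i′) (trans (ℓ-x′ σ i′) (trans (cong (4 ℕ.+_) q) (cong (suc ∘ suc) (sym (ℓ-x′ σ i)))))

      long0 : ∀ i i′ → length (rp σ i′) ≤ length (rp σ i) → m (x′ σ i) (x′ σ i′) ≡ + 0
      long0 i i′ le = m-long _ _ (subst₂ _≤_ (sym (ℓ-x′ σ i′)) (sym (ℓ-x′ σ i)) (ℕ.+-monoʳ-≤ 4 le))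

    -- Identifies the Kronecker term of `lev-5` as a μ-coefficient, so that the v⁻⁵ coefficient
    -- becomes symmetric. Since `x′ σ i` has length at most 7, only y = w_J b with b of length at
    -- most 2 is not excluded by length, and b is then 1, c or cs.
    m-prev : ∀ {y} (j : J σ y) i → m y (x′ σ i) ≡ prevδ j i
    m-prev {y} j i with long-word σ y j
    ... | b , h , refl with length b ℕ.≤? 2
    ...   | no gt = trans (m-long y (x′ σ i) (subst₂ _≤_ (sym (ℓ-x′ σ i)) h (ℕ.+-monoʳ-≤ 4 (≤-trans (rp≤3 i) (≰⇒> gt))))) (sym (z i))
      where
      rp≤3 : ∀ i → length (rp σ i) ≤ 3
      rp≤3 l0 = z≤n
      rp≤3 l1 = s≤s z≤n
      rp≤3 l2 = s≤s (s≤s z≤n)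
      rp≤3 l3 = ≤-refl
      ne : ∀ i → length (rp σ i) ≤ 2 → [ x′ σ i ≡ y ]₀ ≡ + 0
      ne i le = ≡₀-no (λ q → gt (≤-trans (≤-reflexive (ℕ.+-cancelˡ-≡ 4 _ _ (trans h (trans (cong ℓ (sym q)) (ℓ-x′ σ i))))) le))
      z : ∀ i → prevδ j i ≡ + 0
      z l0 = refl
      z l1 = ne l0 z≤n
      z l2 = ne l1 (s≤s z≤n)
      z l3 = ne l2 (s≤s (s≤s z≤n))
    ...   | yes le with tails σ b h le
    ...     | inj₁ refl = z i
      where
      z : ∀ i → m (x′ σ l0) (x′ σ i) ≡ prevδ j i
      z l0 = long0 l0 l0 ≤-refl
      z l1 = trans (next l0 l1 (c σ) refl (trans (ℓ-x′ σ l1) (cong suc (sym (ℓ-x′ σ l0))))) (sym (p-diag₀ _))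
      z l2 = trans (gap2 l0 l2 refl) (sym (distinct l1 l0 λ ()))
      z l3 = trans m-03 (sym (distinct l2 l0 λ ()))
    ...     | inj₂ (inj₁ refl) = z i
      where
      z : ∀ i → m (x′ σ l1) (x′ σ i) ≡ prevδ j i
      z l0 = long0 l1 l0 z≤n
      z l1 = trans (long0 l1 l1 ≤-refl) (sym (distinct l0 l1 λ ()))
      z l2 = trans (next l1 l2 s refl (trans (ℓ-x′ σ l2) (cong suc (sym (ℓ-x′ σ l1))))) (sym (p-diag₀ _))
      z l3 = trans (gap2 l1 l3 refl) (sym (distinct l2 l1 λ ()))
    ...     | inj₂ (inj₂ refl) = z i
      where
      z : ∀ i → m (x′ σ l2) (x′ σ i) ≡ prevδ j i
      z l0 = long0 l2 l0 z≤n
      z l1 = trans (long0 l2 l1 (s≤s z≤n)) (sym (distinct l0 l2 λ ()))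
      z l2 = trans (long0 l2 l2 ≤-refl) (sym (distinct l1 l2 λ ()))
      z l3 = trans (next l2 l3 (a σ) refl (trans (ℓ-x′ σ l3) (cong suc (sym (ℓ-x′ σ l2))))) (sym (p-diag₀ _))

    lev-M : ∀ {y} → J σ y → ∀ i → p 1W (lev σ i y) -[1+ 4 ] ≡ M (x′ σ i) y
    lev-M {y} j i = trans (lev-5 j i) (cong (_+_ (m (x′ σ i) y)) (sym (m-prev j i)))

  p-1-inv : ∀ z e → p 1W (inv z) e ≡ p 1W z e
  p-1-inv z e = trans (sym (p-inv 1W z e)) (cong (λ x → p x z e) inv-1)

  Spn-vanish : ∀ {D : W → ℤ → Set} {f} u e → (∀ w k → D w k → p u w (e - k) ≡ + 0) → Spn D f → f u e ≡ + 0
  Spn-vanish u e h (ts , al , eq) = trans (eq u e) (go ts al)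
    where
    go : ∀ ts → All _ ts → ⟦ ts ⟧ u e ≡ + 0
    go [] _ = refl
    go ((w , k , c) ∷ ts) (d ∷ al) = cong₂ _+_ (trans (cong (_*_ c) (h w k d)) (*-zeroʳ c)) (go ts al)

  rp2 : Lv2 → Word
  rp2 n0 = []
  rp2 ns = s ∷ []
  rp2 (na σ) = s ∷ a σ ∷ []

  xw2 : Lv2 → Word
  xw2 i = r ∷ t ∷ rp2 i

  x″ : Lv2 → W
  x″ i = ev (xw2 i)

  redX2 : ∀ i → redW (xw2 i) ≡ true
  redX2 n0 = refl
  redX2 ns = refl
  redX2 (na RS) = refl
  redX2 (na ST) = refl

  K-x″ : ∀ i → K2 (x″ i)
  K-x″ n0 = lb-ev r (xw2 n0) refl , lb-ev t (xw2 n0) refl , cong av (st-ev (xw2 n0) refl)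
  K-x″ ns = lb-ev r (xw2 ns) refl , lb-ev t (xw2 ns) refl , cong av (st-ev (xw2 ns) refl)
  K-x″ (na RS) = lb-ev r (xw2 (na RS)) refl , lb-ev t (xw2 (na RS)) refl , cong av (st-ev (xw2 (na RS)) refl)
  K-x″ (na ST) = lb-ev r (xw2 (na ST)) refl , lb-ev t (xw2 (na ST)) refl , cong av (st-ev (xw2 (na ST)) refl)

  module Formulas2 {y : W} (k : K2 y) where

    A2 : Lv2 → ℤ → ℤ
    A2 i e = p (x″ i) y e

    private
      P-rp : ∀ i e → p (ev (rp2 i)) y e ≡ A2 i (e + + 2)
      P-rp i e = chain (r ∷ t ∷ []) (rp2 i) y e (redX2 i) (proj₁ k ∷ proj₁ (proj₂ k) ∷ [])

      P-a : ∀ σ e → p (ev (a σ ∷ [])) y e ≡ A2 n0 (e + + 1)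
      P-a σ e = trans (up-one (a σ) [] y e (h σ) (K-a σ k)) (trans (P-rp n0 (ℤ.pred e)) (cong (A2 n0) (i e)))
        where
        h : ∀ σ → redW (a σ ∷ []) ≡ true
        h RS = refl
        h ST = refl
        i : ∀ e → -[1+ 0 ] + e + + 2 ≡ e + + 1
        i = solve-∀

      i₁ : ∀ e → + 1 + e + + 1 ≡ e + + 2
      i₁ = solve-∀
      i₂ : ∀ e → + 1 + e + + 2 ≡ e + + 3
      i₂ = solve-∀
      i₃ : ∀ e → + 1 + e + + 3 ≡ e + + 4
      i₃ = solve-∀

      s-1 : ∀ e → p (ev []) (l s y) e ≡ A2 ns (e + + 2) + A2 n0 (e + + 3)
      s-1 e = trans (p-ev-step (C-K1 k) refl refl e) (cong₂ _+_ (P-rp ns e) (trans (P-rp n0 (ℤ.suc e)) (cong (A2 n0) (i₂ e))))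

      q : ∀ σ → redW (a σ ∷ []) ≡ true × bit s (stW (a σ ∷ [])) ≡ false × bit (a σ) (stW []) ≡ false
      q RS = refl , refl , refl
      q ST = refl , refl , refl

      s-a : ∀ σ e → p (ev (a σ ∷ [])) (l s y) e ≡ A2 (na σ) (e + + 2) + A2 n0 (e + + 2)
      s-a σ e = trans (p-ev-step (C-K1 k) (proj₁ (q σ)) (proj₁ (proj₂ (q σ))) e) (cong₂ _+_ (P-rp (na σ) e) (trans (P-a σ (ℤ.suc e)) (cong (A2 n0) (i₁ e))))

      as-1 : ∀ σ e n → e + + 4 ≡ + suc n → p (ev []) (l (a σ) (l s y)) e ≡ A2 (na σ) (e + + 2) + A2 ns (e + + 3) + A2 n0 (e + + 4)
      as-1 σ e n pos = trans (solve₁ (C (a σ) (pf (l s y)) (ev []) e) _ _ zero-R)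
          (trans (cong₂ (λ x z → x + - z) (trans (p-ev-step {a σ} {false} {[]} {l s y} {C (a σ) (pf (l s y))} (λ _ _ → refl) refl (proj₂ (proj₂ (q σ))) e)
              (cong₂ _+_ (s-a σ e) (trans (s-1 (ℤ.suc e)) (cong₂ (λ x z → A2 ns x + A2 n0 z) (i₂ e) (i₃ e))))) (P-rp n0 e))
            (i (A2 (na σ) (e + + 2)) (A2 n0 (e + + 2)) (A2 ns (e + + 3)) (A2 n0 (e + + 4))))
        where
        i : ∀ a b c d → a + b + (c + d) + - b ≡ a + c + d
        i = solve-∀
        solve₁ : ∀ a b c → a + - (b + c) ≡ + 0 → b ≡ a + - c
        solve₁ a b c z = sym (trans (j a b c) (trans (cong (_+ b) z) (+-identityˡ b)))
          where
          j : ∀ a b c → a + - c ≡ a + - (b + c) + b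
          j = solve-∀
        zero-R : C (a σ) (pf (l s y)) (ev []) e + - (pf (l (a σ) (l s y)) (ev []) e + pf y (ev []) e) ≡ + 0
        zero-R = Spn-vanish (ev []) e (λ { w _ (refl , τ , jw) → trans (cong₂ (λ x z → p x w z) ev-[] (+-identityʳ e)) (Formulas.lev-above τ jw l0 e n pos) }) (C-K2 σ k)

    formula2 : Lv2 → ℤ → ℤ
    formula2 n0 e = A2 n0 (e + + 2)
    formula2 ns e = A2 ns (e + + 2) + A2 n0 (e + + 3)
    formula2 (na σ) e = A2 (na σ) (e + + 2) + A2 ns (e + + 3) + A2 n0 (e + + 4)

    -- The restriction to exponents above -4 discards the error terms of `C-K2`, for whose indices
    -- p(e, · ) starts only at v⁻⁴.
    p-lev2 : ∀ i e n → e + + 4 ≡ + suc n → p 1W (lev2 i y) e ≡ formula2 i e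
    p-lev2 i e n pos = trans (cong (λ x → p x (lev2 i y) e) (sym ev-[])) (h i)
      where
      h : ∀ i → p (ev []) (lev2 i y) e ≡ formula2 i e
      h n0 = P-rp n0 e
      h ns = s-1 e
      h (na σ) = as-1 σ e n pos

    private
      A-pos : ∀ i e n → e ≡ + suc n → A2 i e ≡ + 0
      A-pos i _ n refl = p-pos (x″ i) y n

      A-shift : ∀ i e n d → e + + 2 ≡ + suc n → A2 i (e + (+ 2 + + d)) ≡ + 0
      A-shift i e n d q = A-pos i _ (n ℕ.+ d) (trans (sym (+-assoc e (+ 2) (+ d))) (cong (_+ + d) q))

    lev2-above : ∀ i e n → e + + 2 ≡ + suc n → p 1W (lev2 i y) e ≡ + 0
    lev2-above i e n q = trans (p-lev2 i e (n ℕ.+ 2) (trans (sym (+-assoc e (+ 2) (+ 2))) (cong (_+ + 2) q))) (h i)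
      where
      h : ∀ i → formula2 i e ≡ + 0
      h n0 = A-shift n0 e n 0 q
      h ns = cong₂ _+_ (A-shift ns e n 0 q) (A-shift n0 e n 1 q)
      h (na σ) = cong₂ _+_ (cong₂ _+_ (A-shift (na σ) e n 0 q) (A-shift ns e n 1 q)) (A-shift n0 e n 2 q)

    lev2-2 : ∀ i → p 1W (lev2 i y) -2ℤ ≡ [ x″ i ≡ y ]₀
    lev2-2 i = trans (p-lev2 i -2ℤ 1 refl) (h i)
      where
      z : ∀ i n → A2 i (+ suc n) ≡ + 0
      z i n = A-pos i _ n refl
      h : ∀ i → formula2 i -2ℤ ≡ A2 i (+ 0)
      h n0 = refl
      h ns = trans (cong (_+_ (A2 ns (+ 0))) (z n0 0)) (+-identityʳ _)
      h (na σ) = trans (cong₂ (λ x y → A2 (na σ) (+ 0) + x + y) (z ns 0) (z n0 1)) (trans (+-identityʳ _) (+-identityʳ _))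

    prev2 : Lv2 → ℤ
    prev2 n0 = + 0
    prev2 ns = [ x″ n0 ≡ y ]₀
    prev2 (na σ) = [ x″ ns ≡ y ]₀

    lev2-3 : ∀ i → p 1W (lev2 i y) -[1+ 2 ] ≡ m (x″ i) y + prev2 i
    lev2-3 i = trans (p-lev2 i -[1+ 2 ] 0 refl) (h i)
      where
      h : ∀ i → formula2 i -[1+ 2 ] ≡ m (x″ i) y + prev2 i
      h n0 = sym (+-identityʳ _)
      h ns = refl
      h (na σ) = trans (cong (_+_ (A2 (na σ) -1ℤ + A2 ns (+ 0))) (A-pos n0 _ 0 refl)) (+-identityʳ _)

  ℓ-x″ : ∀ i → ℓ (x″ i) ≡ 2 ℕ.+ length (rp2 i)
  ℓ-x″ i = sym (redW-Red (xw2 i) (redX2 i))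

  private
    tails2 : ∀ b → Red (r ∷ t ∷ b) → length b ≤ 1 → b ≡ [] ⊎ b ≡ s ∷ []
    tails2 [] h _ = inj₁ refl
    tails2 (s ∷ []) h _ = inj₂ refl
    tails2 (r ∷ []) h _ = ⊥-elim (short (r ∷ t ∷ r ∷ []) (t ∷ []) refl h (s≤s (s≤s z≤n)))
    tails2 (t ∷ []) h _ = ⊥-elim (short (r ∷ t ∷ t ∷ []) (r ∷ []) refl h (s≤s (s≤s z≤n)))
    tails2 (_ ∷ _ ∷ _) h (s≤s ())

    next2 : ∀ i i′ g → xw2 i′ ≡ xw2 i ++ g ∷ [] → ℓ (x″ i′) ≡ suc (ℓ (x″ i)) → m (x″ i) (x″ i′) ≡ + 1
    next2 i i′ g q le = trans (cong (m (x″ i)) e) (m-up-r g (x″ i) b)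
      where
      e : x″ i′ ≡ ρ g (x″ i)
      e = trans (cong ev q) (ev-++[] (xw2 i) g)
      b : rb g (x″ i) ≡ false
      b with rb g (x″ i) in b′
      ... | false = refl
      ... | true = ⊥-elim (<⇒≢ (n≤1+n _) (trans (ℓρ-down g (x″ i) b′) (cong suc (trans (cong ℓ (sym e)) le))))

  open Formulas2

  m-prev2 : ∀ {y} (k : K2 y) i → m y (x″ i) ≡ prev2 k i
  m-prev2 {y} k i with K-word y k
  ... | b , h , refl with length b ℕ.≤? 1
  ...   | no gt = trans (m-long y (x″ i) (subst₂ _≤_ (sym (ℓ-x″ i)) h (ℕ.+-monoʳ-≤ 2 (≤-trans (rp≤ i) (≰⇒> gt))))) (sym (z i))
    where
    rp≤ : ∀ i → length (rp2 i) ≤ 2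
    rp≤ n0 = z≤n
    rp≤ ns = s≤s z≤n
    rp≤ (na σ) = ≤-refl
    ne : ∀ i → length (rp2 i) ≤ 1 → [ x″ i ≡ y ]₀ ≡ + 0
    ne i le = ≡₀-no (λ q → gt (≤-trans (≤-reflexive (ℕ.+-cancelˡ-≡ 2 _ _ (trans h (trans (cong ℓ (sym q)) (ℓ-x″ i))))) le))
    z : ∀ i → prev2 k i ≡ + 0
    z n0 = refl
    z ns = ne n0 z≤n
    z (na σ) = ne ns (s≤s z≤n)
  ...   | yes le with tails2 b h le
  ...     | inj₁ refl = z i
    where
    z : ∀ i → m (x″ n0) (x″ i) ≡ prev2 k i
    z n0 = m-long _ _ ≤-refl
    z ns = trans (next2 n0 ns s refl (trans (ℓ-x″ ns) (cong suc (sym (ℓ-x″ n0))))) (sym (p-diag₀ _))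
    z (na σ) = trans (m-gap2 _ _ (trans (ℓ-x″ (na σ)) (cong (suc ∘ suc) (sym (ℓ-x″ n0))))) (sym (≡₀-no (λ q → <⇒≢ ≤-refl (trans (sym (ℓ-x″ n0)) (trans (cong ℓ (sym q)) (ℓ-x″ ns))))))
  ...     | inj₂ refl = z i
    where
    z : ∀ i → m (x″ ns) (x″ i) ≡ prev2 k i
    z n0 = m-long _ _ (subst₂ _≤_ (sym (ℓ-x″ n0)) (sym (ℓ-x″ ns)) (s≤s (s≤s z≤n)))
    z ns = trans (m-long _ _ ≤-refl) (sym (≡₀-no (λ q → <⇒≢ ≤-refl (trans (sym (ℓ-x″ n0)) (trans (cong ℓ q) (ℓ-x″ ns))))))
    z (na σ) = trans (next2 ns (na σ) (a σ) refl (trans (ℓ-x″ (na σ)) (cong suc (sym (ℓ-x″ ns))))) (sym (p-diag₀ _))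

  lev2-M : ∀ {y} → K2 y → ∀ i → p 1W (lev2 i y) -[1+ 2 ] ≡ M (x″ i) y
  lev2-M {y} k i = trans (lev2-3 k i) (cong (_+_ (m (x″ i) y)) (sym (m-prev2 k i)))

  private
    allZero-coeff : ∀ cs → allZero cs ≡ true → ∀ j → coeffP cs j ≡ + 0
    allZero-coeff [] _ j = refl
    allZero-coeff (x ∷ cs) h j with x ℤ.≟ + 0
    allZero-coeff (x ∷ cs) h zero | yes z = z
    allZero-coeff (x ∷ cs) h (suc j) | yes z = allZero-coeff cs h j

    degP-above : ∀ cs j → degP cs < j → coeffP cs j ≡ + 0
    degP-above [] j _ = refl
    degP-above (x ∷ cs) j lt with allZero cs in z
    degP-above (x ∷ cs) (suc j) lt | true = allZero-coeff cs z j
    degP-above (x ∷ cs) (suc j) (s≤s lt) | false = degP-above cs j lt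

    allZero-false : ∀ cs → allZero cs ≡ false → coeffP cs (degP cs) ≢ + 0
    allZero-false (x ∷ cs) h with allZero cs in z
    ... | false = allZero-false cs z
    ... | true with x ℤ.≟ + 0
    ...   | no nz = nz

    degP-coeff : ∀ cs j → coeffP cs j ≢ + 0 → coeffP cs (degP cs) ≢ + 0
    degP-coeff cs j nz with allZero cs in z
    ... | true = ⊥-elim (nz (allZero-coeff cs z j))
    ... | false = allZero-false cs z

  p-1-pv : ∀ z e → p 1W (ev z) e ≡ pv 0 (P [] z) (e + + ℓ (ev z))
  p-1-pv z e = trans (sym (C′-p 1W z e)) (trans (C′-pv 1W z e) (cong₂ (λ w n → pv 0 (P w z) (e + + ℓ (ev z) - + n)) word-1 ℓ-1 ⟨≡⟩ cong (pv 0 (P [] z)) (+-identityʳ _)))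
    where
    _⟨≡⟩_ : ∀ {x y z : ℤ} → x ≡ y → y ≡ z → x ≡ z
    _⟨≡⟩_ = trans

  p-low : ∀ u w e n → e + + ℓ w - + ℓ u ≡ -[1+ n ] → p u w e ≡ + 0
  p-low u w e n q = trans (p-pv u w e) (trans (cong (pv 0 (P (word u) (word w))) q) (pv-other 0 (P (word u) (word w)) -[1+ n ] (λ j ())))

  neg-gap : ∀ a b → a < b → ∃ λ n → - + b + + a ≡ -[1+ n ]
  neg-gap a b lt = b ℕ.∸ suc a , trans (cong (λ z → - + z + + a) (sym (ℕ.m∸n+n≡m lt))) (trans (cong (λ z → - + z + + a) (ℕ.+-comm (b ℕ.∸ suc a) (suc a))) (i (+ a) (+ (b ℕ.∸ suc a))))
    where
    i : ∀ a d → - (+ 1 + a + d) + a ≡ - (+ 1 + d)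
    i = solve-∀

  private
    bottom : ∀ x → Acc _<_ (ℓ x) → p 1W x (- + ℓ x) ≡ + 1
    bottom x (acc rs) with word x | ev-word x | Red-word x
    ... | [] | eq | _ = trans (cong (λ z → p 1W z (- + ℓ z)) (trans (sym eq) ev-[])) (trans (cong (λ n → p 1W 1W (- + n)) ℓ-1) (p-diag₀ 1W))
    ... | g ∷ b | eq | h with Red-tail g b h
    ...   | h′ , bt = trans (cong (λ z → p 1W z (- + ℓ z)) (trans (sym eq) (ev-∷ g b))) (trans (p-step⁻ g w 1W (- + ℓ (l g w)) bt (trans (cong (lb g) (sym ev-[])) (lb1 g)))
          (trans (cong₂ (λ x y → x + y + - S g w 1W (- + ℓ (l g w))) z₁ ih) (cong (λ z → + 0 + + 1 + - z) z₂)))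
      where
      w : W
      w = ev b
      lw : ℓ (l g w) ≡ suc (ℓ w)
      lw = ℓ-up g w bt
      lb1 : ∀ g → lb g (ev []) ≡ false
      lb1 r = lb-ev r [] refl
      lb1 s = lb-ev s [] refl
      lb1 t = lb-ev t [] refl
      i : ∀ n → + 1 + - (+ 1 + n) ≡ - n
      i = solve-∀
      ih : p 1W w (ℤ.suc (- + ℓ (l g w))) ≡ + 1
      ih = trans (cong (p 1W w) (trans (cong (λ n → ℤ.suc (- + n)) lw) (i (+ ℓ w)))) (bottom w (rs (≤-reflexive (trans (sym lw) (cong ℓ (trans (sym (ev-∷ g b)) eq))))))
      low : ∀ u y → ℓ y ≤ ℓ w → p u y (- + ℓ (l g w)) ≡ + 0
      low u y le with neg-gap (ℓ y) (ℓ (l g w)) (subst (ℓ y <_) (sym lw) (s≤s le))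
      ... | n , q = p-low u y _ (n ℕ.+ ℓ u) (trans (cong (_- + ℓ u) q) (trans (j (+ n) (+ ℓ u)) refl))
        where
        j : ∀ n u → - (+ 1 + n) - u ≡ - (+ 1 + (n + u))
        j = solve-∀
      z₁ : p (l g 1W) w (- + ℓ (l g w)) ≡ + 0
      z₁ = low (l g 1W) w ≤-refl
      z₂ : S g w 1W (- + ℓ (l g w)) ≡ + 0
      z₂ = S-none g w 1W _ (λ y _ → two y)
        where
        two : ∀ y → m y w ≡ + 0 ⊎ p 1W y (- + ℓ (l g w)) ≡ + 0
        two y with ℓ y ℕ.≤? ℓ w
        ... | yes le = inj₂ (low 1W y le)
        ... | no gt = inj₁ (m-long y w (<⇒≤ (≰⇒> gt)))

  -- P_{e,x} has constant term 1. Since `degP` assigns degree 0 to the zero polynomial, this is what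
  -- makes the coefficient at the degree nonzero in `deg-top`.
  p-bottom : ∀ x → p 1W x (- + ℓ x) ≡ + 1
  p-bottom x = bottom x (<-wellFounded (ℓ x))

  coeff-1 : ∀ z j → coeffP (P [] z) j ≡ p 1W (ev z) (+ (2 ℕ.* j) - + ℓ (ev z))
  coeff-1 z j = sym (trans (p-1-pv z _) (trans (cong (pv 0 (P [] z)) (i (+ (2 ℕ.* j)) (+ ℓ (ev z)))) (pv-even 0 (P [] z) j)))
    where
    i : ∀ a b → a - b + b ≡ a
    i = solve-∀

  deg-top : ∀ z n → len z ≡ n ℕ.+ 2 ℕ.* degδ P z → p 1W (ev z) (- + n) ≢ + 0
  deg-top z n q zero′ = degP-coeff (P [] z) 0 c0 (trans (coeff-1 z (degP (P [] z))) (trans (cong (p 1W (ev z)) e) zero′))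
    where
    d : ℕ
    d = 2 ℕ.* degP (P [] z)
    i : ∀ a b → a - (b + a) ≡ - b
    i = solve-∀
    e : + d - + ℓ (ev z) ≡ - + n
    e = trans (cong (λ m → + d - + m) (trans (sym (len-ℓ z)) q)) (i (+ d) (+ n))
    c0 : coeffP (P [] z) 0 ≢ + 0
    c0 w with trans (sym w) (trans (coeff-1 z 0) (trans (cong (p 1W (ev z)) (+-identityˡ (- + ℓ (ev z)))) (p-bottom (ev z))))
    ... | ()

  top-deg : ∀ z n → p 1W (ev z) (- + n) ≢ + 0 → (∀ e k → e + + n ≡ + suc k → p 1W (ev z) e ≡ + 0) → len z ≡ n ℕ.+ 2 ℕ.* degδ P z
  top-deg z n nz h with even? (- + n + + ℓ (ev z))
  ... | inj₂ ne = ⊥-elim (nz (trans (p-1-pv z (- + n)) (pv-other 0 (P [] z) _ ne)))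
  ... | inj₁ (j , eq) with ℕ.<-cmp j (degP (P [] z))
  ...   | tri< lt _ _ = ⊥-elim (degP-coeff (P [] z) j cj (trans (coeff-1 z D) (h _ k e)))
    where
    D : ℕ
    D = degP (P [] z)
    cj : coeffP (P [] z) j ≢ + 0
    cj w = nz (trans (p-1-pv z (- + n)) (trans (cong (pv 0 (P [] z)) eq) (trans (pv-even 0 (P [] z) j) w)))
    k : ℕ
    k = suc (2 ℕ.* (D ℕ.∸ suc j))
    D-eq : D ≡ suc (j ℕ.+ (D ℕ.∸ suc j))
    D-eq = sym (ℕ.m+[n∸m]≡n lt)
    i : ∀ d n l → d - l + n ≡ d + - (- n + l)
    i = solve-∀
    i₂ : ∀ j d → (+ 1 + (j + d)) + ((+ 1 + (j + d)) + + 0) + - (j + (j + + 0)) ≡ + 1 + (+ 1 + (d + (d + + 0)))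
    i₂ = solve-∀
    e : + (2 ℕ.* D) - + ℓ (ev z) + + n ≡ + suc k
    e = trans (i (+ (2 ℕ.* D)) (+ n) (+ ℓ (ev z))) (trans (cong (λ x → + (2 ℕ.* D) + - x) eq) (trans (cong (λ x → + (2 ℕ.* x) + - + (2 ℕ.* j)) D-eq) (i₂ (+ j) (+ (D ℕ.∸ suc j)))))
  ...   | tri≈ _ refl _ = trans (len-ℓ z) (+-injective (trans (i (+ ℓ (ev z)) (+ n)) (cong (_+_ (+ n)) eq)))
    where
    i : ∀ l n → l ≡ n + (- n + l)
    i = solve-∀
  ...   | tri> _ _ gt = ⊥-elim (nz (trans (p-1-pv z (- + n)) (trans (cong (pv 0 (P [] z)) eq) (trans (pv-even 0 (P [] z) j) (degP-above (P [] z) j gt)))))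

 -- Degree bounds for products T̃_x T̃_y and C_x C_y.

 module Bremke where
  open Coxeter
  open FormalSums
  open Hecke
  open KLPolynomials
  open KLSpans
  open Descents using (av; aW; aW-inv)
  open Alcoves using (Gen∀; d1; d2; d3; d4)
  open Automaton using (bit; Q; δ; Q∀; tri; Trit; neg; zer; pos)

  same : Trit → Trit → ℕ
  same neg neg = 1
  same pos pos = 1
  same _ _ = 0

  -- the number of directions of hyperplanes separating 1 from both alcoves
  common : Q → Q → ℕ
  common q q′ = same (tri d1 q) (tri d1 q′) ℕ.+ same (tri d2 q) (tri d2 q′) ℕ.+ same (tri d3 q) (tri d3 q′) ℕ.+ same (tri d4 q) (tri d4 q′)

  common≤4 : ∀ q q′ → common q q′ ≤ 4
  common≤4 q q′ = ℕ.+-mono-≤ (ℕ.+-mono-≤ (ℕ.+-mono-≤ (b (tri d1 q) (tri d1 q′)) (b (tri d2 q) (tri d2 q′))) (b (tri d3 q) (tri d3 q′))) (b (tri d4 q) (tri d4 q′))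
    where
    b : ∀ x y → same x y ≤ 1
    b neg neg = ≤-refl
    b neg zer = z≤n
    b neg pos = z≤n
    b zer _ = z≤n
    b pos neg = z≤n
    b pos zer = z≤n
    b pos pos = ≤-refl

  opaque
    common≤3 : ∀ q q′ → av q ≢ 4 → common q q′ ≤ 3
    common≤3 = toWitness {a? = Q∀ λ q → Q∀ λ q′ → (¬? (av q ℕ.≟ 4)) →-dec (common q q′ ℕ.≤? 3)} _

  opaque
    -- One inequality for each term met in the induction: T̃_h T̃_{y} = T̃_{hy} going up, and for
    -- T̃_h T̃_{hy} the terms T̃_y and (v - v⁻¹) T̃_{hy}; the successor in the last inequality pays
    -- for the factor v.
    common-up : ∀ h q q′ → bit h q ≡ false → bit h q′ ≡ false →
      common q (δ h q′) ≤ common (δ h q) q′ × common q q′ ≤ common (δ h q) (δ h q′) × suc (common q (δ h q′)) ≤ common (δ h q) (δ h q′)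
    common-up = toWitness {a? = Gen∀ λ h → Q∀ λ q → Q∀ λ q′ → (bit h q Bool.≟ false) →-dec ((bit h q′ Bool.≟ false) →-dec
      ((common q (δ h q′) ℕ.≤? common (δ h q) q′) ×-dec (common q q′ ℕ.≤? common (δ h q) (δ h q′)) ×-dec (suc (common q (δ h q′)) ℕ.≤? common (δ h q) (δ h q′))))} _

  Deg : ℕ → F → Set
  Deg n f = ∀ u m → f u (+ suc (n ℕ.+ m)) ≡ + 0

  Deg-mono : ∀ {n n′ f} → n ≤ n′ → Deg n f → Deg n′ f
  Deg-mono {n} {n′} {f} le d u m = trans (cong (λ k → f u (+ suc k)) (trans (cong (ℕ._+ m) (sym (ℕ.m+[n∸m]≡n le))) (ℕ.+-assoc n (n′ ℕ.∸ n) m))) (d u (n′ ℕ.∸ n ℕ.+ m))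

  private
    T-three : ∀ h y → lb h y ≡ false → T h (kδ (l h y) (+ 0)) ≗F (λ u e → lin (λ w k → kδ w k u e) ((y , + 0 , + 1) ∷ (l h y , + 1 , + 1) ∷ (l h y , -[1+ 0 ] , -[1+ 0 ]) ∷ []))
    T-three h y b u e = trans (cong₂ (λ x z → x + - z) (trans (C-kδ h (l h y) (+ 0) u e) (cong₂ (λ w k → kδ w (+ 0) u e + kδ (l h y) (sh (not k) (+ 0)) u e) (l-invol h y) (trans (lb-flip h y) (cong not b))))
        (kr-suc u e (l h y) (+ 0))) (i (kδ y (+ 0) u e) (kδ (l h y) (+ 1) u e) (kδ (l h y) -[1+ 0 ] u e))
      where
      i : ∀ a b c → a + b + - c ≡ + 1 * a + (+ 1 * b + (-[1+ 0 ] * c + + 0))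
      i = solve-∀

    kδ-shift : ∀ w k → kδ w k ≗F (λ u e → kδ w (+ 0) u (e - k))
    kδ-shift w k u e = kr-iff (λ q z → q , sym (trans (cong (_-_ e) z) (+-inverseʳ e))) (λ q z → q , sym (i-j≡0⇒i≡j e k (sym z)))

    unit′ : ∀ w → kδ w (+ 0) ≗F val ((w , + 0 , + 1) ∷ [])
    unit′ w u e = sym (trans (+-identityʳ _) (*-identityˡ _))

    Top-kδ : ∀ x w k → Top x (kδ w k) ≗F (λ u e → Top x (kδ w (+ 0)) u (e - k))
    Top-kδ x w k u e = trans (foldr-cong T T-cong (word x) (kδ-shift w k) u e) (foldr-shift (word x) (kδ w (+ 0)) k u e)

    Top-cong : ∀ x {f f′} → f ≗F f′ → Top x f ≗F Top x f′
    Top-cong x = foldr-cong T T-cong (word x)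

  -- Bremke's bound for the degree of T_x T_y
  bremke : ∀ x y → Deg (common (st (inv x)) (st y)) (Top x (kδ y (+ 0)))
  bremke x = go x (<-wellFounded (ℓ x))
    where
    go : ∀ x → Acc _<_ (ℓ x) → ∀ y → Deg (common (st (inv x)) (st y)) (Top x (kδ y (+ 0)))
    go x (acc rs) y with word (inv x) | ev-word (inv x) | Red-word (inv x)
    ... | [] | eq | _ = λ u m → trans (cong (λ a → foldr T (kδ y (+ 0)) a u (+ suc (common (st (inv x)) (st y) ℕ.+ m))) (trans (cong word x1) word-1)) (kr-no₂ u y (λ ()))
      where
      x1 : x ≡ 1W
      x1 = trans (sym (inv-invol x)) (trans (cong inv (trans (sym eq) ev-[])) inv-1)
    ... | h ∷ b | eq | hb with Red-tail h b hb
    ...   | _ , bt = step (lb h y) refl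
      where
      x′ : W
      x′ = inv (ev b)
      ix : inv x ≡ l h (ev b)
      ix = trans (sym eq) (ev-∷ h b)
      ex : x ≡ ρ h x′
      ex = trans (sym (inv-invol x)) (trans (cong inv ix) (inv-l h (ev b)))
      bx : rb h x′ ≡ false
      bx = trans (cong (lb h) (inv-invol (ev b))) bt
      q q₁ : Q
      q = st (inv x′)
      q₁ = st (inv x)
      q₁≡ : q₁ ≡ δ h q
      q₁≡ = trans (cong st ix) (trans (st-up h (ev b) bt) (cong (δ h ∘ st) (sym (inv-invol (ev b)))))
      lt : ℓ x′ < ℓ x
      lt = ≤-reflexive (sym (trans (cong ℓ ex) (ℓρ-up h x′ bx)))
      ih : ∀ y → Deg (common q (st y)) (Top x′ (kδ y (+ 0)))
      ih = go x′ (rs lt)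
      up : ∀ ts → Top x (val ts) ≗F Top x′ (T h (val ts))
      up ts u e = trans (cong (λ z → Top z (val ts) u e) ex) (Top-right h ts x′ bx u e)
      up′ : Top x (kδ y (+ 0)) ≗F Top x′ (T h (kδ y (+ 0)))
      up′ u e = trans (Top-cong x (unit′ y) u e) (trans (up ((y , + 0 , + 1) ∷ []) u e) (Top-cong x′ (T-cong h (λ u e → sym (unit′ y u e))) u e))
      step : ∀ b → lb h y ≡ b → Deg (common q₁ (st y)) (Top x (kδ y (+ 0)))
      step false by u m = trans (up′ u _) (trans (Top-cong x′ (T-kδ h y (+ 0) by) u _)
        (Deg-mono {f = Top x′ (kδ (l h y) (+ 0))} (subst₂ (λ a b → common q a ≤ common b (st y)) (sym (st-up h y by)) (sym q₁≡) (proj₁ (common-up h q (st y) bx by))) (ih (l h y)) u m))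
      step true by u m = trans (up′ u e₀) (trans (Top-cong x′ (λ u e → trans (cong (λ z → T h (kδ z (+ 0)) u e) (sym (l-invol h y))) (T-three h y′ by′ u e)) u e₀)
        (trans (foldr-lin (word x′) kδ ((y′ , + 0 , + 1) ∷ (l h y′ , + 1 , + 1) ∷ (l h y′ , -[1+ 0 ] , -[1+ 0 ]) ∷ []) u e₀)
        (cong₂ _+_ (z (+ 1) z₁) (cong₂ _+_ (z (+ 1) z₂) (cong₂ _+_ (z -[1+ 0 ] z₃) (refl {x = + 0}))))))
        where
        n : ℕ
        n = common q₁ (st y)
        e₀ : ℤ
        e₀ = + suc (n ℕ.+ m)
        y′ : W
        y′ = l h y
        by′ : lb h y′ ≡ false
        by′ = trans (lb-flip h y) (cong not by)
        y≡ : l h y′ ≡ y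
        y≡ = l-invol h y
        sty : st y ≡ δ h (st y′)
        sty = trans (cong st (sym y≡)) (st-up h y′ by′)
        le₂ : common q (st y′) ≤ n
        le₂ = subst₂ (λ a b → common q (st y′) ≤ common a b) (sym q₁≡) (sym sty) (proj₁ (proj₂ (common-up h q (st y′) bx by′)))
        le₃ : suc (common q (st (l h y′))) ≤ n
        le₃ = subst₂ (λ a b → suc (common q b) ≤ common a (st y)) (sym q₁≡) (trans sty′ refl) (subst (λ a → suc (common q (δ h (st y′))) ≤ common (δ h q) a) (sym sty) (proj₂ (proj₂ (common-up h q (st y′) bx by′))))
          where
          sty′ : δ h (st y′) ≡ st (l h y′)
          sty′ = sym (st-up h y′ by′)
        z : ∀ c {x} → x ≡ + 0 → c * x ≡ + 0
        z c refl = *-zeroʳ c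
        z₁ : Top x′ (kδ y′ (+ 0)) u e₀ ≡ + 0
        z₁ = Deg-mono {f = Top x′ (kδ y′ (+ 0))} le₂ (ih y′) u m
        G : ℤ → ℤ
        G = Top x′ (kδ (l h y′) (+ 0)) u
        high : ∀ k → G (+ (n ℕ.+ k)) ≡ + 0
        high k = trans (cong (λ v → G (+ v)) (trans (cong (ℕ._+ k) (sym (ℕ.m+[n∸m]≡n le₃))) (ℕ.+-assoc (suc (common q (st (l h y′)))) _ k))) (ih (l h y′) u (n ℕ.∸ suc (common q (st (l h y′))) ℕ.+ k))
        z₂ : Top x′ (kδ (l h y′) (+ 1)) u e₀ ≡ + 0
        z₂ = trans (Top-kδ x′ (l h y′) (+ 1) u e₀) (trans (cong G (i (+ (n ℕ.+ m)))) (high m))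
          where
          i : ∀ n → + 1 + n - + 1 ≡ n
          i = solve-∀
        z₃ : Top x′ (kδ (l h y′) -[1+ 0 ]) u e₀ ≡ + 0
        z₃ = trans (Top-kδ x′ (l h y′) -[1+ 0 ] u e₀) (trans (cong G (trans (i (+ n) (+ m)) refl)) (high (suc (suc m))))
          where
          i : ∀ n m → + 1 + (n + m) - -[1+ 0 ] ≡ n + (+ 1 + (+ 1 + m))
          i = solve-∀

  Deg-lin : ∀ {n} (G : W → ℤ → F) ts → (∀ w k → val ts w k ≡ + 0 ⊎ Deg n (G w k)) → Deg n (λ u e → lin (λ w k → G w k u e) ts)
  Deg-lin G ts h u m = lin-zero (λ w k → G w k u _) ts (λ w k → one w k (h w k))
    where
    one : ∀ w k → _ ⊎ _ → _ ⊎ _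
    one w k (inj₁ z) = inj₁ z
    one w k (inj₂ d) = inj₂ (d u m)

  private
    shift-Deg : ∀ {n} f k → Deg n f → Deg n (λ u e → f u (e - - + k))
    shift-Deg {n} f k d u m = trans (cong (f u) (i (+ n) (+ m) (+ k))) (d u (m ℕ.+ k))
      where
      i : ∀ n m k → + 1 + (n + m) - (- k) ≡ + 1 + (n + (m + k))
      i = solve-∀

    pos? : ∀ u w k → p u w k ≡ + 0 ⊎ ∃ λ n → k ≡ - + n
    pos? u w (+ zero) = inj₂ (0 , refl)
    pos? u w (+ suc n) = inj₁ (p-pos u w n)
    pos? u w -[1+ n ] = inj₂ (suc n , refl)

    Top-Deg : ∀ {n} w y → (∀ q′ → common (st (inv w)) q′ ≤ n) → Deg n (Top w (pf y))
    Top-Deg {n} w y c u m = trans (lin-T* (word w) (kl y) u _) (Deg-lin {n} (λ z k → Top w (kδ z k)) (kl y) (λ z k → two z k (pos? z y k)) u m)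
      where
      two : ∀ z k → p z y k ≡ + 0 ⊎ (∃ λ i → k ≡ - + i) → p z y k ≡ + 0 ⊎ Deg n (Top w (kδ z k))
      two z k (inj₁ q) = inj₁ q
      two z k (inj₂ (i , refl)) = inj₂ (λ u m → trans (Top-kδ w z (- + i) u _) (shift-Deg {n} (Top w (kδ z (+ 0))) i (Deg-mono {f = Top w (kδ z (+ 0))} (c (st z)) (bremke w z)) u m))

    Top-4 : ∀ w y → Deg 4 (Top w (pf y))
    Top-4 w y = Top-Deg w y (λ q′ → common≤4 (st (inv w)) q′)

  bremke-C : ∀ x y → Deg 4 (OP (kl x) (pf y))
  bremke-C x y = Deg-lin {4} (λ w k u e → Top w (pf y) u (e - k)) (kl x) (λ w k → one w k (pos? w x k))
    where
    one : ∀ w k → p w x k ≡ + 0 ⊎ (∃ λ i → k ≡ - + i) → p w x k ≡ + 0 ⊎ Deg 4 (λ u e → Top w (pf y) u (e - k))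
    one w k (inj₁ q) = inj₁ q
    one w k (inj₂ (n , refl)) = inj₂ (shift-Deg {4} (Top w (pf y)) n (Top-4 w y))

  -- One degree is gained on the term T̃_x by `common≤3`, and on all others because their
  -- coefficients in C_x have only negative powers. This keeps the lowest cell, where p(e,z) starts
  -- at v⁻⁴, from contributing to the trace arguments for a = 1 and a = 2.
  bremke-C3 : ∀ x y → aW x ≢ 4 → Deg 3 (OP (kl x) (pf y))
  bremke-C3 x y nx = Deg-lin {3} (λ w k u e → Top w (pf y) u (e - k)) (kl x) (λ w k → one w k (pos? w x k) (w ≟W x))
    where
    i : ∀ m n → + 1 + (+ 3 + m) - (- (+ 1 + n)) ≡ + 1 + (+ 4 + (m + n))
    i = solve-∀
    one : ∀ w k → p w x k ≡ + 0 ⊎ (∃ λ i → k ≡ - + i) → Dec (w ≡ x) → p w x k ≡ + 0 ⊎ Deg 3 (λ u e → Top w (pf y) u (e - k))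
    one w k (inj₁ q) _ = inj₁ q
    one w k (inj₂ (n , refl)) (yes refl) = inj₂ (shift-Deg {3} (Top w (pf y)) n (Top-Deg {3} w y (λ q′ → common≤3 (st (inv w)) q′ (λ q → nx (trans (sym (aW-inv w)) q)))))
    one w k (inj₂ (zero , refl)) (no ne) = inj₁ (p-nonneg w x 0 ne)
    one w k (inj₂ (suc n , refl)) (no ne) = inj₂ (λ u m → trans (cong (Top w (pf y) u) (i (+ m) (+ n))) (Top-4 w y u (m ℕ.+ n)))

  -- p_{u,w} has no positive powers and C_w is unitriangular, so degrees can be read off in either basis
  C-deg : ∀ {n f} ts → f ≗F ⟦ ts ⟧ → Deg n f → Deg n (val ts)
  C-deg {n} {f} ts q d u m = step (suc (maxℓ ts)) u m (ℕ.m≤n+m (suc (maxℓ ts)) (ℓ u))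
    where
    step : ∀ j u m → maxℓ ts < ℓ u ℕ.+ j → val ts u (+ suc (n ℕ.+ m)) ≡ + 0
    step zero u m le = above-max ts u _ (subst (maxℓ ts <_) (ℕ.+-identityʳ _) le)
    step (suc j) u m le = trans (lin-diff (kr u e) (λ w k → p u w (e - k)) ts g) (trans (sym (q u e)) (d u m))
      where
      e : ℤ
      e = + suc (n ℕ.+ m)
      g : ∀ w k → val ts w k ≡ + 0 ⊎ kr u e w k ≡ p u w (e - k)
      g w k with ℓ w ℕ.≤? ℓ u
      ... | yes le′ = inj₂ (sym (p-tri u w e k le′))
      ... | no gt with pos? u w (e - k)
      ...   | inj₁ z = inj₂ (trans (kr-no′ (k ℤ.≟ e)) (sym z))
        where
        kr-no′ : Dec (k ≡ e) → kr u e w k ≡ + 0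
        kr-no′ _ = kr-no₁ e k (λ w≡u → gt (≤-reflexive (cong ℓ w≡u)))
      ...   | inj₂ (i , z) = inj₁ (subst (λ k → val ts w k ≡ + 0) (sym k≡) (step j w (m ℕ.+ i) (≤-trans le (≤-trans (≤-reflexive (+-suc (ℓ u) j)) (ℕ.+-monoˡ-≤ j (≰⇒> gt))))))
        where
        a₁ : ∀ e k → k ≡ e - (e - k)
        a₁ = solve-∀
        a₂ : ∀ n m i → + 1 + (n + m) - (- i) ≡ + 1 + (n + (m + i))
        a₂ = solve-∀
        k≡ : k ≡ + suc (n ℕ.+ (m ℕ.+ i))
        k≡ = trans (a₁ e k) (trans (cong (_-_ e) z) (a₂ (+ n) (+ m) (+ i)))

 -- The number μ̃ and the criterion for D₁ in the lowest cell.

 module LowestCell where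
  open Defs renaming (same to LR-same; left to LR-left; right to LR-right; trans to LR-trans; δ to degδ; σ to refl-V)
  open Coxeter
  open FormalSums
  open Hecke
  open ReducedWords
  open KLPolynomials
  open StarOperations
  open KLSpans
  open Descents
  open RightTypes
  open IdentityCoefficients

  private
    half : ∀ j → (suc (2 ℕ.* j) ℕ.∸ 1) ℕ./ 2 ≡ j
    half j = trans (cong (ℕ._/ 2) (ℕ.*-comm 2 j)) (ℕ.m*n/n≡m j 2)

    odd-even : ∀ j → odd (2 ℕ.* j) ≡ false
    odd-even j = cong (ℕ._≡ᵇ 1) (trans (cong (ℕ._% 2) (ℕ.*-comm 2 j)) (ℕ.m*n%n≡0 j 2))

    odd-odd : ∀ j → odd (suc (2 ℕ.* j)) ≡ true
    odd-odd j = cong (ℕ._≡ᵇ 1) (trans (cong (λ n → suc n ℕ.% 2) (ℕ.*-comm 2 j)) (ℕ.[m+kn]%n≡m%n 1 j 2))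

    parity : ∀ n → (∃ λ j → n ≡ 2 ℕ.* j) ⊎ (∃ λ j → n ≡ suc (2 ℕ.* j))
    parity zero = inj₁ (0 , refl)
    parity (suc n) with parity n
    ... | inj₁ (j , q) = inj₂ (j , cong suc q)
    ... | inj₂ (j , q) = inj₁ (suc j , trans (cong suc q) (cong suc (sym (+-suc j (j ℕ.+ 0)))))

    <ᵇ-false : ∀ a b → (a ℕ.<ᵇ b) ≡ false → b ≤ a
    <ᵇ-false a b q = ℕ.≮⇒≥ (λ lt → clash (trans (sym (yes′ (ℕ.<⇒<ᵇ lt))) q))
      where
      yes′ : ∀ {b} → IsTrue b → b ≡ true
      yes′ {true} _ = refl
      clash : true ≢ false
      clash ()

    <ᵇ-true : ∀ a b → (a ℕ.<ᵇ b) ≡ true → a < b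
    <ᵇ-true a b q = ℕ.<ᵇ⇒< a b (subst IsTrue (sym q) _)

    vanishes : ∀ u w → leqB u w ≡ false → m (ev u) (ev w) ≡ + 0
    vanishes u w b = trans (p-pv (ev u) (ev w) -1ℤ) (pv-zero (P (word (ev u)) (word (ev w))) (-1ℤ + + ℓ (ev w) - + ℓ (ev u))
      (λ k → trans (sym (IsKL.resp isKL u _ w _ (ev-≈ u) (ev-≈ w) k)) (IsKL.vanish isKL u w (¬T b) k)))

  μ-m : ∀ u w → μ P u w ≡ m (ev u) (ev w)
  μ-m u w with leqB u w in b
  ... | false = sym (vanishes u w b)
  ... | true with len u ℕ.<ᵇ len w in lt
  ...   | false = sym (m-long (ev u) (ev w) (subst₂ _≤_ (len-ℓ w) (len-ℓ u) (<ᵇ-false (len u) (len w) lt)))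
  ...   | true with parity (len w ℕ.∸ len u)
  ...     | inj₁ (j , q) = trans (cong (λ n → if odd n then coeffP (P u w) ((n ℕ.∸ 1) ℕ./ 2) else + 0) q) (trans (cong (λ b → if b then coeffP (P u w) ((2 ℕ.* j ℕ.∸ 1) ℕ./ 2) else + 0) (odd-even j))
            (sym (trans (p-pv (ev u) (ev w) -1ℤ) (pv-other 0 (P (word (ev u)) (word (ev w))) _ (λ i z → no-half i (trans (sym z) e))))))
    where
    gap : len w ≡ 2 ℕ.* j ℕ.+ len u
    gap = trans (sym (ℕ.m∸n+n≡m (<⇒≤ (<ᵇ-true (len u) (len w) lt)))) (cong (ℕ._+ len u) q)
    i₁ : ∀ d u → -[1+ 0 ] + (d + u) - u ≡ -[1+ 0 ] + d
    i₁ = solve-∀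
    e : -1ℤ + + ℓ (ev w) - + ℓ (ev u) ≡ -1ℤ + + (2 ℕ.* j)
    e = trans (cong₂ (λ a b → -1ℤ + + a - + b) (trans (sym (len-ℓ w)) gap) (sym (len-ℓ u))) (i₁ (+ (2 ℕ.* j)) (+ len u))
    no-half : ∀ i → + (2 ℕ.* i) ≢ -1ℤ + + (2 ℕ.* j)
    no-half i z = clash (trans (sym (odd-even j)) (trans (cong odd (+-injective (trans (sym (i₂ (+ (2 ℕ.* j)))) (cong (_+_ (+ 1)) (sym z))))) (odd-odd i)))
      where
      clash : false ≢ true
      clash ()
      i₂ : ∀ d → + 1 + (-[1+ 0 ] + d) ≡ d
      i₂ = solve-∀
  ...     | inj₂ (j , q) = trans (cong (λ n → if odd n then coeffP (P u w) ((n ℕ.∸ 1) ℕ./ 2) else + 0) q) (trans (cong₂ (λ b k → if b then coeffP (P u w) k else + 0) (odd-odd j) (half j))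
            (sym (trans (p-pv (ev u) (ev w) -1ℤ) (trans (cong (pv 0 (P (word (ev u)) (word (ev w)))) e) (trans (pv-even 0 (P (word (ev u)) (word (ev w))) j) (sym (IsKL.resp isKL u _ w _ (ev-≈ u) (ev-≈ w) j)))))))
    where
    gap : len w ≡ suc (2 ℕ.* j) ℕ.+ len u
    gap = trans (sym (ℕ.m∸n+n≡m (<⇒≤ (<ᵇ-true (len u) (len w) lt)))) (cong (ℕ._+ len u) q)
    i₁ : ∀ d u → -[1+ 0 ] + (+ 1 + d + u) - u ≡ d
    i₁ = solve-∀
    e : -1ℤ + + ℓ (ev w) - + ℓ (ev u) ≡ + (2 ℕ.* j)
    e = trans (cong₂ (λ a b → -1ℤ + + a - + b) (trans (sym (len-ℓ w)) gap) (sym (len-ℓ u))) (i₁ (+ (2 ℕ.* j)) (+ len u))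

  -- If u ≤ w in the Bruhat order, then m(w,u) vanishes for reasons of length; if neither u ≤ w nor
  -- w ≤ u, both summands vanish with P.
  μ~-M : ∀ u w → μ~ P u w ≡ M (ev u) (ev w)
  μ~-M u w = go (leqB u w) refl (leqB w u) refl
    where
    go : ∀ b → leqB u w ≡ b → ∀ b′ → leqB w u ≡ b′ → (if b then μ P u w else (if b′ then μ P w u else + 0)) ≡ M (ev u) (ev w)
    go true b₁ _ _ = trans (μ-m u w) (sym (trans (cong (_+_ (m (ev u) (ev w))) (m-long (ev w) (ev u) (leqB-ℓ u w b₁))) (+-identityʳ _)))
    go false b₁ true b₂ = trans (μ-m w u) (sym (trans (cong (_+ m (ev w) (ev u)) (vanishes u w b₁)) (+-identityˡ _)))
    go false b₁ false b₂ = sym (cong₂ _+_ (vanishes u w b₁) (vanishes w u b₂))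

  J-long : ∀ {σ z} → J σ z → 4 ≤ ℓ z
  J-long {RS} {z} j with long-word RS z j
  ... | b , hb , q = subst (4 ≤_) (trans hb (cong ℓ q)) (s≤s (s≤s (s≤s (s≤s z≤n))))
  J-long {ST} {z} j with long-word ST z j
  ... | b , hb , q = subst (4 ≤_) (trans hb (cong ℓ q)) (s≤s (s≤s (s≤s (s≤s z≤n))))

  M-same : ∀ y → M y y ≡ + 0
  M-same y = cong₂ _+_ (m-long y y ≤-refl) (m-long y y ≤-refl)

  -- The highest exponent of v in p(e,z) is -n.
  Degree : ℕ → W → Set
  Degree n z = p 1W z (- + n) ≢ + 0 × (∀ e k → e + + n ≡ + suc k → p 1W z e ≡ + 0)

  Degree-inv : ∀ {n z} → Degree n (inv z) → Degree n z
  Degree-inv {n} {z} (a , b) = (λ q → a (trans (p-1-inv z (- + n)) q)) , (λ e k q → trans (sym (p-1-inv z e)) (b e k q))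

  Degree-below : ∀ {n z} → (∀ e k → e + + n ≡ + suc k → p 1W z e ≡ + 0) → p 1W z (- + n) ≡ + 0 → p 1W z (- + suc n) ≢ + 0 → Degree (suc n) z
  Degree-below {n} {z} above top ne = ne , go
    where
    i : ∀ e n → e + n ≡ -[1+ 0 ] + (e + (+ 1 + n))
    i = solve-∀
    i₂ : ∀ e n → e ≡ e + n - n
    i₂ = solve-∀
    i₃ : ∀ n → + 0 - n ≡ - n
    i₃ = solve-∀
    go : ∀ e k → e + + suc n ≡ + suc k → p 1W z e ≡ + 0
    go e zero q = trans (cong (p 1W z) (trans (i₂ e (+ n)) (trans (cong (_- + n) (trans (i e (+ n)) (cong (_+_ -1ℤ) q))) (i₃ (+ n))))) top
    go e (suc k) q = above e k (trans (i e (+ n)) (cong (_+_ -1ℤ) q))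

  -- If m(z,d) vanishes, then m(d,z) does not, and by `m-descent` the only possibility is z = gd,
  -- which is an edge as well.
  LE-M : ∀ {g z d} → lb g z ≡ true → lb g d ≡ false → M z d ≢ + 0 → LE g z d
  LE-M {g} {z} {d} gz gd ne with m z d ℤ.≟ + 0
  ... | no nz = gz , inj₂ nz
  ... | yes z₀ with l g d ≟W z
  ...   | yes q = gz , inj₁ (sym q)
  ...   | no n = ⊥-elim (ne (cong₂ _+_ z₀ (m-descent g d z gz gd n)))

  LE-ty : ∀ {g σ i z w} → Ty σ i (inv w) → lb g w ≡ false → LE g z w → Ty σ i (inv z)
  LE-ty {g} {σ} {i} {z} {w} ty b le = RE-ty {i = i} ty (trans (rb-inv g w) b) (LE→RE le)

  LE-ty2 : ∀ {g i z w} → Ty2 i (inv w) → lb g w ≡ false → LE g z w → Ty2 i (inv z) ⊎ aW (inv z) ≡ 4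
  LE-ty2 {g} {i} {z} {w} ty b le = RE-ty2 {i = i} ty (trans (rb-inv g w) b) (LE→RE le)

  [≡]₀-yes : ∀ {u w} → [ u ≡ w ]₀ ≢ + 0 → u ≡ w
  [≡]₀-yes {u} {w} ne with u ≟W w
  ... | yes q = q
  ... | no n = ⊥-elim (ne (≡₀-no n))

  private
    up-LE : ∀ g y → lb g y ≡ false → LE g (l g y) y
    up-LE g y b = trans (lb-flip g y) (cong not b) , inj₁ refl

  -- Level `l1` is `star-A` with the term killed by `J-m13`; levels `l2` and `l3` are `star-C` for
  -- the strings of (s,c) through y and of (a,s) through cy.
  m-lev : ∀ {σ y y′} → J σ y → J σ y′ → ∀ i → m (lev σ i y) (lev σ i y′) ≡ m y y′
  m-lev j j′ l0 = refl
  m-lev {σ} {y} {y′} j j′ l1 = trans (sym (star-A (J-Str j) (J-Str j′))) (trans (cong (_+ m y y′) (J-m13 j j′)) (+-identityˡ _))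
  m-lev j j′ l2 = star-C (J-Str j) (J-Str j′)
  m-lev j j′ l3 = trans (star-C (J1-Str j) (J1-Str j′)) (m-lev j j′ l1)

  M-lev : ∀ {σ y y′} → J σ y → J σ y′ → ∀ i → M (lev σ i y) (lev σ i y′) ≡ M y y′
  M-lev j j′ i = cong₂ _+_ (m-lev j j′ i) (m-lev j′ j i)

  private
    pre-lev : ∀ σ i w → ev (pre σ i ++ w) ≡ lev σ i (ev w)
    pre-lev σ l0 w = refl
    pre-lev σ l1 w = ev-∷ (c σ) w
    pre-lev σ l2 w = trans (ev-∷ s _) (cong (l s) (ev-∷ (c σ) w))
    pre-lev σ l3 w = trans (ev-∷ (a σ) _) (cong (l (a σ)) (trans (ev-∷ s _) (cong (l s) (ev-∷ (c σ) w))))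

    pre2-lev : ∀ i w → ev (pre2 i ++ w) ≡ lev2 i (ev w)
    pre2-lev n0 w = refl
    pre2-lev ns w = ev-∷ s w
    pre2-lev (na σ) w = trans (ev-∷ (a σ) _) (cong (l (a σ)) (ev-∷ s w))

    inv-ev : ∀ {v x} → ev v ≡ x → ev (reverse v) ≡ ev v → inv x ≡ x
    inv-ev {v} refl q = trans (sym (ev-reverse v)) q

    palindrome : ∀ v → reverse v ≈ v → ev (reverse v) ≡ ev v
    palindrome v q = ≈⇒≡ (reverse v) v q

  dist : Side → Lv → W
  dist σ i = lev σ i (x′ σ i)

  dist-inv : ∀ σ i → inv (dist σ i) ≡ dist σ i
  dist-inv σ i = inv-ev {pre σ i ++ xw σ i} (pre-lev σ i (xw σ i)) (q σ i)
    where
    q : ∀ σ i → ev (reverse (pre σ i ++ xw σ i)) ≡ ev (pre σ i ++ xw σ i)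
    q RS l0 = palindrome (pre RS l0 ++ xw RS l0) refl
    q RS l1 = palindrome (pre RS l1 ++ xw RS l1) refl
    q RS l2 = palindrome (pre RS l2 ++ xw RS l2) refl
    q RS l3 = palindrome (pre RS l3 ++ xw RS l3) refl
    q ST l0 = palindrome (pre ST l0 ++ xw ST l0) refl
    q ST l1 = palindrome (pre ST l1 ++ xw ST l1) refl
    q ST l2 = palindrome (pre ST l2 ++ xw ST l2) refl
    q ST l3 = palindrome (pre ST l3 ++ xw ST l3) refl

  dist2 : Lv2 → W
  dist2 i = lev2 i (x″ i)

  dist2-inv : ∀ i → inv (dist2 i) ≡ dist2 i
  dist2-inv i = inv-ev {pre2 i ++ xw2 i} (pre2-lev i (xw2 i)) (q i)
    where
    q : ∀ i → ev (reverse (pre2 i ++ xw2 i)) ≡ ev (pre2 i ++ xw2 i)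
    q n0 = palindrome (pre2 n0 ++ xw2 n0) refl
    q ns = palindrome (pre2 ns ++ xw2 ns) refl
    q (na RS) = palindrome (pre2 (na RS) ++ xw2 (na RS)) refl
    q (na ST) = palindrome (pre2 (na ST) ++ xw2 (na ST)) refl

  private
    one≢0 : + 1 ≢ + 0
    one≢0 ()

  dist-Degree : ∀ σ i → Degree 4 (dist σ i)
  dist-Degree σ i = (λ q → one≢0 (trans (sym (trans (Formulas.lev-4 σ (J-x′ σ i) i) (p-diag₀ _))) q)) , Formulas.lev-above σ (J-x′ σ i) i

  dist2-Degree : ∀ i → Degree 2 (dist2 i)
  dist2-Degree i = (λ q → one≢0 (trans (sym (trans (Formulas2.lev2-2 (K-x″ i) i) (p-diag₀ _))) q)) , Formulas2.lev2-above (K-x″ i) i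

  -- y = `x′ σ i` is impossible because m(y,y) = 0, so the v⁻⁴ coefficient vanishes, and the next
  -- coefficient is the given number up to `M-lev`.
  c0-core : ∀ {σ i y} → J σ y → M (lev σ i y) (dist σ i) ≢ + 0 → Degree 5 (lev σ i y)
  c0-core {σ} {i} {y} j ne = Degree-below {4} {lev σ i y} (Formulas.lev-above σ j i) (trans (Formulas.lev-4 σ j i) (≡₀-no (λ q → ne′ (trans (cong (M y) q) (M-same y)))))
      (λ q → ne′ (trans (M-comm y (x′ σ i)) (trans (sym (lev-M σ j i)) q)))
    where
    ne′ : M y (x′ σ i) ≢ + 0
    ne′ q = ne (trans (M-lev j (J-x′ σ i) i) q)

  c0-forward : ∀ {σ i y} → J σ y → p 1W (lev σ i y) -[1+ 4 ] ≢ + 0 → M (lev σ i y) (dist σ i) ≢ + 0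
  c0-forward {σ} {i} {y} j ne q = ne (trans (lev-M σ j i) (trans (M-comm (x′ σ i) y) (trans (sym (M-lev j (J-x′ σ i) i)) q)))

  is-dist : ∀ {σ i y} → J σ y → p 1W (lev σ i y) -[1+ 3 ] ≢ + 0 → lev σ i y ≡ dist σ i
  is-dist {σ} {i} {y} j ne = cong (lev σ i) (sym ([≡]₀-yes (λ q → ne (trans (Formulas.lev-4 σ j i) q))))

  private
    c0-typed : ∀ {σ i z d} → Ty σ i z → Ty σ i d → p 1W d -[1+ 3 ] ≢ + 0 → M z d ≢ + 0 → Degree 5 z
    c0-typed {σ} {i} (y , j , refl) (y′ , j′ , refl) nd ne = c0-core {σ} {i} j (subst (λ d → M (lev σ i y) d ≢ + 0) (is-dist {σ} {i} j′ nd) ne)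

    c0-typed-inv : ∀ {σ i z d} → Ty σ i (inv z) → Ty σ i d → inv d ≡ d → p 1W d -[1+ 3 ] ≢ + 0 → M z d ≢ + 0 → Degree 5 z
    c0-typed-inv {σ} {i} {z} {d} ty ty′ id nd ne = Degree-inv {5} {z} (c0-typed {σ} {i} ty ty′ nd (λ q → ne (trans (sym (M-inv z d)) (trans (cong (M (inv z)) id) q))))

    -- A generator in exactly one of the two left descent sets makes the pair a left edge, and left
    -- edges preserve the type of the inverse. So z⁻¹ has the type of d⁻¹ = d, and the case of equal
    -- types is applied to z⁻¹.
    c0-visible : ∀ {g z d} → aW z ≡ 4 → Dec4 d → inv d ≡ d → p 1W d -[1+ 3 ] ≢ + 0 → M z d ≢ + 0 → lb g z ≢ lb g d → Degree 5 z
    c0-visible {g} {z} {d} e4 (dec4 τ j y′ jy q) id nd ne vis = go (lb g z) refl (lb g d) refl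
      where
      dty : Ty τ j d
      dty = y′ , jy , q
      other : Dec4 (inv z) → lb g z ≡ false → lb g d ≡ true → Degree 5 z
      other (dec4 σ i y iy q′) gz gd = c0-typed-inv {σ} {i} ty (subst (Ty σ i) id (LE-ty {i = i} ty gz (LE-M gd gz (λ w → ne (trans (M-comm z d) w))))) id nd ne
        where
        ty : Ty σ i (inv z)
        ty = y , iy , q′
      go : ∀ b → lb g z ≡ b → ∀ b′ → lb g d ≡ b′ → Degree 5 z
      go true gz true gd = ⊥-elim (vis (trans gz (sym gd)))
      go false gz false gd = ⊥-elim (vis (trans gz (sym gd)))
      go true gz false gd = c0-typed-inv {τ} {j} (LE-ty {i = j} (subst (Ty τ j) (sym id) dty) gd (LE-M gz gd ne)) dty id nd ne
      go false gz true gd = other (decompose4 (inv z) (trans (aW-inv z) e4)) gz gd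

    -- The generator c of one side is the generator a of the other, so the strings of (s,c) through
    -- u and of (a,s) through cw, taken on their own sides, have opposite parity. Both pairs are
    -- thereby moved to (u, scw), which has a visible edge.
    M-opp : ∀ σ {u w} → J σ u → J (opp σ) w → M (lev σ l1 u) (lev (opp σ) l1 w) ≡ M u (lev (opp σ) l2 w) × M (lev σ l2 u) (lev (opp σ) l2 w) ≡ M u (lev (opp σ) l2 w)
    M-opp RS {u} {w} j j′ = sym (M-12 (J-Str {RS} j) (J1-Str {ST} j′)) , trans (M-32 (J-Str {RS} j) (J1-Str {ST} j′)) (sym (M-12 (J-Str {RS} j) (J1-Str {ST} j′)))
    M-opp ST {u} {w} j j′ = sym (M-12 (J-Str {ST} j) (J1-Str {RS} j′)) , trans (M-32 (J-Str {ST} j) (J1-Str {RS} j′)) (sym (M-12 (J-Str {ST} j) (J1-Str {RS} j′)))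

    opp-bit : ∀ σ {w} → J (opp σ) w → lb (a σ) (lev (opp σ) l2 w) ≡ false
    opp-bit RS j = J2-c j
    opp-bit ST j = J2-c j

    opp-ty : ∀ σ {u w} → J σ u → J (opp σ) w → M u (lev (opp σ) l2 w) ≢ + 0 → ∀ {τ i} → Ty τ i (inv (lev (opp σ) l2 w)) → Ty τ i (inv u)
    opp-ty σ {u} {w} j j′ ne {τ} {i} ty = LE-ty {i = i} ty (opp-bit σ j′) (LE-M (proj₁ j) (opp-bit σ j′) ne)

    up1-ty : ∀ {σ u} → J σ u → ∀ {τ i} → Ty τ i (inv u) → Ty τ i (inv (lev σ l1 u))
    up1-ty {σ} {u} j {i = i} ty = LE-ty {i = i} ty (J-c j) (up-LE (c σ) u (J-c j))

    up2-ty : ∀ {σ u} → J σ u → ∀ {τ i} → Ty τ i (inv (lev σ l1 u)) → Ty τ i (inv (lev σ l2 u))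
    up2-ty {σ} {u} j {i = i} ty = LE-ty {i = i} ty (J1-s j) (up-LE s (lev σ l1 u) (J1-s j))

    -- All coincidences of descent sets among types: besides equal types, {r,t} at level `l1` and
    -- {s} at level `l2` occur on both sides.
    data Same : Side → Lv → Side → Lv → Set where
      eq : ∀ {σ i} → Same σ i σ i
      op1 : ∀ {σ} → Same σ l1 (opp σ) l1
      op2 : ∀ {σ} → Same σ l2 (opp σ) l2

    tb : Side → Lv → Gen → Bool
    tb σ l0 s = true
    tb σ l1 s = false
    tb σ l2 s = true
    tb σ l3 s = false
    tb RS l0 r = true
    tb RS l0 t = false
    tb ST l0 r = false
    tb ST l0 t = true
    tb σ l1 r = true
    tb σ l1 t = true
    tb σ l2 r = false
    tb σ l2 t = false
    tb RS l3 r = true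
    tb RS l3 t = false
    tb ST l3 r = false
    tb ST l3 t = true

    tb-lev : ∀ σ i {y} → J σ y → ∀ g → lb g (lev σ i y) ≡ tb σ i g
    tb-lev σ l0 j s = proj₂ j
    tb-lev σ l1 j s = J1-s j
    tb-lev σ l2 j s = J2-s j
    tb-lev σ l3 j s = J3-s j
    tb-lev RS l0 j r = proj₁ j
    tb-lev RS l0 j t = J-c j
    tb-lev ST l0 j r = J-c j
    tb-lev ST l0 j t = proj₁ j
    tb-lev RS l1 j r = J1-a j
    tb-lev RS l1 j t = J1-c j
    tb-lev ST l1 j r = J1-c j
    tb-lev ST l1 j t = J1-a j
    tb-lev RS l2 j r = J2-a j
    tb-lev RS l2 j t = J2-c j
    tb-lev ST l2 j r = J2-c j
    tb-lev ST l2 j t = J2-a j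
    tb-lev RS l3 j r = J3-a j
    tb-lev RS l3 j t = J3-c j
    tb-lev ST l3 j r = J3-c j
    tb-lev ST l3 j t = J3-a j

    level : Bool → Bool → Bool → Lv
    level rb true tb = if rb ∨ tb then l0 else l2
    level rb false tb = if rb ∧ tb then l1 else l3

    level-tb : ∀ σ i → i ≡ level (tb σ i r) (tb σ i s) (tb σ i t)
    level-tb RS l0 = refl
    level-tb RS l1 = refl
    level-tb RS l2 = refl
    level-tb RS l3 = refl
    level-tb ST l0 = refl
    level-tb ST l1 = refl
    level-tb ST l2 = refl
    level-tb ST l3 = refl

    same-side : ∀ i σ τ → (∀ g → tb σ i g ≡ tb τ i g) → Same σ i τ i
    same-side i RS RS h = eq
    same-side i ST ST h = eq
    same-side l1 RS ST h = op1 {RS}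
    same-side l1 ST RS h = op1 {ST}
    same-side l2 RS ST h = op2 {RS}
    same-side l2 ST RS h = op2 {ST}
    same-side l0 RS ST h = bool-clash refl (h r)
    same-side l0 ST RS h = bool-clash refl (sym (h r))
    same-side l3 RS ST h = bool-clash refl (h r)
    same-side l3 ST RS h = bool-clash refl (sym (h r))

    same? : ∀ σ i τ j → (∀ g → tb σ i g ≡ tb τ j g) → Same σ i τ j
    same? σ i τ j h with trans (level-tb σ i) (trans (cong₂ (λ f x → f x) (cong₂ level (h r) (h s)) (h t)) (sym (level-tb τ j)))
    ... | refl = same-side i σ τ h

    ∀Gen : ∀ {f f′ : Gen → Bool} → (∃ λ g → f g ≢ f′ g) ⊎ (∀ g → f g ≡ f′ g)
    ∀Gen {f} {f′} with f r Bool.≟ f′ r | f s Bool.≟ f′ s | f t Bool.≟ f′ t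
    ... | no n | _ | _ = inj₁ (r , n)
    ... | yes _ | no n | _ = inj₁ (s , n)
    ... | yes _ | yes _ | no n = inj₁ (t , n)
    ... | yes a | yes b | yes c = inj₂ λ { r → a ; s → b ; t → c }

  c0-back : ∀ {z d} → aW z ≡ 4 → aW d ≡ 4 → p 1W d -[1+ 3 ] ≢ + 0 → M z d ≢ + 0 → Degree 5 z
  c0-back {z} {d} ez ed nd ne = go (decompose4 z ez) (decompose4 d ed)
    where
    go : Dec4 z → Dec4 d → Degree 5 z
    go (dec4 σ i y jy qz) D@(dec4 τ j y′ jy′ qd) = both ∀Gen
      where
      id : inv d ≡ d
      id = trans (cong inv q) (trans (dist-inv τ j) (sym q))
        where
        q : d ≡ dist τ j
        q = trans qd (is-dist {τ} {j} jy′ (subst (λ d → p 1W d -[1+ 3 ] ≢ + 0) qd nd))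
      dty : Ty τ j d
      dty = y′ , jy′ , qd
      ne′ : M (lev σ i y) (lev τ j y′) ≢ + 0
      ne′ q = ne (trans (cong₂ M qz qd) q)
      idy : ∀ {d′} → d′ ≡ d → Ty τ j (inv d′)
      idy {d′} q = subst (Ty τ j) (sym (trans (cong inv q) id)) dty
      invisible : ∀ {σ i τ j y y′} → Same σ i τ j → J σ y → J τ y′ → z ≡ lev σ i y → d ≡ lev τ j y′ → Degree 5 z
      invisible {i = i} eq j₁ j₂ q₁ q₂ = c0-typed {i = i} (_ , j₁ , q₁) (_ , j₂ , q₂) nd ne
      invisible {σ = σ} {y = u} {w} op1 j₁ j₂ q₁ q₂ = c0-typed-inv {τ} {j} (subst (Ty τ j ∘ inv) (sym q₁) (up1-ty j₁ {i = j} (opp-ty σ j₁ j₂ (λ q → ne (trans (cong₂ M q₁ q₂) (trans (proj₁ (M-opp σ j₁ j₂)) q))) {i = j}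
          (LE-ty {i = j} (idy (sym q₂)) (J1-s j₂) (up-LE s (lev (opp σ) l1 w) (J1-s j₂)))))) dty id nd ne
      invisible {σ = σ} {y = u} {w} op2 j₁ j₂ q₁ q₂ = c0-typed-inv {τ} {j} (subst (Ty τ j ∘ inv) (sym q₁) (up2-ty j₁ {i = j} (up1-ty j₁ {i = j} (opp-ty σ j₁ j₂ (λ q → ne (trans (cong₂ M q₁ q₂) (trans (proj₂ (M-opp σ j₁ j₂)) q))) {i = j}
          (idy (sym q₂)))))) dty id nd ne
      both : (∃ λ g → lb g z ≢ lb g d) ⊎ (∀ g → lb g z ≡ lb g d) → Degree 5 z
      both (inj₁ (g , vis)) = c0-visible ez D id nd ne vis
      both (inj₂ h) = invisible (same? σ i τ j (λ g → trans (sym (tb-lev σ i jy g)) (trans (cong (lb g) (sym qz)) (trans (h g) (trans (cong (lb g) qd) (tb-lev τ j jy′ g)))))) jy jy′ qz qd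

 -- The criterion for D₁ in the cell a = 2 and its exceptional pair.

 module MiddleCell where
  open Defs using (Gen; r; s; t; Word)
  open Coxeter
  open FormalSums
  open Hecke
  open ReducedWords
  open KLPolynomials
  open StarOperations
  open KLSpans
  open Descents
  open RightTypes
  open IdentityCoefficients
  open LowestCell
  open Automaton using (bit)

  private
    [_]ʷ : Word → W
    [ w ]ʷ = ev w

    v₀ v₁ v₂ v₃ : W
    v₀ = x″ n0
    v₁ = l s v₀
    v₂ = l t v₁
    v₃ = l r v₂

    k₀ : K2 v₀
    k₀ = K-x″ n0

    v₁-ev : v₁ ≡ ev (s ∷ r ∷ t ∷ [])
    v₁-ev = sym (ev-∷ s (r ∷ t ∷ []))
    v₂-ev : v₂ ≡ ev (t ∷ s ∷ r ∷ t ∷ [])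
    v₂-ev = trans (cong (l t) v₁-ev) (sym (ev-∷ t _))
    v₃-ev : v₃ ≡ ev (r ∷ t ∷ s ∷ r ∷ t ∷ [])
    v₃-ev = trans (cong (l r) v₂-ev) (sym (ev-∷ r _))

    ℓ₀ : ℓ v₀ ≡ 2
    ℓ₀ = ℓ-x″ n0
    ℓ₁ : ℓ v₁ ≡ 3
    ℓ₁ = trans (ℓ-up s v₀ (K-s RS k₀)) (cong suc ℓ₀)
    ℓ₂ : ℓ v₂ ≡ 4
    ℓ₂ = trans (ℓ-up t v₁ (K1-a ST k₀)) (cong suc ℓ₁)

    E₂ : C t (pf v₁) ≗F (λ u e → pf v₂ u e + pf v₀ u e)
    E₂ u e = trans (C-up t v₁ (K1-a ST k₀) u e) (cong (_+_ (p u v₂ e)) (trans (S-one t v₁ u e v₀ (K-a ST k₀) (λ z ne tz → inj₁ (go z ne tz (lb s z) refl)))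
        (trans (cong (_* p u v₀ e) (m-up s v₀ (K-s RS k₀))) (*-identityˡ _))))
      where
      go : ∀ z → z ≢ v₀ → lb t z ≡ true → ∀ b → lb s z ≡ b → m z v₁ ≡ + 0
      go z ne tz true sz = m-long z v₁ (subst (_≤ ℓ z) (sym ℓ₁) (≤-trans (s≤s (s≤s (s≤s z≤n))) (J-long {ST} (tz , sz))))
      go z ne tz false sz = m-descent s z v₁ (K1-s ST k₀) sz (λ q → ne (l-inj s q))

    inv₂ : inv v₂ ≡ ev (r ∷ t ∷ s ∷ t ∷ [])
    inv₂ = trans (cong inv v₂-ev) (trans (sym (ev-reverse (t ∷ s ∷ r ∷ t ∷ []))) (≈⇒≡ _ _ refl))

    rb₂ : ∀ g → g ≡ r ⊎ g ≡ t → rb g v₂ ≡ true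
    rb₂ .r (inj₁ refl) = trans (cong (lb r) inv₂) (lb-ev r (r ∷ t ∷ s ∷ t ∷ []) refl)
    rb₂ .t (inj₂ refl) = trans (cong (lb t) inv₂) (lb-ev t (r ∷ t ∷ s ∷ t ∷ []) refl)

    m-descentʳ : ∀ g u w → rb g w ≡ true → rb g u ≡ false → inv u ≢ l g (inv w) → m u w ≡ + 0
    m-descentʳ g u w b b′ ne = trans (sym (m-inv u w)) (m-descent g (inv u) (inv w) b b′ (λ q → ne (l≡-sym g q)))

    -- Only rt and rts are short enough. The first is excluded by parity; for the second, v₂ = tsrt
    -- has the right descent r, which rts lacks, and rtsr is not v₂.
    m-K : ∀ z → K2 z → m z v₂ ≡ + 0
    m-K z k = go (K-word z k)
      where
      b₁ : ∀ w w′ g → ev w ≡ z → redW (reverse w) ≡ true → bit g (stW (reverse w)) ≡ false → g ≡ r ⊎ g ≡ t → l g (ev (r ∷ t ∷ s ∷ t ∷ [])) ≡ ev w′ → ev (reverse w) ≢ ev w′ → m z v₂ ≡ + 0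
      b₁ w w′ g q h b gg q′ ne = m-descentʳ g z v₂ (rb₂ g gg) (trans (cong (lb g) iz) (trans (lb-ev g (reverse w) h) b)) (λ q″ → ne (trans (sym iz) (trans q″ (trans (cong (l g) inv₂) q′))))
        where
        iz : inv z ≡ ev (reverse w)
        iz = trans (cong inv (sym q)) (sym (ev-reverse w))
      long′ : ∀ w → Red w → ev w ≡ z → 4 ≤ length w → m z v₂ ≡ + 0
      long′ w h q le = m-long z v₂ (subst₂ _≤_ (sym ℓ₂) (trans h (cong ℓ q)) le)
      go : (∃ λ b → Red (r ∷ t ∷ b) × ev (r ∷ t ∷ b) ≡ z) → m z v₂ ≡ + 0
      go ([] , h , q) = m-gap2 z v₂ (trans ℓ₂ (cong (suc ∘ suc) (sym (trans (cong ℓ (sym q)) (sym h)))))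
      go (s ∷ [] , h , q) = b₁ (r ∷ t ∷ s ∷ []) (t ∷ s ∷ t ∷ []) r q refl refl (inj₁ refl) (trans (sym (ev-∷ r _)) (≈⇒≡ _ _ refl))
          (λ e → ne (trans (sym (lb-ev t (s ∷ t ∷ r ∷ []) refl)) (trans (cong (lb t) e) (lb-ev t (t ∷ s ∷ t ∷ []) refl))))
        where
        ne : false ≢ true
        ne ()
      go (r ∷ [] , h , q) = ⊥-elim (short (r ∷ t ∷ r ∷ []) (t ∷ []) refl h (s≤s (s≤s z≤n)))
      go (t ∷ [] , h , q) = ⊥-elim (short (r ∷ t ∷ t ∷ []) (r ∷ []) refl h (s≤s (s≤s z≤n)))
      go (g ∷ g′ ∷ b , h , q) = long′ (r ∷ t ∷ g ∷ g′ ∷ b) h q (s≤s (s≤s (s≤s (s≤s z≤n))))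

    r₂ : lb r v₂ ≡ false
    r₂ = K2-c ST k₀

    t₂ : lb t v₂ ≡ true
    t₂ = K2-a ST k₀

    S₃ : S r v₂ 1W -[1+ 2 ] ≡ + 0
    S₃ = S-none r v₂ 1W -[1+ 2 ] (λ z rz → go z rz (lb t z) refl)
      where
      low : ∀ z → K2 z ⊎ aW z ≡ 4 → m z v₂ ≡ + 0 ⊎ p 1W z -[1+ 2 ] ≡ + 0
      low z (inj₁ k) = inj₁ (m-K z k)
      low z (inj₂ e) = inj₂ (f (decompose4 z e))
        where
        f : Dec4 z → p 1W z -[1+ 2 ] ≡ + 0
        f (dec4 σ i y j q) = trans (cong (λ z → p 1W z -[1+ 2 ]) q) (Formulas.lev-above σ j i -[1+ 2 ] 0 refl)
      go : ∀ z → lb r z ≡ true → ∀ b → lb t z ≡ b → m z v₂ ≡ + 0 ⊎ p 1W z -[1+ 2 ] ≡ + 0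
      go z rz true tz = low z (rt-cases z rz tz)
      go z rz false tz = inj₁ (m-descent t z v₂ t₂ tz (λ q → bool-clash rz (trans (cong (lb r) (l-inj t q)) (K1-a RS k₀))))

    gl : Gen → W
    gl g = l g 1W

    lb-gl : ∀ g g′ → lb g (gl g′) ≡ bit g (stW (g′ ∷ []))
    lb-gl g g′ = trans (cong (lb g) (trans (cong (l g′) (sym ev-[])) (sym (ev-∷ g′ [])))) (lb-ev g (g′ ∷ []) (rd g′))
      where
      rd : ∀ g → redW (g ∷ []) ≡ true
      rd r = refl
      rd s = refl
      rd t = refl

    lb-1W : ∀ g → lb g 1W ≡ false
    lb-1W g = trans (cong (lb g) (sym ev-[])) (trans (lb-ev g [] refl) (q g))
      where
      q : ∀ g → bit g (stW []) ≡ false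
      q r = refl
      q s = refl
      q t = refl

    gl-ev : ∀ g → gl g ≡ ev (g ∷ [])
    gl-ev g = trans (cong (l g) (sym ev-[])) (sym (ev-∷ g []))

    l-ev₂ : ∀ g g′ → l g (gl g′) ≡ ev (g ∷ g′ ∷ [])
    l-ev₂ g g′ = trans (cong (l g) (gl-ev g′)) (sym (ev-∷ g _))

    tr-v₀ : l t (gl r) ≡ v₀
    tr-v₀ = trans (l-ev₂ t r) (≈⇒≡ _ _ refl)

    rt-v₀ : l r (gl t) ≡ v₀
    rt-v₀ = l-ev₂ r t

    p-v₁ : ∀ u e → lb s u ≡ false → p u v₁ e ≡ p (l s u) v₀ e + p u v₀ (ℤ.suc e)
    p-v₁ u e b = trans (sym (C-K1 k₀ u e)) (cong (λ β → p (l s u) v₀ e + p u v₀ (sh β e)) b)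

    p-v₂ : ∀ u e → lb t u ≡ false → p u v₂ e ≡ p (l t u) v₁ e + p u v₁ (ℤ.suc e) + - p u v₀ e
    p-v₂ u e b = minus (trans (sym (E₂ u e)) (cong (λ β → p (l t u) v₁ e + p u v₁ (sh β e)) b))
      where
      minus : ∀ {a b c} → a + b ≡ c → a ≡ c + - b
      minus {a} {b} refl = sym (cancel a b)

    no-v₀ : ∀ u e → ℓ u ≡ 2 → lb r u ≡ false ⊎ lb t u ≡ false → p u v₀ e ≡ + 0
    no-v₀ u e lu b = p-long u v₀ e (ne b) (≤-reflexive (trans ℓ₀ (sym lu)))
      where
      ne : lb r u ≡ false ⊎ lb t u ≡ false → u ≢ v₀
      ne (inj₁ b) q = bool-clash (trans (cong (lb r) q) (proj₁ k₀)) b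
      ne (inj₂ b) q = bool-clash (trans (cong (lb t) q) (proj₁ (proj₂ k₀))) b

    ℓ-gl : ∀ g → ℓ (gl g) ≡ 1
    ℓ-gl g = trans (ℓ-up g 1W (lb-1W g)) (cong suc ℓ-1)

    st-lb : ∀ g g′ g″ → bit g″ (stW (g ∷ g′ ∷ [])) ≡ false → redW (g ∷ g′ ∷ []) ≡ true → lb g″ (l g (gl g′)) ≡ false
    st-lb g g′ g″ b h = trans (cong (lb g″) (l-ev₂ g g′)) (trans (lb-ev g″ (g ∷ g′ ∷ []) h) b)

    p-a-v₁ : ∀ σ → p (gl (a σ)) v₁ -2ℤ ≡ + 1
    p-a-v₁ σ = trans (p-v₁ (gl (a σ)) -2ℤ (trans (lb-gl s (a σ)) (f₁ σ))) (trans (cong₂ _+_ (no-v₀ (l s (gl (a σ))) -2ℤ (trans (ℓ-up s (gl (a σ)) (trans (lb-gl s (a σ)) (f₁ σ))) (cong suc (ℓ-gl (a σ)))) (inj₁ (f₂ σ))) (f₃ σ)) refl)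
      where
      f₁ : ∀ σ → bit s (stW (a σ ∷ [])) ≡ false
      f₁ RS = refl
      f₁ ST = refl
      f₂ : ∀ σ → lb r (l s (gl (a σ))) ≡ false
      f₂ RS = st-lb s r r refl refl
      f₂ ST = st-lb s t r refl refl
      f₃ : ∀ σ → p (gl (a σ)) v₀ -1ℤ ≡ + 1
      f₃ RS = trans (cong (m (gl r)) (sym tr-v₀)) (m-up t (gl r) (trans (lb-gl t r) refl))
      f₃ ST = trans (cong (m (gl t)) (sym rt-v₀)) (m-up r (gl t) (trans (lb-gl r t) refl))

    p-1-v₁ : p 1W v₁ -1ℤ ≡ + 0
    p-1-v₁ = trans (p-v₁ 1W -1ℤ (lb-1W s)) (cong₂ _+_ (m-descent r (gl s) v₀ (proj₁ k₀) (trans (lb-gl r s) refl) (λ q → bool-clash (trans (cong (lb t) q) (proj₁ (proj₂ k₀))) (st-lb r s t refl refl)))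
      (p-nonneg 1W v₀ 0 (λ q → bool-clash (proj₁ k₀) (trans (cong (lb r) (sym q)) (lb-1W r)))))

    p-r-v₂ : p (gl r) v₂ -[1+ 2 ] ≡ + 1
    p-r-v₂ = trans (p-v₂ (gl r) -[1+ 2 ] (trans (lb-gl t r) refl)) (cong₂ (λ a b → a + - b) (cong₂ _+_
        (trans (cong (λ u → p u v₁ -[1+ 2 ]) tr-v₀) (trans (p-v₁ v₀ -[1+ 2 ] (K-s RS k₀)) (cong₂ _+_ (p-long v₁ v₀ -[1+ 2 ] (λ q → <⇒≢ ≤-refl (trans (sym ℓ₀) (trans (cong ℓ (sym q)) ℓ₁))) (subst₂ _≤_ (sym ℓ₀) (sym ℓ₁) (s≤s (s≤s z≤n)))) (p-diag v₀ -2ℤ (λ ())))))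
        (p-a-v₁ RS))
      (trans (sym (trans (cong (λ u → p u v₀ -2ℤ) (sym tr-v₀)) (p-descent t (gl r) v₀ -2ℤ (proj₁ (proj₂ k₀)) (trans (lb-gl t r) refl)))) (p-diag v₀ -2ℤ (λ ()))))

    p-1-v₂ : p 1W v₂ -2ℤ ≡ + 0
    p-1-v₂ = trans (p-v₂ 1W -2ℤ (lb-1W t)) (cong₂ (λ a b → a + - b) (cong₂ _+_ (p-a-v₁ ST) p-1-v₁) (trans (cong (λ n → p 1W v₀ (- + n)) (sym ℓ₀)) (p-bottom v₀)))

    k₃ : K2 v₃
    k₃ = subst K2 (sym v₃-ev) (lb-ev r w₃ refl , lb-ev t w₃ refl , cong av (st-ev w₃ refl))
      where
      w₃ : Word
      w₃ = r ∷ t ∷ s ∷ r ∷ t ∷ []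

    -- By `lev2-M` this number is the v⁻³ coefficient of p(e,rtsrt), so it can be computed by one
    -- step of the recursion from rtsrt down to tsrt.
    m-v₀-v₃ : m v₀ v₃ ≡ + 1
    m-v₀-v₃ = trans (sym (trans (lev2-M k₃ n0) (trans (cong (_+_ (m v₀ v₃)) (m-long v₃ v₀ (subst₂ _≤_ (sym ℓ₀) (sym ℓ₃) (s≤s (s≤s z≤n))))) (+-identityʳ _))))
        (trans (p-step⁻ r v₂ 1W -[1+ 2 ] r₂ (lb-1W r)) (trans (cong₂ (λ a b → a + - b) (cong₂ _+_ p-r-v₂ p-1-v₂) S₃) refl))
      where
      ℓ₃ : ℓ v₃ ≡ 5
      ℓ₃ = trans (ℓ-up r v₂ r₂) (cong suc ℓ₂)

    V Y : W
    V = x″ ns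
    Y = l r (l t (l s V))

    -- Inversion turns the pair into srt and srtsrt, where `star-B` applies to the strings through
    -- rt and rtsrt; each of its two summands is 1.
    m-V-Y : m V Y ≡ + 2
    m-V-Y = trans (sym (cong₂ m qV qY)) (trans (m-inv v₁ (l s v₃)) (trans (star-B (K-Str ST k₀) (K-Str ST k₃)) (cong₂ _+_ m-v₀-v₃ (m-up r v₂ r₂))))
      where
      qV : inv v₁ ≡ V
      qV = trans (cong inv v₁-ev) (trans (sym (ev-reverse (s ∷ r ∷ t ∷ []))) (≈⇒≡ _ _ refl))
      qY : inv (l s v₃) ≡ Y
      qY = trans (cong inv (trans (cong (l s) v₃-ev) (sym (ev-∷ s _)))) (trans (sym (ev-reverse (s ∷ r ∷ t ∷ s ∷ r ∷ t ∷ []))) (trans (≈⇒≡ (reverse (s ∷ r ∷ t ∷ s ∷ r ∷ t ∷ [])) (r ∷ t ∷ s ∷ r ∷ t ∷ s ∷ []) refl)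
        (trans (ev-∷ r _) (cong (l r) (trans (ev-∷ t _) (cong (l t) (ev-∷ s _)))))))

    kV : K2 V
    kV = K-x″ ns

    x : W
    x = l t (l s V)

    ℓV : ℓ V ≡ 3
    ℓV = ℓ-x″ ns

    down₀ : ∀ {y} → K2 y → m (l s y) (l s V) ≡ m y V
    down₀ {y} k = trans (star-B (K-Str ST k) (K-Str ST kV)) (trans (cong (_+_ (m y V)) (m-long (l t (l s y)) V (subst₂ _≤_ (sym ℓV) (sym (trans (ℓ-up t (l s y) (K1-a ST k)) (cong suc (ℓ-up s y (K-s ST k))))) (s≤s (s≤s (len2 (K-word y k))))))) (+-identityʳ _))
      where
      len2 : (∃ λ b → Red (r ∷ t ∷ b) × ev (r ∷ t ∷ b) ≡ y) → 1 ≤ ℓ y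
      len2 (b , h , q) = subst (1 ≤_) (trans h (cong ℓ q)) (s≤s z≤n)

    -- The second term of `star-B` is m(tsV,y). As r is a descent of y and not of tsV, it survives
    -- only for y = rtsV, the exceptional element.
    up₀ : ∀ {y} → K2 y → y ≢ Y → m (l s V) (l s y) ≡ m V y
    up₀ {y} k ne = trans (star-B (K-Str ST kV) (K-Str ST k)) (trans (cong (_+_ (m V y)) (m-descent r x y (proj₁ k) (K2-c ST kV) (λ q → ne (sym q)))) (+-identityʳ _))

    up-Y : ∀ {y} → K2 y → y ≡ Y → m (l s V) (l s y) ≡ + 3
    up-Y k refl = trans (star-B (K-Str ST kV) (K-Str ST k)) (cong₂ _+_ m-V-Y (m-up r x (K2-c ST kV)))

    M-V-≢ : ∀ {y} → K2 y → y ≢ Y → M (l s y) (l s V) ≡ M y V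
    M-V-≢ k ne = cong₂ _+_ (down₀ k) (up₀ k ne)

    ℓY : ∀ {y} → y ≡ Y → 3 ≤ ℓ y
    ℓY refl = subst (3 ≤_) (sym (trans (ℓ-up r x (K2-c ST kV)) (cong suc (trans (ℓ-up t (l s V) (K1-a ST kV)) (cong suc (trans (ℓ-up s V (K-s ST kV)) (cong suc ℓV))))))) (s≤s (s≤s (s≤s z≤n)))

    M-Y : ∀ {y} → K2 y → y ≡ Y → M (l s y) (l s V) ≡ + 3 × M y V ≡ + 2
    M-Y {y} k q = cong₂ _+_ (trans (down₀ k) z) (up-Y k q) , cong₂ _+_ z (trans (cong (m V) q) m-V-Y)
      where
      z : m y V ≡ + 0
      z = m-long y V (subst (_≤ ℓ y) (sym ℓV) (ℓY q))

    nonzero : ∀ {a b n k} → a ≡ + suc n → b ≡ + suc k → a ≢ + 0 → b ≢ + 0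
    nonzero refl refl _ ()

  -- For the prefixes rs and ts the value itself is preserved by `star-C`; for the prefix s the
  -- exceptional element has 2 on one side and 3 on the other, so the claim is restricted to
  -- nonvanishing.
  M-lev2-to : ∀ i {y} → K2 y → M y (x″ i) ≢ + 0 → M (lev2 i y) (dist2 i) ≢ + 0
  M-lev2-to n0 k ne = ne
  M-lev2-to (na σ) k ne q = ne (trans (sym (cong₂ _+_ (star-C (K-Str σ k) (K-Str σ (K-x″ (na σ)))) (star-C (K-Str σ (K-x″ (na σ))) (K-Str σ k)))) q)
  M-lev2-to ns {y} k ne = go (y ≟W Y)
    where
    go : Dec (y ≡ Y) → M (l s y) (l s V) ≢ + 0
    go (no n) q = ne (trans (sym (M-V-≢ k n)) q)
    go (yes e) = nonzero (proj₂ (M-Y k e)) (proj₁ (M-Y k e)) ne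

  M-lev2-from : ∀ i {y} → K2 y → M (lev2 i y) (dist2 i) ≢ + 0 → M y (x″ i) ≢ + 0
  M-lev2-from n0 k ne = ne
  M-lev2-from (na σ) k ne q = ne (trans (cong₂ _+_ (star-C (K-Str σ k) (K-Str σ (K-x″ (na σ)))) (star-C (K-Str σ (K-x″ (na σ))) (K-Str σ k))) q)
  M-lev2-from ns {y} k ne = go (y ≟W Y)
    where
    go : Dec (y ≡ Y) → M y V ≢ + 0
    go (no n) q = ne (trans (M-V-≢ k n) q)
    go (yes e) = nonzero (proj₁ (M-Y k e)) (proj₂ (M-Y k e)) ne

  c2-forward : ∀ {i y} → K2 y → p 1W (lev2 i y) -[1+ 2 ] ≢ + 0 → M (lev2 i y) (dist2 i) ≢ + 0
  c2-forward {i} {y} k ne = M-lev2-to i k (λ q → ne (trans (lev2-M k i) (trans (M-comm (x″ i) y) q)))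

  c2-core : ∀ {i y} → K2 y → M (lev2 i y) (dist2 i) ≢ + 0 → Degree 3 (lev2 i y)
  c2-core {i} {y} k ne = Degree-below {2} {lev2 i y} (Formulas2.lev2-above k i) (trans (Formulas2.lev2-2 k i) (≡₀-no (λ q → ne′ (trans (cong (M y) q) (M-same y)))))
      (λ q → ne′ (trans (M-comm y (x″ i)) (trans (sym (lev2-M k i)) q)))
    where
    ne′ : M y (x″ i) ≢ + 0
    ne′ = M-lev2-from i k ne

  is-dist2 : ∀ {i y} → K2 y → p 1W (lev2 i y) -2ℤ ≢ + 0 → lev2 i y ≡ dist2 i
  is-dist2 {i} {y} k ne = cong (lev2 i) (sym ([≡]₀-yes (λ q → ne (trans (Formulas2.lev2-2 k i) q))))

  private
    c2-typed : ∀ {i z d} → Ty2 i z → Ty2 i d → p 1W d -2ℤ ≢ + 0 → M z d ≢ + 0 → Degree 3 z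
    c2-typed {i} (y , k , refl) (y′ , k′ , refl) nd ne = c2-core {i} k (subst (λ d → M (lev2 i y) d ≢ + 0) (is-dist2 {i} k′ nd) ne)

    c2-typed-inv : ∀ {i z d} → Ty2 i (inv z) → Ty2 i d → inv d ≡ d → p 1W d -2ℤ ≢ + 0 → M z d ≢ + 0 → Degree 3 z
    c2-typed-inv {i} {z} {d} ty ty′ id nd ne = Degree-inv {3} {z} (c2-typed {i} ty ty′ nd (λ q → ne (trans (sym (M-inv z d)) (trans (cong (M (inv z)) id) q))))

    not4 : ∀ {A : Set} {i z} → aW z ≡ 2 → Ty2 i z ⊎ aW z ≡ 4 → (Ty2 i z → A) → A
    not4 e (inj₁ ty) f = f ty
    not4 e (inj₂ q) f = ⊥-elim (contra (trans (sym e) q))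
      where
      contra : 2 ≢ 4
      contra ()

    c2-visible : ∀ {g z d} → aW z ≡ 2 → aW d ≡ 2 → Dec2 d → inv d ≡ d → p 1W d -2ℤ ≢ + 0 → M z d ≢ + 0 → lb g z ≢ lb g d → Degree 3 z
    c2-visible {g} {z} {d} ez ed (dec2 j y′ jy q) id nd ne vis = go (lb g z) refl (lb g d) refl
      where
      dty : Ty2 j d
      dty = y′ , jy , q
      other : Dec2 (inv z) → lb g z ≡ false → lb g d ≡ true → Degree 3 z
      other (dec2 i y iy q′) gz gd = not4 {i = i} (trans (aW-inv d) ed) (LE-ty2 {i = i} ty gz (LE-M gd gz (λ w → ne (trans (M-comm z d) w)))) (λ ty′ → c2-typed-inv {i} ty (subst (Ty2 i) id ty′) id nd ne)
        where
        ty : Ty2 i (inv z)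
        ty = y , iy , q′
      go : ∀ b → lb g z ≡ b → ∀ b′ → lb g d ≡ b′ → Degree 3 z
      go true gz true gd = ⊥-elim (vis (trans gz (sym gd)))
      go false gz false gd = ⊥-elim (vis (trans gz (sym gd)))
      go true gz false gd = not4 {i = j} (trans (aW-inv z) ez) (LE-ty2 {i = j} (subst (Ty2 j) (sym id) dty) gd (LE-M gz gd ne)) (λ ty → c2-typed-inv {j} ty dty id nd ne)
      go false gz true gd = other (decompose2 (inv z) (trans (aW-inv z) ez)) gz gd

    -- Within the cell a = 2 the left descent set determines the type, so a pair with equal descent
    -- sets has equal types and there is no counterpart of `op1` and `op2`.
    kind : Bool → Bool → Lv2
    kind true true = n0
    kind true false = na RS
    kind false true = na ST
    kind false false = ns

    kind-bits : ∀ i {y} → K2 y → i ≡ kind (lb r (lev2 i y)) (lb t (lev2 i y))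
    kind-bits n0 k = sym (cong₂ kind (proj₁ k) (proj₁ (proj₂ k)))
    kind-bits ns k = sym (cong₂ kind (K1-a RS k) (K1-a ST k))
    kind-bits (na RS) k = sym (cong₂ kind (K2-a RS k) (K2-c RS k))
    kind-bits (na ST) k = sym (cong₂ kind (K2-c ST k) (K2-a ST k))

  c2-back : ∀ {z d} → aW z ≡ 2 → aW d ≡ 2 → p 1W d -2ℤ ≢ + 0 → M z d ≢ + 0 → Degree 3 z
  c2-back {z} {d} ez ed nd ne = go (decompose2 z ez) (decompose2 d ed)
    where
    go : Dec2 z → Dec2 d → Degree 3 z
    go (dec2 i y ky qz) D@(dec2 j y′ ky′ qd) = both (lb r z Bool.≟ lb r d) (lb t z Bool.≟ lb t d)
      where
      id : inv d ≡ d
      id = trans (cong inv q) (trans (dist2-inv j) (sym q))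
        where
        q : d ≡ dist2 j
        q = trans qd (is-dist2 {j} ky′ (subst (λ d → p 1W d -2ℤ ≢ + 0) qd nd))
      both : Dec (lb r z ≡ lb r d) → Dec (lb t z ≡ lb t d) → Degree 3 z
      both (no vis) _ = c2-visible {r} ez ed D id nd ne vis
      both (yes _) (no vis) = c2-visible {t} ez ed D id nd ne vis
      both (yes b₁) (yes b₂) = c2-typed {i} (y , ky , qz) (subst (λ i → Ty2 i d) j≡i (y′ , ky′ , qd)) nd ne
        where
        j≡i : j ≡ i
        j≡i = trans (kind-bits j ky′) (trans (cong (λ d → kind (lb r d) (lb t d)) (sym qd)) (trans (cong₂ kind (sym b₁) (sym b₂)) (trans (cong (λ z → kind (lb r z) (lb t z)) qz) (sym (kind-bits i ky)))))

 module StructureConstants (h : StructFun) (isStruct : IsStruct P h) where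

  -- The given structure constants and the preorder they define.

  module Products where
   open Defs renaming (same to LR-same; left to LR-left; right to LR-right; trans to LR-trans; δ to degδ)
   open Coxeter
   open FormalSums
   open Hecke
   open ReducedWords
   open KLPolynomials
   open StarOperations
   open KLSpans
   open Descents
   open RightTypes

   hv : W → W → W → ℤ → ℤ
   hv x y z k = coefL (h (word x) (word y) (word z)) k

   hv-ev : ∀ x y z k → coefL (h x y z) k ≡ hv (ev x) (ev y) (ev z) k
   hv-ev x y z k = IsStruct.resp isStruct _ _ _ _ _ _ (ev-≈ x) (ev-≈ y) (ev-≈ z) k

   Op : W → F → F
   Op x f = OP (kl x) f

   private
     val-tW* : ∀ a h u e → val (N (foldr tSH h a)) u e ≡ foldr T (val (N h)) a u (e - + length a)
     val-tW* [] h u e = cong (val (N h) u) (sym (+-identityʳ e))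
     val-tW* (g ∷ a) h u e = trans (val-tSH g (foldr tSH h a) u e) (trans (T-cong g (val-tW* a h) u (ℤ.pred e))
         (trans (foldr-shift (g ∷ []) (foldr T (val (N h)) a) (+ length a) u (ℤ.pred e)) (cong (foldr T (val (N h)) (g ∷ a) u) (i e (+ length a)))))
       where
       i : ∀ e n → -[1+ 0 ] + e - n ≡ e - (+ 1 + n)
       i = solve-∀

     val-tW : ∀ x h u e → val (N (tW x h)) u e ≡ Top (ev x) (val (N h)) u (e - + ℓ (ev x))
     val-tW x h u e = trans (val-tW* (red x) h u e) (trans (cong (λ n → foldr T (val (N h)) (red x) u (e - + n)) (proj₂ (red-spec x)))
       (T*-indep (red x) (word (ev x)) (N h) (Red-red x) (Red-word (ev x)) (trans (proj₁ (red-spec x)) (sym (ev-word (ev x)))) u _))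

     val-mulH : ∀ h₁ h₂ u e → val (N (mulH h₁ h₂)) u e ≡ OP (N h₁) (val (N h₂)) u e
     val-mulH [] h₂ u e = refl
     val-mulH ((x , e′ , c) ∷ h₁) h₂ u e = trans (cong (lin (kr u e)) (N-++ (map (scaleT e′ c) (tW x h₂)) (mulH h₁ h₂))) (trans (lin-++ (kr u e) (N (map (scaleT e′ c) (tW x h₂))) _)
         (cong₂ _+_ (trans (val-scaleT e′ c (tW x h₂) u e) (cong (_*_ c) (trans (val-tW x h₂ u _) (cong (Top (ev x) (val (N h₂)) u) (i e e′ (+ ℓ (ev x))))))) (val-mulH h₁ h₂ u e)))
       where
       i : ∀ e a n → e + - a - n ≡ e - (a + n)
       i = solve-∀

     tag : Word → Laur → List Tm
     tag z [] = []
     tag z ((e , c) ∷ L) = (ev z , e , c) ∷ tag z L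

     val-tag : ∀ z L k → val (tag z L) (ev z) k ≡ coefL L k
     val-tag z [] k = refl
     val-tag z ((e , c) ∷ L) k = cong₂ _+_ (one (e ℤ.≟ k)) (val-tag z L k)
       where
       one : ∀ d → c * kr (ev z) k (ev z) e ≡ (if isYes d then c else + 0)
       one (yes refl) = trans (cong (_*_ c) (kr-yes (ev z) e)) (*-identityʳ c)
       one (no n) = trans (cong (_*_ c) (kr-no₂ (ev z) (ev z) n)) (*-zeroʳ c)

     val-tag-other : ∀ z L w k → ev z ≢ w → val (tag z L) w k ≡ + 0
     val-tag-other z [] w k n = refl
     val-tag-other z ((e , c) ∷ L) w k n = cong₂ _+_ (trans (cong (_*_ c) (kr-no₁ k e n)) (*-zeroʳ c)) (val-tag-other z L w k n)

     val-scaleL : ∀ L z u e → val (N (scaleL L (C' P z))) u e ≡ ⟦ tag z L ⟧ u e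
     val-scaleL [] z u e = refl
     val-scaleL ((e′ , c) ∷ L) z u e = trans (cong (lin (kr u e)) (N-++ (map (scaleT e′ c) (C' P z)) (scaleL L (C' P z)))) (trans (lin-++ (kr u e) (N (map (scaleT e′ c) (C' P z))) _)
       (cong₂ _+_ (trans (val-scaleT e′ c (C' P z) u e) (cong (_*_ c) (C′-p u z (e - e′)))) (val-scaleL L z u e)))

     lin-concat : ∀ φ (f : Word → List Tm) ys → lin φ (concatMap f ys) ≡ sumOver (λ y → lin φ (f y)) ys
     lin-concat φ f [] = refl
     lin-concat φ f (y ∷ ys) = trans (lin-++ φ (f y) _) (cong (_+_ (lin φ (f y))) (lin-concat φ f ys))

     sumOver-cong : ∀ {f f′} → (∀ y → f y ≡ f′ y) → ∀ ys → sumOver f ys ≡ sumOver f′ ys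
     sumOver-cong q [] = refl
     sumOver-cong q (y ∷ ys) = cong₂ _+_ (q y) (sumOver-cong q ys)

     hl : Word → Word → List Tm
     hl x y = concatMap (λ z → tag z (h x y z)) (Ball (len x ℕ.+ len y))

     val-hl : ∀ x y w k → val (hl x y) w k ≡ coefL (h x y (word w)) k
     val-hl x y w k = trans (lin-concat (kr w k) _ (Ball n)) (go (ℓ w ℕ.≤? n))
       where
       n : ℕ
       n = len x ℕ.+ len y
       f : Word → ℤ
       f z = val (tag z (h x y z)) w k
       go : Dec (ℓ w ≤ n) → sumOver f (Ball n) ≡ coefL (h x y (word w)) k
       go (yes le) with ∈.∈-map⁻ ev (ball-complete n w le)
       ... | z , mem , refl = trans (sumOver-one f (Ball n) (ev z) (ball-unique n) (λ z′ ne → val-tag-other z′ (h x y z′) (ev z) k ne) z mem refl)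
             (trans (val-tag z (h x y z) k) (IsStruct.resp isStruct x x y y _ _ refl refl (ev-≈ z) k))
       go (no gt) = trans (sumOver-none f (Ball n) (λ z mem → val-tag-other z (h x y z) w k (λ q → gt (ball-sound n w (subst (λ v → v ∈ ball n) q (∈.∈-map⁺ ev mem))))))
           (sym (IsStruct.outside isStruct x y (word w) (≤-trans (≰⇒> gt) (≤-reflexive (sym (trans (len-ℓ (word w)) (cong ℓ (ev-word w)))))) k))

     Op-hl : ∀ x y → OP (N (C' P x)) (val (N (C' P y))) ≗F ⟦ hl x y ⟧
     Op-hl x y u e = trans (sym (val-mulH (C' P x) (C' P y) u e)) (trans (val-coefH (mulH (C' P x) (C' P y)) u e) (trans (IsStruct.expand isStruct x y (word u) (e - + ℓ u))
       (trans (sym (val-coefH (concatMap (λ z → scaleL (h x y z) (C' P z)) (Ball (len x ℕ.+ len y))) u e)) (trans (lin-N-concatMap (kr u e) _ (Ball (len x ℕ.+ len y)))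
       (trans (sumOver-cong (λ z → val-scaleL (h x y z) z u e) (Ball (len x ℕ.+ len y))) (sym (lin-concat (λ w k → p u w (e - k)) _ (Ball (len x ℕ.+ len y)))))))))

   -- By independence of the C_w, any expansion of C_x C_y computes the constants that the axioms
   -- provide.
   hv-val : ∀ x y ts → Op x (pf y) ≗F ⟦ ts ⟧ → ∀ z k → hv x y z k ≡ val ts z k
   hv-val x y ts q z k = trans (sym (val-hl (word x) (word y) z k)) (C-indep (hl (word x) (word y)) ts (λ u e → trans (sym (Op-hl (word x) (word y) u e))
     (trans (trans (OP-val (N (C' P (word x))) (kl x) _ (λ u e → cong (λ n → val n u e) (sym (kl-def x))) u e) (OP-cong (kl x) (λ u e → cong (λ n → val n u e) (sym (kl-def y))) u e)) (q u e))) z k)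

   hv-Spn : ∀ {D x y} → Spn D (Op x (pf y)) → ∀ z k → hv x y z k ≢ + 0 → D z k
   hv-Spn {D} {x} {y} S@(ts , _ , q) z k ne = Spn-coef S ts q z k (λ w → ne (trans (hv-val x y ts q z k) w))

   hv-rep : ∀ x y → Spn (λ z k → hv x y z k ≢ + 0) (Op x (pf y))
   hv-rep x y = Spn-nonzero ts q (λ w k ne z → ne (trans (sym (hv-val x y ts q w k)) z))
     where
     ts : List Tm
     ts = hl (word x) (word y)
     q : Op x (pf y) ≗F ⟦ ts ⟧
     q u e = trans (trans (OP-val (kl x) (N (C' P (word x))) _ (λ u e → cong (λ n → val n u e) (kl-def x)) u e) (OP-cong (N (C' P (word x))) (λ u e → cong (λ n → val n u e) (kl-def y)) u e)) (Op-hl (word x) (word y) u e)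

   gen : Gen → W
   gen g = l g 1W

   lb-1 : ∀ g → lb g 1W ≡ false
   lb-1 g with lb g 1W in b
   ... | false = refl
   ... | true with trans (sym ℓ-1) (ℓ-down g 1W b)
   ...   | ()

   Op-gen : ∀ g us → Op (gen g) (val us) ≗F C g (val us)
   Op-gen g us u e = trans (OP-up g 1W us (lb-1 g) u e) (trans (cong₂ (λ x y → x + - y) (C-cong g (OP-1 (val us)) u e)
     (Σl-zero (ball (ℓ 1W)) _ (λ y _ → one y (lb g y)))) (+-identityʳ _))
     where
     one : ∀ y b → (if b then m y 1W * OP (kl y) (val us) u e else + 0) ≡ + 0
     one y false = refl
     one y true = cong (_* OP (kl y) (val us) u e) (m-long y 1W (subst (_≤ ℓ y) (sym ℓ-1) z≤n))

   pf-gen : ∀ g → pf (gen g) ≗F C g (val unit)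
   pf-gen g u e = sym (trans (C-cong g (λ u e → trans (val-unit u e) (sym (kl-1 u e))) u e) (trans (C-up g 1W (lb-1 g) u e)
     (trans (cong (_+_ (p u (gen g) e)) (S-none g 1W u e (λ y _ → inj₁ (m-long y 1W (subst (_≤ ℓ y) (sym ℓ-1) z≤n))))) (+-identityʳ _))))

   OP-gen : ∀ ts g → OP ts (pf (gen g)) ≗F CR g (val ts)
   OP-gen ts g u e = trans (OP-cong ts (pf-gen g) u e) (trans (sym (OP-R g ts unit u e)) (trans (OP-cong (cR g ts) val-unit u e) (trans (OP-unit (cR g ts) u e) (val-cR g ts u e))))

   left-edge : ∀ g y z k → hv (gen g) y z k ≢ + 0 → z ≡ y ⊎ lb g y ≡ false × LE g z y
   left-edge g y z k = hv-Spn {D = λ z _ → z ≡ y ⊎ lb g y ≡ false × LE g z y} (Spn-cong (λ u e → sym (Op-gen g (kl y) u e)) (Spn-C {λ w _ → w ≡ y} g (λ { w k refl _ → inj₁ refl , inj₁ refl }) (λ { w k refl b z le → inj₂ (b , le) }) (Spn-pf y refl))) z k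

   right-edge : ∀ g y z k → hv y (gen g) z k ≢ + 0 → z ≡ y ⊎ rb g y ≡ false × RE g z y
   right-edge g y z k = hv-Spn {D = λ z _ → z ≡ y ⊎ rb g y ≡ false × RE g z y} (Spn-cong (λ u e → sym (OP-gen (kl y) g u e)) (CR-edges g y (λ _ → inj₁ refl , inj₁ refl) (λ b z re → inj₂ (b , re)))) z k

   _≼_ : W → W → Set
   z ≼ y = word z ≤LR⟨ h ⟩ word y

   ≼-refl : ∀ {z} → z ≼ z
   ≼-refl = LR-same refl

   ≼-trans : ∀ {x y z} → x ≼ y → y ≼ z → x ≼ z
   ≼-trans = LR-trans

   ev-gen : ∀ g → ev List.[ g ] ≡ gen g
   ev-gen g = trans (ev-∷ g []) (cong (l g) ev-[])

   private
     hv-word : ∀ a b c {x y z} → ev a ≡ x → ev b ≡ y → ev c ≡ z → ∀ k → coefL (h a b c) k ≡ hv x y z k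
     hv-word a b c refl refl refl k = hv-ev a b c k

   ≼-left : ∀ {g z y} → lb g y ≡ false → LE g z y → z ≼ y
   ≼-left {g} {z} {y} b le = LR-left g (+ 0 , λ q → edge-nonzero g y z b le (trans (sym (hv-val (gen g) y (edges g y) (λ u e → trans (Op-gen g (kl y) u e) (C-edges g y b u e)) z (+ 0)))
     (trans (sym (hv-word List.[ g ] (word y) (word z) (ev-gen g) (ev-word y) (ev-word z) (+ 0))) q)))

   ≼-right : ∀ {g z y} → rb g y ≡ false → RE g z y → z ≼ y
   ≼-right {g} {z} {y} b re = LR-right g (+ 0 , λ q → RE-coef b re (Spn-cong (OP-gen (kl y) g) (hv-rep y (gen g)))
     (trans (sym (hv-word (word y) List.[ g ] (word z) (ev-word y) (ev-gen g) (ev-word z) (+ 0))) q))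

   ≼-ev : ∀ {x y} → ev x ≼ ev y → x ≤LR⟨ h ⟩ y
   ≼-ev {x} {y} q = LR-trans (LR-same (ev-≈ x)) (LR-trans q (LR-same (sym (ev-≈ y))))

   module _ (D : W → Set) (cl : ∀ {g z y} → D y → lb g y ≡ false → LE g z y → D z) (cr : ∀ {g z y} → D y → rb g y ≡ false → RE g z y → D z) where
     private
       by-left : ∀ g {z y} → D y → z ≡ y ⊎ lb g y ≡ false × LE g z y → D z
       by-left g d (inj₁ q) = subst D (sym q) d
       by-left g d (inj₂ (b , le)) = cl d b le

       by-right : ∀ g {z y} → D y → z ≡ y ⊎ rb g y ≡ false × RE g z y → D z
       by-right g d (inj₁ q) = subst D (sym q) d
       by-right g d (inj₂ (b , re)) = cr d b re

       hv-left : ∀ g x y k → coefL (h List.[ g ] y x) k ≢ + 0 → hv (gen g) (ev y) (ev x) k ≢ + 0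
       hv-left g x y k ne q = ne (trans (hv-word List.[ g ] y x (ev-gen g) refl refl k) q)

       hv-right : ∀ g x y k → coefL (h y List.[ g ] x) k ≢ + 0 → hv (ev y) (gen g) (ev x) k ≢ + 0
       hv-right g x y k ne q = ne (trans (hv-word y List.[ g ] x refl (ev-gen g) refl k) q)

     -- Each generating step of the preorder is trivial or an edge of the W-graph by `left-edge` and
     -- `right-edge`, so closure under edges is enough. With D the sets a = 4, a ≥ 2 and a ≥ 1 this
     -- makes a monotone.
     ≼-closed : ∀ {x y} → x ≤LR⟨ h ⟩ y → D (ev y) → D (ev x)
     ≼-closed (LR-same {x = x} {y} q) d = subst D (sym (≈⇒≡ x y q)) d
     ≼-closed (LR-left {x = x} {y} g (k , ne)) d = by-left g d (left-edge g (ev y) (ev x) k (hv-left g x y k ne))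
     ≼-closed (LR-right {x = x} {y} g (k , ne)) d = by-right g d (right-edge g (ev y) (ev x) k (hv-right g x y k ne))
     ≼-closed (LR-trans p q) d = ≼-closed p (≼-closed q d)

   ≼-aW : ∀ {x y} → x ≤LR⟨ h ⟩ y → aW (ev y) ≤ aW (ev x)
   ≼-aW {x} {y} q with aW-cases (ev y)
   ... | inj₁ e = ≤-reflexive (trans e (sym (≼-closed (λ z → aW z ≡ 4) LE-4 RE-4 q e)))
   ... | inj₂ (inj₁ e) = subst (_≤ aW (ev x)) (sym e) (≼-closed (λ z → 2 ≤ aW z) LE-≥2 RE-≥2 q (≤-reflexive (sym e)))
   ... | inj₂ (inj₂ (inj₁ e)) = subst (_≤ aW (ev x)) (sym e) (≼-closed (λ z → 1 ≤ aW z) (λ {g} {z} _ _ le → aW-lb g z (proj₁ le)) (λ {g} {z} _ _ re → subst (1 ≤_) (aW-inv z) (aW-lb g (inv z) (proj₁ re))) q (≤-reflexive (sym e)))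
   ... | inj₂ (inj₂ (inj₂ e)) = subst (_≤ aW (ev x)) (sym e) z≤n

   private
     moveL : ℤ → List Tm → List Tm
     moveL j = map (λ (w , k , c) → w , j + k , c)

     lin-moveL : ∀ j φ ts → lin φ (moveL j ts) ≡ lin (λ w k → φ w (j + k)) ts
     lin-moveL j φ [] = refl
     lin-moveL j φ ((w , k , c) ∷ ts) = cong (_+_ (c * φ w (j + k))) (lin-moveL j φ ts)

     klL : List Tm → List Tm
     klL [] = []
     klL ((w , k , c) ∷ us) = scale c (moveL k (kl w)) ++ klL us

     lin-klL : ∀ φ us → lin φ (klL us) ≡ lin (λ w k → lin (λ w′ k′ → φ w′ (k + k′)) (kl w)) us
     lin-klL φ [] = refl
     lin-klL φ ((w , k , c) ∷ us) = trans (lin-++ φ (scale c (moveL k (kl w))) _) (cong₂ _+_ (trans (lin-scale c φ (moveL k (kl w))) (cong (_*_ c) (lin-moveL k φ (kl w)))) (lin-klL φ us))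

     val-klL : ∀ us → val (klL us) ≗F ⟦ us ⟧
     val-klL us u e = trans (lin-klL (kr u e) us) (lin-cong (λ w k → lin-cong (λ w′ k′ → kr-iff (λ q z → q , i k k′ e z) (λ q z → q , j k k′ e z)) (kl w)) us)
       where
       i : ∀ k k′ e → k + k′ ≡ e → k′ ≡ e - k
       i k k′ _ refl = i′ k k′
         where
         i′ : ∀ k k′ → k′ ≡ k + k′ - k
         i′ = solve-∀
       j : ∀ k k′ e → k′ ≡ e - k → k + k′ ≡ e
       j k _ e refl = i′ k e
         where
         i′ : ∀ k e → k + (e - k) ≡ e
         i′ = solve-∀

   OP-rep : ∀ ts us f → val ts ≗F ⟦ us ⟧ → OP ts f ≗F (λ u e → lin (λ w k → Op w f u (e - k)) us)
   OP-rep ts us f q u e = trans (OP-val ts (klL us) f (λ u e → trans (q u e) (sym (val-klL us u e))) u e) (trans (lin-klL (λ w k → Top w f u (e - k)) us)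
     (lin-cong (λ w k → lin-cong (λ w′ k′ → cong (Top w′ f u) (i e k k′)) (kl w)) us))
     where
     i : ∀ e k k′ → e - (k + k′) ≡ e - k - k′
     i = solve-∀

   OP-SpnL : ∀ {D D′ : W → ℤ → Set} ts f → (∀ w k → D w k → Spn D′ (λ u e → Op w f u (e - k))) → Spn D (val ts) → Spn D′ (OP ts f)
   OP-SpnL {D} ts f one (us , al , q) = Spn-cong (λ u e → sym (OP-rep ts us f q u e)) (Spn-lin {D} (λ w k u e → Op w f u (e - k)) one us al)

   private
     Spn-sub : ∀ {D : W → ℤ → Set} {f f₁ f₂ : F} → (∀ u e → f u e ≡ f₁ u e + - f₂ u e) → Spn D f₁ → Spn D f₂ → Spn D f
     Spn-sub q S₁ S₂ = Spn-cong (λ u e → sym (q u e)) (Spn-+ S₁ (Spn-neg S₂))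

     shift-closed : ∀ {D : W → Set} {f} k → Spn (λ w _ → D w) f → Spn (λ w _ → D w) (λ u e → f u (e - k))
     shift-closed {D} k = Spn-shift {λ w _ → D w} k (λ _ _ d → d)

   module _ (D : W → Set) (cl : ∀ g w → D w → Spn (λ z _ → D z) (CR g (pf w))) where
     private
       D′ : W → ℤ → Set
       D′ z _ = D z

       rest : Gen → W → List Tm
       rest g w = map (λ y → y , + 0 , (if lb g y then m y w else + 0)) (ball (ℓ w))

       OP-edges : ∀ ts g w → OP ts (⟦ edges g w ⟧) ≗F (λ u e → OP ts (pf (l g w)) u e + lin (λ w k → OP ts (pf w) u (e - k)) (rest g w))
       OP-edges ts g w u e = trans (lin-cong (λ w′ k → trans (foldr-lin (word w′) (λ y j u e → p u y (e - j)) (edges g w) u (e - k)) (lin-cong (λ y j → trans (foldr-shift (word w′) (pf y) j u (e - k)) (cong (Top w′ (pf y) u) (i e k j))) (edges g w))) ts)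
           (trans (lin-swap (λ w k y j → Top w (pf y) u (e - j - k)) ts (edges g w)) (cong (_+ lin (λ w k → OP ts (pf w) u (e - k)) (rest g w)) (trans (*-identityˡ _) (cong (OP ts (pf (l g w)) u) (+-identityʳ e)))))
         where
         i : ∀ e k j → e + - k + - j ≡ e + - j + - k
         i = solve-∀

       go : ∀ u → Acc _<_ (ℓ u) → ∀ x → D x → Spn D′ (Op x (pf u))
       go u (acc rs) x d with word u | ev-word u | Red-word u
       ... | [] | eq | _ = Spn-cong (λ v e → sym (trans (OP-cong (kl x) (λ v e → trans (cong (λ w → p v w e) (trans (sym eq) ev-[])) (kl-1 v e)) v e) (OP-unit (kl x) v e))) (Spn-pf x d)
       ... | g ∷ b | eq | hb with Red-tail g b hb
       ...   | _ , bt = subst (λ u → Spn D′ (Op x (pf u))) (trans (sym (ev-∷ g b)) eq) (Spn-sub (λ v e → minus (OP-edges (kl x) g w v e)) main (Spn-lin′ (ball (ℓ w)) (λ y i → ball-sound (ℓ w) y i)))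
         where
         w : W
         w = ev b
         lt : ℓ w < ℓ u
         lt = subst (ℓ w <_) (cong ℓ (trans (sym (ev-∷ g b)) eq)) (≤-reflexive (sym (ℓ-up g w bt)))
         minus : ∀ {a b c} → a ≡ b + c → b ≡ a + - c
         minus {b = b} {c} refl = sym (cancel b c)
         main : Spn D′ (OP (kl x) ⟦ edges g w ⟧)
         main = Spn-cong (λ v e → trans (OP-R g (kl x) (kl w) v e) (OP-cong (kl x) (C-edges g w bt) v e))
           (OP-SpnL {D′} (cR g (kl x)) (pf w) (λ z k dz → shift-closed k (go w (rs lt) z dz)) (Spn-cong (λ v e → sym (val-cR g (kl x) v e)) (cl g x d)))
         Spn-lin′ : ∀ ys → (∀ y → y ∈ ys → ℓ y ≤ ℓ w) → Spn D′ (λ v e → lin (λ w k → OP (kl x) (pf w) v (e - k)) (map (λ y → y , + 0 , (if lb g y then m y w else + 0)) ys))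
         Spn-lin′ [] _ = Spn-0
         Spn-lin′ (y ∷ ys) le = Spn-+ (Spn-* (if lb g y then m y w else + 0) (shift-closed {D} (+ 0) (go y (rs (ℕ.≤-<-trans (le y (here refl)) lt)) x d))) (Spn-lin′ ys (λ z i → le z (there i)))

     -- Induction on the length of u = gw. In C_x C_g C_w the factor C_x C_g stays in the span by
     -- `cl`, and C_w is shorter than C_u; the products C_x C_y subtracted on account of C_g C_w
     -- also have shorter y.
     Op-right : ∀ u x → D x → Spn D′ (Op x (pf u))
     Op-right u x d = go u (<-wellFounded (ℓ u)) x d

   Op-step : ∀ {D : W → ℤ → Set} g x us → lb g x ≡ false → Spn D (C g (Op x (val us))) →
     (∀ y → lb g y ≡ true → m y x ≢ + 0 → Spn D (Op y (val us))) → Spn D (Op (l g x) (val us))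
   Op-step {D} g x us b S₁ S₂ = Spn-sub (λ u e → OP-up g x us b u e) S₁ (Spn-Σ (ball (ℓ x)) (λ y u e → if lb g y then m y x * OP (kl y) (val us) u e else + 0) (λ y _ → one y (lb g y) refl))
     where
     one : ∀ y b → lb g y ≡ b → Spn D (λ u e → if b then m y x * OP (kl y) (val us) u e else + 0)
     one y false _ = Spn-0
     one y true gy with m y x ℤ.≟ + 0
     ... | yes z = Spn-cong (λ u e → sym (cong (_* OP (kl y) (val us) u e) z)) Spn-0
     ... | no nz = Spn-* (m y x) (S₂ y gy nz)

   m-< : ∀ {y x} → m y x ≢ + 0 → ℓ y < ℓ x
   m-< {y} {x} nz with ℓ y ℕ.<? ℓ x
   ... | yes lt = lt
   ... | no ge = ⊥-elim (nz (m-long y x (ℕ.≮⇒≥ ge)))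

  -- Upper bounds for the degrees of structure constants.

  module DegreeBounds where
   open Defs renaming (same to LR-same; left to LR-left; right to LR-right; trans to LR-trans; δ to degδ)
   open Coxeter
   open FormalSums
   open Hecke
   open ReducedWords
   open KLPolynomials
   open StarOperations
   open KLSpans
   open Descents
   open RightTypes
   open Bremke
   open Products
   open Alcoves using (Gen∀)
   open Automaton using (bit; δ; Q∀)

   G2 G1 : W → Set
   G2 w = 2 ≤ aW w
   G1 w = 1 ≤ aW w

   A4-Op : ∀ x u → aW x ≡ 4 → Spn A4 (Op x (pf u))
   A4-Op x u = Op-right (λ w → aW w ≡ 4) (λ g w d → Spn-CR4 g (Spn-pf w d)) u x

   G2-Op : ∀ x u → G2 x → Spn (λ w _ → G2 w) (Op x (pf u))
   G2-Op x u = Op-right G2 (λ g w d → CR-edges g w (λ _ → d , d) (λ b y re → RE-≥2 d b re)) u x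

   G1-Op : ∀ x u → G1 x → Spn (λ w _ → G1 w) (Op x (pf u))
   G1-Op x u = Op-right G1 (λ g w d → CR-edges g w (λ _ → d , d) (λ b y re → subst (1 ≤_) (aW-inv y) (aW-lb g (inv y) (proj₁ re)))) u x

   A4-shift : ∀ {f} k → Spn A4 f → Spn A4 (λ u e → f u (e - k))
   A4-shift k = Spn-shift {A4} k (λ _ _ d → d)

   D1 : Gen → W → ℤ → Set
   D1 g w k = aW w ≡ 4 ⊎ k ℤ.≤ + 1 × lb g w ≡ true

   private
     le01 : + 0 ℤ.≤ + 1
     le01 = ℤ.+≤+ z≤n

     -- two left descents g, h′ force the lowest cell, as soon as they arise from an element of the cell a = 1
     opaque
       two-descents : ∀ q g h′ → bit g q ≡ false → bit h′ q ≡ true → av (δ g q) ≡ 1 → ∀ q₂ → bit g q₂ ≡ true → bit h′ q₂ ≡ true → av q₂ ≡ 4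
       two-descents = toWitness {a? = Q∀ λ q → Gen∀ λ g → Gen∀ λ h′ → (bit g q is false) →-dec ((bit h′ q is true) →-dec ((av (δ g q) ℕ.≟ 1) →-dec
         (Q∀ λ q₂ → (bit g q₂ is true) →-dec ((bit h′ q₂ is true) →-dec (av q₂ ℕ.≟ 4)))))} _

     opaque
       descent : ∀ q → av q ≡ 1 → bit r q ≡ true ⊎ bit s q ≡ true ⊎ bit t q ≡ true
       descent = toWitness {a? = Q∀ λ q → (av q ℕ.≟ 1) →-dec ((bit r q is true) ⊎-dec ((bit s q is true) ⊎-dec (bit t q is true)))} _

     opaque
       below1 : ∀ q g → bit g q ≡ false → av (δ g q) ≡ 1 → av q ≡ 1 ⊎ av q ≡ 0
       below1 = toWitness {a? = Q∀ λ q → Gen∀ λ g → (bit g q is false) →-dec ((av (δ g q) ℕ.≟ 1) →-dec ((av q ℕ.≟ 1) ⊎-dec (av q ℕ.≟ 0)))} _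

   has-descent : ∀ x → aW x ≡ 1 → ∃ λ g → lb g x ≡ true
   has-descent x e with descent (st x) e
   ... | inj₁ b = r , b
   ... | inj₂ (inj₁ b) = s , b
   ... | inj₂ (inj₂ b) = t , b

   down : ∀ g x → lb g x ≡ true → lb g (l g x) ≡ false × ℓ (l g x) < ℓ x × δ g (st (l g x)) ≡ st x
   down g x b = proj₁ (st-down g x b) , ≤-reflexive (sym (ℓ-down g x b)) , proj₂ (st-down g x b)

   -- Write x = gx′ with x′ having a descent h′. Multiplication by C_g raises the degree only on
   -- terms with g as descent; by induction they have h′ as well, and `two-descents` puts them into
   -- the lowest cell. Outside it the exponent therefore never exceeds that of the base case x = g.
   c1-bound : ∀ x → aW x ≡ 1 → ∀ g → lb g x ≡ true → ∀ u → Spn (D1 g) (Op x (pf u))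
   c1-bound x = go x (<-wellFounded (ℓ x))
     where
     go : ∀ x → Acc _<_ (ℓ x) → aW x ≡ 1 → ∀ g → lb g x ≡ true → ∀ u → Spn (D1 g) (Op x (pf u))
     go x (acc rs) ax g gx u with down g x gx
     ... | b , lt , dq with below1 (st (l g x)) g b (trans (cong av dq) ax)
     ...   | inj₂ z = subst (λ x → Spn (D1 g) (Op x (pf u))) (trans (cong (l g) (sym (aW0 _ z))) (l-invol g x))
         (Spn-cong (λ v e → sym (Op-gen g (kl u) v e)) (Spn-C {λ w k → w ≡ u × k ≡ + 0} g (λ { w _ (refl , refl) gw → inj₂ (ℤ.+≤+ ≤-refl , gw) , inj₂ (ℤ.-≤+ , gw) })
           (λ { w _ (refl , refl) _ y le → inj₂ (le01 , proj₁ le) }) (Spn-pf u (refl , refl))))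
     ...   | inj₁ ax′ with has-descent (l g x) ax′
     ...     | h′ , hx′ = subst (λ x → Spn (D1 g) (Op x (pf u))) (l-invol g x) (Op-step g x′ (kl u) b main corr)
       where
       x′ : W
       x′ = l g x
       both : ∀ w → lb g w ≡ true → lb h′ w ≡ true → aW w ≡ 4
       both w = two-descents (st x′) g h′ b hx′ (trans (cong av dq) ax) (st w)
       main : Spn (D1 g) (C g (Op x′ (pf u)))
       main = Spn-C {D1 h′} g
         (λ { w k (inj₁ d) _ → inj₁ d , inj₁ d ; w k (inj₂ (_ , hw)) gw → inj₁ (both w gw hw) , inj₁ (both w gw hw) })
         (λ { w k (inj₁ d) bw y le → inj₁ (LE-4 d bw le) ; w k (inj₂ (k≤ , _)) bw y le → inj₂ (k≤ , proj₁ le) })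
         (go x′ (rs lt) ax′ h′ hx′ u)
       corr : ∀ y → lb g y ≡ true → m y x′ ≢ + 0 → Spn (D1 g) (Op y (pf u))
       corr y gy nz with lb h′ y in hy
       ... | true = Spn-mono (λ _ _ → inj₁) (A4-Op y u (both y gy hy))
       ... | false with l h′ y ≟W x′
       ...   | no n = ⊥-elim (nz (m-descent h′ y x′ hx′ hy n))
       ...   | yes q with below1 (st y) h′ hy (trans (cong av (sym (st-up h′ y hy))) (trans (cong aW q) ax′))
       ...     | inj₁ ay = go y (rs (ℕ.<-trans (m-< nz) lt)) ay g gy u
       ...     | inj₂ z = ⊥-elim (<⇒≱ (s≤s z≤n) (subst (1 ≤_) z (aW-lb g y gy)))

   module _ where
     -- `X2 i` on lists, that is, as multiplication of a Hecke algebra element. Together with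
     -- `OP-X2L` it moves the prefix from a left factor to the whole product.
     X2L : Lv2 → List Tm → List Tm
     X2L n0 ts = ts
     X2L ns ts = cL s ts
     X2L (na σ) ts = cL (a σ) (cL s ts) ++ scale -1ℤ ts

     private
       sub : ∀ φ ts us → lin φ (ts ++ scale -1ℤ us) ≡ lin φ ts + - lin φ us
       sub φ ts us = trans (lin-++ φ ts _) (cong (_+_ (lin φ ts)) (trans (lin-scale -1ℤ φ us) (ℤ.-1*i≡-i _)))

     val-X2L : ∀ i ts → val (X2L i ts) ≗F X2 i (val ts)
     val-X2L n0 ts u e = refl
     val-X2L ns ts = val-cL s ts
     val-X2L (na σ) ts u e = trans (sub (kr u e) (cL (a σ) (cL s ts)) ts) (cong (_+ - val ts u e) (trans (val-cL (a σ) (cL s ts) u e) (C-cong (a σ) (val-cL s ts) u e)))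

     OP-X2L : ∀ i ts us → OP (X2L i ts) (val us) ≗F X2 i (OP ts (val us))
     OP-X2L n0 ts us u e = refl
     OP-X2L ns ts us = OP-C s ts us
     OP-X2L (na σ) ts us u e = trans (sub (λ w k → Top w (val us) u (e - k)) (cL (a σ) (cL s ts)) ts) (cong (_+ - OP ts (val us) u e) (trans (OP-C (a σ) (cL s ts) us u e) (C-cong (a σ) (OP-C s ts us) u e)))

     Op-lev2 : ∀ i {y} → K2 y → ∀ v → Spn A4 (λ u e → X2 i (Op y (pf v)) u e + - Op (lev2 i y) (pf v) u e)
     Op-lev2 i {y} k v = Spn-cong (λ u e → trans (sub (λ w k → Top w (pf v) u (e - k)) (X2L i (kl y)) (kl (lev2 i y))) (cong (_+ - Op (lev2 i y) (pf v) u e) (OP-X2L i (kl y) (kl v) u e)))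
       (OP-SpnL {A4} (X2L i (kl y) ++ scale -1ℤ (kl (lev2 i y))) (pf v) (λ w j d → A4-shift j (A4-Op w v d))
         (Spn-cong (λ u e → sym (trans (sub (kr u e) (X2L i (kl y)) (kl (lev2 i y))) (cong (_+ - pf (lev2 i y) u e) (val-X2L i (kl y) u e)))) (X2-pf i k)))

     XL : Side → Lv → List Tm → List Tm
     XL σ l0 ts = ts
     XL σ l1 ts = cL (c σ) ts
     XL σ l2 ts = cL s (cL (c σ) ts) ++ scale -1ℤ ts
     XL σ l3 ts = cL (a σ) (XL σ l2 ts) ++ scale -1ℤ (XL σ l1 ts)

     private
       val-XL2 : ∀ σ ts → val (XL σ l2 ts) ≗F X σ l2 (val ts)
       val-XL2 σ ts u e = trans (sub (kr u e) (cL s (cL (c σ) ts)) ts) (cong (_+ - val ts u e) (trans (val-cL s (cL (c σ) ts) u e) (C-cong s (val-cL (c σ) ts) u e)))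

       OP-XL2 : ∀ σ ts us → OP (XL σ l2 ts) (val us) ≗F X σ l2 (OP ts (val us))
       OP-XL2 σ ts us u e = trans (sub (λ w k → Top w (val us) u (e - k)) (cL s (cL (c σ) ts)) ts) (cong (_+ - OP ts (val us) u e) (trans (OP-C s (cL (c σ) ts) us u e) (C-cong s (OP-C (c σ) ts us) u e)))

     val-XL : ∀ σ i ts → val (XL σ i ts) ≗F X σ i (val ts)
     val-XL σ l0 ts u e = refl
     val-XL σ l1 ts = val-cL (c σ) ts
     val-XL σ l2 ts = val-XL2 σ ts
     val-XL σ l3 ts u e = trans (sub (kr u e) (cL (a σ) (XL σ l2 ts)) (XL σ l1 ts)) (cong₂ (λ x y → x + - y) (trans (val-cL (a σ) (XL σ l2 ts) u e) (C-cong (a σ) (val-XL2 σ ts) u e)) (val-cL (c σ) ts u e))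

     OP-XL : ∀ σ i ts us → OP (XL σ i ts) (val us) ≗F X σ i (OP ts (val us))
     OP-XL σ l0 ts us u e = refl
     OP-XL σ l1 ts us = OP-C (c σ) ts us
     OP-XL σ l2 ts us = OP-XL2 σ ts us
     OP-XL σ l3 ts us u e = trans (sub (λ w k → Top w (val us) u (e - k)) (cL (a σ) (XL σ l2 ts)) (XL σ l1 ts)) (cong₂ (λ x y → x + - y) (trans (OP-C (a σ) (XL σ l2 ts) us u e) (C-cong (a σ) (OP-XL2 σ ts us) u e)) (OP-C (c σ) ts us u e))

     Op-lev : ∀ σ i {y} → J σ y → ∀ us → Op (lev σ i y) (val us) ≗F X σ i (Op y (val us))
     Op-lev σ i {y} j us u e = trans (OP-val (kl (lev σ i y)) (XL σ i (kl y)) (val us) (λ u e → sym (trans (val-XL σ i (kl y) u e) (X-pf σ i j u e))) u e) (OP-XL σ i (kl y) us u e)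

   D2 : W → ℤ → Set
   D2 w k = aW w ≡ 4 ⊎ K2 w × k ℤ.≤ + 2

   D2′ : Lv2 → W → ℤ → Set
   D2′ i w k = aW w ≡ 4 ⊎ Ty2 i w × k ℤ.≤ + 2

   X2-D2 : ∀ i {f} → Spn D2 f → Spn (D2′ i) (X2 i f)
   X2-D2 i (ts , al , eq) = Spn-cong (λ u e → sym (trans (X2-cong i eq u e) (X2-lin i (λ w k u e → p u w (e - k)) ts u e)))
     (Spn-lin {D2} (λ w k → X2 i (λ u e → p u w (e - k))) one ts al)
     where
     one : ∀ w k → D2 w k → Spn (D2′ i) (X2 i (λ u e → p u w (e - k)))
     one w k (inj₂ (d , k≤)) = Spn-cong (λ u e → trans (j (p u (lev2 i w) (e - k)) (X2 i (pf w) u (e - k))) (sym (X2-shift i (pf w) k u e)))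
         (Spn-+ (Spn-one (lev2 i w) k (inj₂ ((w , d , refl) , k≤))) (Spn-mono (λ _ _ → inj₁) (A4-shift k (X2-pf i d))))
       where
       j : ∀ a b → a + (b + - a) ≡ b
       j = solve-∀
     one w k (inj₁ d) = Spn-mono (λ _ _ → inj₁) (X2-4 i (Spn-one w k d))

   Op-lev2-D2 : ∀ i {y} → K2 y → ∀ v → Spn D2 (Op y (pf v)) → Spn (D2′ i) (Op (lev2 i y) (pf v))
   Op-lev2-D2 i {y} k v S = Spn-cong (λ u e → j (X2 i (Op y (pf v)) u e) (Op (lev2 i y) (pf v) u e)) (Spn-+ (X2-D2 i S) (Spn-mono (λ _ _ → inj₁) (Spn-neg (Op-lev2 i k v))))
     where
     j : ∀ a b → a + - (a + - b) ≡ b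
     j = solve-∀

   private
     opaque
       rt-commute : ∀ q → (bit t q ≡ false → bit r q ≡ true → bit r (δ t q) ≡ true) × (bit r q ≡ false → bit t q ≡ true → bit t (δ r q) ≡ true)
       rt-commute = toWitness {a? = Q∀ λ q → ((bit t q is false) →-dec ((bit r q is true) →-dec (bit r (δ t q) is true))) ×-dec ((bit r q is false) →-dec ((bit t q is true) →-dec (bit t (δ r q) is true)))} _

     opaque
       K-below : ∀ q → bit t q ≡ false → Kq (δ t q) → bit r q ≡ true × (av q ≡ 2 ⊎ av q ≡ 1)
       K-below = toWitness {a? = Q∀ λ q → (bit t q is false) →-dec (Kq? (δ t q) →-dec ((bit r q is true) ×-dec ((av q ℕ.≟ 2) ⊎-dec (av q ℕ.≟ 1))))} _

   rt-edge : ∀ {z w} → lb r w ≡ true → lb t w ≡ false → lb t z ≡ true → z ≡ l t w ⊎ m z w ≢ + 0 → lb r z ≡ true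
   rt-edge {z} {w} rw tw tz (inj₁ refl) = trans (cong (bit r) (st-up t w tw)) (proj₁ (rt-commute (st w)) tw rw)
   rt-edge {z} {w} rw tw tz (inj₂ nz) with lb r z in rz
   ... | true = refl
   ... | false with l r z ≟W w
   ...   | no n = ⊥-elim (nz (m-descent r z w rw rz n))
   ...   | yes refl = bool-clash (trans (cong (bit t) (st-up r z rz)) (proj₂ (rt-commute (st z)) rz tz)) tw

   private
     suc-pred≤ : ∀ k → k ℤ.≤ + 1 → ℤ.suc k ℤ.≤ + 2 × ℤ.pred k ℤ.≤ + 2
     suc-pred≤ k h = ℤ.+-monoʳ-≤ (+ 1) h , ℤ.≤-trans (ℤ.pred-mono h) (ℤ.+≤+ z≤n)

     le12 : ∀ {k} → k ℤ.≤ + 1 → k ℤ.≤ + 2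
     le12 h = ℤ.≤-trans h (ℤ.+≤+ (s≤s z≤n))

   -- Write y = ty′. If a(y′) = 1, then `c1-bound` with r gives exponent at most 1 and C_t adds one.
   -- Otherwise y′ = rsy″ with y″ in `K2`, and outside the lowest cell the terms have the type of
   -- y′, hence lack the descent t, so C_t adds nothing. Corrections keep both r and t by `rt-edge`.
   K-bound : ∀ y → K2 y → ∀ u → Spn D2 (Op y (pf u))
   K-bound y = go y (<-wellFounded (ℓ y))
     where
     go : ∀ y → Acc _<_ (ℓ y) → K2 y → ∀ u → Spn D2 (Op y (pf u))
     go y (acc rs) k u with down t y (proj₁ (proj₂ k))
     ... | b , lt , dq = subst (λ x → Spn D2 (Op x (pf u))) (l-invol t y) (Op-step t y′ (kl u) b main corr)
       where
       y′ : W
       y′ = l t y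
       below : lb r y′ ≡ true × (aW y′ ≡ 2 ⊎ aW y′ ≡ 1)
       below = K-below (st y′) b (subst Kq (sym dq) k)
       corr : ∀ z → lb t z ≡ true → m z y′ ≢ + 0 → Spn D2 (Op z (pf u))
       corr z tz nz with rt-cases z (rt-edge (proj₁ below) b tz (inj₂ nz)) tz
       ... | inj₁ kz = go z (rs (ℕ.<-trans (m-< nz) lt)) kz u
       ... | inj₂ e = Spn-mono (λ _ _ → inj₁) (A4-Op z u e)
       edge : ∀ w k → k ℤ.≤ + 2 → lb r w ≡ true → lb t w ≡ false → ∀ z → LE t z w → D2 z k
       edge w k k≤ rw tw z (tz , le) with rt-cases z (rt-edge rw tw tz le) tz
       ... | inj₁ kz = inj₂ (kz , k≤)
       ... | inj₂ e = inj₁ e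
       bits : ∀ {w} → Ty2 (na RS) w → lb r w ≡ true × lb t w ≡ false
       bits (y , k , refl) = K2-a RS k , K2-c RS k
       main : Spn D2 (C t (Op y′ (pf u)))
       main with proj₂ below
       ... | inj₂ e1 = Spn-C {D1 r} t
           (λ { w k (inj₁ d) _ → inj₁ d , inj₁ d ; w k (inj₂ (k≤ , rw)) tw → two w k k≤ (rt-cases w rw tw) })
           (λ { w k (inj₁ d) bw y le → inj₁ (LE-4 d bw le) ; w k (inj₂ (k≤ , rw)) bw y le → edge w k (le12 k≤) rw bw y le })
           (c1-bound y′ e1 r (proj₁ below) u)
         where
         two : ∀ w k → k ℤ.≤ + 1 → K2 w ⊎ aW w ≡ 4 → D2 w (ℤ.suc k) × D2 w (ℤ.pred k)
         two w k k≤ (inj₁ kw) = inj₂ (kw , proj₁ (suc-pred≤ k k≤)) , inj₂ (kw , proj₂ (suc-pred≤ k k≤))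
         two w k k≤ (inj₂ e) = inj₁ e , inj₁ e
       ... | inj₁ e2 with decompose2 y′ e2
       ...   | dec2 n0 y″ k″ eq = bool-clash (trans (cong (lb t) eq) (proj₁ (proj₂ k″))) b
       ...   | dec2 ns y″ k″ eq = bool-clash (proj₁ below) (trans (cong (lb r) eq) (K1-a RS k″))
       ...   | dec2 (na ST) y″ k″ eq = bool-clash (proj₁ below) (trans (cong (lb r) eq) (K2-c ST k″))
       ...   | dec2 (na RS) y″ k″ eq = Spn-C {D2′ (na RS)} t
           (λ { w k (inj₁ d) _ → inj₁ d , inj₁ d ; w k (inj₂ (ty , _)) tw → bool-clash tw (proj₂ (bits ty)) })
           (λ { w k (inj₁ d) bw y le → inj₁ (LE-4 d bw le) ; w k (inj₂ (ty , k≤)) bw y le → edge w k k≤ (proj₁ (bits ty)) bw y le })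
           (subst (λ x → Spn (D2′ (na RS)) (Op x (pf u))) (sym eq) (Op-lev2-D2 (na RS) k″ u (go y″ (rs lt″) k″ u)))
         where
         lt″ : ℓ y″ < ℓ y
         lt″ = ℕ.<-trans (ℕ.<-trans (≤-reflexive (sym (ℓ-up s y″ (K-s RS k″)))) (≤-reflexive (sym (trans (cong ℓ eq) (ℓ-up r (l s y″) (K1-a RS k″)))))) lt

   hv-1 : ∀ u z k → hv 1W u z k ≢ + 0 → z ≡ u × k ≡ + 0
   hv-1 u = hv-Spn {D = λ z k → z ≡ u × k ≡ + 0} (Spn-cong (λ v e → sym (OP-1 (pf u) v e)) (Spn-pf u (refl , refl)))

   private
     four-bound : ∀ x u z k → hv x u z k ≢ + 0 → k ℤ.≤ + 4
     four-bound x u z -[1+ n ] ne = ℤ.-≤+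
     four-bound x u z (+ n) ne = go (n ℕ.≤? 4)
       where
       rep : Spn (λ z k → hv x u z k ≢ + 0) (Op x (pf u)) → ∀ m → hv x u z (+ suc (4 ℕ.+ m)) ≡ + 0
       rep (ts , _ , q) m = trans (hv-val x u ts q z _) (C-deg ts q (bremke-C x u) z m)
       go : Dec (n ≤ 4) → + n ℤ.≤ + 4
       go (yes le) = ℤ.+≤+ le
       go (no gt) = ⊥-elim (ne (trans (cong (λ n → hv x u z (+ n)) (sym (ℕ.m+[n∸m]≡n (≰⇒> gt)))) (rep (hv-rep x u) (n ℕ.∸ 5))))

     0≤ : ∀ n → + 0 ℤ.≤ + n
     0≤ n = ℤ.+≤+ z≤n

     Small : W → ℤ → Set
     Small z k = aW z ≡ 4 ⊎ k ℤ.≤ + 2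

     small : ∀ x u z k → hv x u z k ≢ + 0 → Small z k
     small x u z k ne = go (aW-cases x)
       where
       two : Dec2 x → Small z k
       two (dec2 i y ky eq) = f (hv-Spn {D = D2′ i} {x} {u} (subst (λ x → Spn (D2′ i) (Op x (pf u))) (sym eq) (Op-lev2-D2 i ky u (K-bound y ky u))) z k ne)
         where
         f : D2′ i z k → Small z k
         f (inj₁ q) = inj₁ q
         f (inj₂ (_ , k≤)) = inj₂ k≤
       go : aW x ≡ 4 ⊎ aW x ≡ 2 ⊎ aW x ≡ 1 ⊎ aW x ≡ 0 → Small z k
       go (inj₁ e) = inj₁ (hv-Spn {D = A4} {x} {u} (A4-Op x u e) z k ne)
       go (inj₂ (inj₁ e)) = two (decompose2 x e)
       go (inj₂ (inj₂ (inj₁ e))) = f (has-descent x e)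
         where
         f : (∃ λ g → lb g x ≡ true) → Small z k
         f (g , gx) = f′ (hv-Spn {D = D1 g} {x} {u} (c1-bound x e g gx u) z k ne)
           where
           f′ : D1 g z k → Small z k
           f′ (inj₁ q) = inj₁ q
           f′ (inj₂ (k≤ , _)) = inj₂ (le12 k≤)
       go (inj₂ (inj₂ (inj₂ e))) = inj₂ (subst (ℤ._≤ + 2) (sym (proj₂ (hv-1 u z k (λ q → ne (trans (cong (λ x → hv x u z k) (aW0 x e)) q))))) (0≤ 2))

     one : ∀ x u z k → aW z ≡ 1 → hv x u z k ≢ + 0 → k ℤ.≤ + 1
     one x u z k e1 ne = go (aW-cases x)
       where
       n2 : ¬ G2 z
       n2 q = <⇒≱ (s≤s (s≤s z≤n)) (subst (2 ≤_) e1 q)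
       two : G2 x → k ℤ.≤ + 1
       two g = ⊥-elim (n2 (hv-Spn {D = λ w _ → G2 w} {x} {u} (G2-Op x u g) z k ne))
       go : aW x ≡ 4 ⊎ aW x ≡ 2 ⊎ aW x ≡ 1 ⊎ aW x ≡ 0 → k ℤ.≤ + 1
       go (inj₁ e) = two (subst (2 ≤_) (sym e) (s≤s (s≤s z≤n)))
       go (inj₂ (inj₁ e)) = two (≤-reflexive (sym e))
       go (inj₂ (inj₂ (inj₁ e))) = f (has-descent x e)
         where
         f : (∃ λ g → lb g x ≡ true) → k ℤ.≤ + 1
         f (g , gx) = f′ (hv-Spn {D = D1 g} {x} {u} (c1-bound x e g gx u) z k ne)
           where
           f′ : D1 g z k → k ℤ.≤ + 1
           f′ (inj₁ q) = ⊥-elim (n2 (subst (2 ≤_) (sym q) (s≤s (s≤s z≤n))))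
           f′ (inj₂ (k≤ , _)) = k≤
       go (inj₂ (inj₂ (inj₂ e))) = subst (ℤ._≤ + 1) (sym (proj₂ (hv-1 u z k (λ q → ne (trans (cong (λ x → hv x u z k) (aW0 x e)) q))))) (0≤ 1)

     none : ∀ x u z k → aW z ≡ 0 → hv x u z k ≢ + 0 → k ℤ.≤ + 0
     none x u z k e0 ne = go (aW x) refl
       where
       go : ∀ n → aW x ≡ n → k ℤ.≤ + 0
       go (suc n) e = ⊥-elim (<⇒≱ (s≤s z≤n) (subst (1 ≤_) e0 (hv-Spn {D = λ w _ → G1 w} {x} {u} (G1-Op x u (subst (1 ≤_) (sym e) (s≤s z≤n))) z k ne)))
       go zero e = subst (ℤ._≤ + 0) (sym (proj₂ (hv-1 u z k (λ q → ne (trans (cong (λ x → hv x u z k) (aW0 x e)) q))))) (0≤ 0)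

   -- A factor x with large a produces only terms with large a (`A4-Op`, `G2-Op`, `G1-Op`), so for
   -- given z the bound belonging to the cell of x applies; for a(z) = 4 it is the general one of
   -- `bremke-C`.
   hv-bound : ∀ x u z k → hv x u z k ≢ + 0 → k ℤ.≤ + aW z
   hv-bound x u z k ne = go (aW-cases z)
     where
     to : ∀ {n} → aW z ≡ n → k ℤ.≤ + n → k ℤ.≤ + aW z
     to refl le = le
     go : aW z ≡ 4 ⊎ aW z ≡ 2 ⊎ aW z ≡ 1 ⊎ aW z ≡ 0 → k ℤ.≤ + aW z
     go (inj₁ e) = to e (four-bound x u z k ne)
     go (inj₂ (inj₁ e)) = to e (f (small x u z k ne))
       where
       f : Small z k → k ℤ.≤ + 2
       f (inj₁ q) = ⊥-elim (contra (trans (sym e) q))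
         where
         contra : 2 ≢ 4
         contra ()
       f (inj₂ le) = le
     go (inj₂ (inj₂ (inj₁ e))) = to e (one x u z k e ne)
     go (inj₂ (inj₂ (inj₂ e))) = to e (none x u z k e ne)

  -- Structure constants that attain the bounds, and the value of the a-function.

  module AFunction where
   open Defs renaming (same to LR-same; left to LR-left; right to LR-right; trans to LR-trans; δ to degδ)
   open Coxeter
   open FormalSums
   open Hecke
   open ReducedWords
   open KLPolynomials
   open StarOperations
   open KLSpans
   open Descents
   open RightTypes
   open Products
   open LowestCell using (J-long)
   open DegreeBounds
   open IdentityCoefficients using (x′; x″; J-x′; K-x″; lb-ev)

   -- The term vᵏ C_z cannot cancel, because the remainder lies in a span whose condition D excludes
   -- the pair (z,k).
   hv-lead : ∀ {D x u} z k G → (∀ v e → Op x (pf u) v e ≡ p v z (e - k) + G v e) → Spn D G → ¬ D z k → hv x u z k ≢ + 0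
   hv-lead {D} {x} {u} z k G eq (us , al , q) nd h0 = contra (trans (sym h0) (trans (hv-val x u ts rep z k) (cong₂ _+_ (trans (*-identityˡ _) (kr-yes z k)) (zero′ (val us z k ℤ.≟ + 0)))))
     where
     ts : List Tm
     ts = (z , k , + 1) ∷ us
     rep : Op x (pf u) ≗F ⟦ ts ⟧
     rep v e = trans (eq v e) (cong₂ _+_ (sym (*-identityˡ (p v z (e - k)))) (q v e))
     zero′ : Dec (val us z k ≡ + 0) → val us z k ≡ + 0
     zero′ (yes q) = q
     zero′ (no ne) = ⊥-elim (nd (All.lookup al (proj₂ (val-entry us z k ne))))
     contra : + 0 ≢ + 1 + + 0
     contra ()

   module _ (g : Gen) (x : W) (us : List Tm) (b : lb g x ≡ false) where
     private
       sum : F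
       sum v e = Σl (ball (ℓ x)) (λ y → if lb g y then m y x * OP (kl y) (val us) v e else + 0)

     Op-step-none : (∀ y → lb g y ≡ true → m y x ≡ + 0) → Op (l g x) (val us) ≗F C g (Op x (val us))
     Op-step-none h v e = trans (OP-up g x us b v e) (trans (cong (λ z → C g (Op x (val us)) v e + - z) (Σl-zero (ball (ℓ x)) _ (λ y _ → one y (lb g y) refl))) (+-identityʳ _))
       where
       one : ∀ y b → lb g y ≡ b → (if b then m y x * OP (kl y) (val us) v e else + 0) ≡ + 0
       one y false _ = refl
       one y true gy = cong (_* OP (kl y) (val us) v e) (h y gy)

     Op-step-one : ∀ y₀ → lb g y₀ ≡ true → m y₀ x ≡ + 1 → (∀ y → y ≢ y₀ → lb g y ≡ true → m y x ≡ + 0) →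
       Op (l g x) (val us) ≗F (λ v e → C g (Op x (val us)) v e + - Op y₀ (val us) v e)
     Op-step-one y₀ g₀ m₀ h v e = trans (OP-up g x us b v e) (cong (λ z → C g (Op x (val us)) v e + - z)
         (trans (Σl-single (ball (ℓ x)) _ y₀ (ball-unique (ℓ x)) (inj₁ (ball-complete (ℓ x) y₀ le)) (λ y ne → one y ne (lb g y) refl)) (at (lb g y₀) g₀)))
       where
       one : ∀ y → y ≢ y₀ → ∀ b → lb g y ≡ b → (if b then m y x * OP (kl y) (val us) v e else + 0) ≡ + 0
       one y ne false _ = refl
       one y ne true gy = cong (_* OP (kl y) (val us) v e) (h y ne gy)
       at : ∀ b → b ≡ true → (if b then m y₀ x * OP (kl y₀) (val us) v e else + 0) ≡ Op y₀ (val us) v e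
       at true _ = trans (cong (_* OP (kl y₀) (val us) v e) m₀) (*-identityˡ _)
       le : ℓ y₀ ≤ ℓ x
       le = <⇒≤ (m-< (λ q → contra (trans (sym m₀) q)))
         where
         contra : + 1 ≢ + 0
         contra ()

   private
     m-only : ∀ h w z → lb h w ≡ true → (lb h z ≡ true → ℓ w ≤ ℓ z) → z ≢ l h w → m z w ≡ + 0
     m-only h w z hw big ne = go (lb h z) refl
       where
       go : ∀ b → lb h z ≡ b → m z w ≡ + 0
       go true hz = m-long z w (big hz)
       go false hz = m-descent h z w hw hz (λ q → ne (l≡-sym h q))

     down-ev : ∀ g w → l g (ev (g ∷ w)) ≡ ev w
     down-ev g w = trans (cong (l g) (ev-∷ g w)) (l-invol g (ev w))

   module _ (σ : Side) (us : List Tm) where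
     private
       f : F
       f = val us
       w1 w2 w3 : Word
       w1 = a σ ∷ []
       w2 = s ∷ w1
       w3 = a σ ∷ w2
       tail : ∀ {g w} → redW (g ∷ w) ≡ true → redW w ≡ true × lb g (ev w) ≡ false
       tail {g} {w} = IdentityCoefficients.redW-tail g w
       r3 : redW w3 ≡ true × lb s (ev w3) ≡ false
       r3 = tail {s} {w3} (r4 σ)
         where
         r4 : ∀ σ → redW (s ∷ a σ ∷ s ∷ a σ ∷ []) ≡ true
         r4 RS = refl
         r4 ST = refl
       r2 : redW w2 ≡ true × lb (a σ) (ev w2) ≡ false
       r2 = tail {a σ} {w2} (proj₁ r3)
       r1 : redW w1 ≡ true × lb s (ev w1) ≡ false
       r1 = tail {s} {w1} (proj₁ r2)
       up : ∀ {g w} → lb g (ev w) ≡ false → lb g (ev (g ∷ w)) ≡ true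
       up {g} {w} b = trans (cong (lb g) (ev-∷ g w)) (trans (lb-flip g (ev w)) (cong not b))
       a1 : lb (a σ) (ev w1) ≡ true
       a1 = up {a σ} {[]} (trans (cong (lb (a σ)) ev-[]) (lb-1 (a σ)))
       s2 : lb s (ev w2) ≡ true
       s2 = up {s} {w1} (proj₂ r1)
       a3 : lb (a σ) (ev w3) ≡ true
       a3 = up {a σ} {w2} (proj₂ r2)
       le4 : ∀ w → length w ≤ 4 → ∀ {z} → J σ z → ℓ (ev w) ≤ ℓ z
       le4 w le j = ≤-trans (ℓ-ev w) (≤-trans le (J-long j))
       4≥1 : 1 ≤ 4
       4≥1 = s≤s z≤n
       m-ev : ∀ g w → lb g (ev w) ≡ false → m (ev w) (ev (g ∷ w)) ≡ + 1
       m-ev g w b = trans (cong (m (ev w)) (ev-∷ g w)) (m-up g (ev w) b)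

       o1 : Op (ev w1) f ≗F C (a σ) f
       o1 u e = trans (cong (λ x → Op x f u e) (ev-gen (a σ))) (Op-gen (a σ) us u e)

       o2 : Op (ev w2) f ≗F C s (Op (ev w1) f)
       o2 u e = trans (cong (λ x → Op x f u e) (ev-∷ s w1)) (Op-step-none s (ev w1) us (proj₂ r1) (λ y sy → m-only (a σ) (ev w1) y a1 (λ ay → le4 w1 4≥1 (ay , sy))
         (λ q → bool-clash sy (trans (cong (lb s) (trans q (trans (down-ev (a σ) []) ev-[]))) (lb-1 s)))) u e)

       o3 : Op (ev w3) f ≗F (λ u e → C (a σ) (Op (ev w2) f) u e + - Op (ev w1) f u e)
       o3 u e = trans (cong (λ x → Op x f u e) (ev-∷ (a σ) w2)) (Op-step-one (a σ) (ev w2) us (proj₂ r2) (ev w1) a1 (m-ev s w1 (proj₂ r1))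
         (λ y ne ay → m-only s (ev w2) y s2 (λ sy → le4 w2 (s≤s (s≤s z≤n)) (ay , sy)) (λ q → ne (trans q (down-ev s w1)))) u e)

       o4 : Op (ev (s ∷ w3)) f ≗F (λ u e → C s (Op (ev w3) f) u e + - Op (ev w2) f u e)
       o4 u e = trans (cong (λ x → Op x f u e) (ev-∷ s w3)) (Op-step-one s (ev w3) us (proj₂ r3) (ev w2) s2 (m-ev (a σ) w2 (proj₂ r2))
         (λ y ne sy → m-only (a σ) (ev w3) y a3 (λ ay → le4 w3 (s≤s (s≤s (s≤s z≤n))) (ay , sy)) (λ q → ne (trans q (down-ev (a σ) w2)))) u e)

     -- C_{w_J} = C_s C_a C_s C_a - 2 C_s C_a
     Op-wJ : Op (x′ σ l0) f ≗F (λ u e → C s (λ u e → C (a σ) (C s (C (a σ) f)) u e + - C (a σ) f u e) u e + - C s (C (a σ) f) u e)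
     Op-wJ u e = trans (cong (λ x → Op x f u e) (wJ-ev σ)) (trans (o4 u e) (cong₂ (λ x y → x + - y)
         (C-cong s (λ u e → trans (o3 u e) (cong₂ (λ x y → x + - y) (C-cong (a σ) (λ u e → trans (o2 u e) (C-cong s o1 u e)) u e) (o1 u e))) u e) (trans (o2 u e) (C-cong s o1 u e))))
       where
       wJ-ev : ∀ σ → x′ σ l0 ≡ ev (s ∷ a σ ∷ s ∷ a σ ∷ [])
       wJ-ev RS = ≈⇒≡ _ _ refl
       wJ-ev ST = ≈⇒≡ _ _ refl

   Op-rt : ∀ us → Op (x″ n0) (val us) ≗F C r (C t (val us))
   Op-rt us u e = trans (cong (λ x → Op x (val us) u e) (ev-∷ r (t ∷ []))) (trans (Op-step-none r (ev (t ∷ [])) us (lb-ev r (t ∷ []) refl)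
       (λ y ry → m-only t (ev (t ∷ [])) y (lb-ev t (t ∷ []) refl) (λ ty → ≤-trans (ℓ-ev (t ∷ [])) (pos y ry))
         (λ q → bool-clash ry (trans (cong (lb r) (trans q (trans (down-ev t []) ev-[]))) (lb-1 r)))) u e)
     (C-cong r (λ u e → trans (cong (λ x → Op x (val us) u e) (ev-gen t)) (Op-gen t us u e)) u e))
     where
     pos : ∀ y → lb r y ≡ true → 1 ≤ ℓ y
     pos y b = subst (1 ≤_) (sym (ℓ-down r y b)) (s≤s z≤n)

   -- f is vⁿ C_y plus multiples of C_y by lower powers of v.
   Lead : ℕ → W → F → Set
   Lead n y f = Spn (λ w k → w ≡ y × k ℤ.< + n) (λ u e → f u e + - p u y (e - + n))

   private
     Low : ℕ → W → F → Set
     Low n y f = Spn (λ w k → w ≡ y × k ℤ.< + n) f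

     suc-< : ∀ k n → k ℤ.< + n → ℤ.suc k ℤ.< + suc n × ℤ.pred k ℤ.< + suc n
     suc-< k n lt = ℤ.+-monoʳ-< (+ 1) lt , ℤ.<-trans (ℤ.+-monoʳ-< -[1+ 0 ] lt) (low n)
       where
       low : ∀ n → -[1+ 0 ] + + n ℤ.< + suc n
       low zero = ℤ.-<+
       low (suc n) = ℤ.+<+ (n≤1+n _)

     Low-C : ∀ {n y f} g → lb g y ≡ true → Low n y f → Low (suc n) y (C g f)
     Low-C {n} g b = Spn-C {λ w k → _} g (λ { w k (refl , lt) _ → (refl , proj₁ (suc-< k n lt)) , (refl , proj₂ (suc-< k n lt)) }) (λ { w k (refl , lt) b′ → bool-clash b b′ })

     Lead-Low : ∀ {n y f} → Lead n y f → Low (suc n) y f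
     Lead-Low {n} {y} {f} S = Spn-cong (λ u e → j (f u e) (p u y (e - + n))) (Spn-+ (Spn-mono (λ w k (q , lt) → q , ℤ.<-trans lt (ℤ.+<+ ≤-refl)) S) (Spn-one y (+ n) (refl , ℤ.+<+ ≤-refl)))
       where
       j : ∀ a b → a + - b + b ≡ a
       j = solve-∀

     Lead-C : ∀ {n y f} g → lb g y ≡ true → Lead n y f → Lead (suc n) y (C g f)
     Lead-C {n} {y} {f} g b S = Spn-cong eq (Spn-+ (Low-C {n} g b S) (Spn-one y (+ n - + 1) (refl , lt n)))
       where
       lt : ∀ n → + n - + 1 ℤ.< + suc n
       lt zero = ℤ.-<+
       lt (suc n) = ℤ.+<+ (n≤1+n _)
       k₁ : ∀ e n → -[1+ 0 ] + (e - n) ≡ e - (+ 1 + n)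
       k₁ = solve-∀
       k₂ : ∀ e n → + 1 + (e - n) ≡ e - (n - + 1)
       k₂ = solve-∀
       k₃ : ∀ a b c → a + - (b + c) + c ≡ a + - b
       k₃ = solve-∀
       eq : ∀ u e → C g (λ u e → f u e + - p u y (e - + n)) u e + p u y (e - (+ n - + 1)) ≡ C g f u e + - p u y (e - + suc n)
       eq u e = trans (cong (_+ p u y (e - (+ n - + 1))) (trans (C-sub g f (λ u e → p u y (e - + n)) u e) (cong (λ z → C g f u e + - z)
         (trans (C-shift g (pf y) (+ n) u e) (trans (C-down g y b u (e - + n)) (cong₂ (λ x z → p u y x + p u y z) (k₁ e (+ n)) (k₂ e (+ n)))))))) (k₃ (C g f u e) (p u y (e - + suc n)) (p u y (e - (+ n - + 1))))

     Lead-sub : ∀ {n y f f′} → Lead n y f → Low n y f′ → Lead n y (λ u e → f u e + - f′ u e)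
     Lead-sub {n} {y} {f} {f′} S S′ = Spn-cong (λ u e → j (f u e) (p u y (e - + n)) (f′ u e)) (Spn-+ S (Spn-neg S′))
       where
       j : ∀ a b c → a + - b + - c ≡ a + - c + - b
       j = solve-∀

     Low-suc : ∀ {n y f} → Low n y f → Low (suc n) y f
     Low-suc = Spn-mono (λ w k (q , lt) → q , ℤ.<-trans lt (ℤ.+<+ ≤-refl))

     Lead-0 : ∀ y → Lead 0 y (pf y)
     Lead-0 y = Spn-cong (λ u e → sym (trans (cong (λ z → p u y e + - p u y z) (+-identityʳ e)) (+-inverseʳ (p u y e)))) Spn-0

   -- C_s and C_a act on C_y by v + v⁻¹. In the expression of `Op-wJ` only the fourfold product
   -- reaches v⁴; what is subtracted has lower degree.
   Lead-wJ : ∀ {σ y} → J σ y → Lead 4 y (Op (x′ σ l0) (pf y))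
   Lead-wJ {σ} {y} (ja , js) = Spn-cong (λ u e → cong (_+ - p u y (e - + 4)) (sym (Op-wJ σ (kl y) u e)))
     (Lead-sub {4} {y} {C s c3} {C s (C (a σ) (pf y))} (Lead-C {3} {y} {c3} s js (Lead-sub {3} {y} {C (a σ) (C s c1)} {c1} (Lead-C {2} {y} {C s c1} (a σ) ja L2) (Low-suc {2} {y} {c1} (Lead-Low {1} {y} {c1} L1))))
       (Low-suc {3} {y} {C s c1} (Lead-Low {2} {y} {C s c1} L2)))
     where
     c1 c3 : F
     c1 = C (a σ) (pf y)
     c3 u e = C (a σ) (C s c1) u e + - c1 u e
     L1 : Lead 1 y c1
     L1 = Lead-C {0} {y} {pf y} (a σ) ja (Lead-0 y)
     L2 : Lead 2 y (C s c1)
     L2 = Lead-C {1} {y} {c1} s js L1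

   Lead-rt : ∀ {y} → K2 y → Lead 2 y (Op (x″ n0) (pf y))
   Lead-rt {y} k = Spn-cong (λ u e → cong (_+ - p u y (e - + 2)) (sym (Op-rt (kl y) u e))) (Lead-C {1} {y} {C t (pf y)} r (proj₁ k) (Lead-C {0} {y} {pf y} t (proj₁ (proj₂ k)) (Lead-0 y)))

   private
     n<n : ∀ n → ¬ (+ n ℤ.< + n)
     n<n n lt = ℤ.<-irrefl refl lt

     Lead-rep : ∀ {n y f} → Lead n y f → Σ (List Tm) λ ts → All (λ (w , k , _) → w ≡ y × k ℤ.< + n) ts × f ≗F ⟦ (y , + n , + 1) ∷ ts ⟧
     Lead-rep {n} {y} {f} (ts , al , eq) = ts , al , λ u e → trans (j (f u e) (p u y (e - + n))) (cong (_+_ (+ 1 * p u y (e - + n))) (eq u e))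
       where
       j : ∀ a b → a ≡ + 1 * b + (a + - b)
       j = solve-∀

   hv-c0 : ∀ σ i {y} → J σ y → hv (lev σ i (x′ σ l0)) y (lev σ i y) (+ 4) ≢ + 0
   hv-c0 σ i {y} j = go (Lead-rep {4} {y} {Op (x′ σ l0) (pf y)} (Lead-wJ j))
     where
     go : (Σ (List Tm) λ ts → All (λ (w , k , _) → w ≡ y × k ℤ.< + 4) ts × Op (x′ σ l0) (pf y) ≗F ⟦ (y , + 4 , + 1) ∷ ts ⟧) → hv (lev σ i (x′ σ l0)) y (lev σ i y) (+ 4) ≢ + 0
     go (ts , al , q) = hv-lead {λ w k → k ℤ.< + 4} {lev σ i (x′ σ l0)} {y} (lev σ i y) (+ 4) G eq (Spn-lin {λ w k → w ≡ y × k ℤ.< + 4} Xs one ts al) (n<n 4)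
       where
       Xs : W → ℤ → F
       Xs w k = X σ i (λ u e → p u w (e - k))
       Xs-y : ∀ k → Xs y k ≗F (λ u e → p u (lev σ i y) (e - k))
       Xs-y k u e = trans (X-shift σ i (pf y) k u e) (X-pf σ i j u (e - k))
       G : F
       G u e = lin (λ w k → Xs w k u e) ts
       one : ∀ w k → w ≡ y × k ℤ.< + 4 → Spn (λ w k → k ℤ.< + 4) (Xs w k)
       one w k (refl , lt) = Spn-cong (λ u e → sym (Xs-y k u e)) (Spn-one (lev σ i y) k lt)
       eq : ∀ v e → Op (lev σ i (x′ σ l0)) (pf y) v e ≡ p v (lev σ i y) (e - + 4) + G v e
       eq v e = trans (Op-lev σ i (J-x′ σ l0) (kl y) v e) (trans (X-cong σ i q v e) (trans (X-lin σ i (λ w k u e → p u w (e - k)) ((y , + 4 , + 1) ∷ ts) v e)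
         (cong (_+ G v e) (trans (*-identityˡ _) (Xs-y (+ 4) v e)))))

   -- The leading term is known only modulo the lowest cell, which suffices because `lev2 i y` lies
   -- outside that cell.
   hv-c2 : ∀ i {y} → K2 y → hv (lev2 i (x″ n0)) y (lev2 i y) (+ 2) ≢ + 0
   hv-c2 i {y} k₀ = go (Lead-rep {2} {y} {Op (x″ n0) (pf y)} (Lead-rt k₀))
     where
     D : W → ℤ → Set
     D w k = aW w ≡ 4 ⊎ k ℤ.< + 2
     nD : ¬ D (lev2 i y) (+ 2)
     nD (inj₁ q) = contra (trans (sym (aW-lev2 i k₀)) q)
       where
       contra : 2 ≢ 4
       contra ()
     nD (inj₂ lt) = n<n 2 lt
     Xs : W → ℤ → F
     Xs w k = X2 i (λ u e → p u w (e - k))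
     Err : ℤ → F
     Err k u e = Xs y k u e + - p u (lev2 i y) (e - k)
     Err-4 : ∀ k → Spn A4 (Err k)
     Err-4 k = Spn-cong (λ u e → cong (_+ - p u (lev2 i y) (e - k)) (sym (X2-shift i (pf y) k u e))) (A4-shift k (X2-pf i k₀))
     go : (Σ (List Tm) λ ts → All (λ (w , k , _) → w ≡ y × k ℤ.< + 2) ts × Op (x″ n0) (pf y) ≗F ⟦ (y , + 2 , + 1) ∷ ts ⟧) → hv (lev2 i (x″ n0)) y (lev2 i y) (+ 2) ≢ + 0
     go (ts , al , q) = hv-lead {D} {lev2 i (x″ n0)} {y} (lev2 i y) (+ 2) G eq SG nD
       where
       Lo R G : F
       Lo u e = lin (λ w k → Xs w k u e) ts
       R u e = X2 i (Op (x″ n0) (pf y)) u e + - Op (lev2 i (x″ n0)) (pf y) u e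
       G u e = Err (+ 2) u e + Lo u e + - R u e
       one : ∀ w k → w ≡ y × k ℤ.< + 2 → Spn D (Xs w k)
       one w k (refl , lt) = Spn-cong (λ u e → j (Xs y k u e) (p u (lev2 i y) (e - k))) (Spn-+ (Spn-mono (λ _ _ → inj₁) (Err-4 k)) (Spn-one (lev2 i y) k (inj₂ lt)))
         where
         j : ∀ a b → a + - b + b ≡ a
         j = solve-∀
       SG : Spn D G
       SG = Spn-+ (Spn-+ (Spn-mono (λ _ _ → inj₁) (Err-4 (+ 2))) (Spn-lin {λ w k → w ≡ y × k ℤ.< + 2} Xs one ts al)) (Spn-neg (Spn-mono (λ _ _ → inj₁) (Op-lev2 i (K-x″ n0) y)))
       main : ∀ v e → X2 i (Op (x″ n0) (pf y)) v e ≡ Xs y (+ 2) v e + Lo v e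
       main v e = trans (X2-cong i q v e) (trans (X2-lin i (λ w k u e → p u w (e - k)) ((y , + 2 , + 1) ∷ ts) v e) (cong (_+ Lo v e) (*-identityˡ (Xs y (+ 2) v e))))
       eq : ∀ v e → Op (lev2 i (x″ n0)) (pf y) v e ≡ p v (lev2 i y) (e - + 2) + G v e
       eq v e = sym (trans (cong (λ z → p v (lev2 i y) (e - + 2) + (Err (+ 2) v e + Lo v e + - (z + - Op (lev2 i (x″ n0)) (pf y) v e))) (main v e))
           (j (p v (lev2 i y) (e - + 2)) (Xs y (+ 2) v e) (Lo v e) (Op (lev2 i (x″ n0)) (pf y) v e)))
         where
         j : ∀ a b c d → a + (b + - a + c + - (b + c + - d)) ≡ d
         j = solve-∀

   hv-c1 : ∀ g z → lb g z ≡ true → hv (gen g) z z (+ 1) ≢ + 0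
   hv-c1 g z b = hv-lead {λ w k → k ℤ.< + 1} {gen g} {z} z (+ 1) (λ u e → C g (pf z) u e + - p u z (e - + 1))
       (λ v e → trans (Op-gen g (kl z) v e) (j (C g (pf z) v e) (p v z (e - + 1)))) (Spn-mono (λ w k → proj₂) (Lead-C {0} {z} {pf z} g b (Lead-0 z))) (n<n 1)
     where
     j : ∀ a b → a ≡ b + (a + - b)
     j = solve-∀

   hv-e : hv 1W 1W 1W (+ 0) ≢ + 0
   hv-e = hv-lead {λ _ _ → ⊥} {1W} {1W} 1W (+ 0) (λ _ _ → + 0) (λ v e → trans (OP-1 (pf 1W) v e) (trans (cong (p v 1W) (sym (+-identityʳ e))) (sym (+-identityʳ _)))) Spn-0 (λ x → x)

   hv-attained : ∀ z → ∃₂ λ x u → hv x u z (+ aW z) ≢ + 0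
   hv-attained z = go (aW-cases z)
     where
     to : ∀ {n} → aW z ≡ n → (∃₂ λ x u → hv x u z (+ n) ≢ + 0) → ∃₂ λ x u → hv x u z (+ aW z) ≢ + 0
     to refl x = x
     four : Dec4 z → ∃₂ λ x u → hv x u z (+ 4) ≢ + 0
     four (dec4 σ i y j refl) = lev σ i (x′ σ l0) , y , hv-c0 σ i j
     two : Dec2 z → ∃₂ λ x u → hv x u z (+ 2) ≢ + 0
     two (dec2 i y k refl) = lev2 i (x″ n0) , y , hv-c2 i k
     one : (∃ λ g → lb g z ≡ true) → ∃₂ λ x u → hv x u z (+ 1) ≢ + 0
     one (g , b) = gen g , z , hv-c1 g z b
     go : aW z ≡ 4 ⊎ aW z ≡ 2 ⊎ aW z ≡ 1 ⊎ aW z ≡ 0 → ∃₂ λ x u → hv x u z (+ aW z) ≢ + 0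
     go (inj₁ e) = to e (four (decompose4 z e))
     go (inj₂ (inj₁ e)) = to e (two (decompose2 z e))
     go (inj₂ (inj₂ (inj₁ e))) = to e (one (has-descent z e))
     go (inj₂ (inj₂ (inj₂ e))) = to e (1W , 1W , subst (λ z → hv 1W 1W z (+ 0) ≢ + 0) (sym (aW0 z e)) hv-e)

   a-value : ∀ α → IsAFun h α → ∀ z → α z ≡ aW (ev z)
   a-value α isA z = ℕ.≤-antisym (upper (proj₂ (isA z))) (lower (hv-attained (ev z)))
     where
     upper : (∃₂ λ x y → ¬ (coefL (h x y z) (+ α z) ≡ + 0)) → α z ≤ aW (ev z)
     upper (x , y , ne) = ℤ.drop‿+≤+ (hv-bound (ev x) (ev y) (ev z) (+ α z) (λ q → ne (trans (hv-ev x y z (+ α z)) q)))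
     lower : (∃₂ λ x u → hv x u (ev z) (+ aW (ev z)) ≢ + 0) → aW (ev z) ≤ α z
     lower (x , u , ne) = go (aW (ev z) ℕ.≤? α z)
       where
       go : Dec (aW (ev z) ≤ α z) → aW (ev z) ≤ α z
       go (yes le) = le
       go (no gt) = ⊥-elim (ne (trans (sym (trans (hv-ev (word x) (word u) z _) (cong₂ (λ a b → hv a b (ev z) (+ aW (ev z))) (ev-word x) (ev-word u))))
         (proj₁ (isA z) (word x) (word u) (+ aW (ev z)) (ℤ.+<+ (≰⇒> gt)))))

  -- Equivalence of the elements of a cell with w_J, rt or a generator.

  module Cells where
   open Defs using (r; s; t; Word)
   open Coxeter
   open FormalSums
   open Hecke
   open ReducedWords
   open KLPolynomials
   open StarOperations
   open KLSpans
   open Descents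
   open RightTypes
   open Bremke
   open Products
   open DegreeBounds
   open IdentityCoefficients
   open LowestCell using ([≡]₀-yes)

   _∼_ : W → W → Set
   z ∼ y = z ≼ y × y ≼ z

   ∼-refl : ∀ {z} → z ∼ z
   ∼-refl = ≼-refl , ≼-refl

   ∼-sym : ∀ {z y} → z ∼ y → y ∼ z
   ∼-sym (p , q) = q , p

   ∼-trans : ∀ {x y z} → x ∼ y → y ∼ z → x ∼ z
   ∼-trans (p , q) (p′ , q′) = ≼-trans p p′ , ≼-trans q′ q

   -- The way back uses g′, a descent of y that gy has lost: together with μ(y,gy) = 1 it gives an
   -- edge from gy to y.
   up-∼ : ∀ g g′ {y} → lb g y ≡ false → lb g′ y ≡ true → lb g′ (l g y) ≡ false → l g y ∼ y
   up-∼ g g′ {y} b b₁ b₂ = ≼-left {g} b (trans (lb-flip g y) (cong not b) , inj₁ refl) , ≼-left {g′} b₂ (b₁ , inj₂ (λ q → contra (trans (sym (m-up g y b)) q)))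
     where
     contra : + 1 ≢ + 0
     contra ()

   lev-∼ : ∀ σ i {y} → J σ y → lev σ i y ∼ y
   lev-∼ σ l0 j = ∼-refl
   lev-∼ σ l1 j = up-∼ (c σ) s (J-c j) (proj₂ j) (J1-s j)
   lev-∼ σ l2 j = ∼-trans (up-∼ s (a σ) (J1-s j) (J1-a j) (J2-a j)) (lev-∼ σ l1 j)
   lev-∼ σ l3 j = ∼-trans (up-∼ (a σ) s (J2-a j) (J2-s j) (J3-s j)) (∼-trans (up-∼ s (a σ) (J1-s j) (J1-a j) (J2-a j)) (lev-∼ σ l1 j))

   lev2-∼ : ∀ i {y} → K2 y → lev2 i y ∼ y
   lev2-∼ n0 k = ∼-refl
   lev2-∼ ns k = up-∼ s r (K-s RS k) (K-a RS k) (K1-a RS k)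
   lev2-∼ (na σ) k = ∼-trans (up-∼ (a σ) s (K1-a σ k) (K1-s σ k) (K2-s σ k)) (lev2-∼ ns k)

   Red-prefix : ∀ w b → Red (w ++ b) → Red w
   Red-prefix w b h = subst Red (List.reverse-involutive w) (Red-reverse (reverse w) (Red-suffix (reverse b) (reverse w) (subst Red (List.reverse-++ w b) (Red-reverse (w ++ b) h))))

   prefix-≼ : ∀ w b → Red (w ++ b) → ev (w ++ b) ≼ ev w
   prefix-≼ w [] h = subst (λ v → ev v ≼ ev w) (sym (List.++-identityʳ w)) ≼-refl
   prefix-≼ w (g ∷ b) h = ≼-trans (subst (λ v → ev v ≼ ev w′) eq (prefix-≼ w′ b h′)) (subst (_≼ ev w) (sym (ev-++[] w g)) (≼-right {g} (up (rb g (ev w)) refl) (trans (cong (lb g) (inv-ρ g (ev w))) (trans (lb-flip g (inv (ev w))) (cong not (up (rb g (ev w)) refl))) , inj₁ (inv-ρ g (ev w)))))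
     where
     w′ : Word
     w′ = w ++ g ∷ []
     eq : w′ ++ b ≡ w ++ g ∷ b
     eq = List.++-assoc w (g ∷ []) b
     h′ : Red (w′ ++ b)
     h′ = subst Red (sym eq) h
     up : ∀ β → rb g (ev w) ≡ β → rb g (ev w) ≡ false
     up false q = q
     up true q = ⊥-elim (<⇒≢ (n≤1+n _) (trans (trans (Red-prefix w (g ∷ b) h) (ℓρ-down g (ev w) q)) (cong suc (trans (cong ℓ (sym (ev-++[] w g)))
       (trans (sym (Red-prefix w′ b h′)) (trans (List.length-++ w) (ℕ.+-comm (length w) 1)))))))

   -- the coefficient of C_y C_{y⁻¹} at T_e is Σ_w p(w,y)², with constant term 1

   foldr-T-1 : ∀ w b f e → Red (w ʳ++ b) → foldr T f w (ev b) e ≡ f (ev (w ʳ++ b)) e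
   foldr-T-1 [] b f e h = refl
   foldr-T-1 (g ∷ w) b f e h = trans (Tg (lb g (ev b)) refl) (trans (cong (λ x → foldr T f w x e) (sym (ev-∷ g b))) (foldr-T-1 w (g ∷ b) f e h))
     where
     f′ : F
     f′ = foldr T f w
     bt : lb g (ev b) ≡ false
     bt = proj₂ (Red-tail g b (Red-suffix (reverse w) (g ∷ b) (subst Red (List.ʳ++-defn w) h)))
     i : ∀ a b → a + b + - b ≡ a
     i = solve-∀
     Tg : ∀ β → lb g (ev b) ≡ β → T g f′ (ev b) e ≡ f′ (l g (ev b)) e
     Tg true q = bool-clash q bt
     Tg false q = trans (cong (λ β → f′ (l g (ev b)) e + f′ (ev b) (sh β e) + - f′ (ev b) (ℤ.suc e)) q) (i _ _)

   Top-1 : ∀ w f e → Top w f 1W e ≡ f (inv w) e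
   Top-1 w f e = trans (cong (λ x → foldr T f (word w) x e) (sym ev-[])) (trans (foldr-T-1 (word w) [] f e (Red-reverse (word w) (Red-word w))) (cong (λ x → f x e) (trans (ev-reverse (word w)) (cong inv (ev-word w)))))

   trace-1 : ∀ y → Op y (pf (inv y)) 1W (+ 0) ≡ + 1
   trace-1 y = trans (lin-diff (λ w k → Top w (pf (inv y)) 1W (+ 0 - k)) (kr y (+ 0)) (kl y) (λ w k → one w k (w ≟W y) k refl)) (p-diag₀ y)
     where
     val-1 : ∀ w k → Top w (pf (inv y)) 1W (+ 0 - k) ≡ p w y (- k)
     val-1 w k = trans (Top-1 w (pf (inv y)) (+ 0 - k)) (trans (p-inv w (inv y) (+ 0 - k)) (cong₂ (p w) (inv-invol y) (+-identityˡ (- k))))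
     one : ∀ w k → Dec (w ≡ y) → ∀ k′ → k ≡ k′ → p w y k ≡ + 0 ⊎ Top w (pf (inv y)) 1W (+ 0 - k) ≡ kr y (+ 0) w k
     one w k (no ne) (+ n) refl = inj₁ (p-nonneg w y n ne)
     one w k (no ne) -[1+ n ] refl = inj₂ (trans (val-1 w k) (trans (p-pos w y n) (sym (kr-no₁ (+ 0) k ne))))
     one w k (yes refl) (+ zero) refl = inj₂ (trans (val-1 w k) (trans (p-diag₀ w) (sym (kr-yes w (+ 0)))))
     one w k (yes refl) (+ suc n) refl = inj₁ (p-pos w y n)
     one w k (yes refl) -[1+ n ] refl = inj₁ (p-diag w k (λ ()))

   -- Since the coefficient in `trace-1` is nonzero, some term vᵏ C_z of the product contributes to
   -- it. An upper bound for k and the known highest exponent of p(e,z) will leave a single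
   -- candidate for z.
   trace : ∀ {D : W → ℤ → Set} y → Spn D (Op y (pf (inv y))) → ∃₂ λ z k → D z k × p 1W z (- k) ≢ + 0
   trace {D} y (ts , al , q) = go (lin-nonzero (λ w k → p 1W w (+ 0 - k)) ts (λ z → contra (trans (sym (trans (sym (q 1W (+ 0))) (trace-1 y))) z)))
     where
     contra : + 1 ≢ + 0
     contra ()
     go : (∃ λ w → ∃ λ k → val ts w k ≢ + 0 × p 1W w (+ 0 - k) ≢ + 0) → ∃₂ λ z k → D z k × p 1W z (- k) ≢ + 0
     go (z , k , nz , pz) = z , k , All.lookup al (proj₂ (val-entry ts z k nz)) , λ q → pz (trans (cong (p 1W z) (+-identityˡ (- k))) q)

   ≼-Op : ∀ y u → Spn (λ z _ → z ≼ y) (Op y (pf u))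
   ≼-Op y u = Op-right (_≼ y) (λ g w d → CR-edges g w (λ _ → d , d) (λ b z re → ≼-trans (≼-right b re) d)) u y ≼-refl

   J-Op : ∀ {σ} y u → J σ y → Spn (λ z _ → J σ z) (Op y (pf u))
   J-Op {σ} y u j = Op-right (J σ) (λ g w d → CR-edges g w (λ _ → d , d) (λ b z re → RE-desc re b (proj₁ d) , RE-desc re b (proj₂ d))) u y j

   deg-Op : ∀ {n} y u → Deg n (Op y (pf u)) → Spn (λ _ k → k ℤ.≤ + n) (Op y (pf u))
   deg-Op {n} y u d = go (hv-rep y u)
     where
     go : Spn (λ z k → hv y u z k ≢ + 0) (Op y (pf u)) → Spn (λ _ k → k ℤ.≤ + n) (Op y (pf u))
     go (ts , _ , q) = Spn-nonzero ts q (λ w k ne → le w k ne (k ℤ.≤? + n))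
       where
       le : ∀ w k → val ts w k ≢ + 0 → Dec (k ℤ.≤ + n) → k ℤ.≤ + n
       le w k ne (yes le) = le
       le w (+ k) ne (no gt) = ⊥-elim (ne (trans (cong (λ k → val ts w (+ k)) (sym (ℕ.m+[n∸m]≡n (≰⇒> (λ le → gt (ℤ.+≤+ le)))))) (C-deg ts q d w (k ℕ.∸ suc n))))
       le w -[1+ k ] ne (no gt) = ⊥-elim (gt ℤ.-≤+)

   degree-≡ : ∀ {z n k} → (∀ e m → e + + n ≡ + suc m → p 1W z e ≡ + 0) → p 1W z (- k) ≢ + 0 → k ℤ.≤ + n → k ≡ + n
   degree-≡ {z} {n} {k} h ne le with k ℤ.≟ + n
   ... | yes q = q
   ... | no nq = ⊥-elim (gap (+ n - k) refl)
     where
     pos : + 0 ℤ.≤ + n - k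
     pos = ℤ.i≤j⇒0≤j-i le
     i : ∀ k n → - k + n ≡ n - k
     i = solve-∀
     gap : ∀ d → + n - k ≡ d → ⊥
     gap (+ zero) q = nq (sym (i-j≡0⇒i≡j (+ n) k q))
     gap (+ suc m) q = ne (h (- k) m (trans (i k (+ n)) q))
     gap -[1+ m ] q = neg (subst (+ 0 ℤ.≤_) q pos)
       where
       neg : ¬ (+ 0 ℤ.≤ -[1+ m ])
       neg ()

   degree-4 : ∀ {z k} → aW z ≡ 4 → p 1W z (- k) ≢ + 0 → k ℤ.≤ + 3 → ⊥
   degree-4 {z} {k} e4 ne le = go (decompose4 z e4)
     where
     contra : ∀ {k} → k ≡ + 4 → k ℤ.≤ + 3 → ⊥
     contra refl (ℤ.+≤+ (s≤s (s≤s (s≤s ()))))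
     go : Dec4 z → ⊥
     go (dec4 σ i y j refl) = contra (degree-≡ (Formulas.lev-above σ j i) ne (ℤ.≤-trans le (ℤ.+≤+ (s≤s (s≤s (s≤s z≤n)))))) le

   -- The contributing z has a and s as descents, and k ≤ 4. As p(e,z) has no exponent above -4, k
   -- is 4, and the v⁻⁴ coefficient is the Kronecker symbol of z = w_J.
   c0-∼ : ∀ {σ y} → J σ y → y ∼ x′ σ l0
   c0-∼ {σ} {y} j = up (long-word σ y j) , back (trace y (Spn-∧ (≼-Op y (inv y)) (Spn-∧ (J-Op y (inv y) j) (deg-Op y (inv y) (bremke-C y (inv y))))))
     where
     up : (∃ λ b → Red (wJ σ ++ b) × ev (wJ σ ++ b) ≡ y) → y ≼ x′ σ l0
     up (b , hb , q) = subst₂ _≼_ q (cong ev (sym (List.++-identityʳ (wJ σ)))) (prefix-≼ (wJ σ) b hb)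
     back : (∃₂ λ z k → (z ≼ y × J σ z × k ℤ.≤ + 4) × p 1W z (- k) ≢ + 0) → x′ σ l0 ≼ y
     back (z , k , (zy , jz , le) , ne) = subst (_≼ y) (sym ([≡]₀-yes (λ q → ne (trans (cong (λ k → p 1W z (- k)) k≡) (trans (Formulas.lev-4 σ jz l0) q))))) zy
       where
       k≡ : k ≡ + 4
       k≡ = degree-≡ (Formulas.lev-above σ jz l0) ne le

   -- The bound k ≤ 3 excludes contributions from the lowest cell; on `K2` the bound k ≤ 2 meets the
   -- highest exponent -2 of p(e,z), which leaves z = rt.
   c2-∼ : ∀ {y} → K2 y → y ∼ x″ n0
   c2-∼ {y} ky = up (K-word y ky) , back (trace y (Spn-∧ (≼-Op y (inv y)) (Spn-∧ (K-bound y ky (inv y)) (deg-Op y (inv y) (bremke-C3 y (inv y) n4)))))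
     where
     n4 : aW y ≢ 4
     n4 q = contra (trans (sym (proj₂ (proj₂ ky))) q)
       where
       contra : 2 ≢ 4
       contra ()
     up : (∃ λ b → Red (r ∷ t ∷ b) × ev (r ∷ t ∷ b) ≡ y) → y ≼ x″ n0
     up (b , hb , q) = subst (_≼ x″ n0) q (prefix-≼ (r ∷ t ∷ []) b hb)
     back : (∃₂ λ z k → (z ≼ y × D2 z k × k ℤ.≤ + 3) × p 1W z (- k) ≢ + 0) → x″ n0 ≼ y
     back (z , k , (zy , inj₁ e4 , le) , ne) = ⊥-elim (degree-4 {z} {k} e4 ne le)
     back (z , k , (zy , inj₂ (kz , le) , _) , ne) = subst (_≼ y) (sym ([≡]₀-yes (λ q → ne (trans (cong (λ k → p 1W z (- k)) k≡) (trans (Formulas2.lev2-2 kz n0) q))))) zy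
       where
       k≡ : k ≡ + 2
       k≡ = degree-≡ (Formulas2.lev2-above kz n0) ne le

   p-gen : ∀ g z e → lb g z ≡ true → p 1W z e ≡ p (gen g) z (ℤ.suc e)
   p-gen g z e b = trans (cong (p 1W z) (sym (ℤ.pred-suc e))) (sym (p-descent g 1W z (ℤ.suc e) b (lb-1 g)))

   p-gen-above : ∀ g z → lb g z ≡ true → ∀ e m → e + + 1 ≡ + suc m → p 1W z e ≡ + 0
   p-gen-above g z b e m q = trans (p-gen g z e b) (trans (cong (p (gen g) z) (trans (+-comm (+ 1) e) q)) (p-pos (gen g) z m))

   c1-∼ : ∀ {g y} → aW y ≡ 1 → lb g y ≡ true → y ∼ gen g
   c1-∼ {g} {y} e1 b = up , back (trace y (Spn-∧ (≼-Op y (inv y)) (Spn-∧ (c1-bound y e1 g b (inv y)) (deg-Op y (inv y) (bremke-C3 y (inv y) n4)))))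
     where
     n4 : aW y ≢ 4
     n4 q = contra (trans (sym e1) q)
       where
       contra : 1 ≢ 4
       contra ()
     y′ : W
     y′ = l g y
     w : Word
     w = word y′
     red-w : Red (g ∷ w) × ev (g ∷ w) ≡ l g y′
     red-w = cons-word g (Red-word y′ , ev-word y′) (trans (lb-flip g y) (cong not b))
     up : y ≼ gen g
     up = subst₂ _≼_ (trans (proj₂ red-w) (l-invol g y)) (ev-gen g) (prefix-≼ (g ∷ []) w (proj₁ red-w))
     back : (∃₂ λ z k → (z ≼ y × D1 g z k × k ℤ.≤ + 3) × p 1W z (- k) ≢ + 0) → gen g ≼ y
     back (z , k , (zy , inj₁ e4 , le) , ne) = ⊥-elim (degree-4 {z} {k} e4 ne le)
     back (z , k , (zy , inj₂ (le , gz) , _) , ne) = go (gen g ≟W z)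
       where
       k≡ : k ≡ + 1
       k≡ = degree-≡ (p-gen-above g z gz) ne le
       go : Dec (gen g ≡ z) → gen g ≼ y
       go (yes q) = subst (_≼ y) (sym q) zy
       go (no n) = ⊥-elim (ne (trans (cong (λ k → p 1W z (- k)) k≡) (trans (p-gen g z -1ℤ gz) (p-nonneg (gen g) z 0 n))))

  -- The two implications, separately for each value of a.

  module Theorem (α : Word → ℕ) (isA : IsAFun h α) where
   open Defs renaming (same to LR-same; left to LR-left; right to LR-right; trans to LR-trans; δ to degδ; σ to refl-V)
   open Coxeter
   open FormalSums
   open Hecke
   open ReducedWords
   open KLPolynomials
   open StarOperations
   open KLSpans
   open Descents
   open RightTypes
   open IdentityCoefficients
   open LowestCell
   open MiddleCell
   open Automaton using (bit)
   open Products
   open DegreeBounds using (has-descent)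
   open AFunction using (a-value)
   open Cells

   private
     swap : ∀ a b c → a ℕ.+ b ℕ.+ c ≡ a ℕ.+ c ℕ.+ b
     swap a b c = trans (ℕ.+-assoc a b c) (trans (cong (a ℕ.+_) (ℕ.+-comm b c)) (sym (ℕ.+-assoc a c b)))

     from-InD : ∀ i z → InD i P α z → p 1W (ev z) (- + (aW (ev z) ℕ.+ i)) ≢ + 0
     from-InD i z q = deg-top z (aW (ev z) ℕ.+ i) (trans q (trans (swap (α z) _ i) (cong (λ n → n ℕ.+ i ℕ.+ 2 ℕ.* degδ P z) (a-value α isA z))))

     to-InD : ∀ i z → Degree (aW (ev z) ℕ.+ i) (ev z) → InD i P α z
     to-InD i z (ne , above) = trans (top-deg z (aW (ev z) ℕ.+ i) ne above) (trans (cong (λ n → n ℕ.+ i ℕ.+ 2 ℕ.* degδ P z) (sym (a-value α isA z))) (swap (α z) i _))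

     InD-at : ∀ {n} i z → aW (ev z) ≡ n → Degree (n ℕ.+ i) (ev z) → InD i P α z
     InD-at i z refl = to-InD i z

     top-at : ∀ {n} i z → aW (ev z) ≡ n → InD i P α z → p 1W (ev z) (- + (n ℕ.+ i)) ≢ + 0
     top-at i z refl = from-InD i z

     c1-core : ∀ {g z} → lb g z ≡ true → m (gen g) z ≢ + 0 → Degree 2 z
     c1-core {g} {z} b ne = Degree-below {1} {z} (p-gen-above g z b) (trans (p-gen g z -1ℤ b) (p-nonneg (gen g) z 0 (λ q → ne (trans (cong (m (gen g)) (sym q)) (m-long (gen g) (gen g) ≤-refl)))))
       (λ q → ne (trans (sym (p-gen g z -2ℤ b)) q))

     gen-inv : ∀ g → inv (gen g) ≡ gen g
     gen-inv g = trans (cong inv (sym (ev-gen g))) (trans (sym (ev-reverse (g ∷ []))) (ev-gen g))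

     lb-gen : ∀ g → lb g (gen g) ≡ true
     lb-gen g = trans (lb-flip g 1W) (cong not (lb-1 g))

     aW-gen : ∀ g → aW (gen g) ≡ 1
     aW-gen g = trans (cong aW (sym (ev-gen g))) (q g)
       where
       q : ∀ g → aW (ev (g ∷ [])) ≡ 1
       q r = cong av (st-ev (r ∷ []) refl)
       q s = cong av (st-ev (s ∷ []) refl)
       q t = cong av (st-ev (t ∷ []) refl)

     one≢0 : + 1 ≢ + 0
     one≢0 ()

     gen-Degree : ∀ g → Degree 1 (gen g)
     gen-Degree g = (λ q → one≢0 (trans (sym (p-diag₀ (gen g))) (trans (sym (p-gen g (gen g) -1ℤ (lb-gen g))) q))) , p-gen-above g (gen g) (lb-gen g)

     ℓ-gen : ∀ g → ℓ (gen g) ≡ 1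
     ℓ-gen g = trans (ℓ-up g 1W (lb-1 g)) (cong suc ℓ-1)

     m-gen : ∀ {g′} g z → lb g′ z ≡ true → m z (gen g) ≡ + 0
     m-gen {g′} g z b = m-long z (gen g) (subst₂ _≤_ (sym (ℓ-gen g)) (sym (ℓ-down g′ z b)) (s≤s z≤n))

     -- Here d is a generator g. If g is a left descent of z, then `c1-core` applies directly.
     -- Otherwise a descent g′ of z is missing from g, so z = g′g; now g is a right descent, and the
     -- argument is applied to z⁻¹.
     c1-back : ∀ {z d} → aW z ≡ 1 → aW d ≡ 1 → p 1W d -1ℤ ≢ + 0 → M z d ≢ + 0 → Degree 2 z
     c1-back {z} {d} ez ed nd ne = go (has-descent d ed) (has-descent z ez)
       where
       go : (∃ λ g → lb g d ≡ true) → (∃ λ g → lb g z ≡ true) → Degree 2 z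
       go (g , gd) (g′ , gz) = two (lb g z) refl
         where
         d≡ : gen g ≡ d
         d≡ = eq (gen g ≟W d)
           where
           eq : Dec (gen g ≡ d) → gen g ≡ d
           eq (yes q) = q
           eq (no n) = ⊥-elim (nd (trans (p-gen g d -1ℤ gd) (p-nonneg (gen g) d 0 n)))
         nz : m (gen g) z ≢ + 0
         nz q = ne (trans (cong (M z) (sym d≡)) (cong₂ _+_ (m-gen g z gz) q))
         two : ∀ b → lb g z ≡ b → Degree 2 z
         two true b = c1-core b nz
         two false b = Degree-inv {2} {z} (c1-core {g} rgz (λ q → nz (trans (sym (m-inv (gen g) z)) (trans (cong (λ x → m x (inv z)) (gen-inv g)) q))))
           where
           no-g′ : lb g′ (gen g) ≡ false
           no-g′ = f (lb g′ (gen g)) refl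
             where
             f : ∀ b′ → lb g′ (gen g) ≡ b′ → lb g′ (gen g) ≡ false
             f false q = q
             f true q = ⊥-elim (bool-clash gz (trans (cong (λ x → lb x z) g≡) b))
               where
               g≡ : g′ ≡ g
               g≡ = h₁ g′ g (trans (sym (lb-ev g′ (g ∷ []) (rd g))) (trans (cong (lb g′) (ev-gen g)) q))
                 where
                 rd : ∀ g → redW (g ∷ []) ≡ true
                 rd r = refl
                 rd s = refl
                 rd t = refl
                 h₁ : ∀ g′ g → bit g′ (stW (g ∷ [])) ≡ true → g′ ≡ g
                 h₁ r r _ = refl
                 h₁ s s _ = refl
                 h₁ t t _ = refl
                 h₁ r s ()
                 h₁ r t ()
                 h₁ s r ()
                 h₁ s t ()
                 h₁ t r ()
                 h₁ t s ()
           z≡ : z ≡ l g′ (gen g)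
           z≡ = eq (l g′ (gen g) ≟W z)
             where
             eq : Dec (l g′ (gen g) ≡ z) → z ≡ l g′ (gen g)
             eq (yes q) = sym q
             eq (no n) = ⊥-elim (nz (m-descent g′ (gen g) z gz no-g′ n))
           rgz : rb g z ≡ true
           rgz = trans (cong (rb g) z≡) (f (rb-l g′ g (gen g)))
             where
             f : rb g (l g′ (gen g)) ≡ rb g (gen g) ⊎ l g′ (gen g) ≡ ρ g (gen g) → rb g (l g′ (gen g)) ≡ true
             f (inj₁ q) = trans q (trans (cong (lb g) (gen-inv g)) (lb-gen g))
             f (inj₂ q) = ⊥-elim (bool-clash gz (trans (cong (lb g′) (trans z≡ (trans q (trans (sym (inv-invol _)) (trans (cong inv (trans (inv-ρ g (gen g)) (trans (cong (l g) (gen-inv g)) (l-invol g 1W)))) inv-1))))) (lb-1 g′)))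

     Witness : Word → Set
     Witness z = Σ Word (λ d → InD 0 P α d × (z ∼LR⟨ h ⟩ d) × ¬ (μ~ P z d ≡ + 0))

     pack : ∀ {n z} d → aW d ≡ n → Degree n d → ev z ∼ d → M (ev z) d ≢ + 0 → Witness z
     pack {n} {z} d e deg (zd , dz) ne = word d , InD-at 0 (word d) (trans (cong aW (ev-word d)) e) (subst₂ Degree (sym (ℕ.+-identityʳ n)) (sym (ev-word d)) deg) ,
       (≼-ev (subst (ev z ≼_) (sym (ev-word d)) zd) , ≼-ev (subst (_≼ ev z) (sym (ev-word d)) dz)) , λ q → ne (trans (cong (M (ev z)) (sym (ev-word d))) (trans (sym (μ~-M z (word d))) q))

     forward : ∀ z → InD 1 P α z → Witness z
     forward z q = go (aW-cases (ev z))
       where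
       four : aW (ev z) ≡ 4 → Dec4 (ev z) → Witness z
       -- The witness has the side and the prefix of z itself, so both are equivalent to the same
       -- w_J.
       four e (dec4 σ i y j eq) = pack (dist σ i) (aW-lev (J-x′ σ i) i) (dist-Degree σ i)
           (subst (_∼ dist σ i) (sym eq) (∼-trans (lev-∼ σ i j) (∼-trans (c0-∼ j) (∼-sym (∼-trans (lev-∼ σ i (J-x′ σ i)) (c0-∼ (J-x′ σ i)))))))
           (subst (λ z → M z (dist σ i) ≢ + 0) (sym eq) (c0-forward {σ} {i} j (subst (λ z → p 1W z -[1+ 4 ] ≢ + 0) eq (top-at 1 z e q))))
       two : aW (ev z) ≡ 2 → Dec2 (ev z) → Witness z
       two e (dec2 i y k eq) = pack (dist2 i) (aW-lev2 i (K-x″ i)) (dist2-Degree i)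
           (subst (_∼ dist2 i) (sym eq) (∼-trans (lev2-∼ i k) (∼-trans (c2-∼ k) (∼-sym (∼-trans (lev2-∼ i (K-x″ i)) (c2-∼ (K-x″ i)))))))
           (subst (λ z → M z (dist2 i) ≢ + 0) (sym eq) (c2-forward {i} k (subst (λ z → p 1W z -[1+ 2 ] ≢ + 0) eq (top-at 1 z e q))))
       one : aW (ev z) ≡ 1 → (∃ λ g → lb g (ev z) ≡ true) → Witness z
       one e (g , b) = pack (gen g) (aW-gen g) (gen-Degree g) (c1-∼ e b)
           (λ w → top-at 1 z e q (trans (p-gen g (ev z) -2ℤ b) (trans (sym (+-identityˡ _)) (trans (cong (_+ m (gen g) (ev z)) (sym (m-gen g (ev z) b))) w))))
       go : aW (ev z) ≡ 4 ⊎ aW (ev z) ≡ 2 ⊎ aW (ev z) ≡ 1 ⊎ aW (ev z) ≡ 0 → Witness z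
       go (inj₁ e) = four e (decompose4 (ev z) e)
       go (inj₂ (inj₁ e)) = two e (decompose2 (ev z) e)
       go (inj₂ (inj₂ (inj₁ e))) = one e (has-descent (ev z) e)
       go (inj₂ (inj₂ (inj₂ e))) = ⊥-elim (top-at 1 z e q (trans (cong (λ z → p 1W z -1ℤ) (aW0 (ev z) e)) (p-diag 1W -1ℤ (λ ()))))

     backward : ∀ z → Witness z → InD 1 P α z
     backward z (d , dq , (zd , dz) , ne) = go (aW-cases (ev z))
       where
       same-a : aW (ev d) ≡ aW (ev z)
       -- Monotonicity of a along both halves of the equivalence places z and d at the same value of
       -- a; the rest of the argument works with μ̃.
       same-a = ℕ.≤-antisym (≼-aW zd) (≼-aW dz)
       ne′ : M (ev z) (ev d) ≢ + 0
       ne′ q = ne (trans (μ~-M z d) q)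
       ad : ∀ {n} → aW (ev z) ≡ n → aW (ev d) ≡ n
       ad = trans same-a
       go : aW (ev z) ≡ 4 ⊎ aW (ev z) ≡ 2 ⊎ aW (ev z) ≡ 1 ⊎ aW (ev z) ≡ 0 → InD 1 P α z
       go (inj₁ e) = InD-at 1 z e (c0-back e (ad e) (top-at 0 d (ad e) dq) ne′)
       go (inj₂ (inj₁ e)) = InD-at 1 z e (c2-back e (ad e) (top-at 0 d (ad e) dq) ne′)
       go (inj₂ (inj₂ (inj₁ e))) = InD-at 1 z e (c1-back e (ad e) (top-at 0 d (ad e) dq) ne′)
       go (inj₂ (inj₂ (inj₂ e))) = ⊥-elim (ne′ (trans (cong₂ M (aW0 (ev z) e) (aW0 (ev d) (ad e))) (M-same 1W)))

   theorem : ∀ z → (InD 1 P α z → Σ Word (λ d → InD 0 P α d × (z ∼LR⟨ h ⟩ d) × ¬ (μ~ P z d ≡ + 0)))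
       × (Σ Word (λ d → InD 0 P α d × (z ∼LR⟨ h ⟩ d) × ¬ (μ~ P z d ≡ + 0)) → InD 1 P α z)
   theorem z = forward z , backward z

open Defs using (InD; _∼LR⟨_⟩_; μ~)

theorem2p2 : (P : KLFun) → IsKL P → (h : StructFun) → IsStruct P h
    → (a : Word → ℕ) → IsAFun h a → (z : Word)
    → (InD 1 P a z → Σ Word (λ d → InD 0 P a d × (z ∼LR⟨ h ⟩ d) × ¬ (μ~ P z d ≡ + 0)))
    × (Σ Word (λ d → InD 0 P a d × (z ∼LR⟨ h ⟩ d) × ¬ (μ~ P z d ≡ + 0)) → InD 1 P a z)
theorem2p2 P isKL h isStruct a isA z = KLBasis.StructureConstants.Theorem.theorem P isKL h isStruct a isA z
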